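{- For every $n\in\{4,5\}$ and every integer $k\ge 1$, $GR_k(C_{2n+1}) = n\cdot 2^k+1$. Equivalently: every Gallai $k$-coloring of the edges of the complete graph $K_{n\cdot 2^k+1}$ contains a monochromatic cycle of length $2n+1$, and there is a Gallai $k$-coloring of $K_{n\cdot 2^k}$ with no monochromatic cycle of length $2n+1$. In particular, $GR_k(C_9)=4\cdot 2^k+1$ and $GR_k(C_{11})=5\cdot 2^k+1$ for all $k\ge1$.
   Context: All graphs are finite and simple. $K_m$ denotes the complete graph on $m$ vertices and $C_m$ the cycle on $m$ vertices. A Gallai coloring is a coloring of the edges of a complete graph with no rainbow triangle (a triangle whose three edges receive three distinct colors). A Gallai $k$-coloring is a Gallai coloring using (at most) $k$ colors. For an integer $k\ge1$ and a graph $H$, the Gallai-Ramsey number $GR_k(H)$ is the least positive integer $N$ such that every Gallai $k$-coloring of $K_N$ contains a monochromatic copy of $H$. -}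

module Defs where

open import Data.Nat using (ℕ; suc; _<_; _*_; _+_; _^_)
open import Data.Fin using (Fin; zero; suc; toℕ; inject₁; fromℕ)
open import Data.Product using (Σ; _×_; ∃)
open import Data.Empty using (⊥)
open import Relation.Nullary using (¬_)
open import Relation.Binary.PropositionalEquality using (_≡_; _≢_)
open import Function.Definitions using (Injective)

-- An edge-colouring of K_N with (at most) k colours: a colour for every
-- ordered pair of vertices, required symmetric; values on the diagonal
-- (loops) are irrelevant and never used.
record EdgeColouring (N k : ℕ) : Set where
  field
    col : Fin N → Fin N → Fin k
    sym : ∀ x y → col x y ≡ col y x
open EdgeColouring public

RainbowTriangle : ∀ {N k} → EdgeColouring N k → Set
RainbowTriangle {N} c =
  Σ (Fin N) λ x → Σ (Fin N) λ y → Σ (Fin N) λ z →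
    (x ≢ y) × (y ≢ z) × (x ≢ z) ×
    (col c x y ≢ col c y z) × (col c y z ≢ col c x z) × (col c x y ≢ col c x z)

Gallai : ∀ {N k} → EdgeColouring N k → Set
Gallai c = ¬ RainbowTriangle c

-- A monochromatic cycle C_{suc m} in colour j: an injective vertex
-- sequence v_0,...,v_m with edges v_i v_{i+1} (i < m) and v_m v_0 all of
-- colour j.  (Meaningful as a cycle for suc m ≥ 3.)
MonoCycle : ∀ {N k} → EdgeColouring N k → ℕ → Set
MonoCycle {N} {k} c m =
  Σ (Fin k) λ j → Σ (Fin (suc m) → Fin N) λ v →
    Injective _≡_ _≡_ v ×
    (∀ (i : Fin m) → col c (v (inject₁ i)) (v (suc i)) ≡ j) ×
    (col c (v (fromℕ m)) (v zero) ≡ j)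

Arrows : ℕ → ℕ → ℕ → Set
Arrows k m N = ∀ (c : EdgeColouring N k) → Gallai c → MonoCycle c m

IsGR : ℕ → ℕ → ℕ → Set
IsGR k m N = (0 < N) × Arrows k m N × (∀ N' → 0 < N' → N' < N → ¬ Arrows k m N')

-- By Gallai, a colouring of W without rainbow triangle splits W into homogeneous
-- classes, any two of which are joined in one of two colours, red and blue. Call a
-- class large if it has at least n vertices. Two large sets joined in red contain
-- no red edge (if they have more than n vertices), as it would close a red cycle
-- of length 2n+1 through the complete bipartite graph between them. So large
-- classes see fewer colours, and one inducts on the number k of colours. The
-- induction carries sets X c with fewer than n vertices, joined to W in colour c,
-- which absorb the vertices outside large classes; the bound proved is
-- |W| + Σ |X c| ≤ n 2^k.
--
-- If no class is large, only red and blue matter. If X red and X blue are both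
-- nonempty, W is nearly covered by a red and a blue path, and a long path closes to
-- a cycle through X. Otherwise one needs that a two-coloured K_{4n+1} contains a
-- monochromatic C_{2n+1}: comparing numbers of edges, some colour has a subgraph of
-- minimum degree greater than n, hence by Dirac's argument a cycle of length at
-- least 2n+1, unless the other colour contains K_{n,n+1}; the latter forces a
-- C_{2n+1}, and a case distinction on chords shortens the long cycle.
module Submission where

open import Defs
open import Data.Nat using (ℕ; zero; suc; pred; _+_; _*_; _∸_; _^_; _≤_; _<_; z≤n; s≤s; _≡ᵇ_; _<ᵇ_; _≤?_; _<?_; _/_; _%_; NonZero)
open import Data.Nat.Properties hiding (_≟_)
open import Data.Nat.Tactic.RingSolver using (solve-∀)
open import Data.Nat.ListAction using (sum)
open import Data.Nat.ListAction.Properties using (sum-↭)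
open import Data.Bool using (Bool; true; false; not; _∧_; _∨_; if_then_else_; T)
open import Data.Nat.DivMod using (n/1≡n; m%n<n; m≡m%n+[m/n]*n; m<n*o⇒m/o<n)
open import Relation.Binary.Construct.Closure.ReflexiveTransitive using (Star; ε; _◅_; _◅◅_)
import Relation.Binary.Construct.Closure.ReflexiveTransitive as Star
import Data.Nat as Nat
import Data.Bool.Properties as Boolₚ
open import Data.Fin using (Fin; zero; suc; toℕ; fromℕ<; inject₁; fromℕ)
import Data.Fin.Properties as Finₚ
open import Data.List using (List; []; _∷_; _++_; length; map; filter; take; drop; reverse; allFin; upTo; tabulate; [_])
open import Data.List.Properties using (length-++; length-take; length-map; ++-assoc; length-filter; take++drop≡id; unfold-reverse; filter-accept; filter-reject; filter-++; ∷ʳ-injectiveʳ; ∷-injectiveʳ; length-tabulate; length-upTo; map-id)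
open import Data.List.Relation.Unary.All using (All; []; _∷_)
import Data.List.Relation.Unary.All as All
import Data.List.Relation.Unary.All.Properties as Allₚ
open import Data.List.Relation.Unary.Any using (Any; here; there; any?)
open import Data.List.Relation.Unary.AllPairs using (AllPairs; []; _∷_)
import Data.List.Relation.Unary.AllPairs.Properties as AllPairsₚ
open import Data.List.Relation.Unary.Unique.Propositional using (Unique)
import Data.List.Relation.Unary.Unique.Propositional.Properties as Uniqueₚ
open import Data.List.Membership.Propositional using (_∈_; _∉_; find; lose)
open import Data.List.Membership.Propositional.Properties using (∈-++⁺ˡ; ∈-++⁺ʳ; ∈-++⁻; ∈-filter⁺; ∈-filter⁻; ∈-∃++; ∈-map⁻; ∈-allFin; ∈-upTo⁻; ∈-upTo⁺; ∈-tabulate⁻)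
open import Data.List.Relation.Binary.Subset.Propositional using (_⊆_)
open import Data.List.Relation.Binary.Permutation.Propositional using (_↭_; ↭⇒↭ₛ; refl; prep; swap; trans; ↭-sym; ↭-trans; ↭-refl; ↭-reflexive)
open import Data.List.Relation.Binary.Permutation.Propositional.Properties using (∈-resp-↭; ↭-length; shift; ++-comm; ↭-reverse; filter-↭; ++⁺ˡ; All-resp-↭) renaming (++⁺ to ↭-++⁺; map⁺ to ↭-map⁺)
import Data.List.Relation.Binary.Permutation.Setoid.Properties as PermSetoid
open import Data.List.Relation.Unary.Linked.Properties using (Linked⇒AllPairs)
import Data.List.Sort as Sort
import Relation.Binary.Construct.On as On
open import Data.Product using (∃; ∃₂; _×_; _,_; proj₁; proj₂)
open import Data.Sum using (_⊎_; inj₁; inj₂; [_,_]′)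
open import Data.Empty using (⊥; ⊥-elim)
open import Data.Unit using (tt)
open import Function using (_∘_; id)
open import Relation.Nullary using (¬_; Dec; yes; no; ¬?; contradiction)
open import Relation.Nullary.Decidable using (⌊_⌋; _×-dec_; _⊎-dec_; decidable-stable)
open import Relation.Binary using (DecidableEquality; DecTotalOrder; Symmetric)
open import Relation.Binary.PropositionalEquality using (_≡_; _≢_; refl; cong; cong₂; subst; subst₂; setoid; module ≡-Reasoning) renaming (sym to ≡-sym; trans to ≡-trans)

-- Paths, cycles and complete bipartite pairs

-- Everything except the finite certificates is uniform in `n = 2 + j`; the values n = 4, 5 enter
-- only through `UngreyedBound` and `GreyedBound`. Grey stands for the edges inside a class, whose
-- colours are forgotten. The obstacle is a single large class with few vertices outside: it may
-- keep all its colours, so the number of colours does not drop. Moving the outer vertices into X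
-- red and X blue keeps the sum |W| + Σ |X c| unchanged while W shrinks. For F = n 2^(k+1), the
-- bound for k + 1 colours, the goal for k + 3 colours is 4F. A set that loses both red and blue
-- costs F, a set that loses one of them 2F. Since Σ |X c| over the other colours is at most F - n -
-- 1, and 2n ≤ F, up to 7n + 1 vertices fit when no class is large. This slack is the reason for the
-- threshold 7n + 2 of `GreyedBound`: there it suffices to bound the number of classes of each size.
-- Only the case of two colours needs the sharp value 4n.

module _ {V : Set} where

  Unique-resp-↭ : {xs ys : List V} → xs ↭ ys → Unique xs → Unique ys
  Unique-resp-↭ p = PermSetoid.Unique-resp-↭ (setoid V) (↭⇒↭ₛ p)

  Unique-cons : {x : V} {xs : List V} → x ∉ xs → Unique xs → Unique (x ∷ xs)
  Unique-cons x∉ u = Allₚ.¬Any⇒All¬ _ x∉ ∷ u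

  head∉ : {x : V} {xs : List V} → Unique (x ∷ xs) → x ∉ xs
  head∉ (p ∷ _) = Allₚ.All¬⇒¬Any p

  Unique-++⁺ : {xs ys : List V} → Unique xs → Unique ys → (∀ {v} → v ∈ xs → v ∉ ys) → Unique (xs ++ ys)
  Unique-++⁺ u w d = Uniqueₚ.++⁺ u w λ (p , q) → d p q

  Unique-++⁻ʳ : (xs : List V) {ys : List V} → Unique (xs ++ ys) → Unique ys
  Unique-++⁻ʳ [] u = u
  Unique-++⁻ʳ (x ∷ xs) (_ ∷ u) = Unique-++⁻ʳ xs u

  Unique-++⁻ˡ : (xs : List V) {ys : List V} → Unique (xs ++ ys) → Unique xs
  Unique-++⁻ˡ [] u = []
  Unique-++⁻ˡ (x ∷ xs) u@(_ ∷ u′) = Unique-cons (λ p → head∉ u (∈-++⁺ˡ p)) (Unique-++⁻ˡ xs u′)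

  Unique-disjoint : (xs : List V) {ys : List V} → Unique (xs ++ ys) → ∀ {v} → v ∈ xs → v ∉ ys
  Unique-disjoint (x ∷ xs) u (here refl) q = head∉ u (∈-++⁺ʳ xs q)
  Unique-disjoint (x ∷ xs) (_ ∷ u) (there p) q = Unique-disjoint xs u p q

  ↭-head : {x : V} {xs : List V} → x ∈ xs → ∃ λ ys → xs ↭ x ∷ ys
  ↭-head {x} p with ys , zs , refl ← ∈-∃++ p = ys ++ zs , shift x ys zs

  length-⊆ : {xs ys : List V} → Unique xs → xs ⊆ ys → length xs ≤ length ys
  length-⊆ {[]} _ _ = z≤n
  length-⊆ {x ∷ xs} u@(_ ∷ u′) s with zs , p ← ↭-head (s (here refl)) =
    subst (suc (length xs) ≤_) (≡-sym (↭-length p)) (s≤s (length-⊆ u′ λ {v} q → tail v q (∈-resp-↭ p (s (there q)))))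
    where
    tail : ∀ v → v ∈ xs → v ∈ x ∷ zs → v ∈ zs
    tail v q (here refl) = ⊥-elim (head∉ u q)
    tail v q (there r) = r

  ∈-take : (k : ℕ) {xs : List V} {x : V} → x ∈ take k xs → x ∈ xs
  ∈-take (suc k) {y ∷ xs} (here p) = here p
  ∈-take (suc k) {y ∷ xs} (there p) = there (∈-take k p)

  ∈-drop : (k : ℕ) {xs : List V} {x : V} → x ∈ drop k xs → x ∈ xs
  ∈-drop zero p = p
  ∈-drop (suc k) {y ∷ xs} p = there (∈-drop k p)

  length-take-≤ : (k : ℕ) (xs : List V) → k ≤ length xs → length (take k xs) ≡ k
  length-take-≤ k xs h = ≡-trans (length-take k xs) (m≤n⇒m⊓n≡m h)

  shrink : (k : ℕ) {xs : List V} → Unique xs → k ≤ length xs →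
           ∃ λ ys → Unique ys × ys ⊆ xs × length ys ≡ k
  shrink k {xs} u h = take k xs , Uniqueₚ.take⁺ k u , ∈-take k , length-take-≤ k xs h

  nonempty : {xs : List V} → 0 < length xs → ∃ λ x → x ∈ xs
  nonempty {x ∷ _} _ = x , here refl

  two-distinct : {xs : List V} → Unique xs → 2 ≤ length xs → ∃₂ λ x y → x ∈ xs × y ∈ xs × x ≢ y
  two-distinct {x ∷ y ∷ _} ((x≢y ∷ _) ∷ _) _ = x , y , here refl , there (here refl) , x≢y
  two-distinct {_ ∷ []} _ (s≤s ())

  length-filter-split : {P : V → Set} (P? : ∀ v → Dec (P v)) (xs : List V) →
    length (filter P? xs) + length (filter (¬? ∘ P?) xs) ≡ length xs
  length-filter-split P? [] = refl
  length-filter-split P? (x ∷ xs) with P? x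
  ... | yes _ = cong suc (length-filter-split P? xs)
  ... | no _ = ≡-trans (+-suc _ _) (cong suc (length-filter-split P? xs))

  -- Exchanging the arguments at each call makes the lists alternate; if the first is longer by one,
  -- it supplies both ends.
  weave : List V → List V → List V
  weave [] ys = ys
  weave (x ∷ xs) ys = x ∷ weave ys xs

  weave-↭ : (xs ys : List V) → weave xs ys ↭ xs ++ ys
  weave-↭ [] ys = ↭-refl
  weave-↭ (x ∷ xs) ys = prep x (↭-trans (weave-↭ ys xs) (++-comm ys xs))

  data Path (R : V → V → Set) : V → V → List V → Set where
    stop : ∀ {x} → Path R x x (x ∷ [])
    _◂_ : ∀ {x y z vs} → R x y → Path R y z vs → Path R x z (x ∷ vs)

  infixr 5 _◂_

  HasCycle : (V → V → Set) → ℕ → Set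
  HasCycle R m = ∃ λ vs → ∃₂ λ x z → Path R x z vs × R z x × Unique vs × length vs ≡ m

  module _ {R : V → V → Set} where

    Path-head∈ : ∀ {x z vs} → Path R x z vs → x ∈ vs
    Path-head∈ stop = here refl
    Path-head∈ (_ ◂ _) = here refl

    Path-last∈ : ∀ {x z vs} → Path R x z vs → z ∈ vs
    Path-last∈ stop = here refl
    Path-last∈ (_ ◂ p) = there (Path-last∈ p)

    Path-++ : ∀ {x y u z vs ws} → Path R x y vs → R y u → Path R u z ws → Path R x z (vs ++ ws)
    Path-++ stop r q = r ◂ q
    Path-++ (s ◂ p) r q = s ◂ Path-++ p r q

    Path-reverse : Symmetric R → ∀ {x z vs} → Path R x z vs → Path R z x (reverse vs)
    Path-reverse _ stop = stop
    Path-reverse sy {x} (_◂_ {vs = vs} r p) =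
      subst (Path R _ x) (≡-sym (unfold-reverse x vs)) (Path-++ (Path-reverse sy p) (sy r) stop)

    Path-split : ∀ {x z} as {c b bs} → Path R x z (as ++ c ∷ b ∷ bs) →
                 Path R x c (as ++ [ c ]) × R c b × Path R b z (b ∷ bs)
    Path-split [] (r ◂ stop) = stop , r , stop
    Path-split [] (r ◂ (s ◂ p)) = stop , r , s ◂ p
    Path-split (a ∷ []) (r ◂ (s ◂ p)) with Path-split [] (s ◂ p)
    ... | q , t , w = r ◂ q , t , w
    Path-split (a ∷ as@(_ ∷ _)) (r ◂ p) with Path-split as p
    ... | q , t , w = r ◂ q , t , w

    Path-weave : (x : V) (mid ys : List V) (z : V) → length ys ≡ suc (length mid) →
      (∀ {a b} → a ∈ x ∷ mid ++ [ z ] → b ∈ ys → R a b × R b a) →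
      Path R x z (weave (x ∷ mid ++ [ z ]) ys)
    Path-weave x [] (y ∷ []) z _ c =
      proj₁ (c (here refl) (here refl)) ◂ proj₂ (c (there (here refl)) (here refl)) ◂ stop
    Path-weave x (m ∷ mid) (y ∷ ys) z e c =
      proj₁ (c (here refl) (here refl)) ◂ proj₂ (c (there (here refl)) (here refl)) ◂
      Path-weave m mid ys z (suc-injective e) (λ p q → c (there p) (there q))

  Path-map : {R S : V → V → Set} → (∀ {x y} → R x y → S x y) → ∀ {x z vs} → Path R x z vs → Path S x z vs
  Path-map f stop = stop
  Path-map f (r ◂ p) = f r ◂ Path-map f p

  HasCycle-map : {R S : V → V → Set} → (∀ {x y} → R x y → S x y) → ∀ {m} → HasCycle R m → HasCycle S m
  HasCycle-map f (vs , x , z , p , r , u) = vs , x , z , Path-map f p , f r , u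

module _ {V : Set} (_≟_ : DecidableEquality V) where

  open import Data.List.Membership.DecPropositional _≟_ using (_∈?_)

  without : V → List V → List V
  without x = filter λ v → ¬? (v ≟ x)

  ∈-without : ∀ {x v xs} → v ∈ without x xs → v ∈ xs × v ≢ x
  ∈-without {x} = ∈-filter⁻ λ v → ¬? (v ≟ x)

  length-without : ∀ x {xs} → Unique xs → length xs ≤ suc (length (without x xs))
  length-without x {xs} u = length-⊆ u sub
    where
    sub : xs ⊆ x ∷ without x xs
    sub {v} p with v ≟ x
    ... | yes e = here e
    ... | no ne = there (∈-filter⁺ _ p ne)

  Unique-without : ∀ x {xs} → Unique xs → Unique (without x xs)
  Unique-without x = Uniqueₚ.filter⁺ _

  avoid : ∀ {k} x {xs} → Unique xs → suc k ≤ length xs →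
          ∃ λ ys → Unique ys × (∀ {v} → v ∈ ys → v ∈ xs × v ≢ x) × k ≤ length ys
  avoid x {xs} u h = without x xs , Unique-without x u , ∈-without ,
    ≤-pred (≤-trans h (length-without x u))

  -- Writing n as `2 + j` guarantees two distinct vertices in a set of size n and expresses n - 1 as
  -- `suc j` without truncated subtraction.
  module Bipartite {R : V → V → Set} (sy : Symmetric R) (irr : ∀ {v} → ¬ R v v) (j : ℕ) where

    private n = 2 + j

    Complete : List V → List V → Set
    Complete A B = ∀ {a b} → a ∈ A → b ∈ B → R a b

    disjoint : ∀ {A B} → Complete A B → ∀ {v} → v ∈ A → v ∉ B
    disjoint c p q = irr (c p q)

    -- The cycle is y, a, ..., a′, y′: from a to a′ it alternates between n vertices of `A` and n -
    -- 1 of `B`, and the edge between y′ and y closes it. The two outer vertices make the length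
    -- odd.
    attach : ∀ {A B y y′ a a′} → Unique A → Unique B → Complete A B → n ≤ length A → suc j ≤ length B →
      y ∉ A → y ∉ B → y′ ∉ A → y′ ∉ B → R y y′ → a ∈ A → a′ ∈ A → a ≢ a′ → R y a → R y′ a′ →
      HasCycle R (2 * n + 1)
    attach {A} {B} {y} {y′} {a} {a′} uA uB c hA hB yA yB y′A y′B yy′ aA a′A a≢a′ ya y′a′
      with A₁ , uA₁ , sA₁ , hA₁ ← avoid a uA hA
      with A₂ , uA₂ , sA₂ , hA₂ ← avoid a′ uA₁ hA₁
      with A₃ , uA₃ , sA₃ , hA₃ ← shrink j uA₂ hA₂
      with B₁ , uB₁ , sB₁ , hB₁ ← shrink (suc j) uB hB =
      y ∷ w ++ [ y′ ] , y , y′ , ya ◂ Path-++ path (sy y′a′) stop , sy yy′ , uniq , len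
      where
      mid = a ∷ A₃ ++ [ a′ ]
      w = weave mid B₁
      mid⊆ : mid ⊆ A
      mid⊆ (here refl) = aA
      mid⊆ (there p) with ∈-++⁻ A₃ p
      ... | inj₁ q = proj₁ (sA₁ (proj₁ (sA₂ (sA₃ q))))
      ... | inj₂ (here refl) = a′A
      path : Path R a a′ w
      path = Path-weave a A₃ B₁ a′ (≡-trans hB₁ (cong suc (≡-sym hA₃)))
        (λ p q → c (mid⊆ p) (sB₁ q) , sy (c (mid⊆ p) (sB₁ q)))
      midU : Unique mid
      midU = Unique-cons
        (λ p → [ (λ q → proj₂ (sA₁ (proj₁ (sA₂ (sA₃ q)))) refl) , (λ { (here e) → a≢a′ e }) ]′ (∈-++⁻ A₃ p))
        (Unique-++⁺ uA₃ ([] ∷ []) λ { q (here refl) → proj₂ (sA₂ (sA₃ q)) refl })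
      w⊆ : ∀ {v} → v ∈ w → v ∈ A ⊎ v ∈ B
      w⊆ p with ∈-++⁻ mid (∈-resp-↭ (weave-↭ mid B₁) p)
      ... | inj₁ q = inj₁ (mid⊆ q)
      ... | inj₂ q = inj₂ (sB₁ q)
      uw : Unique w
      uw = Unique-resp-↭ (↭-sym (weave-↭ mid B₁)) (Unique-++⁺ midU uB₁ λ p q → disjoint c (mid⊆ p) (sB₁ q))
      uniq : Unique (y ∷ w ++ [ y′ ])
      uniq = Unique-cons
        (λ p → [ (λ q → [ yA , yB ]′ (w⊆ q)) , (λ { (here refl) → irr yy′ }) ]′ (∈-++⁻ w p))
        (Unique-++⁺ uw ([] ∷ []) λ { q (here refl) → [ y′A , y′B ]′ (w⊆ q) })
      len : length (y ∷ w ++ [ y′ ]) ≡ 2 * n + 1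
      lw : length w ≡ suc (j + 1) + suc j
      lw = ≡-trans (↭-length (weave-↭ mid B₁)) (≡-trans (length-++ mid)
        (cong₂ _+_ (cong suc (≡-trans (length-++ A₃) (cong (_+ 1) hA₃))) hB₁))
      len = ≡-trans (cong suc (≡-trans (length-++ w) (cong (_+ 1) lw))) (arith j)
        where
        arith : ∀ j → suc (suc (j + 1 + suc j) + 1) ≡ 2 * (2 + j) + 1
        arith = solve-∀

    -- The ends of the edge are removed from `B`, which leaves the n - 1 vertices needed by
    -- `attach`; hence `B` must have n + 1 vertices and `A` only n.
    inner-edge : ∀ {A B y y′} → Unique A → Unique B → Complete A B → n ≤ length A → suc n ≤ length B →
      y ∈ B → y′ ∈ B → R y y′ → HasCycle R (2 * n + 1)
    inner-edge {A} {B} {y} {y′} uA uB c hA hB yB y′B yy′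
      with B₁ , uB₁ , sB₁ , hB₁ ← avoid y uB hB
      with B₂ , uB₂ , sB₂ , hB₂ ← avoid y′ uB₁ hB₁
      with a , a′ , aA , a′A , ne ← two-distinct uA (≤-trans (s≤s (s≤s z≤n)) hA) =
      attach uA uB₂ (λ p q → c p (proj₁ (sB₁ (proj₁ (sB₂ q))))) hA hB₂
        (λ p → disjoint c p yB) (λ q → proj₂ (sB₁ (proj₁ (sB₂ q))) refl)
        (λ p → disjoint c p y′B) (λ q → proj₂ (sB₂ q) refl)
        yy′ aA a′A ne (sy (c aA yB)) (sy (c a′A y′B))

    -- The edge from `v` to `b` is the outer edge of `attach`, with `b` taken out of `B`: `v` enters
    -- `A` at `a`, and `b` enters it at any other vertex.
    apex : ∀ {A B v a b} → Unique A → Unique B → Complete A B → n ≤ length A → n ≤ length B →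
      v ∉ A → v ∉ B → a ∈ A → b ∈ B → R v a → R v b → HasCycle R (2 * n + 1)
    apex {A} {B} {v} {a} {b} uA uB c hA hB vA vB aA bB va vb
      with B₁ , uB₁ , sB₁ , hB₁ ← avoid b uB hB
      with A₁ , uA₁ , sA₁ , hA₁ ← avoid a uA hA
      with a′ , p ← nonempty (≤-trans (s≤s z≤n) hA₁) =
      attach uA uB₁ (λ p q → c p (proj₁ (sB₁ q))) hA hB₁ vA (λ q → vB (proj₁ (sB₁ q)))
        (λ p → disjoint c p bB) (λ q → proj₂ (sB₁ q) refl) vb aA (proj₁ (sA₁ p))
        (λ e → proj₂ (sA₁ p) (≡-sym e)) va (sy (c (proj₁ (sA₁ p)) bB))

-- Complete multipartite graphs

module _ {V : Set} where

  Alike : (V → ℕ) → List V → Set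
  Alike lab zs = ∀ {x y} → x ∈ zs → y ∈ zs → lab x ≡ lab y

  -- Quantifying over lists of like-labelled vertices, not over classes as objects, lets the bound
  -- pass to sublists at once.
  ClassBound : (V → ℕ) → ℕ → List V → Set
  ClassBound lab g vs = ∀ zs → Unique zs → zs ⊆ vs → Alike lab zs → length zs ≤ g

  AllPairs-++⁻ʳ : {S : V → V → Set} (xs : List V) {ys : List V} → AllPairs S (xs ++ ys) → AllPairs S ys
  AllPairs-++⁻ʳ [] p = p
  AllPairs-++⁻ʳ (x ∷ xs) (_ ∷ p) = AllPairs-++⁻ʳ xs p

  AllPairs-before : {S : V → V → Set} (xs : List V) {y : V} {ys : List V} →
    AllPairs S (xs ++ y ∷ ys) → ∀ {x} → x ∈ xs → S x y
  AllPairs-before (x ∷ xs) (p ∷ _) (here refl) = All.lookup p (∈-++⁺ʳ xs (here refl))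
  AllPairs-before (x ∷ xs) (_ ∷ p) (there q) = AllPairs-before xs p q

  -- In a list of 2n+1 vertices sorted by class, equal classes are less than n
  -- apart when classes have at most n members; weaving the first n+1 with the
  -- last n vertices only joins vertices that are n or n+1 apart.
  module Multipartite {R : V → V → Set} (lab : V → ℕ) (n′ : ℕ) where

    private n = suc n′

    Far : List V → Set
    Far l = ∀ p a mid b q → l ≡ p ++ a ∷ mid ++ b ∷ q → n ≤ suc (length mid) → R a b × R b a

    private
      far-tail : ∀ {x l} → Far (x ∷ l) → Far l
      far-tail {x} f p a mid b q e = f (x ∷ p) a mid b q (cong (x ∷_) e)

      -- `done` collects the vertices of the second part that are already woven. They still lie
      -- between the next `x` and the next `y`, so these stay n + 1 places apart, and the successor
      -- of `x` stays n places from `y`.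
      weave-far : ∀ x xs done ys → length xs ≡ length ys → length done + length xs ≡ n →
        Far (x ∷ xs ++ done ++ ys) →
        ∃₂ λ pre z → x ∷ xs ≡ pre ++ [ z ] × length pre ≡ length xs × Path R x z (weave (x ∷ xs) ys)
      weave-far x [] done [] _ _ _ = [] , x , refl , refl , stop
      weave-far x (x′ ∷ xs) done (y ∷ ys) e h f
        with pre , z , e₁ , e₂ , p ← weave-far x′ xs (done ++ [ y ]) ys (suc-injective e)
          (≡-trans (cong (_+ length xs) (length-++ done)) (≡-trans (+-assoc (length done) 1 _) h))
          (subst Far (cong (λ l → x′ ∷ xs ++ l) (≡-sym (++-assoc done [ y ] ys))) (far-tail f)) =
        x ∷ pre , z , cong (x ∷_) e₁ , cong suc e₂ ,
        proj₁ (f [] x (x′ ∷ xs ++ done) y ys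
          (cong (λ l → x ∷ x′ ∷ l) (≡-sym (++-assoc xs done (y ∷ ys))))
          (≤-trans (≤-reflexive (≡-sym h)) (≤-trans (≤-reflexive (≡-trans (+-comm (length done) _) (≡-sym (length-++ (x′ ∷ xs))))) (n≤1+n _)))) ◂
        proj₂ (f (x ∷ []) x′ (xs ++ done) y ys
          (cong (λ l → x ∷ x′ ∷ l) (≡-sym (++-assoc xs done (y ∷ ys))))
          (≤-reflexive (≡-trans (≡-sym h) (≡-trans (+-suc (length done) _) (cong suc (≡-trans (+-comm (length done) _) (≡-sym (length-++ xs)))))))) ◂ p

    labelOrder : DecTotalOrder _ _ _
    labelOrder = On.decTotalOrder ≤-decTotalOrder lab

    open Sort labelOrder using (sort; sort-↭; sort-↗)

    -- If both ends of the block had the same label, sortedness would give that label to the whole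
    -- block, which has at least n + 1 vertices.
    sorted-far : ∀ {s} → Unique s → AllPairs (λ x y → lab x ≤ lab y) s → ClassBound lab n s →
      (∀ {x y} → x ∈ s → y ∈ s → lab x ≢ lab y → R x y) → Far s
    sorted-far {s} u ap cb r p a mid b q refl h = r a∈ b∈ differ , r b∈ a∈ (differ ∘ ≡-sym)
      where
      a∈ : a ∈ p ++ a ∷ mid ++ b ∷ q
      a∈ = ∈-++⁺ʳ p (here refl)
      b∈ : b ∈ p ++ a ∷ mid ++ b ∷ q
      b∈ = ∈-++⁺ʳ p (there (∈-++⁺ʳ mid (here refl)))
      ap′ = AllPairs-++⁻ʳ p ap
      block : List V
      block = a ∷ mid ++ [ b ]
      e : p ++ a ∷ mid ++ b ∷ q ≡ p ++ block ++ q
      e = cong (λ l → p ++ a ∷ l) (≡-sym (++-assoc mid [ b ] q))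
      differ : lab a ≢ lab b
      differ eq = <⇒≱ (≤-reflexive (cong suc (≡-sym (≡-trans (length-++ mid) (+-comm (length mid) 1)))))
          (≤-trans (cb block (Unique-++⁻ˡ block (Unique-++⁻ʳ p (subst Unique e u)))
            (λ m → subst (_ ∈_) (≡-sym e) (∈-++⁺ʳ p (∈-++⁺ˡ m))) same) h)
        where
        val : ∀ {x} → x ∈ block → lab x ≡ lab a
        val (here refl) = refl
        val (there m) with ∈-++⁻ mid m
        ... | inj₂ (here refl) = ≡-sym eq
        ... | inj₁ m′ with ap′
        ...   | la ∷ rest = ≤-antisym
          (≤-trans (AllPairs-before mid rest m′) (≤-reflexive (≡-sym eq)))
          (All.lookup la (∈-++⁺ˡ m′))
        same : Alike lab block
        same m m′ = ≡-trans (val m) (≡-sym (val m′))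

    multipartite-cycle : ∀ {vs} → Unique vs → 2 * n + 1 ≤ length vs → ClassBound lab n vs →
      (∀ {x y} → x ∈ vs → y ∈ vs → lab x ≢ lab y → R x y) → HasCycle R (2 * n + 1)
    multipartite-cycle {vs} u h cb r with shrink (2 * n + 1) u h
    ... | vs′ , u′ , sub , len = result
      where
      s = sort vs′
      s↭ : s ↭ vs′
      s↭ = sort-↭ vs′
      us : Unique s
      us = Unique-resp-↭ (↭-sym s↭) u′
      lens : length s ≡ 2 * n + 1
      lens = ≡-trans (↭-length s↭) len
      s⊆ : s ⊆ vs
      s⊆ m = sub (∈-resp-↭ s↭ m)
      far : Far s
      far = sorted-far us (Linked⇒AllPairs ≤-trans (sort-↗ vs′))
        (λ zs uz z⊆ → cb zs uz (λ m → s⊆ (z⊆ m))) (λ m m′ → r (s⊆ m) (s⊆ m′))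
      xs = take (suc n) s
      ys = drop (suc n) s
      xy : xs ++ ys ≡ s
      xy = take++drop≡id (suc n) s
      lx : length xs ≡ suc n
      lx = length-take-≤ (suc n) s (≤-trans (m≤m+n (suc n) n) (≤-reflexive (≡-trans (arith n) (≡-sym lens))))
        where
        arith : ∀ n → suc n + n ≡ 2 * n + 1
        arith = solve-∀
      ly : length ys ≡ n
      ly = +-cancelˡ-≡ (suc n) _ _ (≡-trans (≡-trans (cong (_+ length ys) (≡-sym lx)) (≡-sym (length-++ xs)))
        (≡-trans (cong length xy) (≡-trans lens (arith n))))
        where
        arith : ∀ n → 2 * n + 1 ≡ suc n + n
        arith = solve-∀
      finish : ∀ x xs′ → xs ≡ x ∷ xs′ → HasCycle R (2 * n + 1)
      finish x xs′ ex
        with pre , z , e₁ , e₂ , p ← weave-far x xs′ [] ys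
          (suc-injective (≡-trans (≡-trans (cong length (≡-sym ex)) lx) (cong suc (≡-sym ly))))
          (suc-injective (≡-trans (cong length (≡-sym ex)) lx))
          (subst Far (≡-trans (≡-sym xy) (cong (_++ ys) ex)) far) =
        weave (x ∷ xs′) ys , x , z , p , close pre e₁ e₂ ,
        Unique-resp-↭ (↭-sym w↭) us , ≡-trans (↭-length w↭) lens
        where
        w↭ : weave (x ∷ xs′) ys ↭ s
        w↭ = ↭-trans (weave-↭ (x ∷ xs′) ys) (↭-reflexive (≡-trans (cong (_++ ys) (≡-sym ex)) xy))
        lxs′ : length xs′ ≡ n
        lxs′ = suc-injective (≡-trans (cong length (≡-sym ex)) lx)
        -- The two ends of the woven path are the first and the last of the n + 1 vertices of `xs`,
        -- hence n places apart in the sorted list and joined.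
        close : ∀ pre → x ∷ xs′ ≡ pre ++ [ z ] → length pre ≡ length xs′ → R z x
        close [] _ e₂ = contradiction (≡-trans e₂ lxs′) λ ()
        close (_ ∷ pre) refl e₂ = proj₂ (far [] x pre z ys
          (≡-trans (≡-sym xy) (≡-trans (cong (_++ ys) ex) (cong (x ∷_) (++-assoc pre [ z ] ys))))
          (≤-reflexive (≡-trans (≡-sym lxs′) (≡-sym e₂))))
      result : HasCycle R (2 * n + 1)
      result with xs in eq
      ... | [] = contradiction lx′ λ ()
        where
        lx′ : 0 ≡ suc n
        lx′ = ≡-trans (≡-sym (cong length eq)) lx
      ... | x ∷ xs′ = finish x xs′ eq

-- Refutation certificates

-- A refutation by cases: split u v continues with the edge u v red, then blue; a
-- leaf names a monochromatic cycle of given length or a complete bipartite graph.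
-- Lists of vertices are the base 32 digits of one number, lowest digit first.
data Tree : Set where
  split : ℕ → ℕ → Tree → Tree → Tree
  red blue : ℕ → ℕ → Tree
  bip : Bool → ℕ → ℕ → Tree

decode : ℕ → ℕ → List ℕ
decode zero _ = []
decode (suc m) k = k % 32 ∷ decode m (k / 32)

Edge : Set
Edge = ℕ × ℕ × Bool

_==_ : Bool → Bool → Bool
true == b = b
false == b = not b

≡ᵇ-refl : ∀ n → (n ≡ᵇ n) ≡ true
≡ᵇ-refl zero = refl
≡ᵇ-refl (suc n) = ≡ᵇ-refl n

≡ᵇ-complete : ∀ m {n} → m ≡ n → (m ≡ᵇ n) ≡ true
≡ᵇ-complete m refl = ≡ᵇ-refl m

≡ᵇ-sound : ∀ {m n} → (m ≡ᵇ n) ≡ true → m ≡ n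
≡ᵇ-sound {m} {n} e = ≡ᵇ⇒≡ m n (subst T (≡-sym e) tt)

<ᵇ-sound : ∀ {m n} → (m <ᵇ n) ≡ true → m < n
<ᵇ-sound {m} {n} e = <ᵇ⇒< m n (subst T (≡-sym e) tt)

==-sound : ∀ {a b} → (a == b) ≡ true → a ≡ b
==-sound {true} {true} _ = refl
==-sound {false} {false} _ = refl

∧-split : ∀ a {b} → (a ∧ b) ≡ true → a ≡ true × b ≡ true
∧-split true e = refl , e

not-true : ∀ {a} → not a ≡ true → a ≡ false
not-true {false} _ = refl

known : Edge → List Edge → Bool
known _ [] = false
known (u , v , c) ((u′ , v′ , c′) ∷ es) =
  ((c == c′) ∧ (((u ≡ᵇ u′) ∧ (v ≡ᵇ v′)) ∨ ((u ≡ᵇ v′) ∧ (v ≡ᵇ u′)))) ∨ known (u , v , c) es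

elem : ℕ → List ℕ → Bool
elem x [] = false
elem x (y ∷ ys) = (x ≡ᵇ y) ∨ elem x ys

distinct : List ℕ → Bool
distinct [] = true
distinct (x ∷ xs) = not (elem x xs) ∧ distinct xs

every : (ℕ → Bool) → List ℕ → Bool
every p [] = true
every p (x ∷ xs) = p x ∧ every p xs

below : ℕ → List ℕ → Bool
below M = every (_<ᵇ M)

elem-complete : ∀ {x xs} → x ∈ xs → elem x xs ≡ true
elem-complete {x} {_ ∷ xs} (here refl) rewrite ≡ᵇ-refl x = refl
elem-complete {x} {y ∷ xs} (there p) with x ≡ᵇ y
... | true = refl
... | false = elem-complete p

distinct-sound : ∀ xs → distinct xs ≡ true → Unique xs
distinct-sound [] _ = []
distinct-sound (x ∷ xs) e with h , e′ ← ∧-split (not (elem x xs)) e =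
  Unique-cons (λ p → contradiction (≡-trans (≡-sym (elem-complete p)) (not-true h)) λ ()) (distinct-sound xs e′)

below-sound : ∀ M xs → below M xs ≡ true → ∀ {x} → x ∈ xs → x < M
below-sound M (x ∷ xs) e (here refl) = <ᵇ-sound (proj₁ (∧-split (x <ᵇ M) e))
below-sound M (x ∷ xs) e (there p) = below-sound M xs (proj₂ (∧-split (x <ᵇ M) e)) p

-- Vertex x of the blow-up is one of b copies of the vertex x / b; edges are
-- recorded between blocks.
module Checker (n M b : ℕ) .{{_ : NonZero b}} (allowed : ℕ → Bool) where

  edge : List Edge → Bool → ℕ → ℕ → Bool
  edge K c x y = not ((x / b) ≡ᵇ (y / b)) ∧ known (x / b , y / b , c) K

  trail : List Edge → Bool → ℕ → ℕ → List ℕ → Bool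
  trail K c x₀ x [] = edge K c x x₀
  trail K c x₀ x (y ∷ ys) = edge K c x y ∧ trail K c x₀ y ys

  closed : List Edge → Bool → List ℕ → Bool
  closed K c [] = false
  closed K c (x ∷ xs) = trail K c x x xs

  joined : List Edge → Bool → List ℕ → List ℕ → Bool
  joined K c [] ys = true
  joined K c (x ∷ xs) ys = every (edge K c x) ys ∧ joined K c xs ys

  checkCycle : List Edge → Bool → List ℕ → Bool
  checkCycle K c vs = below M vs ∧ distinct vs ∧ closed K c vs

  checkBip : List Edge → Bool → List ℕ → List ℕ → Bool
  checkBip K c as bs = (below M as ∧ distinct as) ∧ (below M bs ∧ distinct bs) ∧ joined K c as bs

  check : List Edge → Tree → Bool
  check K (split u v t t′) = check ((u , v , true) ∷ K) t ∧ check ((u , v , false) ∷ K) t′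
  check K (red m k) = allowed m ∧ checkCycle K true (decode m k)
  check K (blue m k) = allowed m ∧ checkCycle K false (decode m k)
  check K (bip c k l) = checkBip K c (decode n k) (decode (suc n) l)

  module Sound {V : Set} (Adj : Bool → V → V → Set)
    (noCycle : ∀ c m → allowed m ≡ true → ¬ HasCycle (Adj c) m)
    (noBip : ∀ c A B → Unique A → Unique B → (∀ {x y} → x ∈ A → y ∈ B → Adj c x y) →
      length A ≡ n → length B ≡ suc n → ⊥)
    (f : ℕ → V) (f-inj : ∀ {x y} → x < M → y < M → f x ≡ f y → x ≡ y)
    (κ : ℕ → ℕ → Bool) (κ-sym : ∀ u v → κ u v ≡ κ v u)
    (adj : ∀ {x y} → x < M → y < M → x / b ≢ y / b → Adj (κ (x / b) (y / b)) (f x) (f y)) where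

    Valid : List Edge → Set
    Valid = All λ (u , v , c) → κ u v ≡ c

    known-sound : ∀ {u v c} K → Valid K → known (u , v , c) K ≡ true → κ u v ≡ c
    known-sound {u} {v} {c} ((u′ , v′ , c′) ∷ K) (h ∷ hs) e
      with c == c′ in ec | u ≡ᵇ u′ in e₁ | v ≡ᵇ v′ in e₂ | u ≡ᵇ v′ in e₃ | v ≡ᵇ u′ in e₄
    ... | false | _ | _ | _ | _ = known-sound K hs e
    ... | true | true | true | _ | _ rewrite ≡ᵇ-sound {u} e₁ | ≡ᵇ-sound {v} e₂ | ==-sound {c} ec = h
    ... | true | true | false | true | true rewrite ≡ᵇ-sound {u} e₃ | ≡ᵇ-sound {v} e₄ | ==-sound {c} ec = ≡-trans (κ-sym v′ u′) h
    ... | true | true | false | true | false = known-sound K hs e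
    ... | true | true | false | false | _ = known-sound K hs e
    ... | true | false | _ | true | true rewrite ≡ᵇ-sound {u} e₃ | ≡ᵇ-sound {v} e₄ | ==-sound {c} ec = ≡-trans (κ-sym v′ u′) h
    ... | true | false | _ | true | false = known-sound K hs e
    ... | true | false | _ | false | _ = known-sound K hs e

    edge-sound : ∀ {K c x y} → Valid K → x < M → y < M → edge K c x y ≡ true → Adj c (f x) (f y)
    edge-sound {K} {c} {x} {y} hK hx hy e with h , h′ ← ∧-split (not ((x / b) ≡ᵇ (y / b))) e =
      subst (λ d → Adj d (f x) (f y)) (known-sound K hK h′)
        (adj hx hy λ eq → contradiction (≡-trans (≡-sym (not-true h)) (≡ᵇ-complete (x / b) eq)) λ ())

    trail-sound : ∀ {K c} x₀ x xs → Valid K → x₀ < M → x < M → (∀ {y} → y ∈ xs → y < M) →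
      trail K c x₀ x xs ≡ true → ∃ λ z → Path (Adj c) (f x) z (map f (x ∷ xs)) × Adj c z (f x₀)
    trail-sound x₀ x [] hK h₀ hx hs e = f x , stop , edge-sound hK hx h₀ e
    trail-sound {K} {c} x₀ x (y ∷ ys) hK h₀ hx hs e
      with e₁ , e₂ ← ∧-split (edge K c x y) e
      with z , p , r ← trail-sound x₀ y ys hK h₀ (hs (here refl)) (hs ∘ there) e₂ =
      z , edge-sound hK hx (hs (here refl)) e₁ ◂ p , r

    map-unique : ∀ xs → Unique xs → (∀ {x} → x ∈ xs → x < M) → Unique (map f xs)
    map-unique [] _ _ = []
    map-unique (x ∷ xs) u@(_ ∷ u′) h = Unique-cons
      (λ p → let y , q , e = ∈-map⁻ f p in
        head∉ u (subst (_∈ xs) (≡-sym (f-inj (h (here refl)) (h (there q)) e)) q))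
      (map-unique xs u′ (h ∘ there))

    length-decode : ∀ m k → length (decode m k) ≡ m
    length-decode zero k = refl
    length-decode (suc m) k = cong suc (length-decode m (k / 32))

    cycle-sound : ∀ {K c} vs → Valid K → checkCycle K c vs ≡ true → HasCycle (Adj c) (length vs)
    cycle-sound {K} {c} (x ∷ xs) hK e
      with e₁ , e′ ← ∧-split (below M (x ∷ xs)) e
      with e₂ , e₃ ← ∧-split (distinct (x ∷ xs)) e′
      with hb ← below-sound M (x ∷ xs) e₁
      with z , p , r ← trail-sound x x xs hK (hb (here refl)) (hb (here refl)) (hb ∘ there) e₃ =
      map f (x ∷ xs) , f x , z , p , r , map-unique (x ∷ xs) (distinct-sound (x ∷ xs) e₂) hb , length-map f (x ∷ xs)
    cycle-sound {K} {c} [] hK ()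

    joined-sound : ∀ {K c} as bs → Valid K → (∀ {x} → x ∈ as → x < M) → (∀ {x} → x ∈ bs → x < M) →
      joined K c as bs ≡ true → ∀ {x y} → x ∈ as → y ∈ bs → Adj c (f x) (f y)
    joined-sound {K} {c} (a ∷ as) bs hK ha hb e (here refl) q =
      row bs hb (proj₁ (∧-split (every (edge K c a) bs) e)) q
      where
      row : ∀ bs → (∀ {x} → x ∈ bs → x < M) → every (edge K c a) bs ≡ true → ∀ {y} → y ∈ bs → Adj c (f a) (f y)
      row (b ∷ bs) hb e (here refl) = edge-sound hK (ha (here refl)) (hb (here refl)) (proj₁ (∧-split (edge K c a b) e))
      row (b ∷ bs) hb e (there q) = row bs (hb ∘ there) (proj₂ (∧-split (edge K c a b) e)) q
    joined-sound {K} {c} (a ∷ as) bs hK ha hb e (there p) q =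
      joined-sound as bs hK (ha ∘ there) hb (proj₂ (∧-split (every (edge K c a) bs) e)) p q

    bip-sound : ∀ {K c} as bs → Valid K → checkBip K c as bs ≡ true → length as ≡ n → length bs ≡ suc n → ⊥
    bip-sound {K} {c} as bs hK e la lb
      with e₁ , e′ ← ∧-split (below M as ∧ distinct as) e
      with e₂ , e₃ ← ∧-split (below M bs ∧ distinct bs) e′
      with h₁ , d₁ ← ∧-split (below M as) e₁ | h₂ , d₂ ← ∧-split (below M bs) e₂ =
      noBip c (map f as) (map f bs)
        (map-unique as (distinct-sound as d₁) (below-sound M as h₁))
        (map-unique bs (distinct-sound bs d₂) (below-sound M bs h₂))
        (λ p q → let x , p′ , ex = ∈-map⁻ f p ; y , q′ , ey = ∈-map⁻ f q in
          subst₂ (Adj c) (≡-sym ex) (≡-sym ey)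
            (joined-sound as bs hK (below-sound M as h₁) (below-sound M bs h₂) e₃ p′ q′))
        (≡-trans (length-map f as) la) (≡-trans (length-map f bs) lb)

    -- The actual colouring `κ` selects one branch at every `split`, so all edges recorded along the
    -- way are true, and the leaf reached contradicts `noCycle` or `noBip`.
    check-sound : ∀ {K} t → Valid K → check K t ≡ true → ⊥
    check-sound {K} (split u v t t′) hK e
      with e₁ , e₂ ← ∧-split (check ((u , v , true) ∷ K) t) e
      with κ u v in eq
    ... | true = check-sound t (eq ∷ hK) e₁
    ... | false = check-sound t′ (eq ∷ hK) e₂
    check-sound {K} (red m k) hK e with e₁ , e₂ ← ∧-split (allowed m) e =
      noCycle true m e₁ (subst (HasCycle (Adj true)) (length-decode m k) (cycle-sound (decode m k) hK e₂))
    check-sound {K} (blue m k) hK e with e₁ , e₂ ← ∧-split (allowed m) e =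
      noCycle false m e₁ (subst (HasCycle (Adj false)) (length-decode m k) (cycle-sound (decode m k) hK e₂))
    check-sound {K} (bip c k l) hK e =
      bip-sound (decode n k) (decode (suc n) l) hK e (length-decode n k) (length-decode (suc n) l)

-- Two-coloured complete graphs

module _ {V : Set} (W : List V) (lab : V → ℕ) (χ : V → V → Bool) where

  -- Vertices with equal labels are never adjacent, so the inside of a class carries no colour; with
  -- injective labels the graph is complete. Membership in `W` is part of adjacency, which keeps
  -- every cycle inside `W`.
  Adj : Bool → V → V → Set
  Adj c x y = (x ∈ W) × (y ∈ W) × lab x ≢ lab y × χ x y ≡ c

  Adj-sym : (∀ x y → χ x y ≡ χ y x) → ∀ c → Symmetric (Adj c)
  Adj-sym χ-sym c {x} {y} (p , q , ne , e) = q , p , ne ∘ ≡-sym , ≡-trans (χ-sym y x) e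

  Adj-irrefl : ∀ c {v} → ¬ Adj c v v
  Adj-irrefl c (_ , _ , ne , _) = ne refl

  Adj-path⊆ : ∀ {c x z vs} → Path (Adj c) x z vs → z ∈ W → vs ⊆ W
  Adj-path⊆ stop h (here refl) = h
  Adj-path⊆ (s ◂ p) h (here refl) = proj₁ s
  Adj-path⊆ (s ◂ p) h (there m) = Adj-path⊆ p h m

≢⇒≡not : ∀ {a c : Bool} → a ≢ c → a ≡ not c
≢⇒≡not {true} {true} h = contradiction refl h
≢⇒≡not {true} {false} _ = refl
≢⇒≡not {false} {true} _ = refl
≢⇒≡not {false} {false} h = contradiction refl h

equal-pair : (a b c : Bool) → a ≡ b ⊎ a ≡ c ⊎ b ≡ c
equal-pair true true _ = inj₁ refl
equal-pair false false _ = inj₁ refl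
equal-pair true false true = inj₂ (inj₁ refl)
equal-pair true false false = inj₂ (inj₂ refl)
equal-pair false true false = inj₂ (inj₁ refl)
equal-pair false true true = inj₂ (inj₂ refl)

three-distinct : ∀ {V : Set} {xs : List V} → Unique xs → 3 ≤ length xs →
  ∃ λ x → ∃₂ λ y z → (x ∈ xs × y ∈ xs × z ∈ xs) × (x ≢ y × x ≢ z × y ≢ z)
three-distinct {xs = x ∷ y ∷ z ∷ _} ((xy ∷ xz ∷ _) ∷ (yz ∷ _) ∷ _) _ =
  x , y , z , (here refl , there (here refl) , there (there (here refl))) , xy , xz , yz
three-distinct {xs = _ ∷ []} _ (s≤s ())
three-distinct {xs = _ ∷ _ ∷ []} _ (s≤s (s≤s ()))

module NoBip {V : Set} (_≟_ : DecidableEquality V) (W : List V) (uW : Unique W)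
  (lab : V → ℕ) (χ : V → V → Bool) (χ-sym : ∀ x y → χ x y ≡ χ y x)
  (inj : ∀ {x y} → x ∈ W → y ∈ W → lab x ≡ lab y → x ≡ y) (j : ℕ)
  (noOdd : ∀ c → ¬ HasCycle (Adj W lab χ c) (2 * (2 + j) + 1))
  (big : 4 * (2 + j) + 1 ≤ length W) where

  open import Data.List.Membership.DecPropositional _≟_ using (_∈?_)

  private
    n = 2 + j
    A[_] = Adj W lab χ
    asym : ∀ c → Symmetric A[ c ]
    asym c = Adj-sym W lab χ χ-sym c
    airr : ∀ c {v} → ¬ A[ c ] v v
    airr c = Adj-irrefl W lab χ c
    module B (c : Bool) = Bipartite _≟_ {R = A[ c ]} (asym c) (airr c) j

  join : ∀ {x y} → x ∈ W → y ∈ W → x ≢ y → A[ χ x y ] x y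
  join p q ne = p , q , (λ e → ne (inj p q e)) , refl

  -- `B` has no inner edge of colour c, so fewer than n outer vertices see `B` entirely in the other
  -- colour. Every remaining one, in `D`, sends an edge of colour c into `B` and therefore none into
  -- `A`; as |D| > n, all edges inside `D` have colour c. Of three disjoint edges between `D` and
  -- `B` two agree in colour, which `parallel` excludes.
  bip-exact : ∀ c A B → Unique A → Unique B → (∀ {x y} → x ∈ A → y ∈ B → A[ c ] x y) →
    length A ≡ n → length B ≡ suc n → ⊥
  bip-exact c A B uA uB AB lA lB = pick (three-distinct uD D≥3) (three-distinct uB (≤-trans (s≤s (s≤s (s≤s z≤n))) (≤-reflexive (≡-sym lB))))
    where
    hA : n ≤ length A
    hA = ≤-reflexive (≡-sym lA)
    hB : suc n ≤ length B
    hB = ≤-reflexive (≡-sym lB)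
    A⊆W : A ⊆ W
    A⊆W p with b , q ← nonempty (≤-trans (s≤s z≤n) hB) = proj₁ (AB p q)
    B⊆W : B ⊆ W
    B⊆W q with a , p ← nonempty (≤-trans (s≤s z≤n) hA) = proj₁ (proj₂ (AB p q))
    out? : ∀ v → Dec (v ∉ A ++ B)
    out? v = ¬? (v ∈? (A ++ B))
    O = filter out? W
    blueB? : ∀ v → Dec (All (λ b → χ v b ≡ not c) B)
    blueB? v = All.all? (λ b → χ v b Boolₚ.≟ not c) B
    D₁ = filter blueB? O
    D = filter (¬? ∘ blueB?) O
    uO : Unique O
    uO = Uniqueₚ.filter⁺ out? uW
    uD : Unique D
    uD = Uniqueₚ.filter⁺ _ uO
    O⊆ : ∀ {v} → v ∈ O → v ∈ W × v ∉ A × v ∉ B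
    O⊆ p with q , r ← ∈-filter⁻ out? {xs = W} p = q , (λ s → r (∈-++⁺ˡ s)) , (λ s → r (∈-++⁺ʳ A s))
    D⊆ : ∀ {v} → v ∈ D → v ∈ O × ¬ All (λ b → χ v b ≡ not c) B
    D⊆ = ∈-filter⁻ (¬? ∘ blueB?) {xs = O}
    D₁⊆ : ∀ {v} → v ∈ D₁ → v ∈ O × All (λ b → χ v b ≡ not c) B
    D₁⊆ = ∈-filter⁻ blueB? {xs = O}
    hO : length W ≤ length O + (n + suc n)
    hO = ≤-trans (length-⊆ uW sub) (≤-reflexive (≡-trans (length-++ O) (cong (length O +_) (≡-trans (length-++ A) (cong₂ _+_ lA lB)))))
      where
      sub : W ⊆ O ++ (A ++ B)
      sub {v} p with v ∈? (A ++ B)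
      ... | yes q = ∈-++⁺ʳ O q
      ... | no q = ∈-++⁺ˡ (∈-filter⁺ out? p q)
    inner : ∀ {b b′} → b ∈ B → b′ ∈ B → b ≢ b′ → A[ not c ] b b′
    inner p q ne with join (B⊆W p) (B⊆W q) ne
    ... | x , y , d , _ = x , y , d , ≢⇒≡not λ e → noOdd c (B.inner-edge c uA uB AB hA hB p q (x , y , d , e))
    D₁B : ∀ {v b} → v ∈ D₁ → b ∈ B → A[ not c ] v b
    D₁B p q with r , s ← D₁⊆ p with w , _ , v∉B ← O⊆ r =
      w , B⊆W q , (λ e → v∉B (subst (_∈ B) (≡-sym (inj w (B⊆W q) e)) q)) , All.lookup s q
    D₁< : length D₁ < n
    D₁< with n ≤? length D₁
    ... | no h = ≰⇒> h
    ... | yes h with b , b′ , p , q , ne ← two-distinct uB (≤-trans (s≤s (s≤s z≤n)) hB) =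
      ⊥-elim (noOdd (not c) (B.inner-edge (not c) (Uniqueₚ.filter⁺ blueB? uO) uB D₁B h hB p q (inner p q ne)))
    -- At least 4n + 1 vertices, less the 2n + 1 of `A` and `B` and the at most n - 1 of `D₁`, leave
    -- n + 1.
    hD : suc n ≤ length D
    hD = +-cancelˡ-≤ (n + (n + suc n)) _ _ (≤-trans (≤-reflexive (arith n)) (≤-trans (s≤s big) (≤-trans (s≤s hO)
      (≤-trans (+-monoˡ-≤ (n + suc n) (≤-trans (s≤s (≤-reflexive (≡-sym (length-filter-split blueB? O))))
        (+-monoˡ-≤ (length D) D₁<))) (≤-reflexive (arith′ n (length D)))))))
      where
      arith : ∀ n → n + (n + suc n) + suc n ≡ suc (4 * n + 1)
      arith = solve-∀
      arith′ : ∀ n d → n + d + (n + suc n) ≡ n + (n + suc n) + d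
      arith′ = solve-∀
    D≥3 : 3 ≤ length D
    D≥3 = ≤-trans (s≤s (s≤s (s≤s z≤n))) hD
    AD : ∀ {v a} → v ∈ D → a ∈ A → A[ not c ] v a
    AD {v} {a} p q with r , s ← D⊆ p with w , v∉A , v∉B ← O⊆ r
      with join w (A⊆W q) (λ e → v∉A (subst (_∈ A) (≡-sym e) q))
    ... | x , y , d , _ = x , y , d , ≢⇒≡not λ e → s (All.tabulate λ {b} b∈ → ≢⇒≡not λ e′ →
      noOdd c (B.apex c uA uB AB hA (≤-trans (n≤1+n n) hB) v∉A v∉B q b∈ (x , y , d , e)
        (w , B⊆W b∈ , (λ l → v∉B (subst (_∈ B) (≡-sym (inj w (B⊆W b∈) l)) b∈)) , e′)))
    innerD : ∀ {v w} → v ∈ D → w ∈ D → v ≢ w → A[ c ] v w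
    innerD p q ne with join (proj₁ (O⊆ (proj₁ (D⊆ p)))) (proj₁ (O⊆ (proj₁ (D⊆ q)))) ne
    ... | x , y , d , _ = x , y , d , ≡-trans (≢⇒≡not λ e → noOdd (not c)
      (B.inner-edge (not c) uA uD (λ p q → asym (not c) (AD q p)) hA hD p q (x , y , d , e))) (Boolₚ.not-involutive c)
    -- Two disjoint edges of the same colour between D and B close a cycle of
    -- length 2n+1: through K(A,B) if they have colour c, through K(A,D) otherwise.
    parallel : ∀ {d d′ b b′} → d ∈ D → d′ ∈ D → b ∈ B → b′ ∈ B → d ≢ d′ → b ≢ b′ → χ d b ≢ χ d′ b′
    parallel {d} {d′} {b} {b′} p p′ q q′ d≢ b≢ e with χ d b Boolₚ.≟ c
    ... | yes ec = noOdd c (B.attach c uB uA (λ q p → asym c (AB p q)) (≤-trans (n≤1+n n) hB) (≤-trans (n≤1+n (suc j)) hA)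
        (∉B p) (∉A p) (∉B p′) (∉A p′) (innerD p p′ d≢) q q′ b≢
        (DB p q ec) (DB p′ q′ (≡-trans (≡-sym e) ec)))
      where
      ∉A : ∀ {v} → v ∈ D → v ∉ A
      ∉A p = proj₁ (proj₂ (O⊆ (proj₁ (D⊆ p))))
      ∉B : ∀ {v} → v ∈ D → v ∉ B
      ∉B p = proj₂ (proj₂ (O⊆ (proj₁ (D⊆ p))))
      DB : ∀ {v b c} → v ∈ D → b ∈ B → χ v b ≡ c → A[ c ] v b
      DB p q ec = proj₁ (O⊆ (proj₁ (D⊆ p))) , B⊆W q , (λ l → ∉B p (subst (_∈ B) (≡-sym (inj (proj₁ (O⊆ (proj₁ (D⊆ p)))) (B⊆W q) l)) q)) , ec
    ... | no ec = noOdd (not c) (B.attach (not c) uD uA AD (≤-trans (n≤1+n n) hD) (≤-trans (n≤1+n (suc j)) hA)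
        (b∉D q) (b∉A q) (b∉D q′) (b∉A q′) (inner q q′ b≢) p p′ d≢
        (BD p q (≢⇒≡not ec)) (BD p′ q′ (≡-trans (≡-sym e) (≢⇒≡not ec))))
      where
      b∉D : ∀ {b} → b ∈ B → b ∉ D
      b∉D q p = proj₂ (proj₂ (O⊆ (proj₁ (D⊆ p)))) q
      b∉A : ∀ {b} → b ∈ B → b ∉ A
      b∉A q p = Adj-irrefl W lab χ c (AB p q)
      BD : ∀ {v b} → v ∈ D → b ∈ B → χ v b ≡ not c → A[ not c ] b v
      BD p q ec = asym (not c) (proj₁ (O⊆ (proj₁ (D⊆ p))) , B⊆W q ,
        (λ l → b∉D q (subst (_∈ D) (inj (proj₁ (O⊆ (proj₁ (D⊆ p)))) (B⊆W q) l) p)) , ec)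
    pick : (∃ λ x → ∃₂ λ y z → (x ∈ D × y ∈ D × z ∈ D) × (x ≢ y × x ≢ z × y ≢ z)) →
           (∃ λ x → ∃₂ λ y z → (x ∈ B × y ∈ B × z ∈ B) × (x ≢ y × x ≢ z × y ≢ z)) → ⊥
    pick (d₁ , d₂ , d₃ , (p₁ , p₂ , p₃) , d₁₂ , d₁₃ , d₂₃) (b₁ , b₂ , b₃ , (q₁ , q₂ , q₃) , b₁₂ , b₁₃ , b₂₃)
      with equal-pair (χ d₁ b₁) (χ d₂ b₂) (χ d₃ b₃)
    ... | inj₁ e = parallel p₁ p₂ q₁ q₂ d₁₂ b₁₂ e
    ... | inj₂ (inj₁ e) = parallel p₁ p₃ q₁ q₃ d₁₃ b₁₃ e
    ... | inj₂ (inj₂ e) = parallel p₂ p₃ q₂ q₃ d₂₃ b₂₃ e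

-- Longest paths and long cycles under a minimum degree condition

module _ {V : Set} where

  snoc-view : (x : V) (xs : List V) → ∃₂ λ ys y → x ∷ xs ≡ ys ++ [ y ]
  snoc-view x [] = [] , x , refl
  snoc-view x (x′ ∷ xs) with ys , y , e ← snoc-view x′ xs = x ∷ ys , y , cong (x ∷_) e

  snoc-last : (ys : List V) {y : V} (as : List V) {bs : List V} {b : V} → ys ++ [ y ] ≡ as ++ bs ++ [ b ] → y ≡ b
  snoc-last ys as {bs} e = ∷ʳ-injectiveʳ ys (as ++ bs) (≡-trans e (≡-sym (++-assoc as bs _)))

  Path-snoc : {R : V → V → Set} → ∀ {x z vs} → Path R x z vs → ∃ λ us → vs ≡ us ++ [ z ]
  Path-snoc stop = [] , refl
  Path-snoc {x = x} (r ◂ p) with us , e ← Path-snoc p = x ∷ us , cong (x ∷_) e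

  Path-cons : {R : V → V → Set} → ∀ {x z vs} → Path R x z vs → ∃ λ us → vs ≡ x ∷ us
  Path-cons stop = [] , refl
  Path-cons (_◂_ {vs = vs} _ _) = vs , refl

  Path-prefix : {R : V → V → Set} → ∀ {x z} as {c} ms {b bs} → Path R x z (as ++ c ∷ ms ++ b ∷ bs) → Path R x c (as ++ [ c ])
  Path-prefix as [] p = proj₁ (Path-split as p)
  Path-prefix as (_ ∷ ms) p = proj₁ (Path-split as p)

  Cycle-rotate : {R : V → V → Set} → ∀ {x z vs v} → Path R x z vs → R z x → v ∈ vs →
    ∃₂ λ y us → Path R v y us × us ↭ vs
  Cycle-rotate p r v∈ with ∈-∃++ v∈
  Cycle-rotate {z = z} p r v∈ | [] , bs , refl with p
  ... | stop = z , _ , stop , ↭-refl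
  ... | s ◂ q = z , _ , s ◂ q , ↭-refl
  Cycle-rotate {R} {x} {z} {v = v} p r v∈ | a ∷ as , bs , refl with snoc-view a as
  ... | cs , c , e with q , _ , q′ ← Path-split cs (subst (Path R x z) (≡-trans (cong (_++ v ∷ bs) e) (++-assoc cs [ c ] (v ∷ bs))) p) =
    c , (v ∷ bs) ++ cs ++ [ c ] , Path-++ q′ r q ,
    ↭-trans (++-comm (v ∷ bs) (cs ++ [ c ])) (↭-reflexive (cong (_++ v ∷ bs) (≡-sym e)))

-- Dirac's argument: a longest path whose ends have degree greater than n either
-- yields a cycle through at least 2n+1 of its vertices or two sets joined by no edge.
module Dirac {V : Set} (_≟_ : DecidableEquality V) {R : V → V → Set} (sy : Symmetric R)
  (irr : ∀ {v} → ¬ R v v) (R? : ∀ x y → Dec (R x y)) (H : List V) (uH : Unique H) (n : ℕ)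
  (big : 2 * n + 1 ≤ length H)
  (mindeg : ∀ {v} → v ∈ H → suc n ≤ length (filter (R? v) H))
  (noLong : ∀ L → 2 * n + 1 ≤ L → L ≤ length H → ¬ HasCycle R L)
  (dense : ∀ A B → Unique A → Unique B → A ⊆ H → B ⊆ H → (∀ {v} → v ∈ A → v ∉ B) →
    n ≤ length A → suc n ≤ length B → (∀ {a b} → a ∈ A → b ∈ B → ¬ R a b) → ⊥) where

  open import Data.List.Membership.DecPropositional _≟_ using (_∈?_)

  N : V → List V → List V
  N v = filter (R? v)

  d : V → List V → ℕ
  d v xs = length (N v xs)

  d-++ : ∀ v xs ys → d v (xs ++ ys) ≡ d v xs + d v ys
  d-++ v xs ys = ≡-trans (cong length (filter-++ (R? v) xs ys)) (length-++ (N v xs))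

  d-cons-no : ∀ {v w} xs → ¬ R v w → d v (w ∷ xs) ≡ d v xs
  d-cons-no xs h = cong length (filter-reject (R? _) h)

  d-cons-yes : ∀ {v w} xs → R v w → d v (w ∷ xs) ≡ suc (d v xs)
  d-cons-yes xs h = cong length (filter-accept (R? _) h)

  -- Excludes the configuration of Ore: an edge s t of the path with z joined to s and x joined to
  -- t, which would close the path to a cycle on the same vertices.
  NoPair : V → V → List V → Set
  NoPair x z ps = ∀ as s t bs → ps ≡ as ++ s ∷ t ∷ bs → R z s → R x t → ⊥

  NoPair-tail : ∀ {x z y ys} → NoPair x z (y ∷ ys) → NoPair x z ys
  NoPair-tail h as s t bs e = h (_ ∷ as) s t bs (cong (_ ∷_) e)

  findPair : ∀ x z ps → (∃₂ λ as s → ∃₂ λ t bs → ps ≡ as ++ s ∷ t ∷ bs × R z s × R x t) ⊎ NoPair x z ps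
  findPair x z [] = inj₂ λ { [] _ _ _ () ; (_ ∷ _) _ _ _ () }
  findPair x z (y ∷ []) = inj₂ λ { [] _ _ _ () ; (_ ∷ []) _ _ _ () ; (_ ∷ _ ∷ _) _ _ _ () }
  findPair x z (y ∷ y′ ∷ ys) with R? z y ×-dec R? x y′ | findPair x z (y′ ∷ ys)
  ... | yes (p , q) | _ = inj₁ ([] , y , y′ , ys , refl , p , q)
  ... | no _ | inj₁ (as , s , t , bs , e , p , q) = inj₁ (y ∷ as , s , t , bs , cong (y ∷_) e , p , q)
  ... | no h | inj₂ g = inj₂ λ { [] s t bs refl p q → h (p , q) ; (_ ∷ as) s t bs e p q → g as s t bs (∷-injectiveʳ e) p q }

  -- For consecutive vertices y, y′ at most one of the edges z y and x y′ exists. The last vertex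
  -- has no successor and accounts for the extra 1.
  segment : ∀ x z y ys → NoPair x z (y ∷ ys) → d x ys + d z (y ∷ ys) ≤ suc (length ys)
  segment x z y [] h = length-filter (R? z) [ y ]
  segment x z y (y′ ∷ ys) h with segment x z y′ ys (NoPair-tail h) | R? x y′ | R? z y
  ... | _ | yes p | yes q = ⊥-elim (h [] y y′ ys refl q p)
  ... | ih | yes p | no _ = s≤s ih
  ... | ih | no _ | yes _ = ≤-trans (≤-reflexive (+-suc _ _)) (s≤s ih)
  ... | ih | no _ | no _ = ≤-trans ih (n≤1+n _)

  -- The extra 1 of `segment` is due to the last vertex alone and disappears if that is not a
  -- neighbour of z.
  segment-open : ∀ x z y ys → NoPair x z (y ∷ ys) → ∀ us w → y ∷ ys ≡ us ++ [ w ] → ¬ R z w →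
    d x ys + d z (y ∷ ys) ≤ length ys
  segment-open x z y [] h [] w refl nw = ≤-reflexive (d-cons-no [] nw)
  segment-open x z y [] h (_ ∷ []) w () nw
  segment-open x z y [] h (_ ∷ _ ∷ _) w () nw
  segment-open x z y (y′ ∷ ys) h [] w () nw
  segment-open x z y (y′ ∷ ys) h (_ ∷ us) w e nw
    with segment-open x z y′ ys (NoPair-tail h) us w (∷-injectiveʳ e) nw | R? x y′ | R? z y
  ... | _ | yes p | yes q = ⊥-elim (h [] y y′ ys refl q p)
  ... | ih | yes p | no _ = s≤s ih
  ... | ih | no _ | yes _ = ≤-trans (≤-reflexive (+-suc _ _)) (s≤s ih)
  ... | ih | no _ | no _ = ≤-trans ih (n≤1+n _)

  preds : V → V → List V → List V
  preds x a [] = []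
  preds x a (b ∷ l) with R? x b
  ... | yes _ = a ∷ preds x b l
  ... | no _ = preds x b l

  preds-length : ∀ x a l → length (preds x a l) ≡ d x l
  preds-length x a [] = refl
  preds-length x a (b ∷ l) with R? x b
  ... | yes _ = cong suc (preds-length x b l)
  ... | no _ = preds-length x b l

  preds-∈ : ∀ x a l {s} → s ∈ preds x a l → ∃₂ λ as u → ∃ λ bs → a ∷ l ≡ as ++ s ∷ u ∷ bs × R x u
  preds-∈ x a (b ∷ l) p with R? x b
  preds-∈ x a (b ∷ l) (here refl) | yes r = [] , b , l , refl , r
  preds-∈ x a (b ∷ l) (there p) | yes r with as , u , bs , e , q ← preds-∈ x b l p = a ∷ as , u , bs , cong (a ∷_) e , q
  preds-∈ x a (b ∷ l) p | no r with as , u , bs , e , q ← preds-∈ x b l p = a ∷ as , u , bs , cong (a ∷_) e , q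

  preds-⊆ : ∀ x a l → preds x a l ⊆ a ∷ l
  preds-⊆ x a l p with as , u , bs , e , _ ← preds-∈ x a l p = subst (_ ∈_) (≡-sym e) (∈-++⁺ʳ as (here refl))

  preds-unique : ∀ x a l → Unique (a ∷ l) → Unique (preds x a l)
  preds-unique x a [] u = []
  preds-unique x a (b ∷ l) u@(_ ∷ u′) with R? x b
  ... | yes _ = Unique-cons (λ p → head∉ u (preds-⊆ x b l p)) (preds-unique x b l u′)
  ... | no _ = preds-unique x b l u′

  succs : V → V → List V → List V
  succs z a [] = []
  succs z a (b ∷ l) with R? z a
  ... | yes _ = b ∷ succs z b l
  ... | no _ = succs z b l

  succs-length : ∀ z a l us w → a ∷ l ≡ us ++ [ w ] → ¬ R z w → length (succs z a l) ≡ d z (a ∷ l)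
  succs-length z a [] [] w refl nw = ≡-sym (d-cons-no [] nw)
  succs-length z a [] (_ ∷ []) w () nw
  succs-length z a [] (_ ∷ _ ∷ _) w () nw
  succs-length z a (b ∷ l) [] w () nw
  succs-length z a (b ∷ l) (_ ∷ us) w e nw with succs-length z b l us w (∷-injectiveʳ e) nw | R? z a
  ... | ih | yes _ = cong suc ih
  ... | ih | no _ = ih

  succs-∈ : ∀ z a l {t} → t ∈ succs z a l → ∃₂ λ as w → ∃ λ bs → a ∷ l ≡ as ++ w ∷ t ∷ bs × R z w
  succs-∈ z a (b ∷ l) p with R? z a
  succs-∈ z a (b ∷ l) (here refl) | yes r = [] , a , l , refl , r
  succs-∈ z a (b ∷ l) (there p) | yes r with as , u , bs , e , q ← succs-∈ z b l p = a ∷ as , u , bs , cong (a ∷_) e , q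
  succs-∈ z a (b ∷ l) p | no r with as , u , bs , e , q ← succs-∈ z b l p = a ∷ as , u , bs , cong (a ∷_) e , q

  succs-⊆ : ∀ z a l → succs z a l ⊆ l
  succs-⊆ z a l p with succs-∈ z a l p
  ... | [] , w , bs , e , _ = subst (_ ∈_) (≡-sym (∷-injectiveʳ e)) (here refl)
  ... | _ ∷ as , w , bs , e , _ = subst (_ ∈_) (≡-sym (∷-injectiveʳ e)) (∈-++⁺ʳ as (there (here refl)))

  succs-unique : ∀ z a l → Unique (a ∷ l) → Unique (succs z a l)
  succs-unique z a [] u = []
  succs-unique z a (b ∷ l) (_ ∷ u) with R? z a
  ... | yes _ = Unique-cons (λ p → head∉ u (succs-⊆ z b l p)) (succs-unique z b l u)
  ... | no _ = succs-unique z b l u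

  firstZ : ∀ z ps → 0 < d z ps → ∃₂ λ as v → ∃ λ bs → ps ≡ as ++ v ∷ bs × R z v × d z as ≡ 0
  firstZ z (p ∷ ps) h with R? z p
  ... | yes r = [] , p , ps , refl , r , refl
  ... | no nr with as , v , bs , e , r , none ← firstZ z ps h =
    p ∷ as , v , bs , cong (p ∷_) e , r , ≡-trans (d-cons-no as nr) none

  -- The scan to the right of `v` keeps in `M` the gap since the latest neighbour of z. The first
  -- neighbour of x that it meets ends a gap free of neighbours of x and z; if it meets none, x has
  -- no neighbour beyond `v`.
  crossing : ∀ x z as v M bs → R z v → d x M ≡ 0 → d z M ≡ 0 →
    (∃₂ λ as′ v′ → ∃ λ M′ → ∃₂ λ u bs′ → as ++ v ∷ M ++ bs ≡ as′ ++ v′ ∷ M′ ++ u ∷ bs′ ×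
      R z v′ × R x u × d x M′ ≡ 0 × d z M′ ≡ 0) ⊎ d x bs ≡ 0
  crossing x z as v M [] r mx mz = inj₂ refl
  crossing x z as v M (q ∷ bs) r mx mz with R? x q | R? z q
  ... | yes p | _ = inj₁ (as , v , M , q , bs , refl , r , p , mx , mz)
  ... | no p | yes p′ with crossing x z (as ++ v ∷ M) q [] bs p′ refl refl
  ...   | inj₁ (as′ , v′ , M′ , u , bs′ , e , f) = inj₁ (as′ , v′ , M′ , u , bs′ , ≡-trans (≡-sym (++-assoc as (v ∷ M) (q ∷ bs))) e , f)
  ...   | inj₂ h = inj₂ h
  crossing x z as v M (q ∷ bs) r mx mz | no p | no p′
    with crossing x z as v (M ++ [ q ]) bs r
      (≡-trans (d-++ x M [ q ]) (cong₂ _+_ mx (d-cons-no [] p))) (≡-trans (d-++ z M [ q ]) (cong₂ _+_ mz (d-cons-no [] p′)))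
  ... | inj₁ (as′ , v′ , M′ , u , bs′ , e , f) = inj₁ (as′ , v′ , M′ , u , bs′ , ≡-trans (cong (λ l → as ++ v ∷ l) (≡-sym (++-assoc M [ q ] bs))) e , f)
  ... | inj₂ h = inj₂ h

  -- Maximality is assumed for every path on the vertices of `ps`, not only for the given one,
  -- because the argument also opens cycles through `ps` at arbitrary vertices.
  module Maximal {x z ps} (P : Path R x z ps) (uP : Unique ps) (P⊆ : ps ⊆ H)
    (grow : ∀ {v w y us} → Path R v y us → us ↭ ps → w ∈ H → w ∉ ps → R v w → ⊥) where

    inside : ∀ {v y us} → Path R v y us → us ↭ ps → v ∈ H → suc n ≤ d v ps
    inside {v} p e v∈ = ≤-trans (mindeg v∈) (length-⊆ (Uniqueₚ.filter⁺ (R? v) uH) sub)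
      where
      sub : N v H ⊆ N v ps
      sub {w} q with w∈ , r ← ∈-filter⁻ (R? v) {xs = H} q with w ∈? ps
      ... | yes q′ = ∈-filter⁺ (R? v) q′ r
      ... | no q′ = ⊥-elim (grow p e w∈ q′ r)

    dx : suc n ≤ d x ps
    dx = inside P ↭-refl (P⊆ (Path-head∈ P))

    dz : suc n ≤ d z ps
    dz = inside (Path-reverse sy P) (↭-reverse ps) (P⊆ (Path-last∈ P))

    -- A cycle can be opened at each of its vertices, so by maximality no edge leaves `ps`. If a
    -- vertex o lies outside, all its neighbours do too, and `ps` with its complement contradicts
    -- `dense`; otherwise the cycle spans `H` and is one of the excluded long cycles.
    spanning-cycle : ∀ {x′ z′ us} → Path R x′ z′ us → R z′ x′ → us ↭ ps → ⊥
    spanning-cycle {x′} {z′} {us} p r e with any? (λ w → ¬? (w ∈? ps)) H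
    ... | no full = noLong (length us) (≤-trans big H≤) (≤-trans (≤-reflexive (↭-length e)) (length-⊆ uP P⊆))
        (us , x′ , z′ , p , r , Unique-resp-↭ (↭-sym e) uP , refl)
      where
      H≤ : length H ≤ length us
      H≤ = ≤-trans (length-⊆ uH (λ {v} v∈ → decidable-stable (v ∈? ps) λ v∉ → full (lose v∈ v∉)))
        (≤-reflexive (≡-sym (↭-length e)))
    ... | yes some with o , o∈H , o∉ ← find some =
      dense ps O uP (Uniqueₚ.filter⁺ _ uH) P⊆ (proj₁ ∘ O⊆) (λ p q → proj₂ (O⊆ q) p)
        (≤-trans (n≤1+n n) (≤-trans dx (length-filter (R? x) ps)))
        (≤-trans (mindeg o∈H) (length-⊆ (Uniqueₚ.filter⁺ _ uH) nb⊆)) sep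
      where
      O : List V
      O = filter (λ w → ¬? (w ∈? ps)) H
      O⊆ : ∀ {w} → w ∈ O → w ∈ H × w ∉ ps
      O⊆ = ∈-filter⁻ (λ w → ¬? (w ∈? ps)) {xs = H}
      sep : ∀ {a b} → a ∈ ps → b ∈ O → ¬ R a b
      sep a∈ b∈ ab with y , vs , q , e′ ← Cycle-rotate p r (∈-resp-↭ (↭-sym e) a∈) =
        grow q (↭-trans e′ e) (proj₁ (O⊆ b∈)) (proj₂ (O⊆ b∈)) ab
      nb⊆ : N o H ⊆ O
      nb⊆ {w} q with w∈ , ow ← ∈-filter⁻ (R? o) {xs = H} q =
        ∈-filter⁺ (λ w → ¬? (w ∈? ps)) w∈ λ w∈ps → sep w∈ps (∈-filter⁺ _ o∈H o∉) (sy ow)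

    stuck : ⊥
    stuck with findPair x z ps
    ... | inj₁ (as , s , t , bs , refl , zs , xt) with p , _ , q ← Path-split as P =
      spanning-cycle (Path-++ p (sy zs) (Path-reverse sy q)) (sy xt)
        (↭-trans (++⁺ˡ (as ++ [ s ]) (↭-reverse (t ∷ bs))) (↭-reflexive (++-assoc as [ s ] (t ∷ bs))))
    ... | inj₂ noPair with firstZ z ps (≤-trans (s≤s z≤n) dz)
    ...   | as , v , bs , refl , zv , none with crossing x z as v [] bs zv refl refl
    -- The cycle x ... v′ z ... u x omits only `M`, where neither x nor z has a neighbour. So both
    -- degrees, together at least 2n + 2, are attained on the cycle, and the two segment counts
    -- bound its length from below.
    ...     | inj₁ (as′ , v′ , M , u , bs′ , e , zv′ , xu , mx , mz) =
      noLong (length loop) len (≤-trans (length-⊆ uloop (λ m → P⊆ (loop⊆ m))) ≤-refl)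
        (loop , x , u , Path-++ P₁ (sy zv′) (Path-reverse sy P₃) , sy xu , uloop , refl)
      where
      qs = as′ ++ v′ ∷ M ++ u ∷ bs′
      P′ : Path R x z qs
      P′ = subst (Path R x z) e P
      Q₁ = as′ ++ [ v′ ]
      Q₃ = u ∷ bs′
      qs≡ : qs ≡ Q₁ ++ M ++ Q₃
      qs≡ = ≡-sym (++-assoc as′ [ v′ ] (M ++ Q₃))
      P₁ : Path R x v′ Q₁
      P₁ = Path-prefix as′ M P′
      P₃ : Path R u z Q₃
      P₃ with snoc-view v′ M
      ... | cs , c , ec = proj₂ (proj₂ (Path-split (as′ ++ cs) (subst (Path R x z)
        (≡-trans (cong (as′ ++_) (≡-trans (cong (_++ Q₃) ec) (++-assoc cs [ c ] Q₃))) (≡-sym (++-assoc as′ cs (c ∷ Q₃)))) P′)))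
      loop = Q₁ ++ reverse Q₃
      loop↭ : loop ↭ Q₁ ++ Q₃
      loop↭ = ++⁺ˡ Q₁ (↭-reverse Q₃)
      uqs : Unique (Q₁ ++ M ++ Q₃)
      uqs = subst Unique (≡-trans e qs≡) uP
      uloop : Unique loop
      uloop = Unique-resp-↭ (↭-sym loop↭) (Unique-++⁺ (Unique-++⁻ˡ Q₁ uqs) (Unique-++⁻ʳ M (Unique-++⁻ʳ Q₁ uqs))
        λ p q → Unique-disjoint Q₁ uqs p (∈-++⁺ʳ M q))
      loop⊆ : loop ⊆ as ++ v ∷ bs
      loop⊆ m with ∈-++⁻ Q₁ (∈-resp-↭ loop↭ m)
      ... | inj₁ p = subst (_ ∈_) (≡-sym (≡-trans e qs≡)) (∈-++⁺ˡ p)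
      ... | inj₂ p = subst (_ ∈_) (≡-sym (≡-trans e qs≡)) (∈-++⁺ʳ Q₁ (∈-++⁺ʳ M p))
      d≡ : ∀ w → d w M ≡ 0 → d w (as ++ v ∷ bs) ≡ d w Q₁ + d w Q₃
      d≡ w mw = ≡-trans (cong (d w) (≡-trans e qs≡)) (≡-trans (d-++ w Q₁ (M ++ Q₃))
        (cong (d w Q₁ +_) (≡-trans (d-++ w M Q₃) (cong (_+ d w Q₃) mw))))
      count₁ : d x Q₁ + d z Q₁ ≤ length Q₁
      count₁ with us , eu ← Path-cons P₁ = subst (λ l → d x l + d z l ≤ length l) (≡-sym eu)
        (≤-trans (≤-reflexive (cong (_+ d z (x ∷ us)) (d-cons-no us irr)))
          (segment x z x us λ bs₁ s t bs₂ e₁ → noPair bs₁ s t (bs₂ ++ M ++ Q₃)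
            (≡-trans e (≡-trans qs≡ (≡-trans (cong (_++ M ++ Q₃) (≡-trans eu e₁)) (++-assoc bs₁ (s ∷ t ∷ bs₂) (M ++ Q₃)))))))
      count₃ : d x Q₃ + d z Q₃ ≤ length Q₃
      count₃ with us , eu ← Path-snoc P₃ = ≤-trans (≤-reflexive (cong (_+ d z Q₃) (d-cons-yes bs′ xu)))
        (s≤s (segment-open x z u bs′ (λ bs₁ s t bs₂ e₁ → noPair ((Q₁ ++ M) ++ bs₁) s t bs₂
          (≡-trans e (≡-trans qs≡ (≡-trans (cong (λ l → Q₁ ++ M ++ l) e₁) (≡-trans (≡-sym (++-assoc Q₁ M _)) (≡-sym (++-assoc (Q₁ ++ M) bs₁ _)))))))
          us z eu irr))
      len : 2 * n + 1 ≤ length loop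
      len = ≤-trans (m+n≤o⇒m≤o (2 * n + 1) (≤-reflexive (arith₁ n))) (≤-trans (+-mono-≤ dx dz)
        (≤-trans (≤-reflexive (≡-trans (cong₂ _+_ (d≡ x mx) (d≡ z mz)) (arith₂ (d x Q₁) (d x Q₃) (d z Q₁) (d z Q₃))))
        (≤-trans (+-mono-≤ count₁ count₃) (≤-reflexive (≡-trans (≡-sym (length-++ Q₁)) (≡-sym (↭-length loop↭)))))))
        where
        arith₁ : ∀ n → 2 * n + 1 + 1 ≡ suc n + suc n
        arith₁ = solve-∀
        arith₂ : ∀ a b c e → a + b + (c + e) ≡ a + c + (b + e)
        arith₂ = solve-∀
    -- No neighbour of x lies beyond v and none of z before it. An edge from a predecessor of a
    -- neighbour of x to a successor of a neighbour of z would close a cycle on the whole path;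
    -- hence these two sets, with at least n + 1 vertices each, contradict `dense`.
    ...     | inj₂ noX = separated
      where
      qs = as ++ v ∷ bs
      e₀ : qs ≡ (as ++ [ v ]) ++ bs
      e₀ = ≡-sym (++-assoc as [ v ] bs)
      front = as ++ [ v ]
      T′ = succs z v bs
      uq : Unique (front ++ bs)
      uq = subst Unique e₀ uP
      shape : ∃ λ ys → front ≡ x ∷ ys
      shape with us , eu ← Path-cons P = head as eu
        where
        head : ∀ as′ {us} → as′ ++ v ∷ bs ≡ x ∷ us → ∃ λ ys → as′ ++ [ v ] ≡ x ∷ ys
        head [] refl = [] , refl
        head (_ ∷ as′) refl = as′ ++ [ v ] , refl
      fs = proj₁ shape
      ef : front ≡ x ∷ fs
      ef = proj₂ shape
      S = preds x x fs
      S≥ : suc n ≤ length S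
      S≥ = ≤-trans dx (≤-reflexive (≡-trans (≡-trans (cong (d x) e₀) (≡-trans (d-++ x front bs)
        (≡-trans (cong (d x front +_) noX) (+-identityʳ _))))
        (≡-trans (cong (d x) ef) (≡-trans (d-cons-no fs irr) (≡-sym (preds-length x x fs))))))
      T≥ : suc n ≤ length T′
      T≥ with us , eu ← Path-snoc P = ≤-trans dz (≤-reflexive (≡-trans (≡-trans (d-++ z as (v ∷ bs)) (cong (_+ d z (v ∷ bs)) none)) (≡-sym tl)))
        where
        tl : length T′ ≡ d z (v ∷ bs)
        tl with cs , c , ec ← snoc-view v bs =
          succs-length z v bs cs z (≡-trans ec (cong (λ w → cs ++ [ w ]) (≡-sym (snoc-last us as (≡-trans (≡-sym eu) (cong (as ++_) ec)))))) irr
      long : 2 * n + 1 ≤ length qs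
      long with us , eu ← Path-cons P = subst (λ l → 2 * n + 1 ≤ length l) (≡-sym eu)
        (≤-trans (m+n≤o⇒m≤o (2 * n + 1) (≤-reflexive (arith₁ n))) (≤-trans (+-mono-≤ dx dz)
          (≤-trans (≤-reflexive (≡-trans (cong (λ l → d x l + d z l) eu) (cong (_+ d z (x ∷ us)) (d-cons-no us irr))))
            (segment x z x us (subst (NoPair x z) eu noPair)))))
        where
        arith₁ : ∀ n → 2 * n + 1 + 1 ≡ suc n + suc n
        arith₁ = solve-∀
      separated : ⊥
      separated = dense S T′ (preds-unique x x fs (subst Unique ef (Unique-++⁻ˡ front uq)))
        (succs-unique z v bs (Unique-++⁻ʳ as uP))
        (λ m → P⊆ (subst (_ ∈_) (≡-sym e₀) (∈-++⁺ˡ (S⊆ m))))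
        (λ m → P⊆ (∈-++⁺ʳ as (there (succs-⊆ z v bs m))))
        (λ p q → Unique-disjoint front uq (S⊆ p) (succs-⊆ z v bs q))
        (≤-trans (n≤1+n n) S≥) T≥ no-edge
        where
        S⊆ : S ⊆ front
        S⊆ m = subst (_ ∈_) (≡-sym ef) (preds-⊆ x x fs m)
        no-edge : ∀ {s t} → s ∈ S → t ∈ T′ → ¬ R s t
        no-edge {s} {t} s∈ t∈ st
          with as₁ , u , bs₁ , e₁′ , xu ← preds-∈ x x fs s∈
          with e₁ ← ≡-trans ef e₁′
          with cs , w , ds , e₂ , zw ← succs-∈ z v bs t∈
          with β , b , eβ ← snoc-view u bs₁
          with refl ← snoc-last as {v} (as₁ ++ [ s ]) {β} {b}
            (≡-trans e₁ (≡-trans (cong (λ l → as₁ ++ s ∷ l) eβ) (≡-sym (++-assoc as₁ [ s ] (β ++ [ b ])))))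
          with p₁ , _ , p₂ ← Path-split as₁ {s} {u} {bs₁ ++ bs} (subst (Path R x z)
            (≡-trans e₀ (≡-trans (cong (_++ bs) e₁) (++-assoc as₁ (s ∷ u ∷ bs₁) bs))) P)
          with p₃ , _ , p₄ ← Path-split (β ++ cs) {w} {t} {ds} (subst (Path R u z)
            (≡-trans (cong (_++ bs) eβ) (≡-trans (++-assoc β [ v ] bs) (≡-trans (cong (β ++_) e₂) (≡-sym (++-assoc β cs _))))) p₂) =
          noLong (length loop) (≤-trans long (≤-reflexive (≡-sym (↭-length loop↭))))
            (≤-trans (≤-reflexive (↭-length loop↭)) (length-⊆ uP P⊆))
            (loop , s , t , Path-++ (Path-reverse sy p₁) xu (Path-++ p₃ (sy zw) (Path-reverse sy p₄)) , sy st ,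
              Unique-resp-↭ (↭-sym loop↭) uP , refl)
          where
          Q₁ = as₁ ++ [ s ]
          Q₂ = (β ++ cs) ++ [ w ]
          loop = reverse Q₁ ++ Q₂ ++ reverse (t ∷ ds)
          loop↭ : loop ↭ qs
          loop↭ = ↭-trans (↭-++⁺ (↭-reverse Q₁) (++⁺ˡ Q₂ (↭-reverse (t ∷ ds)))) (↭-reflexive eq)
            where
            open ≡-Reasoning
            eq : Q₁ ++ Q₂ ++ t ∷ ds ≡ qs
            eq = begin
              Q₁ ++ Q₂ ++ t ∷ ds ≡⟨ cong (Q₁ ++_) (++-assoc (β ++ cs) [ w ] (t ∷ ds)) ⟩
              Q₁ ++ (β ++ cs) ++ w ∷ t ∷ ds ≡⟨ cong (Q₁ ++_) (++-assoc β cs _) ⟩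
              Q₁ ++ β ++ cs ++ w ∷ t ∷ ds ≡⟨ cong (λ l → Q₁ ++ β ++ l) (≡-sym e₂) ⟩
              Q₁ ++ β ++ v ∷ bs ≡⟨ cong (Q₁ ++_) (≡-sym (++-assoc β [ v ] bs)) ⟩
              Q₁ ++ (β ++ [ v ]) ++ bs ≡⟨ cong (λ l → Q₁ ++ l ++ bs) (≡-sym eβ) ⟩
              Q₁ ++ (u ∷ bs₁) ++ bs ≡⟨ ++-assoc as₁ [ s ] ((u ∷ bs₁) ++ bs) ⟩
              as₁ ++ (s ∷ u ∷ bs₁) ++ bs ≡⟨ ≡-sym (++-assoc as₁ (s ∷ u ∷ bs₁) bs) ⟩
              (as₁ ++ s ∷ u ∷ bs₁) ++ bs ≡⟨ cong (_++ bs) (≡-sym e₁) ⟩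
              front ++ bs ≡⟨ ≡-sym e₀ ⟩
              qs ∎

  -- The fuel bounds the number of vertices of `H` off the path, so repeated extension ends at a
  -- maximal path.
  exhaust : ∀ fuel {x z ps} → Path R x z ps → Unique ps → ps ⊆ H → length H ≤ length ps + fuel → ⊥
  exhaust fuel {x} {z} {ps} P uP P⊆ hf = Maximal.stuck P uP P⊆ grow
    where
    grow : ∀ {v w y us} → Path R v y us → us ↭ ps → w ∈ H → w ∉ ps → R v w → ⊥
    grow {v} {w} {y} {us} p e w∈ w∉ vw = step fuel hf
      where
      u′ : Unique (w ∷ us)
      u′ = Unique-cons (λ q → w∉ (∈-resp-↭ e q)) (Unique-resp-↭ (↭-sym e) uP)
      sub : w ∷ us ⊆ H
      sub (here refl) = w∈
      sub (there q) = P⊆ (∈-resp-↭ e q)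
      step : ∀ f → length H ≤ length ps + f → ⊥
      step zero h = <⇒≱ (≤-trans (s≤s (≤-reflexive (≡-sym (↭-length e)))) (length-⊆ u′ sub)) (≤-trans h (≤-reflexive (+-identityʳ _)))
      step (suc f) h = exhaust f (sy vw ◂ p) u′ sub
        (≤-trans h (≤-reflexive (≡-trans (+-suc (length ps) f) (cong (λ k → suc (k + f)) (≡-sym (↭-length e))))))

  impossible : ⊥
  impossible with v , v∈ ← nonempty (≤-trans (m≤n+m 1 (2 * n)) big) =
    exhaust (length H) stop ([] ∷ []) (λ { (here refl) → v∈ }) (m≤n+m (length H) 1)

-- Counting edges

length-cover : ∀ {V : Set} {P Q : V → Set} (P? : ∀ v → Dec (P v)) (Q? : ∀ v → Dec (Q v)) (l : List V) →
  (∀ {v} → v ∈ l → P v ⊎ Q v) → length l ≤ length (filter P? l) + length (filter Q? l)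
length-cover P? Q? [] _ = z≤n
length-cover P? Q? (y ∷ l) h with length-cover P? Q? l (h ∘ there) | P? y | Q? y
... | ih | yes _ | yes _ = s≤s (≤-trans ih (+-monoʳ-≤ _ (n≤1+n _)))
... | ih | yes _ | no _ = s≤s ih
... | ih | no _ | yes _ = ≤-trans (s≤s ih) (≤-reflexive (≡-sym (+-suc _ _)))
... | ih | no p | no q = ⊥-elim ([ p , q ]′ (h (here refl)))

-- The binomial coefficient m choose 2, the number of edges of a complete graph.
triangular : ℕ → ℕ
triangular zero = 0
triangular (suc m) = m + triangular m

double-triangular : ∀ m → 2 * triangular (suc m) ≡ suc m * m
double-triangular zero = refl
double-triangular (suc m) = ≡-trans (arith m (triangular (suc m))) (≡-trans (cong (2 * suc m +_) (double-triangular m)) (arith′ m))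
  where
  arith : ∀ m t → 2 * (suc m + t) ≡ 2 * suc m + 2 * t
  arith = solve-∀
  arith′ : ∀ m → 2 * suc m + suc m * m ≡ suc (suc m) * suc m
  arith′ = solve-∀

module Edges {V : Set} {R : V → V → Set} (sy : Symmetric R) (irr : ∀ {v} → ¬ R v v) (R? : ∀ x y → Dec (R x y)) where

  degree : V → List V → ℕ
  degree v l = length (filter (R? v) l)

  edges : List V → ℕ
  edges [] = 0
  edges (x ∷ l) = degree x l + edges l

  degree-↭ : ∀ x {l l′} → l ↭ l′ → degree x l ≡ degree x l′
  degree-↭ x p = ↭-length (filter-↭ (R? x) p)

  edges-↭ : ∀ {l l′} → l ↭ l′ → edges l ≡ edges l′
  edges-↭ refl = refl
  edges-↭ (prep x p) = cong₂ _+_ (degree-↭ x p) (edges-↭ p)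
  edges-↭ (swap {xs = l} {ys = l′} x y p) with R? x y | R? y x
  ... | yes r | no s = contradiction (sy r) s
  ... | no r | yes s = contradiction (sy s) r
  ... | no _ | no _ = ≡-trans (cong₂ _+_ (degree-↭ x p) (cong₂ _+_ (degree-↭ y p) (edges-↭ p)))
    (arith (degree x l′) (degree y l′) (edges l′))
    where
    arith : ∀ a b c → a + (b + c) ≡ b + (a + c)
    arith = solve-∀
  ... | yes _ | yes _ = cong suc (≡-trans (cong₂ _+_ (degree-↭ x p) (cong₂ _+_ (degree-↭ y p) (edges-↭ p)))
    (arith (degree x l′) (degree y l′) (edges l′)))
    where
    arith : ∀ a b c → a + (b + c) ≡ b + (a + c)
    arith = solve-∀
  edges-↭ (trans p q) = ≡-trans (edges-↭ p) (edges-↭ q)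

  edges≤ : ∀ l → edges l ≤ triangular (length l)
  edges≤ [] = z≤n
  edges≤ (x ∷ l) = +-mono-≤ (length-filter (R? x) l) (edges≤ l)

  -- Vertices of degree at most n are deleted one at a time, each at the cost of at most n edges. If
  -- this stops at m ≤ 2n vertices, they span at most m(m - 1)/2 ≤ n(m - 1) edges, which fits the
  -- same linear bound; if it stops earlier, the rest is the subgraph wanted.
  peel : ∀ n k l → length l ≡ suc k → Unique l →
    (∃ λ H → Unique H × H ⊆ l × 2 * n + 1 ≤ length H × (∀ {v} → v ∈ H → suc n ≤ degree v H)) ⊎ edges l ≤ n * k
  peel n zero (x ∷ []) _ _ = inj₂ z≤n
  peel n (suc k) l e u with any? (λ v → degree v l ≤? n) l
  ... | yes some with v , v∈ , h ← find some with l′ , p ← ↭-head v∈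
    with peel n k l′ (suc-injective (≡-trans (≡-sym (↭-length p)) e)) (Unique-tail (Unique-resp-↭ p u))
    where
    Unique-tail : ∀ {x xs} → Unique (x ∷ xs) → Unique {A = V} xs
    Unique-tail (_ ∷ u) = u
  ...   | inj₁ (H , uH , H⊆ , r) = inj₁ (H , uH , (λ m → ∈-resp-↭ (↭-sym p) (there (H⊆ m))) , r)
  ...   | inj₂ h′ = inj₂ (≤-trans (≤-reflexive (edges-↭ p)) (≤-trans (+-mono-≤
      (≤-trans (≤-reflexive (≡-sym (≡-trans (degree-↭ v p) (cong length (filter-reject (R? v) irr))))) h) h′)
      (≤-reflexive (≡-sym (*-suc n k)))))
  peel n (suc k) l e u | no none with 2 * n + 1 ≤? length l
  ... | yes h = inj₁ (l , u , (λ m → m) , h , λ v∈ → ≰⇒> λ h′ → none (lose v∈ h′))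
  ... | no h = inj₂ (*-cancelˡ-≤ 2 (≤-trans (*-monoʳ-≤ 2 (edges≤ l))
    (≤-trans (≤-reflexive (≡-trans (cong (λ m → 2 * triangular m) e) (double-triangular (suc k))))
      (≤-trans (*-monoˡ-≤ (suc k) small) (≤-reflexive (*-assoc 2 n (suc k)))))))
    where
    small : suc (suc k) ≤ 2 * n
    small = ≤-pred (≤-trans (s≤s (≤-reflexive (≡-sym e))) (≤-trans (≰⇒> h) (≤-reflexive (+-comm (2 * n) 1))))

-- By `inj` every class is a single vertex, so there are no grey edges and `W` is a two-coloured
-- complete graph.
module NoGrey {V : Set} (_≟_ : DecidableEquality V) (W : List V) (uW : Unique W)
  (lab : V → ℕ) (χ : V → V → Bool) (χ-sym : ∀ x y → χ x y ≡ χ y x)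
  (inj : ∀ {x y} → x ∈ W → y ∈ W → lab x ≡ lab y → x ≡ y) (j : ℕ)
  (noOdd : ∀ c → ¬ HasCycle (Adj W lab χ c) (2 * (2 + j) + 1))
  (size : length W ≡ suc (4 * (2 + j)))
  (noLong : ∀ c L → 2 * (2 + j) + 1 ≤ L → L ≤ length W → ¬ HasCycle (Adj W lab χ c) L) where

  open import Data.List.Membership.DecPropositional _≟_ using (_∈?_)

  private
    n = 2 + j
    A[_] = Adj W lab χ
    open NoBip _≟_ W uW lab χ χ-sym inj j noOdd
      (≤-reflexive (≡-trans (+-comm (4 * (2 + j)) 1) (≡-sym size))) using (bip-exact; join)
    A? : ∀ c x y → Dec (A[ c ] x y)
    A? c x y = (x ∈? W) ×-dec ((y ∈? W) ×-dec ((¬? (lab x Nat.≟ lab y)) ×-dec (χ x y Boolₚ.≟ c)))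
    asym : ∀ c → Symmetric A[ c ]
    asym c = Adj-sym W lab χ χ-sym c
    airr : ∀ c {v} → ¬ A[ c ] v v
    airr c = Adj-irrefl W lab χ c
    module E (c : Bool) = Edges {R = A[ c ]} (asym c) (airr c) (A? c)

  sparse : ∀ c → E.edges c W ≤ n * (4 * n)
  sparse c with E.peel c n (4 * n) W size uW
  ... | inj₂ h = h
  ... | inj₁ (H , uH , H⊆ , big , deg) = ⊥-elim (Dirac.impossible _≟_ (asym c) (airr c) (A? c) H uH n big deg
    (λ L h h′ → noLong c L h (≤-trans h′ (length-⊆ uH H⊆))) dense)
    where
    dense : ∀ A B → Unique A → Unique B → A ⊆ H → B ⊆ H → (∀ {v} → v ∈ A → v ∉ B) →
      n ≤ length A → suc n ≤ length B → (∀ {a b} → a ∈ A → b ∈ B → ¬ A[ c ] a b) → ⊥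
    dense A B uA uB A⊆ B⊆ dis hA hB sep
      with A₁ , uA₁ , sA , lA ← shrink n uA hA
      with B₁ , uB₁ , sB , lB ← shrink (suc n) uB hB =
      bip-exact (not c) A₁ B₁ uA₁ uB₁ (λ p q → other (sA p) (sB q)) lA lB
      where
      other : ∀ {a b} → a ∈ A → b ∈ B → A[ not c ] a b
      other p q with join (H⊆ (A⊆ p)) (H⊆ (B⊆ q)) (λ e → dis p (subst (_∈ B) (≡-sym e) q))
      ... | x , y , ne , _ = x , y , ne , ≢⇒≡not λ e → sep p q (x , y , ne , e)

  total : ∀ l → Unique l → l ⊆ W → triangular (length l) ≤ E.edges true l + E.edges false l
  total [] _ _ = z≤n
  total (x ∷ l) u@(_ ∷ u′) s = ≤-trans (+-mono-≤ (row l (λ p → s (there p)) (head∉ u)) (total l u′ (s ∘ there)))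
    (≤-reflexive (arith (E.degree true x l) (E.degree false x l) (E.edges true l) (E.edges false l)))
    where
    arith : ∀ a b c e → a + b + (c + e) ≡ a + c + (b + e)
    arith = solve-∀
    row : ∀ l → l ⊆ W → x ∉ l → length l ≤ E.degree true x l + E.degree false x l
    row l h x∉ = length-cover (A? true x) (A? false x) l λ {y} m → either m (join (s (here refl)) (h m) (λ e → x∉ (subst (_∈ l) (≡-sym e) m)))
      where
      either : ∀ {y} → y ∈ l → A[ χ x y ] x y → A[ true ] x y ⊎ A[ false ] x y
      either {y} _ r with χ x y
      ... | true = inj₁ r
      ... | false = inj₂ r

  -- There are 2n(4n + 1) edges in all, but each colour has at most n · 4n of them.
  impossible : ⊥
  impossible = <⇒≱ gap (≤-trans (*-monoʳ-≤ 2 (total W uW λ m → m)) (*-monoʳ-≤ 2 (+-mono-≤ (sparse true) (sparse false))))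
    where
    gap : 2 * (n * (4 * n) + n * (4 * n)) < 2 * triangular (length W)
    gap = ≤-trans (≤-trans (≤-reflexive (arith j)) (m≤m+n _ (4 * j + 7))) (≤-reflexive (≡-sym (≡-trans (cong (λ m → 2 * triangular m) size) (≡-trans (double-triangular (4 * n)) (arith′ j)))))
      where
      arith : ∀ j → suc (2 * ((2 + j) * (4 * (2 + j)) + (2 + j) * (4 * (2 + j)))) ≡ 16 * j * j + 64 * j + 65
      arith = solve-∀
      arith′ : ∀ j → suc (4 * (2 + j)) * (4 * (2 + j)) ≡ 16 * j * j + 64 * j + 65 + (4 * j + 7)
      arith′ = solve-∀

-- Rotations and chords of monochromatic cycles

module _ {V : Set} where

  nth : V → List V → ℕ → V
  nth d [] _ = d
  nth d (x ∷ xs) zero = x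
  nth d (x ∷ xs) (suc i) = nth d xs i

  nth-∈ : ∀ d xs {i} → i < length xs → nth d xs i ∈ xs
  nth-∈ d (x ∷ xs) {zero} _ = here refl
  nth-∈ d (x ∷ xs) {suc i} (s≤s h) = there (nth-∈ d xs h)

  nth-injective : ∀ d xs → Unique xs → ∀ {i k} → i < length xs → k < length xs → nth d xs i ≡ nth d xs k → i ≡ k
  nth-injective d (x ∷ xs) u {zero} {zero} _ _ _ = refl
  nth-injective d (x ∷ xs) u {zero} {suc k} _ (s≤s h) e = ⊥-elim (head∉ u (subst (_∈ xs) (≡-sym e) (nth-∈ d xs h)))
  nth-injective d (x ∷ xs) u {suc i} {zero} (s≤s h) _ e = ⊥-elim (head∉ u (subst (_∈ xs) e (nth-∈ d xs h)))
  nth-injective d (x ∷ xs) (_ ∷ u) {suc i} {suc k} (s≤s h) (s≤s h′) e = cong suc (nth-injective d xs u h h′ e)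

  nth-snoc : ∀ d xs x {i} → i < length xs → nth d (xs ++ [ x ]) i ≡ nth d xs i
  nth-snoc d (y ∷ xs) x {zero} _ = refl
  nth-snoc d (y ∷ xs) x {suc i} (s≤s h) = nth-snoc d xs x h

  nth-last : ∀ d xs x → nth d (xs ++ [ x ]) (length xs) ≡ x
  nth-last d [] x = refl
  nth-last d (y ∷ xs) x = nth-last d xs x

  rotate : List V → List V
  rotate [] = []
  rotate (x ∷ xs) = xs ++ [ x ]

  length-rotate : ∀ xs → length (rotate xs) ≡ length xs
  length-rotate [] = refl
  length-rotate (x ∷ xs) = ≡-trans (length-++ xs) (+-comm (length xs) 1)

  rotations : ℕ → List V → List V
  rotations zero xs = xs
  rotations (suc r) xs = rotate (rotations r xs)

  Ring : (V → V → Set) → List V → Set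
  Ring R vs = ∃₂ λ x z → Path R x z vs × R z x × Unique vs

  rotate-ring : ∀ {R vs} → 2 ≤ length vs → Ring R vs → Ring R (rotate vs)
  rotate-ring _ (x , z , stop , r , u) = x , z , stop , r , u
  rotate-ring _ (x , z , _◂_ {vs = vs} s p , r , u) =
    _ , x , Path-++ p r stop , s , Unique-resp-↭ (++-comm [ x ] vs) u

  Path-nth-head : ∀ {R : V → V → Set} {x z vs} d → Path R x z vs → nth d vs 0 ≡ x
  Path-nth-head d stop = refl
  Path-nth-head d (_ ◂ _) = refl

  Path-nth-step : ∀ {R : V → V → Set} {x z vs} d → Path R x z vs → ∀ i → suc i < length vs → R (nth d vs i) (nth d vs (suc i))
  Path-nth-step d stop i (s≤s ())
  Path-nth-step {R} d (r ◂ p) zero _ = subst (R _) (≡-sym (Path-nth-head d p)) r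
  Path-nth-step d (r ◂ p) (suc i) (s≤s h) = Path-nth-step d p i h

  Path-nth-last : ∀ {R : V → V → Set} {x z vs} d → Path R x z vs → nth d vs (pred (length vs)) ≡ z
  Path-nth-last d stop = refl
  Path-nth-last d (_ ◂ stop) = refl
  Path-nth-last d (_ ◂ (s ◂ p)) = Path-nth-last d (s ◂ p)

step : ℕ → ℕ → ℕ
step L i = if suc i ≡ᵇ L then 0 else suc i

steps : ℕ → ℕ → ℕ → ℕ
steps L zero i = i
steps L (suc r) i = steps L r (step L i)

nth-rotate : ∀ {V : Set} (d : V) vs {i} → i < length vs → nth d (rotate vs) i ≡ nth d vs (step (length vs) i)
nth-rotate d (x ∷ xs) {i} h with i ≡ᵇ length xs in e
... | true rewrite ≡ᵇ-sound {i} e = nth-last d xs x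
... | false = nth-snoc d xs x (≤∧≢⇒< (≤-pred h) λ e′ → contradiction (≡-trans (≡-sym e) (≡ᵇ-complete i e′)) λ ())

step-< : ∀ L {i} → i < L → step L i < L
step-< L {i} h with suc i ≡ᵇ L in e
... | true = ≤-trans (s≤s z≤n) h
... | false = ≤∧≢⇒< h λ e′ → contradiction (≡-trans (≡-sym e) (≡ᵇ-complete (suc i) e′)) λ ()

ringEdges : ℕ → List Edge
ringEdges L = (pred L , 0 , true) ∷ map (λ i → i , suc i , true) (upTo (pred L))

chordEdges : ℕ → ℕ → List Edge
chordEdges L d = map (λ r → steps L r 0 , steps L r d , true) (upTo L)

==-involutive : ∀ a c → ((a == c) == c) ≡ a
==-involutive true true = refl
==-involutive true false = refl
==-involutive false true = refl
==-involutive false false = refl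

==-true : ∀ {a c} → a ≡ c → (a == c) ≡ true
==-true {true} refl = refl
==-true {false} refl = refl

module Rings {V : Set} (W : List V) (lab : V → ℕ) (χ : V → V → Bool) (χ-sym : ∀ x y → χ x y ≡ χ y x)
  (inj : ∀ {x y} → x ∈ W → y ∈ W → lab x ≡ lab y → x ≡ y) (n : ℕ)
  (noBip : ∀ c A B → Unique A → Unique B → (∀ {x y} → x ∈ A → y ∈ B → Adj W lab χ c x y) →
    length A ≡ n → length B ≡ suc n → ⊥)
  (allowed : ℕ → Bool) (noCycle : ∀ c m → allowed m ≡ true → ¬ HasCycle (Adj W lab χ c) m)
  (c : Bool) (L : ℕ) (2≤L : 2 ≤ L) where

  open Checker n L 1 allowed using (check)

  ring⊆ : ∀ {vs} → Ring (Adj W lab χ c) vs → vs ⊆ W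
  ring⊆ (x , z , p , r , _) = Adj-path⊆ W lab χ p (proj₁ r)

  module OnRing (vs : List V) (ring : Ring (Adj W lab χ c) vs) (len : length vs ≡ L) where

    f : ℕ → V
    f = nth (proj₁ ring) vs

    -- Comparison with `c` turns the colour of the ring into `true`, so that a certificate written
    -- for a red ring serves both colours.
    κ : ℕ → ℕ → Bool
    κ u v = χ (f u) (f v) == c

    f∈ : ∀ {i} → i < L → f i ∈ W
    f∈ h = ring⊆ ring (nth-∈ _ vs (≤-trans h (≤-reflexive (≡-sym len))))

    f-inj : ∀ {i k} → i < L → k < L → f i ≡ f k → i ≡ k
    f-inj h h′ = nth-injective _ vs (proj₂ (proj₂ (proj₂ (proj₂ ring)))) (subst (_ <_) (≡-sym len) h) (subst (_ <_) (≡-sym len) h′)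

    refute : ∀ K t → All (λ (u , v , b) → κ u v ≡ b) K → check K t ≡ true → ⊥
    refute K t = Checker.Sound.check-sound n L 1 allowed (λ b → Adj W lab χ (b == c))
      (λ b → noCycle (b == c)) (λ b → noBip (b == c)) f f-inj κ
      (λ u v → cong (_== c) (χ-sym (f u) (f v)))
      (λ {x} {y} hx hy ne → f∈ hx , f∈ hy ,
        (λ e → ne (cong (_/ 1) (f-inj hx hy (inj (f∈ hx) (f∈ hy) e)))) ,
        ≡-trans (cong₂ (λ u v → χ (f u) (f v)) (≡-sym (n/1≡n x)) (≡-sym (n/1≡n y))) (≡-sym (==-involutive _ c))) t

    ring-valid : All (λ (u , v , b) → κ u v ≡ b) (ringEdges L)
    ring-valid = subst (λ l → All (λ (u , v , b) → κ u v ≡ b) (ringEdges l)) len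
      (==-true (≡-trans (cong₂ χ (Path-nth-last x p) (Path-nth-head x p)) (proj₂ (proj₂ (proj₂ r)))) ∷
      Allₚ.map⁺ (All.tabulate λ {i} m → ==-true (proj₂ (proj₂ (proj₂
        (Path-nth-step x p i (below-pred (∈-upTo⁻ m))))))))
      where
      x = proj₁ ring
      p = proj₁ (proj₂ (proj₂ ring))
      r = proj₁ (proj₂ (proj₂ (proj₂ ring)))
      below-pred : ∀ {i l} → i < pred l → suc i < l
      below-pred {l = suc l} h = s≤s h

  turned : ∀ r vs → Ring (Adj W lab χ c) vs → length vs ≡ L →
    Ring (Adj W lab χ c) (rotations r vs) × length (rotations r vs) ≡ L ×
    (∀ d {i} → i < L → nth d (rotations r vs) i ≡ nth d vs (steps L r i))
  turned zero vs ring len = ring , len , λ _ _ → refl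
  turned (suc r) vs ring len with ring′ , len′ , e ← turned r vs ring len =
    rotate-ring (subst (2 ≤_) (≡-sym len′) 2≤L) ring′ , ≡-trans (length-rotate (rotations r vs)) len′ ,
    λ d {i} h → ≡-trans (nth-rotate d (rotations r vs) (subst (i <_) (≡-sym len′) h))
      (≡-trans (cong (λ l → nth d (rotations r vs) (step l i)) len′) (e d (step-< L h)))

  -- A certificate against one blue chord from 0 to d applies to every rotation of the ring, so all
  -- chords of span d take the colour of the ring.
  chord : ∀ d t → d < L → check ((0 , d , false) ∷ ringEdges L) t ≡ true →
    ∀ vs (ring : Ring (Adj W lab χ c) vs) (len : length vs ≡ L) →
    All (λ (u , v , b) → OnRing.κ vs ring len u v ≡ b) (chordEdges L d)
  chord d t hd ok vs ring len = Allₚ.map⁺ (All.universal each (upTo L))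
    where
    0<L : 0 < L
    0<L = ≤-trans (s≤s z≤n) 2≤L
    base : ∀ us (ring′ : Ring (Adj W lab χ c) us) (len′ : length us ≡ L) → OnRing.κ us ring′ len′ 0 d ≡ true
    base us ring′ len′ with OnRing.κ us ring′ len′ 0 d in e
    ... | true = refl
    ... | false = ⊥-elim (OnRing.refute us ring′ len′ _ t (e ∷ OnRing.ring-valid us ring′ len′) ok)
    nth-default : ∀ (a b : V) xs {i} → i < length xs → nth a xs i ≡ nth b xs i
    nth-default a b (x ∷ xs) {zero} _ = refl
    nth-default a b (x ∷ xs) {suc i} (s≤s h) = nth-default a b xs h
    each : ∀ r → OnRing.κ vs ring len (steps L r 0) (steps L r d) ≡ true
    each r with ring′ , len′ , e ← turned r vs ring len =
      ≡-trans (cong (_== c) (cong₂ χ (≡-sym (same 0<L)) (≡-sym (same hd)))) (base (rotations r vs) ring′ len′)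
      where
      same : ∀ {i} → i < L → nth (proj₁ ring′) (rotations r vs) i ≡ nth (proj₁ ring) vs (steps L r i)
      same h = ≡-trans (nth-default (proj₁ ring′) (proj₁ ring) (rotations r vs) (subst (_ <_) (≡-sym len′) h)) (e (proj₁ ring) h)

-- Found by backtracking search. chordL-d refutes a red cycle 0, 1, …, L-1 with the
-- chord 0 d blue, using cycles of length L-1 and complete bipartite graphs;
-- descentm-L refutes a red L-cycle, using cycles of lengths m and m+1.
chord10-3 : Tree
chord10-3 =
  split 2 5 (split 2 7 (split 2 9 (split 4 1 (split 4 7 (split 4 9 (split 6 1 (split 6 9 (split 8 1 (split 8 5 (split
  6 3 (split 8 3 (bip true 268418 9671777) (split 0 5 (split 0 7 (bip true 302241 8589376) (split 0 4 (red 9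
  4647328778272) (split 1 5 (red 9 5711370200065) (split 1 7 (red 9 7912540935169) (split 2 6 (red 9 6915136585762)
  (split 2 8 (red 9 9043158663202) (split 3 5 (red 9 5711376417859) (split 4 6 (red 9 6915134488612) (blue 9
  6674485124100))))))))) (split 0 4 (red 9 4647328778272) (split 1 5 (red 9 5711370200065) (split 1 7 (red 9
  7908245971969) (split 2 6 (red 9 6846350131234) (split 2 8 (red 9 8974439317538) (split 3 7 (red 9 7908252189763)
  (split 4 6 (red 9 6846348034084) (blue 9 6674487219204)))))))))) (split 0 5 (split 0 7 (bip true 302241 8589376)
  (split 0 8 (red 9 9043225708576) (split 1 5 (red 9 5711370200065) (split 1 7 (red 9 7912540935169) (split 2 4 (red
  9 4716115427362) (split 2 8 (red 9 9112012357666) (split 3 5 (red 9 5711376417859) (split 4 6 (red 9 6915134488612)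
  (blue 9 6705558593604))))))))) (split 0 8 (red 9 9043225708576) (split 1 5 (red 9 5711370200065) (split 1 7 (red 9
  7908245971969) (split 2 4 (red 9 4647328972834) (split 2 8 (red 9 9043225903138) (split 3 7 (red 9 7908252189763)
  (split 4 6 (red 9 6846348034084) (blue 9 6707703980100)))))))))) (split 0 4 (red 9 4716115429408) (split 1 5 (red 9
  5711370200065) (split 1 7 (red 9 7908245971969) (split 2 6 (red 9 6773406990370) (split 2 8 (red 9 9043225903138)
  (split 3 7 (red 9 7908252189763) (split 4 6 (red 9 6771259506724) (blue 9 6674548231172))))))))) (split 0 6 (red 9
  6915136522272) (split 1 5 (red 9 5711370200065) (split 2 4 (red 9 4576531218466) (split 2 8 (red 9 9043225903138)
  (split 3 7 (red 9 7908252189763) (split 4 6 (red 9 6771259506724) (split 5 7 (red 9 7912404683845) (blue 9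
  7799866204197))))))))) (split 0 4 (red 9 4716115429408) (split 0 6 (red 9 6846484154400) (split 0 8 (red 9
  9043225708576) (split 1 5 (red 9 5711370200065) (split 1 9 (red 9 10178205453377) (split 2 4 (red 9 4576531218466)
  (split 2 8 (red 9 9043225903138) (split 3 5 (red 9 5711376417859) (split 3 8 (split 4 6 (red 9 6846280925220) (blue
  9 6907552079940)) (blue 9 8869114053795))))))))))) (split 0 8 (red 9 9043225708576) (split 1 5 (red 9
  5711370200065) (split 2 4 (red 9 4576531218466) (split 2 6 (red 9 6773406990370) (split 3 7 (red 9 7908252189763)
  (split 4 8 (red 9 9043223805988) (split 5 7 (red 9 7981124160581) (blue 9 7799933311013))))))))) (split 0 4 (red 9
  4576531220512) (split 0 6 (red 9 6773406992416) (split 0 8 (red 9 9043225708576) (split 1 5 (red 9 5711370200065)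
  (split 1 9 (red 9 10178205453377) (split 2 6 (red 9 6773406990370) (split 2 8 (red 9 9105368651938) (split 3 5 (red
  9 5642791158851) (split 3 8 (split 4 6 (red 9 6846280925220) (blue 9 6674382488868)) (blue 9
  8871259440291))))))))))) (split 0 4 (red 9 4576531220512) (split 0 6 (red 9 6846482059296) (split 0 8 (red 9
  9043225708576) (split 1 5 (red 9 5638293038081) (split 1 7 (red 9 7908245971969) (split 2 6 (red 9 6846479896674)
  (split 2 8 (red 9 9105368586466) (split 3 5 (red 9 5711510635587) (split 3 8 (split 4 6 (red 9 6846280925220) (blue
  9 6674382488804)) (blue 9 8871259374755))))))))))) (split 0 8 (red 9 9043225708576) (split 1 5 (red 9
  5638293038081) (split 3 9 (red 9 9896753042563) (split 4 6 (red 9 6846479894628) (split 5 7 (red 9 7981124095109)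
  (split 6 8 (red 9 9105366421670) (split 7 9 (red 9 9896748782791) (blue 9 9998958724263))))))))) (split 0 6 (red 9
  6773266424096) (split 1 5 (red 9 5638293038081) (split 1 9 (red 9 10178205453377) (split 2 4 (red 9 4576531218466)
  (split 3 7 (red 9 7981124097155) (split 4 6 (red 9 6846479894628) (split 5 7 (red 9 7981124095109) (blue 9
  7799866205221))))))))) (split 0 8 (red 9 9043225708576) (split 1 3 (red 9 3372832007169) (split 1 9 (red 9
  10178205453377) (split 2 4 (red 9 4576531218466) (split 4 6 (red 9 6846479894628) (split 6 8 (red 9 9105366421670)
  (split 7 9 (red 9 9896748782791) (blue 9 9933194203207))))))))) (split 0 2 (red 9 2306571739424) (split 0 8 (red 9
  9043225708576) (split 1 3 (red 9 3441551483905) (split 1 9 (red 9 10178205453377) (split 2 4 (red 9 4576531218466)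
  (split 3 5 (red 9 5711510635587) (split 4 6 (red 9 6846479894628) (split 5 7 (red 9 7981124095109) (split 6 8 (red
  9 9105366421670) (split 7 9 (red 9 9896748782791) (split 0 6 (split 1 4 (split 1 8 (red 9 9105537371201) (split 2 6
  (red 9 6846479896674) (blue 9 6873330912258))) (blue 9 4612797144353)) (blue 9 6736831612000))))))))))))

chord10-5 : Tree
chord10-5 =
  split 2 7 (split 2 9 (split 4 1 (split 4 7 (split 4 9 (split 6 1 (split 6 3 (split 6 9 (split 8 1 (split 8 3 (split
  2 5 (split 8 5 (bip true 268418 9671777) (split 0 3 (split 0 7 (bip true 302177 8589376) (split 0 4 (red 9
  4716115363872) (split 1 7 (red 9 7912543030273) (split 1 9 (red 9 10109418802177) (split 2 4 (red 9 4716115361826)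
  (split 2 8 (red 9 9043225706530) (split 3 5 (red 9 5713521869827) (split 3 9 (red 9 10109418800131) (blue 9
  9937484849315))))))))) (split 0 4 (red 9 4716115363872) (split 1 5 (red 9 5711370200065) (split 1 7 (red 9
  7908245971969) (split 2 6 (red 9 6846283022370) (split 2 8 (red 9 9043158794274) (split 3 7 (red 9 7908252189763)
  (split 4 6 (red 9 6846280925220) (blue 9 6674548231172)))))))))) (split 0 3 (split 0 7 (bip true 302177 8589376)
  (split 0 4 (red 9 4716115363872) (split 1 7 (red 9 7908252257281) (split 1 9 (red 9 10107273415681) (split 2 6 (red
  9 6915136520226) (split 3 5 (red 9 5713521869827) (split 3 9 (red 9 10107273413635) (split 4 6 (red 9
  6915134423076) (blue 9 6671268092932))))))))) (split 0 6 (red 9 6915136522272) (split 1 5 (red 9 5711370200065)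
  (split 1 7 (red 9 7908245971969) (split 2 8 (red 9 9043158794274) (split 3 7 (red 9 7908252189763) (split 4 6 (red
  9 6846280925220) (split 4 8 (red 9 9043156697124) (blue 9 8870222201028)))))))))) (split 0 4 (red 9 4716115363872)
  (split 1 5 (red 9 5711370200065) (split 1 7 (red 9 7908245971969) (split 2 6 (red 9 6704687513634) (split 2 8 (red
  9 9043158794274) (split 3 7 (red 9 7908252189763) (split 4 6 (red 9 6702540029988) (blue 9 6674487219204)))))))))
  (split 0 4 (red 9 4716115363872) (split 1 7 (red 9 7908245971969) (split 2 6 (red 9 6704687513634) (split 2 8 (red
  9 9043158794274) (split 3 5 (red 9 5711376417859) (split 3 7 (red 9 7908252189763) (split 4 6 (red 9 6702540029988)
  (blue 9 6674420175876))))))))) (split 0 4 (red 9 4716115363872) (split 1 7 (red 9 7908245971969) (split 1 9 (red 9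
  10178205453377) (split 2 4 (red 9 4507811741730) (split 2 6 (red 9 6704687513634) (split 3 5 (red 9 5711376417859)
  (split 3 7 (red 9 7908252189763) (blue 9 7740808364195))))))))) (split 0 8 (red 9 9043225708576) (split 1 5 (red 9
  5711370200065) (split 1 7 (red 9 7908245971969) (split 2 4 (red 9 4576531218466) (split 2 8 (red 9 9043225903138)
  (split 3 7 (red 9 7908252189763) (split 4 6 (red 9 6846479894628) (blue 9 6707703980100))))))))) (split 0 8 (red 9
  9043225708576) (split 1 7 (red 9 7908245971969) (split 2 4 (red 9 4576531218466) (split 2 8 (red 9 9043225903138)
  (split 3 5 (red 9 5711376417859) (split 3 7 (red 9 7908252189763) (split 4 6 (red 9 6846479894628) (blue 9
  6639051612228))))))))) (split 0 6 (red 9 6773406992416) (split 1 7 (red 9 7908245971969) (split 1 9 (red 9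
  10178205453377) (split 2 4 (red 9 4576531218466) (split 2 6 (red 9 6773406990370) (split 3 5 (red 9 5642791158851)
  (split 3 7 (red 9 7908243809347) (blue 9 7740741320867))))))))) (split 0 6 (red 9 6846482059296) (split 1 7 (red 9
  7908245971969) (split 1 9 (red 9 10178205453377) (split 2 4 (red 9 4576531218466) (split 2 6 (red 9 6846479896674)
  (split 3 5 (red 9 5711510635587) (split 3 9 (red 9 10178205451331) (blue 9 9937617092771))))))))) (split 0 8 (red 9
  9043225708576) (split 1 7 (red 9 7908245971969) (split 3 5 (red 9 5711510635587) (split 3 9 (red 9 9896753042563)
  (split 4 6 (red 9 6846479894628) (split 6 8 (red 9 9105366421670) (split 7 9 (red 9 9896748782791) (blue 9
  10004061163559))))))))) (split 0 6 (red 9 6773266424096) (split 1 3 (red 9 3441551483905) (split 1 5 (red 9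
  5638293038081) (split 2 4 (red 9 4576531218466) (split 3 9 (red 9 9896753042563) (split 4 8 (red 9 9105366554788)
  (split 6 8 (red 9 9105366421670) (blue 9 8935984632838))))))))) (split 0 8 (red 9 9043225708576) (split 1 3 (red 9
  3441551483905) (split 1 9 (red 9 10178205453377) (split 2 4 (red 9 4576531218466) (split 4 6 (red 9 6846479894628)
  (split 6 8 (red 9 9105366421670) (split 7 9 (red 9 9896748782791) (split 0 3 (split 1 5 (red 9 5711510637633) (blue
  9 5506353667361)) (blue 9 3342795413760)))))))))

descent9-11 : Tree
descent9-11 =
  split 0 2 (red 10 73810295661888) (split 0 9 (red 10 325702574508064) (split 1 3 (red 10 110129647495169) (split 1
  9 (red 9 10178205453377) (split 2 5 (red 9 5711510962210) (split 3 6 (red 9 6846490346563) (split 4 6 (red 10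
  219087691090020) (split 4 7 (red 9 7981458557028) (split 5 7 (red 10 255406673824901) (blue 9
  7840564805701)))))))))

descent9-12 : Tree
descent9-12 =
  split 0 4 (red 9 4576531229024) (split 0 9 (red 10 325702574508064) (split 1 5 (red 9 5711510973441) (split 1 9
  (red 9 10178205453377) (split 2 5 (red 10 182768351150114) (split 2 6 (red 9 6846490705954) (split 3 6 (red 10
  219087702590531) (split 3 7 (red 9 7981470057539) (split 4 7 (red 10 255407041841252) (blue 9
  7806175454212)))))))))

descent9-13 : Tree
descent9-13 =
  split 0 4 (red 10 146448999329152) (split 0 5 (red 9 5711510973824) (split 1 5 (red 10 182768351162369) (split 1 6
  (red 9 6846490718209) (split 2 6 (red 10 219087702982690) (split 2 7 (red 9 7981470449698) (split 3 7 (red 10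
  255407054390339) (split 3 8 (red 9 9116449768515) (split 4 8 (red 10 291726392592484) (blue 9
  8906761868292)))))))))

descent9-14 : Tree
descent9-14 =
  split 0 8 (red 9 9043225708576) (split 0 9 (red 10 325702574508064) (split 1 7 (red 9 7981470462977) (split 1 10
  (red 10 362021926341697) (split 2 7 (red 10 255407054815266) (split 2 11 (red 10 398341278175330) (split 3 8 (red
  10 291726406190147) (split 3 11 (red 9 12448164942979) (split 4 9 (red 10 328045743343716) (split 4 10 (red 9
  11386394544228) (blue 10 353186270675236))))))))))

descent9-15 : Tree
descent9-15 =
  split 0 7 (red 9 7981470463424) (split 0 8 (red 9 9043225708576) (split 1 7 (red 10 255407054829569) (split 1 10
  (red 10 362021926341697) (split 2 8 (red 10 291726406647842) (split 2 9 (red 9 10251429937186) (split 3 9 (red 10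
  328045757989955) (split 3 11 (red 9 12448164942979) (split 4 10 (red 10 364365094094948) (split 4 11 (red 9
  12521373206628) (blue 10 390638281655620))))))))))

descent9-16 : Tree
descent9-16 =
  split 0 8 (red 9 9043225708576) (split 0 9 (red 10 325702574508064) (split 1 8 (red 10 291726406663169) (split 1 10
  (red 10 362021926341697) (split 2 9 (red 10 328045758480418) (split 2 11 (red 10 398341278175330) (split 3 10 (red
  10 364365109789763) (split 3 12 (red 10 434660630008963) (split 4 11 (red 10 400684444846180) (split 4 12 (red 9
  13656351869028) (blue 10 425855939807588))))))))))

descent9-17 : Tree
descent9-17 =
  split 0 8 (red 9 9043225708576) (split 0 9 (red 10 325702574508064) (split 1 9 (red 10 328045758496769) (split 1 10
  (red 9 11386409697281) (split 2 10 (red 10 364365110312994) (split 2 11 (red 9 12521389424674) (split 3 11 (red 10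
  400684461589571) (split 3 12 (red 9 13656368612419) (split 5 13 (red 10 473322577005701) (split 5 14 (red 9
  15925739850885) (split 6 14 (red 10 509623675228326) (split 6 15 (red 9 17042465984678) (split 7 15 (red 10
  545358911509703) (split 7 16 (red 9 17593330177223) (split 8 12 (split 8 16 (red 10 562986565671144) (split 9 13
  (split 10 16 (red 9 18123060425066) (split 11 13 (split 12 16 (red 9 18123062584588) (blue 10 571755754237036))
  (blue 10 463382385272907))) (blue 10 463382385270793))) (blue 9 13309107545096)))))))))))))))

chord12-3 : Tree
chord12-3 =
  split 2 5 (split 2 7 (split 2 9 (split 2 11 (split 4 1 (split 4 7 (split 4 9 (split 4 11 (split 6 1 (split 6 9
  (split 6 11 (split 8 1 (split 8 5 (split 8 11 (split 10 1 (split 10 5 (split 10 7 (split 6 3 (split 8 3 (split 10 3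
  (bip true 10754178 378770529) (split 0 5 (split 0 7 (split 0 9 (bip true 11836577 344133696) (split 0 6 (red 11
  7083303186303008) (split 1 5 (red 11 5923285098372097) (split 1 9 (red 11 10426882578256897) (split 2 6 (red 11
  7083303119257634) (split 2 8 (red 11 9335100785459234) (split 3 7 (red 11 8175084914082883) (split 4 8 (red 11
  9335100783362084) (split 4 10 (red 11 11584701573791780) (split 5 7 (red 11 8175084912051205) (blue 11
  7997993682740261))))))))))) (split 0 8 (red 11 9335100852504608) (split 1 5 (red 11 5921083927636993) (split 1 9
  (red 11 10426882578256897) (split 2 6 (red 11 7083303119257634) (split 2 10 (red 11 11584701575888930) (split 3 9
  (red 11 10426882580284483) (split 4 6 (red 11 7083303117160484) (split 4 8 (red 11 9335100783362084) (split 5 7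
  (red 11 8175084912051205) (blue 11 7890239400027173))))))))))) (split 0 6 (red 11 7083303186303008) (split 1 7 (red
  11 8172881593838593) (split 1 9 (red 11 10422482384268289) (split 2 6 (red 11 7012865655799842) (split 2 8 (red 11
  9264663322001442) (split 3 9 (red 11 10422482392581187) (split 4 8 (red 11 9264663319904292) (split 4 10 (red 11
  11514264110333988) (split 5 7 (red 11 8172879454667845) (blue 11 7926493283948549)))))))))))) (split 0 5 (split 0 7
  (split 0 9 (bip true 11836577 344133696) (split 0 6 (red 11 7083303186303008) (split 1 5 (red 11 5923285098372097)
  (split 1 9 (red 11 10426882578256897) (split 2 6 (red 11 7153740717129762) (split 2 10 (red 11 11584701575888930)
  (split 3 7 (red 11 8175084914082883) (split 4 8 (red 11 9335100783362084) (split 4 10 (red 11 11584701573791780)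
  (split 5 7 (red 11 8175084912051205) (blue 11 7995796806968357))))))))))) (split 0 10 (red 11 11584701642934304)
  (split 1 5 (red 11 5921083927636993) (split 1 9 (red 11 10426882578256897) (split 2 6 (red 11 7153740717129762)
  (split 2 8 (red 11 9335100785459234) (split 3 9 (red 11 10426882580284483) (split 4 6 (red 11 7153740715032612)
  (split 4 10 (red 11 11584701573791780) (split 5 7 (red 11 8175084912051205) (blue 11 7892438421185573)))))))))))
  (split 0 6 (red 11 7083303186303008) (split 1 7 (red 11 8172881593838593) (split 1 9 (red 11 10422482384268289)
  (split 2 6 (red 11 7083303186563106) (split 2 10 (red 11 11514264112431138) (split 3 9 (red 11 10422482392581187)
  (split 4 8 (red 11 9264663319904292) (split 4 10 (red 11 11514264110333988) (split 5 7 (red 11 8172879454667845)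
  (blue 11 7926491138562053)))))))))))) (split 0 5 (split 0 7 (split 0 9 (bip true 11836577 344133696) (split 0 8
  (red 11 9335100852504608) (split 1 5 (red 11 5923285098372097) (split 1 9 (red 11 10426882578256897) (split 2 8
  (red 11 9405538383331362) (split 2 10 (red 11 11655139173761058) (split 3 7 (red 11 8175084914082883) (split 4 6
  (red 11 7153740715032612) (split 4 10 (red 11 11655139171663908) (split 5 7 (red 11 8175084912051205) (blue 11
  7993597785809957))))))))))) (split 0 10 (red 11 11584701642934304) (split 1 5 (red 11 5921083927636993) (split 1 9
  (red 11 10426882578256897) (split 2 6 (red 11 7153740717129762) (split 2 8 (red 11 9405538383331362) (split 3 9
  (red 11 10426882580284483) (split 4 8 (red 11 9405538381234212) (split 4 10 (red 11 11655139171663908) (split 5 7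
  (red 11 8175084912051205) (blue 11 7892440566572069))))))))))) (split 0 8 (red 11 9335100852504608) (split 1 7 (red
  11 8172881593838593) (split 1 9 (red 11 10422482384268289) (split 2 8 (red 11 9335100852764706) (split 2 10 (red 11
  11584701643194402) (split 3 9 (red 11 10422482392581187) (split 4 6 (red 11 7083303184465956) (split 4 10 (red 11
  11584701641097252) (split 5 7 (red 11 8172887900032069) (blue 11 7926488991080453)))))))))))) (split 0 6 (red 11
  7153740649957408) (split 1 5 (red 11 5921083927636993) (split 1 9 (red 11 10422482384268289) (split 2 6 (red 11
  7010806286090274) (split 2 8 (red 11 9260407076519970) (split 3 9 (red 11 10422482392581187) (split 4 8 (red 11
  9260407074422820) (split 4 10 (red 11 11584701641097252) (split 5 7 (red 11 8172887900032069) (blue 11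
  8237818342122533))))))))))) (split 0 8 (red 11 9405538316159008) (split 1 7 (red 11 8172881593838593) (split 1 9
  (red 11 10422482384268289) (split 2 6 (red 11 7010662545195042) (split 2 10 (red 11 11584701643194402) (split 3 9
  (red 11 10422482392581187) (split 4 6 (red 11 7010660397711396) (split 4 8 (red 11 9260261188141092) (split 5 7
  (red 11 8172887900032069) (blue 11 7926482676681029))))))))))) (split 0 8 (red 11 9405538316159008) (split 1 7 (red
  11 8172881593838593) (split 2 6 (red 11 7010662545195042) (split 2 10 (red 11 11584701643194402) (split 3 9 (red 11
  10422482392581187) (split 4 6 (red 11 7010660397711396) (split 4 8 (red 11 9260261188141092) (split 5 7 (red 11
  8172887900032069) (split 5 9 (red 11 10422488690461765) (blue 11 10238931654477029))))))))))) (split 0 10 (red 11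
  11584701642934304) (split 1 5 (red 11 5921083927636993) (split 1 11 (red 11 12746920901610561) (split 2 6 (red 11
  7010662545195042) (split 2 8 (red 11 9260263335624738) (split 3 7 (red 11 8172881602151491) (split 4 6 (red 11
  7010660397711396) (split 4 10 (red 11 11584701641097252) (split 5 7 (red 11 8172887900032069) (blue 11
  7987200560213029))))))))))) (split 0 10 (red 11 11584701642934304) (split 1 7 (red 11 8172881593838593) (split 1 9
  (red 11 10422482384268289) (split 2 6 (red 11 6935968768950306) (split 2 8 (red 11 9260263335624738) (split 3 9
  (red 11 10422482392581187) (split 4 6 (red 11 6933769745694756) (split 4 10 (red 11 11584701641097252) (split 5 7
  (red 11 8172887900032069) (blue 11 7926482743789829))))))))))) (split 0 10 (red 11 11584701642934304) (split 1 7
  (red 11 8172881593838593) (split 2 6 (red 11 6935968768950306) (split 2 8 (red 11 9260263335624738) (split 3 9 (red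
  11 10422482392581187) (split 4 6 (red 11 6933769745694756) (split 4 10 (red 11 11584701641097252) (split 5 7 (red
  11 8172887900032069) (split 5 9 (red 11 10422488690461765) (blue 11 10239000373888229))))))))))) (split 0 10 (red
  11 11584701642934304) (split 1 5 (red 11 5850783902936065) (split 1 11 (red 11 12746920901610561) (split 2 6 (red
  11 6935968768950306) (split 2 8 (red 11 9260263335624738) (split 3 7 (red 11 8172881602151491) (split 4 8 (red 11
  9260261188141092) (split 4 10 (red 11 11584701641097252) (split 5 7 (red 11 8102656594807877) (blue 11
  7987200627256357))))))))))) (split 0 10 (red 11 11584701642934304) (split 1 5 (red 11 5848587027164161) (split 1 9
  (red 11 10422482384268289) (split 2 6 (red 11 6935968768950306) (split 2 8 (red 11 9260263335624738) (split 3 7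
  (red 11 8098050588279875) (split 4 8 (red 11 9260261188141092) (split 4 10 (red 11 11584701641097252) (split 5 7
  (red 11 8173025338985541) (blue 11 7987200627254309))))))))))) (split 0 10 (red 11 11584701642934304) (split 1 7
  (red 11 8098043875634177) (split 2 6 (red 11 6935968768950306) (split 2 8 (red 11 9260263335624738) (split 3 9 (red
  11 10422482392581187) (split 4 8 (red 11 9260261188141092) (split 4 10 (red 11 11584701641097252) (split 5 7 (red
  11 8173025338985541) (split 5 9 (red 11 10497038721555653) (blue 11 10239000440931557))))))))))) (split 0 8 (red 11
  9260263335626784) (split 1 7 (red 11 8098043875634177) (split 1 11 (red 11 12746920901610561) (split 2 6 (red 11
  6935968768950306) (split 2 8 (red 11 9260263335624738) (split 3 9 (red 11 10497038725878851) (split 4 6 (red 11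
  6933769745694756) (split 5 7 (red 11 8173025338985541) (split 5 9 (red 11 10497038721555653) (blue 11
  10238929509123301))))))))))) (split 0 6 (red 11 6935968768952352) (split 1 7 (red 11 8098043875634177) (split 1 11
  (red 11 12746920901610561) (split 2 6 (red 11 6935968768950306) (split 2 8 (red 11 9335231714924706) (split 3 11
  (red 11 12746920901608515) (split 4 8 (red 11 9260261188141092) (split 5 7 (red 11 8173025338985541) (split 5 9
  (red 11 10497038721555653) (blue 11 10282707908396261))))))))))) (split 0 8 (red 11 9335234065764384) (split 1 9
  (red 11 10422482384268289) (split 1 11 (red 11 12746920901610561) (split 2 6 (red 11 7010806482899042) (split 2 8
  (red 11 9335231714859234) (split 3 11 (red 11 12746920901608515) (split 4 6 (red 11 6933769745694756) (split 5 7
  (red 11 8173025338985541) (split 5 9 (red 11 10497038721555653) (blue 11 10180481511526629))))))))))) (split 0 10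
  (red 11 11584701642934304) (split 1 5 (red 11 5773612071332865) (split 3 11 (red 11 12386077146027139) (split 4 6
  (red 11 7010806482896996) (split 5 7 (red 11 8173025338920069) (split 6 8 (red 11 9335231712694438) (split 7 9 (red
  11 10497038654510279) (split 8 10 (red 11 11646063773653224) (split 9 11 (red 11 12386070567263497) (blue 11
  12490804484412649))))))))))) (split 0 8 (red 11 9260263125854560) (split 1 5 (red 11 5773612071332865) (split 1 11
  (red 11 12746920901610561) (split 2 4 (red 11 4686367978520610) (split 3 9 (red 11 10497038658770051) (split 4 6
  (red 11 7010806482896996) (split 5 7 (red 11 8173025338920069) (split 6 8 (red 11 9335231712694438) (split 7 9 (red
  11 10497038654510279) (blue 11 10238933734884519))))))))))) (split 0 10 (red 11 11584701642934304) (split 1 3 (red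
  11 3524011280903169) (split 1 5 (red 11 5773612071332865) (split 2 4 (red 11 4686367978520610) (split 4 6 (red 11
  7010806482896996) (split 5 7 (red 11 8173025338920069) (split 6 8 (red 11 9335231712694438) (split 7 9 (red 11
  10497038654510279) (split 8 10 (red 11 11646063773653224) (blue 11 11262337576145096))))))))))) (split 0 10 (red 11
  11584701642934304) (split 1 3 (red 11 3453779975678977) (split 1 11 (red 11 12746920901610561) (split 2 4 (red 11
  4686367978520610) (split 4 6 (red 11 7010806482896996) (split 6 8 (red 11 9335231712694438) (split 7 9 (red 11
  10497038654510279) (split 8 10 (red 11 11646063773653224) (split 9 11 (red 11 12386070567263497) (blue 11
  12423392894519529))))))))))) (split 0 2 (red 11 2361929461180768) (split 0 10 (red 11 11584701642934304) (split 1 3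
  (red 11 3524148719856641) (split 1 11 (red 11 12746920901610561) (split 2 4 (red 11 4686367978520610) (split 3 5
  (red 11 5848587236803651) (split 4 6 (red 11 7010806482896996) (split 5 7 (red 11 8173025338920069) (split 6 8 (red
  11 9335231712694438) (split 7 9 (red 11 10497038654510279) (split 8 10 (red 11 11646063773653224) (split 9 11 (red
  11 12386070567263497) (split 0 8 (split 0 9 (split 1 4 (split 1 10 (red 11 11575941018029121) (split 2 6 (red 11
  7010806482899042) (blue 11 7047916014439426))) (blue 11 4723845622900065)) (blue 11 10521335285621056)) (blue 11
  9222777866650720))))))))))))))

chord12-5 : Tree
chord12-5 =
  split 2 7 (split 2 9 (split 2 11 (split 4 1 (split 4 7 (split 4 9 (split 4 11 (split 6 1 (split 6 3 (split 6 9
  (split 6 11 (split 8 1 (split 8 3 (split 8 11 (split 10 1 (split 10 3 (split 10 7 (split 2 5 (split 8 5 (split 10 5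
  (bip true 10754178 378770529) (split 0 3 (split 0 7 (split 0 9 (bip true 11836513 344133696) (split 0 6 (red 11
  7083303186303008) (split 1 7 (red 11 8175084914150401) (split 1 9 (red 11 10426882580352001) (split 2 8 (red 11
  9335100852502562) (split 2 10 (red 11 11584701642932258) (split 3 5 (red 11 5923285102560259) (split 3 7 (red 11
  8175084914148355) (split 4 6 (red 11 7083303184203812) (split 4 8 (red 11 9335100850405412) (blue 11
  9088738371338436))))))))))) (split 0 6 (red 11 7083303186303008) (split 1 7 (red 11 8175084914150401) (split 1 9
  (red 11 10426882580352001) (split 2 8 (red 11 9335100852502562) (split 2 10 (red 11 11584701642932258) (split 3 5
  (red 11 5923285102560259) (split 3 9 (red 11 10426882580349955) (split 4 6 (red 11 7083303184203812) (split 4 8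
  (red 11 9335100850405412) (blue 11 9088738438381764))))))))))) (split 0 8 (red 11 9335100852504608) (split 1 7 (red
  11 8172881593838593) (split 1 9 (red 11 10422482384268289) (split 2 6 (red 11 7083303119454242) (split 2 10 (red 11
  11514264112431138) (split 3 9 (red 11 10422482392581187) (split 4 6 (red 11 7083303117357092) (split 4 8 (red 11
  9335100783558692) (split 5 7 (red 11 8172879454667845) (blue 11 7926482676681029)))))))))))) (split 0 3 (split 0 7
  (split 0 9 (bip true 11836513 344133696) (split 0 10 (red 11 11584701642934304) (split 1 7 (red 11
  8175084914150401) (split 1 9 (red 11 10426882580352001) (split 2 6 (red 11 7153740717064226) (split 2 10 (red 11
  11584701642932258) (split 3 5 (red 11 5852985077859331) (split 3 7 (red 11 8175084914148355) (split 4 6 (red 11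
  7153740714967076) (split 4 8 (red 11 9335100850405412) (blue 11 9186661544298692))))))))))) (split 0 10 (red 11
  11584701642934304) (split 1 7 (red 11 8175084914150401) (split 1 9 (red 11 10426882580352001) (split 2 6 (red 11
  7153740717064226) (split 2 10 (red 11 11584701642932258) (split 3 5 (red 11 5852985077859331) (split 3 9 (red 11
  10426882580349955) (split 4 6 (red 11 7153740714967076) (split 4 8 (red 11 9335100850405412) (blue 11
  9186730196666564))))))))))) (split 0 10 (red 11 11584701642934304) (split 1 7 (red 11 8172881593838593) (split 1 9
  (red 11 10422482384268289) (split 2 6 (red 11 7083303119454242) (split 2 8 (red 11 9335100785655842) (split 3 9
  (red 11 10422482392581187) (split 4 6 (red 11 7083303117357092) (split 4 10 (red 11 11584701573988388) (split 5 7
  (red 11 8172879454667845) (blue 11 7926482743789829)))))))))))) (split 0 3 (split 0 7 (split 0 9 (bip true 11836513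
  344133696) (split 0 8 (red 11 9335100852504608) (split 1 9 (red 11 10426880434965505) (split 1 11 (red 11
  12676481225395201) (split 2 6 (red 11 7153740717064226) (split 3 7 (red 11 8175080623375363) (split 3 11 (red 11
  12676481225393155) (split 4 6 (red 11 7153740714967076) (split 4 8 (red 11 9405538381168676) (split 5 7 (red 11
  8175084844876933) (blue 11 7998991124011077))))))))))) (split 0 8 (red 11 9335100852504608) (split 1 7 (red 11
  8175080623377409) (split 1 11 (red 11 12676481225395201) (split 2 6 (red 11 7153740717064226) (split 3 9 (red 11
  10426880434963459) (split 3 11 (red 11 12676481225393155) (split 4 6 (red 11 7153740714967076) (split 4 8 (red 11
  9405538381168676) (split 5 9 (red 11 10426882511078533) (blue 11 10250788790212677))))))))))) (split 0 6 (red 11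
  7153740717066272) (split 1 7 (red 11 8172881593838593) (split 1 9 (red 11 10422482384268289) (split 2 6 (red 11
  7083303119454242) (split 2 8 (red 11 9335100785655842) (split 2 10 (red 11 11584701576085538) (split 3 7 (red 11
  8172881602151491) (split 3 9 (red 11 10422482392581187) (split 4 8 (red 11 9335100783558692) (split 4 10 (red 11
  11584701573988388) (split 5 7 (red 11 8172879387559045) (split 5 9 (red 11 10422480177988741) (split 5 10 (split 6
  8 (red 11 9264661172420646) (blue 11 9159006250830854)) (blue 11 11408607815173349)))))))))))))))) (split 0 6 (red
  11 7153740717066272) (split 1 5 (red 11 5850783902936065) (split 1 9 (red 11 10422482384268289) (split 2 8 (red 11
  9260407009411106) (split 2 10 (red 11 11584701576085538) (split 3 7 (red 11 8172881602151491) (split 3 9 (red 11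
  10422482392581187) (split 4 6 (red 11 7010806216884260) (split 4 8 (red 11 9260407007313956) (blue 11
  9088807157792964))))))))))) (split 0 6 (red 11 7153740717066272) (split 1 7 (red 11 8172881593838593) (split 1 9
  (red 11 10422482384268289) (split 2 6 (red 11 7010593825718306) (split 2 8 (red 11 9260194616148002) (split 3 9
  (red 11 10422482392581187) (split 4 8 (red 11 9260192468664356) (split 4 10 (red 11 11584701573988388) (split 5 7
  (red 11 8172879387559045) (blue 11 7926493283948549))))))))))) (split 0 6 (red 11 7153740717066272) (split 1 9 (red
  11 10422482384268289) (split 2 6 (red 11 7010593825718306) (split 2 8 (red 11 9260194616148002) (split 3 7 (red 11
  8172881602151491) (split 3 9 (red 11 10422482392581187) (split 4 8 (red 11 9260192468664356) (split 4 10 (red 11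
  11584701573988388) (split 5 7 (red 11 8172879387559045) (blue 11 7996793308649477))))))))))) (split 0 10 (red 11
  11584701642934304) (split 1 5 (red 11 5850783902936065) (split 1 7 (red 11 8172881593838593) (split 2 6 (red 11
  7010593825718306) (split 2 10 (red 11 11584701576085538) (split 3 7 (red 11 8172881602151491) (split 3 11 (red 11
  12746920901608515) (split 4 6 (red 11 7010591678234660) (split 4 8 (red 11 9260192468664356) (blue 11
  9397767642613956))))))))))) (split 0 6 (red 11 7153740717066272) (split 1 7 (red 11 8172881593838593) (split 1 9
  (red 11 10422482384268289) (split 2 6 (red 11 6865600024772642) (split 2 10 (red 11 11584701576085538) (split 3 9
  (red 11 10422482392581187) (split 4 8 (red 11 9260192468664356) (split 4 10 (red 11 11584701573988388) (split 5 7
  (red 11 8172879387559045) (blue 11 7926491138562053))))))))))) (split 0 6 (red 11 7153740717066272) (split 1 9 (red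
  11 10422482384268289) (split 2 6 (red 11 6865600024772642) (split 2 10 (red 11 11584701576085538) (split 3 7 (red
  11 8172881602151491) (split 3 9 (red 11 10422482392581187) (split 4 8 (red 11 9260192468664356) (split 4 10 (red 11
  11584701573988388) (split 5 7 (red 11 8172879387559045) (blue 11 7996791163262981))))))))))) (split 0 10 (red 11
  11584701642934304) (split 1 7 (red 11 8172881593838593) (split 1 11 (red 11 12746920901610561) (split 2 8 (red 11
  9260194616148002) (split 2 10 (red 11 11584701576085538) (split 3 5 (red 11 5850783911248963) (split 3 7 (red 11
  8172881602151491) (split 4 6 (red 11 6863401001517092) (split 4 8 (red 11 9260192468664356) (blue 11
  9088568591953092))))))))))) (split 0 10 (red 11 11584701642934304) (split 1 7 (red 11 8172812941470721) (split 1 9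
  (red 11 10422482384268289) (split 2 8 (red 11 9260194616148002) (split 2 10 (red 11 11584701576085538) (split 3 5
  (red 11 5848587035477059) (split 3 7 (red 11 8098050588279875) (split 4 6 (red 11 6863401001517092) (split 4 8 (red
  11 9260192468664356) (blue 11 9088568591951044))))))))))) (split 0 8 (red 11 9335236146202656) (split 1 7 (red 11
  8098043875634177) (split 1 9 (red 11 10422482384268289) (split 2 8 (red 11 9260263335624738) (split 2 10 (red 11
  11584701643194402) (split 3 9 (red 11 10422482392581187) (split 4 6 (red 11 7010806482896996) (split 4 10 (red 11
  11646068207159396) (split 5 7 (red 11 8173025338920069) (blue 11 7926488991080453))))))))))) (split 0 8 (red 11
  9335236146202656) (split 1 9 (red 11 10422482384268289) (split 2 8 (red 11 9260263335624738) (split 2 10 (red 11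
  11584701643194402) (split 3 7 (red 11 8098050588279875) (split 3 9 (red 11 10422482392581187) (split 4 6 (red 11
  7010806482896996) (split 4 10 (red 11 11646063979239588) (split 5 7 (red 11 8173025338920069) (blue 11
  7996789015781381))))))))))) (split 0 6 (red 11 6935968768952352) (split 1 9 (red 11 10422482384268289) (split 1 11
  (red 11 12746920901610561) (split 2 6 (red 11 6935968768950306) (split 2 8 (red 11 9260263335624738) (split 3 7
  (red 11 8098050588279875) (split 3 9 (red 11 10497038723783747) (split 4 8 (red 11 9335231712827556) (split 5 7
  (red 11 8173025338920069) (blue 11 7996794382391301))))))))))) (split 0 6 (red 11 6935968768952352) (split 1 9 (red
  11 10422482384268289) (split 1 11 (red 11 12746920901610561) (split 2 6 (red 11 6935968768950306) (split 2 8 (red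
  11 9335231714859234) (split 3 7 (red 11 8098041663136835) (split 3 11 (red 11 12746920901608515) (split 4 8 (red 11
  9335231712827556) (split 5 7 (red 11 8173025338920069) (blue 11 7998991258163205))))))))))) (split 0 6 (red 11
  7010806485061664) (split 1 7 (red 11 8098043875634177) (split 1 11 (red 11 12746920901610561) (split 2 6 (red 11
  7010806482899042) (split 2 8 (red 11 9335231714859234) (split 3 9 (red 11 10497038723783747) (split 3 11 (red 11
  12746920901608515) (split 4 8 (red 11 9335231712827556) (split 5 9 (red 11 10497038721555653) (blue 11
  10250788924364805))))))))))) (split 0 2 (red 11 2361929461180768) (split 0 6 (red 11 6935824818284896) (split 1 7
  (red 11 8098043875634177) (split 1 11 (red 11 12746920901610561) (split 2 4 (red 11 4686367978520610) (split 3 5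
  (red 11 5848587236803651) (split 3 9 (red 11 10497038658770051) (split 3 11 (red 11 12386077146027139) (split 4 8
  (red 11 9335231712827556) (split 4 10 (red 11 11646063979239588) (split 5 7 (red 11 8173025338920069) (split 6 8
  (red 11 9335231712694438) (split 6 9 (split 7 9 (red 11 10497038654510279) (split 7 11 (red 11 12386070567265543)
  (split 8 10 (red 11 11646063773653224) (blue 11 11401221847023816)))) (blue 11 10250788949528838)))))))))))))))
  (split 0 6 (red 11 6935824818284896) (split 1 5 (red 11 5773612071332865) (split 1 7 (red 11 8098043875634177)
  (split 2 4 (red 11 4686367978520610) (split 3 9 (red 11 10497038658770051) (split 3 11 (red 11 12386077146027139)
  (split 4 8 (red 11 9335231712827556) (split 6 8 (red 11 9335231712694438) (split 7 9 (red 11 10497038654510279)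
  (blue 11 10250820194931751))))))))))) (split 0 10 (red 11 11584701642934304) (split 1 3 (red 11 3524148719856641)
  (split 1 11 (red 11 12746920901610561) (split 2 4 (red 11 4686367978520610) (split 3 5 (red 11 5848587236803651)
  (split 4 6 (red 11 7010806482896996) (split 6 8 (red 11 9335231712694438) (split 8 10 (red 11 11646063773653224)
  (split 9 11 (red 11 12386070567263497) (blue 11 12423554025066569))))))))))) (split 0 10 (red 11 11584701642934304)
  (split 1 3 (red 11 3524148719856641) (split 1 11 (red 11 12746920901610561) (split 2 4 (red 11 4686367978520610)
  (split 4 6 (red 11 7010806482896996) (split 6 8 (red 11 9335231712694438) (split 7 9 (red 11 10497038654510279)
  (split 8 10 (red 11 11646063773653224) (split 9 11 (red 11 12386070567263497) (split 0 3 (split 1 5 (red 11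
  5848587236805697) (blue 11 5640776107402593)) (blue 11 3425295545868608)))))))))))

descent11-13 : Tree
descent11-13 =
  split 0 3 (red 11 3524148719857024) (split 0 11 (red 12 407901468851537952) (split 1 11 (red 11 12746920901610561)
  (split 1 12 (red 12 445092485129178177) (split 2 4 (red 12 149963775313051682) (split 2 12 (red 11
  13909140160286818) (split 3 6 (red 11 7010806495446083) (split 4 7 (red 11 8173025740490852) (split 5 7 (red 12
  261536823695707269) (split 5 8 (red 11 9335244562959493) (split 6 8 (red 12 298727826014703782) (blue 11
  9190957687079014)))))))))))

descent11-14 : Tree
descent11-14 =
  split 0 3 (red 12 112772759035425184) (split 0 11 (red 12 407901468851537952) (split 1 11 (red 11
  12746920901610561) (split 1 12 (red 12 445092485129178177) (split 2 6 (red 11 7010806495871010) (split 2 12 (red 11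
  13909140160286818) (split 3 7 (red 11 8173025754088515) (split 4 7 (red 12 261536824130832484) (split 4 8 (red 11
  9335244998084708) (split 5 8 (red 12 298727839938710661) (split 5 9 (red 11 10497463786998917) (split 6 9 (red 12
  335918841183965350) (blue 12 330174789479084102))))))))))))

descent11-15 : Tree
descent11-15 =
  split 0 5 (red 11 5848587237209536) (split 0 11 (red 12 407901468851537952) (split 1 6 (red 11 7010806495885313)
  (split 1 11 (red 11 12746920901610561) (split 2 6 (red 12 224345807868330018) (split 2 7 (red 11 8173025754546210)
  (split 3 7 (red 12 261536824145478723) (split 3 8 (red 11 9335245012730947) (split 4 8 (red 12 298727840407390308)
  (split 4 9 (red 11 10497464255678564) (split 5 9 (red 12 335918856181714053) (blue 11 10282743411813381)))))))))))

descent11-16 : Tree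
descent11-16 =
  split 0 5 (red 12 187154791590705632) (split 0 6 (red 11 7010806495885792) (split 1 6 (red 12 224345807868345345)
  (split 1 7 (red 11 8173025754561537) (split 2 7 (red 12 261536824145969186) (split 2 8 (red 11 9335245013221410)
  (split 3 8 (red 12 298727840423085123) (split 3 9 (red 11 10497464271373379) (split 4 9 (red 12 335918856683948132)
  (split 4 10 (red 11 11659683513272420) (split 5 10 (red 12 373109872424717445) (blue 11
  11409743905069061)))))))))))

descent11-17 : Tree
descent11-17 =
  split 0 10 (red 11 11584701642934304) (split 0 11 (red 12 407901468851537952) (split 1 8 (red 11 9335245013237761)
  (split 1 12 (red 12 445092485129178177) (split 2 8 (red 12 298727840423608354) (split 2 9 (red 11
  10497464271896610) (split 3 9 (red 12 335918856700691523) (split 3 14 (red 12 519474517684458627) (split 4 10 (red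
  12 373109872960505956) (split 4 14 (red 11 16233578677639332) (split 5 11 (red 12 410300888667720837) (split 5 12
  (red 11 13984121459117189) (blue 12 433755451067531621))))))))))))

descent11-18 : Tree
descent11-18 =
  split 0 8 (red 11 9335245013238304) (split 0 11 (red 12 407901468851537952) (split 1 8 (red 12 298727840423625729)
  (split 1 12 (red 12 445092485129178177) (split 2 10 (red 11 11659683530571810) (split 2 13 (red 12
  482283501406818402) (split 3 10 (red 12 373109872978297923) (split 3 14 (red 12 519474517684458627) (split 4 11
  (red 12 410300889237063780) (split 4 14 (red 11 16233578677639332) (split 5 12 (red 12 447491904910724229) (split 5
  13 (red 11 15146340683156613) (blue 12 470981789016655237))))))))))))

descent11-19 : Tree
descent11-19 =
  split 0 9 (red 11 10497464271914560) (split 0 10 (red 11 11584701642934304) (split 1 9 (red 12 335918856701265921)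
  (split 1 11 (red 11 12746920901610561) (split 2 10 (red 12 373109872978886690) (split 2 13 (red 12
  482283501406818402) (split 3 11 (red 12 410300889255904323) (split 3 12 (red 11 13984122047300675) (split 4 12 (red
  12 447491905513621604) (split 4 14 (red 11 16233578677639332) (split 5 13 (red 12 484682921153727621) (split 5 14
  (red 11 16308559907196037) (blue 12 509332648225999269))))))))))))

descent11-20 : Tree
descent11-20 =
  split 0 10 (red 11 11584701642934304) (split 0 11 (red 12 407901468851537952) (split 1 10 (red 12
  373109872978906113) (split 1 12 (red 12 445092485129178177) (split 2 11 (red 12 410300889256525858) (split 2 13
  (red 12 482283501406818402) (split 3 12 (red 12 447491905533510723) (split 3 14 (red 12 519474517684458627) (split
  4 13 (red 12 484682921790179428) (split 4 15 (red 12 556665533962098852) (split 5 14 (red 12 521873937396731013)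
  (split 5 15 (red 11 17470779131235461) (blue 12 545395529066352069))))))))))))

descent11-21 : Tree
descent11-21 =
  split 0 10 (red 11 11584701642934304) (split 0 11 (red 12 407901468851537952) (split 1 11 (red 12
  410300889256546305) (split 1 12 (red 11 13984122047942657) (split 2 12 (red 12 447491905534165026) (split 2 13 (red
  11 15146341306597410) (split 3 13 (red 12 484682921811117123) (split 3 14 (red 11 16308560564585539) (split 4 14
  (red 12 521873938066737252) (split 4 15 (red 11 17470779801241700) (split 5 15 (red 12 559064953639734405) (split 5
  16 (red 11 18632998355274885) (split 6 16 (red 12 596255947368796326) (split 6 17 (red 11 19795195065372838) (split
  7 17 (red 12 633446242091930823) (split 7 18 (red 11 20956692769543367) (split 8 18 (red 12 670614168625387752)
  (split 8 19 (red 11 22095822284036328) (split 9 19 (red 12 707066313089162505) (split 9 20 (red 11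
  22519169728847113) (split 10 15 (split 10 20 (red 12 720613431323107626) (split 11 16 (split 12 17 (split 12 20
  (red 11 23206894091352492) (split 13 18 (split 14 17 (split 14 19 (split 15 20 (split 16 18 (red 11
  20877989156202864) (split 16 19 (split 18 20 (red 11 23204693054697906) (blue 11 22942859997451794)) (blue 12
  695397206896819376))) (blue 12 731847081401104527)) (blue 12 695394936937329774)) (blue 12 621013626643362926))
  (blue 12 658204642214195277))) (blue 12 621013626641198124)) (blue 12 583822610364246027))) (blue 11
  17044746371378186)))))))))))))))))))))

-- Long cycles in two-coloured complete graphs on 17 and 21 vertices

module NoGrey4 {V : Set} (_≟_ : DecidableEquality V) (W : List V) (uW : Unique W)
  (lab : V → ℕ) (χ : V → V → Bool) (χ-sym : ∀ x y → χ x y ≡ χ y x)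
  (inj : ∀ {x y} → x ∈ W → y ∈ W → lab x ≡ lab y → x ≡ y)
  (noOdd : ∀ c → ¬ HasCycle (Adj W lab χ c) 9) (size : length W ≡ 17) where

  private
    open NoBip _≟_ W uW lab χ χ-sym inj 2 noOdd (≤-reflexive (≡-sym size)) using (bip-exact)

    odd? : ℕ → Bool
    odd? m = m ≡ᵇ 9

    cycle-odd : ∀ c m → odd? m ≡ true → ¬ HasCycle (Adj W lab χ c) m
    cycle-odd c m e with refl ← ≡ᵇ-sound {m} {9} e = noOdd c

  -- A red K_{5,5} contains a 10-cycle but no 9-cycle, so length 10 cannot be reduced by shortening
  -- cycles alone. Instead all chords of span 3 and 5 are forced to be red; even and odd positions
  -- are then completely joined, and the leaf takes the parts 0, 2, 4, 6 and 1, 3, 5, 7, 9.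
  noEven : ∀ c → ¬ HasCycle (Adj W lab χ c) 10
  noEven c (vs , x , z , p , r , u , len) = OnRing.refute vs ring len _ (bip true 200768 9671777)
    (Allₚ.++⁺ (chord 3 chord10-3 (<ᵇ-sound refl) refl vs ring len)
      (Allₚ.++⁺ (chord 5 chord10-5 (<ᵇ-sound refl) refl vs ring len) (OnRing.ring-valid vs ring len))) refl
    where
    open Rings W lab χ χ-sym inj 4 bip-exact odd? cycle-odd c 10 (s≤s (s≤s z≤n))
    ring : Ring (Adj W lab χ c) vs
    ring = x , z , p , r , u

  private
    both? : ℕ → Bool
    both? m = (m ≡ᵇ 9) ∨ (m ≡ᵇ 10)

    cycle-both : ∀ c m → both? m ≡ true → ¬ HasCycle (Adj W lab χ c) m
    cycle-both c m e with m ≡ᵇ 9 in e₁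
    ... | true with refl ← ≡ᵇ-sound {m} {9} e₁ = noOdd c
    cycle-both c m e | false with refl ← ≡ᵇ-sound {m} {10} e = noEven c

  -- The certificate uses no vertices beyond the L of the cycle itself: it only branches on chords,
  -- and every cycle of length 9 or 10 ends a branch.
  descend : ∀ c L → 2 ≤ L → ∀ t → Checker.check 4 L 1 both? (ringEdges L) t ≡ true → ¬ HasCycle (Adj W lab χ c) L
  descend c L h t ok (vs , x , z , p , r , u , len) = OnRing.refute vs ring len _ t (OnRing.ring-valid vs ring len) ok
    where
    open Rings W lab χ χ-sym inj 4 bip-exact both? cycle-both c L h
    ring : Ring (Adj W lab χ c) vs
    ring = x , z , p , r , u

  noLong : ∀ c i → i ≤ 8 → ¬ HasCycle (Adj W lab χ c) (9 + i)
  noLong c 0 _ = noOdd c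
  noLong c 1 _ = noEven c
  noLong c 2 _ = descend c 11 (s≤s (s≤s z≤n)) descent9-11 refl
  noLong c 3 _ = descend c 12 (s≤s (s≤s z≤n)) descent9-12 refl
  noLong c 4 _ = descend c 13 (s≤s (s≤s z≤n)) descent9-13 refl
  noLong c 5 _ = descend c 14 (s≤s (s≤s z≤n)) descent9-14 refl
  noLong c 6 _ = descend c 15 (s≤s (s≤s z≤n)) descent9-15 refl
  noLong c 7 _ = descend c 16 (s≤s (s≤s z≤n)) descent9-16 refl
  noLong c 8 _ = descend c 17 (s≤s (s≤s z≤n)) descent9-17 refl
  noLong c (suc (suc (suc (suc (suc (suc (suc (suc (suc _))))))))) h = contradiction h λ { (s≤s (s≤s (s≤s (s≤s (s≤s (s≤s (s≤s (s≤s ())))))))) }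

  impossible : ⊥
  impossible = NoGrey.impossible _≟_ W uW lab χ χ-sym inj 2 noOdd size long
    where
    long : ∀ c L → 9 ≤ L → L ≤ length W → ¬ HasCycle (Adj W lab χ c) L
    long c L h h′ = subst (λ k → ¬ HasCycle (Adj W lab χ c) k) (m+[n∸m]≡n h)
      (noLong c (L ∸ 9) (≤-trans (∸-monoˡ-≤ 9 (≤-trans h′ (≤-reflexive size))) ≤-refl))

module NoGrey5 {V : Set} (_≟_ : DecidableEquality V) (W : List V) (uW : Unique W)
  (lab : V → ℕ) (χ : V → V → Bool) (χ-sym : ∀ x y → χ x y ≡ χ y x)
  (inj : ∀ {x y} → x ∈ W → y ∈ W → lab x ≡ lab y → x ≡ y)
  (noOdd : ∀ c → ¬ HasCycle (Adj W lab χ c) 11) (size : length W ≡ 21) where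

  private
    open NoBip _≟_ W uW lab χ χ-sym inj 3 noOdd (≤-reflexive (≡-sym size)) using (bip-exact)

    odd? : ℕ → Bool
    odd? m = m ≡ᵇ 11

    cycle-odd : ∀ c m → odd? m ≡ true → ¬ HasCycle (Adj W lab χ c) m
    cycle-odd c m e with refl ← ≡ᵇ-sound {m} {11} e = noOdd c

  -- As for 10-cycles: chords of span 3 and 5 complete the 12-cycle to K_{6,6}, whose parts contain
  -- 0, 2, 4, 6, 8 and 1, 3, 5, 7, 9, 11.
  noEven : ∀ c → ¬ HasCycle (Adj W lab χ c) 12
  noEven c (vs , x , z , p , r , u , len) = OnRing.refute vs ring len _ (bip true 8589376 378770529)
    (Allₚ.++⁺ (chord 3 chord12-3 (<ᵇ-sound refl) refl vs ring len)
      (Allₚ.++⁺ (chord 5 chord12-5 (<ᵇ-sound refl) refl vs ring len) (OnRing.ring-valid vs ring len))) refl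
    where
    open Rings W lab χ χ-sym inj 5 bip-exact odd? cycle-odd c 12 (s≤s (s≤s z≤n))
    ring : Ring (Adj W lab χ c) vs
    ring = x , z , p , r , u

  private
    both? : ℕ → Bool
    both? m = (m ≡ᵇ 11) ∨ (m ≡ᵇ 12)

    cycle-both : ∀ c m → both? m ≡ true → ¬ HasCycle (Adj W lab χ c) m
    cycle-both c m e with m ≡ᵇ 11 in e₁
    ... | true with refl ← ≡ᵇ-sound {m} {11} e₁ = noOdd c
    cycle-both c m e | false with refl ← ≡ᵇ-sound {m} {12} e = noEven c

  descend : ∀ c L → 2 ≤ L → ∀ t → Checker.check 5 L 1 both? (ringEdges L) t ≡ true → ¬ HasCycle (Adj W lab χ c) L
  descend c L h t ok (vs , x , z , p , r , u , len) = OnRing.refute vs ring len _ t (OnRing.ring-valid vs ring len) ok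
    where
    open Rings W lab χ χ-sym inj 5 bip-exact both? cycle-both c L h
    ring : Ring (Adj W lab χ c) vs
    ring = x , z , p , r , u

  noLong : ∀ c i → i ≤ 10 → ¬ HasCycle (Adj W lab χ c) (11 + i)
  noLong c 0 _ = noOdd c
  noLong c 1 _ = noEven c
  noLong c 2 _ = descend c 13 (s≤s (s≤s z≤n)) descent11-13 refl
  noLong c 3 _ = descend c 14 (s≤s (s≤s z≤n)) descent11-14 refl
  noLong c 4 _ = descend c 15 (s≤s (s≤s z≤n)) descent11-15 refl
  noLong c 5 _ = descend c 16 (s≤s (s≤s z≤n)) descent11-16 refl
  noLong c 6 _ = descend c 17 (s≤s (s≤s z≤n)) descent11-17 refl
  noLong c 7 _ = descend c 18 (s≤s (s≤s z≤n)) descent11-18 refl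
  noLong c 8 _ = descend c 19 (s≤s (s≤s z≤n)) descent11-19 refl
  noLong c 9 _ = descend c 20 (s≤s (s≤s z≤n)) descent11-20 refl
  noLong c 10 _ = descend c 21 (s≤s (s≤s z≤n)) descent11-21 refl
  noLong c (suc (suc (suc (suc (suc (suc (suc (suc (suc (suc (suc _))))))))))) h = contradiction h λ { (s≤s (s≤s (s≤s (s≤s (s≤s (s≤s (s≤s (s≤s (s≤s (s≤s ())))))))))) }

  impossible : ⊥
  impossible = NoGrey.impossible _≟_ W uW lab χ χ-sym inj 3 noOdd size long
    where
    long : ∀ c L → 11 ≤ L → L ≤ length W → ¬ HasCycle (Adj W lab χ c) L
    long c L h h′ = subst (λ k → ¬ HasCycle (Adj W lab χ c) k) (m+[n∸m]≡n h)
      (noLong c (L ∸ 11) (≤-trans (∸-monoˡ-≤ 11 (≤-trans h′ (≤-reflexive size))) ≤-refl))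

-- Two-colourings with uncoloured classes

module _ {V : Set} (lab : V → ℕ) where

  same? : ∀ x y → Dec (lab x ≡ lab y)
  same? x y = lab x Nat.≟ lab y

  Apart : List V → List V → Set
  Apart b b′ = ∀ {x y} → x ∈ b → y ∈ b′ → lab x ≢ lab y

  Apart-sym : Symmetric Apart
  Apart-sym h p q e = h q p (≡-sym e)

  -- The number is fuel, for which the length of the list suffices.
  classes : ℕ → List V → List (List V)
  classes zero _ = []
  classes (suc k) [] = []
  classes (suc k) (x ∷ l) = (x ∷ filter (same? x) l) ∷ classes k (filter (¬? ∘ same? x) l)

  -- The last field makes the block a whole class. So a vertex of `W` outside it has another label,
  -- and homogeneity lets it see the block in one colour.
  data Block (W : List V) : List V → Set where
    block : ∀ {b} → 0 < length b → Unique b → b ⊆ W → Alike lab b →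
      (∀ {x y} → x ∈ b → y ∈ W → lab x ≡ lab y → y ∈ b) → Block W b

  classes-blocks : ∀ k W → Unique W → All (Block W) (classes k W)
  classes-blocks zero W u = []
  classes-blocks (suc k) [] u = []
  classes-blocks (suc k) (x ∷ l) u@(_ ∷ u′) =
    block (s≤s z≤n) (Unique-cons (λ p → head∉ u (proj₁ (∈-filter⁻ (same? x) p))) (Uniqueₚ.filter⁺ (same? x) u′))
      (λ { (here e) → here e ; (there p) → there (proj₁ (∈-filter⁻ (same? x) p)) })
      (λ p q → ≡-trans (≡-sym (val p)) (val q))
      (λ { p (here refl) e → here refl ; p (there q) e → there (∈-filter⁺ (same? x) q (≡-trans (val p) e)) }) ∷
    All.map lift (classes-blocks k _ (Uniqueₚ.filter⁺ _ u′))
    where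
    val : ∀ {y} → y ∈ x ∷ filter (same? x) l → lab x ≡ lab y
    val (here refl) = refl
    val (there p) = proj₂ (∈-filter⁻ (same? x) {xs = l} p)
    lift : ∀ {b} → Block (filter (¬? ∘ same? x) l) b → Block (x ∷ l) b
    lift (block h ub sub al full) = block h ub (λ p → there (proj₁ (∈-filter⁻ _ (sub p)))) al
      λ { {y} p (here refl) e → ⊥-elim (proj₂ (∈-filter⁻ (¬? ∘ same? x) {xs = l} (sub p)) (≡-sym e))
        ; {y} p (there q) e → full p (∈-filter⁺ (¬? ∘ same? x) q λ e′ → proj₂ (∈-filter⁻ (¬? ∘ same? x) {xs = l} (sub p)) (≡-trans e′ (≡-sym e))) e }

  classes-∈ : ∀ k W → length W ≤ k → ∀ {x} → x ∈ W → ∃ λ b → b ∈ classes k W × x ∈ b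
  classes-∈ (suc k) (x ∷ l) h (here refl) = _ , here refl , here refl
  classes-∈ (suc k) (x ∷ l) (s≤s h) {y} (there p) with same? x y
  ... | yes e = _ , here refl , there (∈-filter⁺ (same? x) p e)
  ... | no ne with b , q , r ← classes-∈ k _ (≤-trans (length-filter _ l) h) (∈-filter⁺ (¬? ∘ same? x) p ne) =
    b , there q , r

  classes-apart : ∀ k W → Unique W → AllPairs Apart (classes k W)
  classes-apart zero W u = []
  classes-apart (suc k) [] u = []
  classes-apart (suc k) (x ∷ l) (_ ∷ u) =
    All.tabulate (λ b∈ → λ p q e → far (All.lookup (classes-blocks k _ (Uniqueₚ.filter⁺ _ u)) b∈) p q e) ∷
    classes-apart k _ (Uniqueₚ.filter⁺ _ u)
    where
    far : ∀ {b} → Block (filter (¬? ∘ same? x) l) b → Apart (x ∷ filter (same? x) l) b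
    far (block _ _ sub _ _) (here refl) q e = proj₂ (∈-filter⁻ (¬? ∘ same? x) {xs = l} (sub q)) e
    far (block _ _ sub _ _) (there p) q e =
      proj₂ (∈-filter⁻ (¬? ∘ same? x) {xs = l} (sub q)) (≡-trans (proj₂ (∈-filter⁻ (same? x) {xs = l} p)) e)

  classes-length : ∀ k W → length W ≤ k → sum (map length (classes k W)) ≡ length W
  classes-length zero [] h = refl
  classes-length (suc k) [] h = refl
  classes-length (suc k) (x ∷ l) (s≤s h) = cong suc (≡-trans
    (cong (length (filter (same? x) l) +_) (classes-length k _ (≤-trans (length-filter _ l) h)))
    (length-filter-split (same? x) l))

  alike-or-apart : ∀ b → Unique b → Alike lab b ⊎ ∃₂ λ x y → x ∈ b × y ∈ b × lab x ≢ lab y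
  alike-or-apart [] u = inj₁ λ ()
  alike-or-apart (x ∷ b) u with any? (λ y → ¬? (same? x y)) b
  ... | yes some with y , p , ne ← find some = inj₂ (x , y , here refl , there p , ne)
  ... | no none = inj₁ λ p q → ≡-trans (≡-sym (val p)) (val q)
    where
    val : ∀ {y} → y ∈ x ∷ b → lab x ≡ lab y
    val (here refl) = refl
    val {y} (there p) = decidable-stable (same? x y) λ ne → none (lose p ne)

module Grey {V : Set} (_≟_ : DecidableEquality V) (W : List V) (uW : Unique W)
  (lab : V → ℕ) (χ : V → V → Bool) (χ-sym : ∀ x y → χ x y ≡ χ y x)
  (homog : ∀ {x x′ y} → x ∈ W → x′ ∈ W → y ∈ W → lab x ≡ lab x′ → lab x ≢ lab y → χ x y ≡ χ x′ y) (j : ℕ)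
  (classBound : ClassBound lab (suc j) W)
  (noOdd : ∀ c → ¬ HasCycle (Adj W lab χ c) (2 * (2 + j) + 1)) where

  open import Data.List.Membership.DecPropositional _≟_ using (_∈?_)

  private
    n = 2 + j
    A[_] = Adj W lab χ
    asym : ∀ c → Symmetric A[ c ]
    asym c = Adj-sym W lab χ χ-sym c
    airr : ∀ c {v} → ¬ A[ c ] v v
    airr c = Adj-irrefl W lab χ c
    module B (c : Bool) = Bipartite _≟_ {R = A[ c ]} (asym c) (airr c) j

  homog₂ : ∀ {x x′ y y′} → x ∈ W → x′ ∈ W → y ∈ W → y′ ∈ W → lab x ≡ lab x′ → lab y ≡ lab y′ → lab x ≢ lab y →
    χ x y ≡ χ x′ y′
  homog₂ {x} {x′} {y} {y′} p p′ q q′ e e′ ne = ≡-trans (homog p p′ q e ne) (≡-trans (χ-sym x′ y)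
    (≡-trans (homog q q′ p′ e′ λ e″ → ne (≡-trans e (≡-sym e″))) (χ-sym y′ x′)))

  -- A set carrying no edge of colour c is complete multipartite in the other colour.
  one-colour-bound : ∀ c X → Unique X → X ⊆ W → (∀ {x y} → x ∈ X → y ∈ X → ¬ A[ c ] x y) → length X ≤ 2 * n
  one-colour-bound c X uX X⊆ none with length X ≤? 2 * n
  ... | yes h = h
  ... | no h = ⊥-elim (noOdd (not c) (Multipartite.multipartite-cycle lab (suc j) uX
    (≤-trans (≤-reflexive (+-comm (2 * n) 1)) (≰⇒> h))
    (λ zs uz z⊆ al → ≤-trans (classBound zs uz (λ m → X⊆ (z⊆ m)) al) (n≤1+n _))
    (λ p q ne → X⊆ p , X⊆ q , ne , ≢⇒≡not λ e → none p q (X⊆ p , X⊆ q , ne , e))))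

  module Core (big : 7 * n + 2 ≤ length W) where

    closure : List V → List V
    closure A = filter (λ w → any? (same? lab w) A) W

    closure-∈ : ∀ {A w} → w ∈ closure A → w ∈ W × ∃ λ a → a ∈ A × lab w ≡ lab a
    closure-∈ {A} p with w∈ , some ← ∈-filter⁻ (λ w → any? (same? lab w) A) {xs = W} p with a , q , e ← find some = w∈ , a , q , e

    closure-⊇ : ∀ {A} → A ⊆ W → A ⊆ closure A
    closure-⊇ A⊆ p = ∈-filter⁺ _ (A⊆ p) (lose p refl)

    -- Both parts are enlarged to unions of classes, which stay completely joined, so `A′` and `B′`
    -- have at most 2n vertices each. Outside, at most n vertices see `B′` entirely in the other
    -- colour; the rest sees `A′` entirely in the other colour and has at most 2n vertices. These
    -- are at most 7n vertices in all.
    noBip : ∀ c A B → Unique A → Unique B → (∀ {x y} → x ∈ A → y ∈ B → A[ c ] x y) →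
      length A ≡ n → length B ≡ suc n → ⊥
    noBip c A B uA uB AB lA lB = <⇒≱ gap (≤-trans big (≤-trans hO (+-mono-≤ hO′ (+-mono-≤ hA′≤ hB′≤))))
      where
      A⊆W : A ⊆ W
      A⊆W p with b , q ← nonempty (≤-trans (s≤s z≤n) (≤-reflexive (≡-sym lB))) = proj₁ (AB p q)
      B⊆W : B ⊆ W
      B⊆W q with a , p ← nonempty (≤-trans (s≤s z≤n) (≤-reflexive (≡-sym lA))) = proj₁ (proj₂ (AB p q))
      A′ = closure A
      B′ = closure B
      uA′ : Unique A′
      uA′ = Uniqueₚ.filter⁺ _ uW
      uB′ : Unique B′
      uB′ = Uniqueₚ.filter⁺ _ uW
      hA : n ≤ length A′
      hA = ≤-trans (≤-reflexive (≡-sym lA)) (length-⊆ uA (closure-⊇ A⊆W))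
      hB : suc n ≤ length B′
      hB = ≤-trans (≤-reflexive (≡-sym lB)) (length-⊆ uB (closure-⊇ B⊆W))
      A′B′ : ∀ {x y} → x ∈ A′ → y ∈ B′ → A[ c ] x y
      A′B′ {x} {y} p q with x∈ , a , a∈ , ea ← closure-∈ p | y∈ , b , b∈ , eb ← closure-∈ q
        with _ , _ , ne , e ← AB a∈ b∈ = x∈ , y∈ , (λ e′ → ne (≡-trans (≡-sym ea) (≡-trans e′ eb))) ,
          ≡-trans (≡-sym (homog₂ (A⊆W a∈) x∈ (B⊆W b∈) y∈ (≡-sym ea) (≡-sym eb) ne)) e
      innerB : ∀ {x y} → x ∈ B′ → y ∈ B′ → ¬ A[ c ] x y
      innerB p q r = noOdd c (B.inner-edge c uA′ uB′ A′B′ hA hB p q r)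
      hB′≤ : length B′ ≤ 2 * n
      hB′≤ = one-colour-bound c B′ uB′ (λ p → proj₁ (closure-∈ p)) innerB
      hA′≤ : length A′ ≤ 2 * n
      hA′≤ with suc n ≤? length A′
      ... | no h = ≤-trans (≤-pred (≰⇒> h)) (m≤m+n n _)
      ... | yes h = one-colour-bound c A′ uA′ (λ p → proj₁ (closure-∈ p)) λ p q r →
        noOdd c (B.inner-edge c uB′ uA′ (λ p q → asym c (A′B′ q p)) (≤-trans (n≤1+n n) hB) h p q r)
      out? : ∀ v → Dec (v ∉ A′ ++ B′)
      out? v = ¬? (v ∈? (A′ ++ B′))
      O = filter out? W
      hO : length W ≤ length O + (length A′ + length B′)
      hO = ≤-trans (length-⊆ uW sub) (≤-reflexive (≡-trans (length-++ O) (cong (length O +_) (length-++ A′))))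
        where
        sub : W ⊆ O ++ (A′ ++ B′)
        sub {v} p with v ∈? (A′ ++ B′)
        ... | yes q = ∈-++⁺ʳ O q
        ... | no q = ∈-++⁺ˡ (∈-filter⁺ out? p q)
      uO : Unique O
      uO = Uniqueₚ.filter⁺ out? uW
      O⊆ : ∀ {v} → v ∈ O → v ∈ W × v ∉ A′ × v ∉ B′
      O⊆ p with q , r ← ∈-filter⁻ out? {xs = W} p = q , (λ s → r (∈-++⁺ˡ s)) , (λ s → r (∈-++⁺ʳ A′ s))
      apartA : ∀ {v a} → v ∈ O → a ∈ A′ → lab v ≢ lab a
      apartA p q e with v∈ , v∉ , _ ← O⊆ p | _ , a , a∈ , ea ← closure-∈ q =
        v∉ (∈-filter⁺ _ v∈ (lose a∈ (≡-trans e ea)))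
      apartB : ∀ {v b} → v ∈ O → b ∈ B′ → lab v ≢ lab b
      apartB p q e with v∈ , _ , v∉ ← O⊆ p | _ , b , b∈ , eb ← closure-∈ q =
        v∉ (∈-filter⁺ _ v∈ (lose b∈ (≡-trans e eb)))
      blueB? : ∀ v → Dec (All (λ b → χ v b ≡ not c) B′)
      blueB? v = All.all? (λ b → χ v b Boolₚ.≟ not c) B′
      D₁ = filter blueB? O
      D = filter (¬? ∘ blueB?) O
      D₁⊆ : ∀ {v} → v ∈ D₁ → v ∈ O × All (λ b → χ v b ≡ not c) B′
      D₁⊆ = ∈-filter⁻ blueB? {xs = O}
      D⊆ : ∀ {v} → v ∈ D → v ∈ O × ¬ All (λ b → χ v b ≡ not c) B′
      D⊆ = ∈-filter⁻ (¬? ∘ blueB?) {xs = O}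
      uD : Unique D
      uD = Uniqueₚ.filter⁺ _ uO
      D₁B : ∀ {v b} → v ∈ D₁ → b ∈ B′ → A[ not c ] v b
      D₁B p q with r , s ← D₁⊆ p = proj₁ (O⊆ r) , proj₁ (closure-∈ q) , apartB r q , All.lookup s q
      D₁≤ : length D₁ ≤ n
      D₁≤ with length D₁ ≤? n
      ... | yes h = h
      -- `B′` is too large to be part of one class, so it contains an edge between two classes; this
      -- has the colour in which `B′` is joined to `D₁`.
      ... | no h with alike-or-apart lab B′ uB′
      ...   | inj₁ al = ⊥-elim (<⇒≱ (≤-trans (n≤1+n _) hB) (classBound B′ uB′ (λ p → proj₁ (closure-∈ p)) al))
      ...   | inj₂ (b , b′ , p , q , ne) = ⊥-elim (noOdd (not c) (B.inner-edge (not c) (Uniqueₚ.filter⁺ blueB? uO) uB′ D₁B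
        (<⇒≤ (≰⇒> h)) hB p q (proj₁ (closure-∈ p) , proj₁ (closure-∈ q) , ne ,
          ≢⇒≡not λ e → innerB p q (proj₁ (closure-∈ p) , proj₁ (closure-∈ q) , ne , e))))
      AD : ∀ {v a} → v ∈ D → a ∈ A′ → A[ not c ] v a
      AD {v} {a} p q with r , s ← D⊆ p with w , v∉A , v∉B ← O⊆ r =
        w , proj₁ (closure-∈ q) , apartA r q , ≢⇒≡not λ e → s (All.tabulate λ {b} b∈ → ≢⇒≡not λ e′ →
        noOdd c (B.apex c uA′ uB′ A′B′ hA (≤-trans (n≤1+n n) hB) v∉A v∉B q b∈
          (w , proj₁ (closure-∈ q) , apartA r q , e) (w , proj₁ (closure-∈ b∈) , apartB r b∈ , e′)))
      D≤ : length D ≤ 2 * n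
      D≤ with suc n ≤? length D
      ... | no h = ≤-trans (≤-pred (≰⇒> h)) (m≤m+n n _)
      ... | yes h = one-colour-bound (not c) D uD (λ p → proj₁ (O⊆ (proj₁ (D⊆ p)))) λ p q r →
        noOdd (not c) (B.inner-edge (not c) uA′ uD (λ p q → asym (not c) (AD q p)) hA h p q r)
      hO′ : length O ≤ n + 2 * n
      hO′ = ≤-trans (≤-reflexive (≡-sym (length-filter-split blueB? O))) (+-mono-≤ D₁≤ D≤)
      gap : n + 2 * n + (2 * n + 2 * n) < 7 * n + 2
      gap = ≤-trans (m≤m+n _ 1) (≤-reflexive (arith n))
        where
        arith : ∀ n → suc (n + 2 * n + (2 * n + 2 * n)) + 1 ≡ 7 * n + 2
        arith = solve-∀

-- Blow-ups and the sizes of classes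

module _ {V : Set} where

  ∈-tail : {v u : V} {vs : List V} → v ∈ u ∷ vs → v ≢ u → v ∈ vs
  ∈-tail (here e) ne = contradiction e ne
  ∈-tail (there p) _ = p

  ↭-complete : {us vs : List V} → Unique us → us ⊆ vs → ∃ λ rest → vs ↭ us ++ rest
  ↭-complete {[]} {vs} _ _ = vs , ↭-refl
  ↭-complete {u ∷ us} {vs} uu@(_ ∷ uu′) s with zs , p ← ↭-head (s (here refl))
    with rest , q ← ↭-complete uu′ (λ {v} m → ∈-tail (∈-resp-↭ p (s (there m))) λ { refl → head∉ uu m }) = rest , ↭-trans p (prep u q)

  nth-++ˡ : (d : V) (xs ys : List V) {i : ℕ} → i < length xs → nth d (xs ++ ys) i ≡ nth d xs i
  nth-++ˡ d (x ∷ xs) ys {zero} _ = refl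
  nth-++ˡ d (x ∷ xs) ys {suc i} (s≤s h) = nth-++ˡ d xs ys h

  AllPairs-resp-↭ : {S : V → V → Set} → Symmetric S → {xs ys : List V} → xs ↭ ys → AllPairs S xs → AllPairs S ys
  AllPairs-resp-↭ sy refl a = a
  AllPairs-resp-↭ sy (prep x p) (h ∷ a) = All-resp-↭ p h ∷ AllPairs-resp-↭ sy p a
  AllPairs-resp-↭ sy (swap x y p) ((h ∷ hs) ∷ hy ∷ a) = (sy h ∷ All-resp-↭ p hy) ∷ All-resp-↭ p hs ∷ AllPairs-resp-↭ sy p a
  AllPairs-resp-↭ sy (trans p q) a = AllPairs-resp-↭ sy q (AllPairs-resp-↭ sy p a)

tally : ℕ → List ℕ → ℕ
tally k ls = length (filter (k ≤?_) ls)

tallies : ℕ → List ℕ → ℕ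
tallies zero ls = 0
tallies (suc g) ls = tally (suc g) ls + tallies g ls

-- Summation by layers: a number l ≤ g is counted once at each of the levels 1, ..., l.
sum-tallies : ∀ g ls → All (_≤ g) ls → sum ls ≡ tallies g ls
sum-tallies g ls h = ≡-trans (cong sum (capped ls h)) (by-level g)
  where
  capped : ∀ ls → All (_≤ g) ls → ls ≡ map (Nat._⊓ g) ls
  capped [] [] = refl
  capped (l ∷ ls) (p ∷ ps) = cong₂ _∷_ (≡-sym (m≤n⇒m⊓n≡m p)) (capped ls ps)
  level : ∀ g ls → sum (map (Nat._⊓ suc g) ls) ≡ tally (suc g) ls + sum (map (Nat._⊓ g) ls)
  level g [] = refl
  level g (l ∷ ls) = ≡-trans (cong (l Nat.⊓ suc g +_) (level g ls)) (element (suc g ≤? l))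
    where
    t = tally (suc g) ls
    s = sum (map (Nat._⊓ g) ls)
    arith : ∀ a b c → suc a + (b + c) ≡ suc b + (a + c)
    arith = solve-∀
    arith′ : ∀ a b c → a + (b + c) ≡ b + (a + c)
    arith′ = solve-∀
    element : Dec (suc g ≤ l) → l Nat.⊓ suc g + (t + s) ≡ tally (suc g) (l ∷ ls) + (l Nat.⊓ g + s)
    element (yes p) = ≡-trans (cong (_+ (t + s)) (m≥n⇒m⊓n≡n p)) (≡-trans (arith g t s)
      (cong₂ _+_ (cong length (≡-sym (filter-accept (suc g ≤?_) p)))
        (cong (_+ s) (≡-sym (m≥n⇒m⊓n≡n (≤-trans (n≤1+n g) p))))))
    element (no p) = ≡-trans (cong (_+ (t + s)) (m≤n⇒m⊓n≡m (≤-trans (≤-pred (≰⇒> p)) (n≤1+n g)))) (≡-trans (arith′ l t s)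
      (cong₂ _+_ (cong length (≡-sym (filter-reject (suc g ≤?_) p)))
        (cong (_+ s) (≡-sym (m≤n⇒m⊓n≡m (≤-pred (≰⇒> p)))))))
  by-level : ∀ g → sum (map (Nat._⊓ g) ls) ≡ tallies g ls
  by-level zero = none ls
    where
    none : ∀ ls → sum (map (Nat._⊓ 0) ls) ≡ 0
    none [] = refl
    none (l ∷ ls) rewrite ⊓-zeroʳ l = none ls
  by-level (suc g) = ≡-trans (level g ls) (cong (tally (suc g) ls +_) (by-level g))

filter-map : ∀ {V U : Set} {P : U → Set} (P? : ∀ u → Dec (P u)) (f : V → U) (xs : List V) →
  length (filter P? (map f xs)) ≡ length (filter (λ v → P? (f v)) xs)
filter-map P? f [] = refl
filter-map P? f (x ∷ xs) with P? (f x)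
... | yes _ = cong suc (filter-map P? f xs)
... | no _ = filter-map P? f xs

module BlowUp {V : Set} (_≟_ : DecidableEquality V) (W : List V) (uW : Unique W)
  (lab : V → ℕ) (χ : V → V → Bool) (χ-sym : ∀ x y → χ x y ≡ χ y x)
  (homog : ∀ {x x′ y} → x ∈ W → x′ ∈ W → y ∈ W → lab x ≡ lab x′ → lab x ≢ lab y → χ x y ≡ χ x′ y) (j : ℕ)
  (classBound : ClassBound lab (suc j) W)
  (noOdd : ∀ c → ¬ HasCycle (Adj W lab χ c) (2 * (2 + j) + 1))
  (big : 7 * (2 + j) + 2 ≤ length W) where

  private
    n = 2 + j
    A[_] = Adj W lab χ
    module G = Grey _≟_ W uW lab χ χ-sym homog j classBound noOdd

    odd? : ℕ → Bool
    odd? m = m ≡ᵇ (2 * n + 1)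

    cycle-odd : ∀ c m → odd? m ≡ true → ¬ HasCycle A[ c ] m
    cycle-odd c m e h = noOdd c (subst (HasCycle A[ c ]) (≡ᵇ-sound {m} e) h)

  default : V
  default = proj₁ (nonempty {xs = W} (≤-trans (≤-trans (s≤s z≤n) (m≤n+m 2 (7 * n))) big))

  top : List V → V
  top b = nth default b 0

  -- A part of a class with at least `c` vertices, of which the blow-up uses the first `c`.
  Wide : ℕ → List V → Set
  Wide c b = c ≤ length b × Unique b × b ⊆ W × Alike lab b

  apart-injective : ∀ {bs} → AllPairs (Apart lab) bs → ∀ {b b′ x y} → b ∈ bs → b′ ∈ bs → x ∈ b → y ∈ b′ →
    lab x ≡ lab y → b ≡ b′
  apart-injective (h ∷ a) (here refl) (here refl) _ _ _ = refl
  apart-injective (h ∷ a) (here refl) (there q) r s e = ⊥-elim (All.lookup h q r s e)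
  apart-injective (h ∷ a) (there p) (here refl) r s e = ⊥-elim (All.lookup h p s r (≡-sym e))
  apart-injective (h ∷ a) (there p) (there q) r s e = apart-injective a p q r s e

  apart-unique : ∀ {c bs} → All (Wide (suc c)) bs → AllPairs (Apart lab) bs → Unique bs
  apart-unique [] [] = []
  apart-unique {bs = b ∷ bs} ((l , _) ∷ w) (h ∷ a) = Unique-cons
    (λ p → let x , x∈ = nonempty (≤-trans (s≤s z≤n) l) in All.lookup h p x∈ x∈ refl) (apart-unique w a)

  module _ (c : ℕ) .{{_ : NonZero c}} (bs : List (List V)) (q : ℕ) (len : length bs ≡ q)
    (wide : All (Wide c) bs) (apart : AllPairs (Apart lab) bs) (s : Bool) where

    private
      blk : ℕ → List V
      blk = nth [] bs

      f : ℕ → V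
      f i = nth default (blk (i / c)) (i % c)

    -- By homogeneity the first vertices of two blocks determine the colour between them. The
    -- Boolean `s` is the colour that the certificate calls red.
    quotient : ℕ → ℕ → Bool
    quotient u v = χ (top (blk u)) (top (blk v)) == s

    private
      blk∈ : ∀ {i} → i < q * c → blk (i / c) ∈ bs
      blk∈ h = nth-∈ [] bs (≤-trans (m<n*o⇒m/o<n h) (≤-reflexive (≡-sym len)))

      short : ∀ {i} → i < q * c → i % c < length (blk (i / c))
      short {i} h = ≤-trans (m%n<n i c) (proj₁ (All.lookup wide (blk∈ h)))

      f∈blk : ∀ {i} → i < q * c → f i ∈ blk (i / c)
      f∈blk h = nth-∈ default (blk _) (short h)

      top∈ : ∀ {i} → i < q * c → top (blk (i / c)) ∈ blk (i / c)
      top∈ h = nth-∈ default (blk _) (≤-trans (s≤s z≤n) (short h))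

      blk⊆ : ∀ {i} → i < q * c → blk (i / c) ⊆ W
      blk⊆ h = proj₁ (proj₂ (proj₂ (All.lookup wide (blk∈ h))))

      like : ∀ {i} → i < q * c → lab (f i) ≡ lab (top (blk (i / c)))
      like h = proj₂ (proj₂ (proj₂ (All.lookup wide (blk∈ h)))) (f∈blk h) (top∈ h)

      f-block : ∀ {i k} → i < q * c → k < q * c → lab (f i) ≡ lab (f k) → i / c ≡ k / c
      f-block h h′ e = nth-injective [] bs (uniq c wide)
        (≤-trans (m<n*o⇒m/o<n h) (≤-reflexive (≡-sym len))) (≤-trans (m<n*o⇒m/o<n h′) (≤-reflexive (≡-sym len)))
        (apart-injective apart (blk∈ h) (blk∈ h′) (f∈blk h) (f∈blk h′) e)
        where
        uniq : ∀ c .{{_ : NonZero c}} → All (Wide c) bs → Unique bs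
        uniq (suc c) w = apart-unique w apart

      f-inj : ∀ {i k} → i < q * c → k < q * c → f i ≡ f k → i ≡ k
      f-inj {i} {k} h h′ e = ≡-trans (m≡m%n+[m/n]*n i c) (≡-trans (cong₂ (λ r t → r + t * c) rem quo) (≡-sym (m≡m%n+[m/n]*n k c)))
        where
        quo : i / c ≡ k / c
        quo = f-block h h′ (cong lab e)
        rem : i % c ≡ k % c
        rem = nth-injective default (blk (i / c)) (proj₁ (proj₂ (All.lookup wide (blk∈ h)))) (short h)
          (subst (λ t → k % c < length (blk t)) (≡-sym quo) (short h′))
          (≡-trans e (cong (λ t → nth default (blk t) (k % c)) (≡-sym quo)))

    refute : ∀ K t → All (λ (u , v , b) → quotient u v ≡ b) K → Checker.check n (q * c) c odd? K t ≡ true → ⊥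
    refute K t = Checker.Sound.check-sound n (q * c) c odd? (λ b → A[ b == s ]) (λ b → cycle-odd (b == s))
      (λ b → G.Core.noBip big (b == s)) f f-inj quotient (λ u v → cong (_== s) (χ-sym _ _)) adj t
      where
      adj : ∀ {x y} → x < q * c → y < q * c → x / c ≢ y / c → A[ quotient (x / c) (y / c) == s ] (f x) (f y)
      adj {x} {y} h h′ ne = blk⊆ h (f∈blk h) , blk⊆ h′ (f∈blk h′) , (λ e → ne (f-block h h′ e)) ,
        ≡-trans (G.homog₂ (blk⊆ h (f∈blk h)) (blk⊆ h (top∈ h)) (blk⊆ h′ (f∈blk h′)) (blk⊆ h′ (top∈ h′)) (like h) (like h′)
          (λ e → ne (f-block h h′ e))) (≡-sym (==-involutive _ s))

  -- Among six classes some four form a monochromatic 4-cycle, which seeds the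
  -- refutation for classes with two vertices each.
  module Seeded (q : ℕ) (t : Tree) (ok : Checker.check n (q * 2) 2 odd? (ringEdges 4) t ≡ true)
    (four : Tree) (ok₄ : Checker.check 6 6 1 (_≡ᵇ 4) [] four ≡ true)
    (bs : List (List V)) (len : length bs ≡ q) (6≤q : 6 ≤ q)
    (wide : All (Wide 2) bs) (apart : AllPairs (Apart lab) bs) where

    private
      lab′ : List V → ℕ
      lab′ b = lab (top b)

      χ′ : List V → List V → Bool
      χ′ b b′ = χ (top b) (top b′)

      six : List (List V)
      six = take 6 bs

      six-length : length six ≡ 6
      six-length = length-take-≤ 6 bs (≤-trans 6≤q (≤-reflexive (≡-sym len)))

      uniq : Unique bs
      uniq = apart-unique wide apart

      usix : Unique six
      usix = Uniqueₚ.take⁺ 6 uniq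

      top∈ : ∀ {b} → b ∈ bs → top b ∈ b
      top∈ {b} p = nth-∈ default b (≤-trans (s≤s z≤n) (proj₁ (All.lookup wide p)))

    no-square : ∀ s → ¬ HasCycle (Adj six lab′ χ′ s) 4
    no-square s (us , x , z , p , r , uus , lus) with rest , e ← ↭-complete {vs = bs} uus (λ m → ∈-take 6 (Adj-path⊆ six lab′ χ′ p (proj₁ r) m)) =
      -- The blocks are reordered so that the 4-cycle occupies positions 0, 1, 2, 3, where
      -- `ringEdges 4` expects it.
      refute 2 (us ++ rest) q (≡-trans (≡-sym (↭-length e)) len) (All-resp-↭ e wide)
        (AllPairs-resp-↭ (λ {b} {b′} → Apart-sym lab {b} {b′}) e apart) s (ringEdges 4) t valid ok
      where
      at : ∀ {i} → i < 4 → nth [] (us ++ rest) i ≡ nth [] us i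
      at h = nth-++ˡ [] us rest (subst (_ <_) (≡-sym lus) h)
      go : ∀ i → suc i < 4 → (χ (top (nth [] (us ++ rest) i)) (top (nth [] (us ++ rest) (suc i))) == s) ≡ true
      go i h = ==-true (≡-trans (cong₂ χ′ (at (<⇒≤ h)) (at h)) (proj₂ (proj₂ (proj₂ (Path-nth-step [] p i (subst (_ <_) (≡-sym lus) h))))))
      last : nth [] us 3 ≡ z
      last = ≡-trans (cong (λ k → nth [] us (pred k)) (≡-sym lus)) (Path-nth-last [] p)
      valid : All (λ (u , v , b) → (χ (top (nth [] (us ++ rest) u)) (top (nth [] (us ++ rest) v)) == s) ≡ b) (ringEdges 4)
      valid = ==-true (≡-trans (cong₂ χ′ (≡-trans (at (<ᵇ-sound refl)) last) (≡-trans (at (<ᵇ-sound refl)) (Path-nth-head [] p)))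
          (proj₂ (proj₂ (proj₂ r)))) ∷
        go 0 (<ᵇ-sound refl) ∷ go 1 (<ᵇ-sound refl) ∷ go 2 (<ᵇ-sound refl) ∷ []

    impossible : ⊥
    impossible = Checker.Sound.check-sound 6 6 1 (_≡ᵇ 4) (Adj six lab′ χ′)
      (λ s m e h → no-square s (subst (HasCycle (Adj six lab′ χ′ s)) (≡ᵇ-sound {m} e) h))
      -- A `bip` leaf would be a K_{6,7} here, which does not fit on six vertices.
      (λ s A B uA uB AB lA lB → <⇒≱ (≤-reflexive (≡-sym lB)) (≤-trans (length-⊆ uB
        (λ q → proj₁ (proj₂ (AB (proj₂ (nonempty (≤-trans (s≤s z≤n) (≤-reflexive (≡-sym lA))))) q)))) (≤-reflexive six-length)))
      (nth [] six) inj6 (λ u v → χ′ (nth [] six u) (nth [] six v)) (λ u v → χ-sym _ _)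
      (λ {x} {y} h h′ ne → mem h , mem h′ ,
        (λ e → ne (cong (_/ 1) (inj6 h h′ (apart-injective apart (mem′ h) (mem′ h′) (top∈ (mem′ h)) (top∈ (mem′ h′)) e)))) ,
        cong₂ (λ u v → χ′ (nth [] six u) (nth [] six v)) (≡-sym (n/1≡n x)) (≡-sym (n/1≡n y)))
      four [] ok₄
      where
      mem : ∀ {i} → i < 6 → nth [] six i ∈ six
      mem h = nth-∈ [] six (subst (_ <_) (≡-sym six-length) h)
      mem′ : ∀ {i} → i < 6 → nth [] six i ∈ bs
      mem′ h = ∈-take 6 (mem h)
      inj6 : ∀ {i k} → i < 6 → k < 6 → nth [] six i ≡ nth [] six k → i ≡ k
      inj6 h h′ = nth-injective [] six usix (subst (_ <_) (≡-sym six-length) h) (subst (_ <_) (≡-sym six-length) h′)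

  parts : List (List V)
  parts = classes lab (length W) W

  large : ℕ → List (List V)
  large c = filter (λ b → c ≤? length b) parts

  parts-wide : ∀ {b} → b ∈ parts → Wide 1 b
  parts-wide m with block h u sub al _ ← All.lookup (classes-blocks lab (length W) W uW) m = h , u , sub , al

  chosen : ∀ c q → q ≤ length (large c) →
    length (take q (large c)) ≡ q × All (Wide c) (take q (large c)) × AllPairs (Apart lab) (take q (large c))
  chosen c q h = length-take-≤ q (large c) h ,
    All.tabulate (λ m → let p , l = ∈-filter⁻ (λ b → c ≤? length b) {xs = parts} (∈-take q m) in l , proj₂ (parts-wide p)) ,
    AllPairsₚ.take⁺ q (AllPairsₚ.filter⁺ _ (classes-apart lab (length W) W uW))

  parts-sum : length W ≡ tallies (suc j) (map length parts)
  parts-sum = ≡-trans (≡-sym (classes-length lab (length W) W ≤-refl)) (sum-tallies (suc j) (map length parts)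
    (Allₚ.map⁺ (All.tabulate λ {b} m → let _ , u , sub , al = parts-wide m in classBound b u sub al)))

  tally-large : ∀ c → tally c (map length parts) ≡ length (large c)
  tally-large c = filter-map (c ≤?_) length parts

  tops : ℕ → List V
  tops q = map top (take q (large 1))

  -- One vertex from each class: any two of them are joined by a coloured edge, so the bound for
  -- graphs without grey edges limits the number of classes.
  module Transversal (q : ℕ) (h : q ≤ length (large 1)) where

    private
      bs = take q (large 1)
      wide = proj₁ (proj₂ (chosen 1 q h))
      apart = proj₂ (proj₂ (chosen 1 q h))

    top∈ : ∀ {b} → b ∈ bs → top b ∈ b
    top∈ {b} p = nth-∈ default b (proj₁ (All.lookup wide p))

    tops-length : length (tops q) ≡ q
    tops-length = ≡-trans (length-map top bs) (proj₁ (chosen 1 q h))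

    tops⊆ : tops q ⊆ W
    tops⊆ m with b , p , refl ← ∈-map⁻ top m = proj₁ (proj₂ (proj₂ (All.lookup wide p))) (top∈ p)

    tops-injective : ∀ {x y} → x ∈ tops q → y ∈ tops q → lab x ≡ lab y → x ≡ y
    tops-injective m m′ e with b , p , refl ← ∈-map⁻ top m | b′ , p′ , refl ← ∈-map⁻ top m′ =
      cong top (apart-injective apart p p′ (top∈ p) (top∈ p′) e)

    tops-unique : Unique (tops q)
    tops-unique = go bs wide apart
      where
      go : ∀ bs → All (Wide 1) bs → AllPairs (Apart lab) bs → Unique (map top bs)
      go [] _ _ = []
      go (b ∷ bs) (w ∷ ws) (a ∷ as) = Unique-cons
        (λ m → let b′ , p , e = ∈-map⁻ top m in
          All.lookup a p (nth-∈ default b (proj₁ w)) (nth-∈ default b′ (proj₁ (All.lookup ws p))) (cong lab e))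
        (go bs ws as)

-- blowupn-c refutes a two-coloured complete graph on classes of c vertices each
-- without monochromatic C_{2n+1} and K_{n,n+1}, for c = 2 starting from a red
-- 4-cycle of classes; square finds a monochromatic 4-cycle in K_6.
blowup4-2 : Tree
blowup4-2 =
  split 0 2 (split 1 4 (red 9 8904777076738) (split 1 5 (red 9 11103800332290) (split 1 6 (red 9 13302823587842)
  (split 3 4 (red 9 9042084792326) (split 3 5 (red 9 11241108047878) (split 3 6 (red 9 13440131303430) (bip false
  100582 10789292))))))) (split 1 3 (split 0 4 (red 9 8838143119424) (split 0 5 (red 9 11037166374976) (split 0 6
  (red 9 13236189630528) (split 2 4 (red 9 8975447851076) (split 2 5 (red 9 11174471106628) (split 2 6 (red 9
  13373494362180) (bip false 32932 10789292))))))) (split 0 4 (split 1 4 (red 9 8838143151106) (split 2 4 (bip true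
  32932 6392104) (split 3 4 (red 9 10144749586438) (blue 9 10067546053702)))) (split 1 4 (split 2 4 (red 9
  10076095184964) (split 3 4 (bip true 100582 4227368) (blue 9 10068611570758))) (split 2 4 (split 3 4 (red 9
  8975545305094) (blue 9 9934267849798)) (blue 9 10005201851396)))))

blowup5-2 : Tree
blowup5-2 =
  split 0 2 (split 4 5 (split 1 4 (red 11 10493847659548674) (split 1 5 (red 11 12677477752311810) (split 3 4 (red 11
  10493984967264262) (split 3 5 (red 11 12677615060027398) (split 0 4 (split 0 5 (red 11 12712829598666816) (split 1
  3 (red 11 8063958981615618) (split 1 6 (red 11 13622060053241858) (split 2 4 (split 2 5 (red 11 12712833889435716)
  (split 2 6 (split 3 6 (red 11 14896364059133958) (split 4 6 (red 11 14966730655827976) (blue 11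
  14966804617205832))) (blue 11 14825926661865796))) (blue 11 10391495336397060))))) (split 4 6 (split 0 5 (red 11
  12715038117826624) (split 0 6 (red 11 14964641055739968) (split 1 3 (split 1 6 (red 11 14964641122783234) (split 2
  4 (red 11 10493918397368324) (split 2 5 (red 11 12715038249879556) (split 2 6 (red 11 14964641187792900) (bip false
  2130084 379888044))))) (blue 11 8275271632683266)))) (split 0 6 (split 1 6 (split 1 7 (red 11 15882492715374722)
  (split 2 4 (red 11 10493914433062916) (split 2 5 (red 11 12677544525826052) (split 2 6 (split 2 7 (red 11
  15946257953566788) (split 3 6 (split 3 7 (red 11 16023367772571654) (bip false 4294886 379888110)) (blue 11
  14896497438296326))) (blue 11 14826130841602308))))) (blue 11 14755755558541634)) (blue 11
  14685393353246976)))))))) (split 4 6 (split 1 4 (red 11 10564216403726338) (split 1 6 (red 11 14931476589252610)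
  (split 3 4 (red 11 10564353711441926) (split 3 6 (red 11 14931613896968198) (split 1 5 (split 0 4 (red 11
  10564147653748800) (split 0 5 (split 0 6 (red 11 14931413108461632) (split 0 7 (red 11 15809991585009856) (split 1
  3 (split 1 7 (red 11 15880291544635522) (split 2 4 (red 11 10564287141545988) (split 2 5 (split 2 6 (red 11
  14931547327072260) (split 2 7 (red 11 15950729075267588) (bip false 2130084 449094126))) (blue 11
  12572127774769412)))) (blue 11 8340208326282434)))) (blue 11 12431394583480576))) (split 0 4 (split 0 6 (red 11
  14966828435607616) (blue 11 14893100119165312)) (blue 11 10523771978258688))))))) (split 4 7 (split 1 4 (red 11
  10634585147904002) (split 1 7 (red 11 17185475426193410) (split 3 4 (red 11 10634722455619590) (split 3 7 (red 11
  17185612733908998) (split 5 6 (split 1 5 (red 11 12818215240667138) (blue 11 12715035367771458)) (blue 11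
  15037237208484106)))))) (split 5 6 (split 1 5 (red 11 12818215240667138) (split 1 6 (red 11 15001845333430274)
  (split 3 5 (red 11 12818352548382726) (split 3 6 (red 11 15001982641145862) (split 5 7 (split 6 7 (split 0 5 (red
  11 12927452465696832) (split 0 6 (red 11 15177051175751744) (split 0 7 (red 11 17358413592891456) (split 1 7 (red
  11 17358413594923010) (bip false 8421474 449161710))))) (blue 11 17220840163747916)) (blue 11
  17220840164797514)))))) (split 1 7 (split 5 7 (red 11 16999791074478538) (split 6 7 (red 11 16999791074478540)
  (split 3 7 (split 0 4 (red 11 9048138025373760) (split 0 5 (red 11 11299937839059008) (split 1 4 (red 11
  9129500802584578) (blue 11 10675652685791490)))) (split 1 3 (split 3 4 (split 0 4 (red 11 10388397424228416) (split
  0 5 (red 11 11299930312390720) (blue 11 12859010091091200))) (split 0 4 (split 0 7 (red 11 17009521291560192) (blue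
  11 17358413431577024)) (blue 11 10603014192044288))) (blue 11 8423749735168194))))) (split 1 3 (split 1 5 (split 5
  7 (red 11 16153171413041226) (split 0 6 (split 0 5 (red 11 12501523617678720) (split 0 7 (split 1 6 (red 11
  14755495444387970) (blue 11 14970229113687426)) (blue 11 16974583987275072))) (split 0 4 (split 0 5 (red 11
  12501523617678592) (blue 11 12915354724861248)) (blue 11 10663557060756736)))) (split 0 4 (split 0 5 (split 0 6
  (split 1 6 (red 11 14755489001937026) (split 2 4 (red 11 10317862219651140) (blue 11 10664646909765892))) (blue 11
  15034141576077696)) (blue 11 12852612830792000)) (blue 11 10664646844690688))) (blue 11 6877768810045890)))))))
  (split 1 3 (split 4 5 (split 0 4 (red 11 10493781025591360) (split 0 5 (red 11 12677411118354496) (split 2 4 (red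
  11 10493918330323012) (split 2 5 (red 11 12677548423086148) (split 4 6 (split 1 5 (red 11 12715038186969090) (split
  1 6 (red 11 14964641124882434) (blue 11 13628628130726210))) (split 1 6 (split 3 6 (split 5 6 (red 11
  14884298287361290) (split 5 7 (split 6 7 (red 11 17256189719052364) (blue 11 16232272740090124)) (blue 11
  16164242836197386))) (blue 11 14959235066503558)) (blue 11 14959235066503554))))))) (split 4 6 (split 0 4 (red 11
  10564149769769024) (split 0 6 (red 11 14931409955295296) (split 2 4 (red 11 10564287074500676) (split 2 6 (red 11
  14931547260026948) (split 3 5 (split 5 6 (red 11 14931753480290506) (split 5 7 (split 6 7 (red 11
  17283292208772364) (blue 11 16232410409635852)) (blue 11 16164105166651658))) (blue 11 12707504039403846))))))
  (split 4 7 (split 0 4 (red 11 10634518513946688) (split 0 7 (red 11 17185408792236096) (split 2 4 (red 11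
  10634655818678340) (split 2 7 (red 11 17185546096967748) (split 3 5 (split 3 6 (split 5 6 (red 11
  15037165936378058) (blue 11 15037236098760970)) (blue 11 14959372639674758)) (blue 11 12707572825989446))))))
  (split 5 6 (split 0 6 (red 11 15001778699472960) (split 2 5 (red 11 12818285911441476) (blue 11
  12572140504133636))) (split 0 7 (split 2 7 (split 3 4 (red 11 9256976447997958) (split 3 5 (red 11
  11508776261683206) (split 6 7 (red 11 17072261027660236) (split 0 4 (red 11 9059063273986112) (blue 11
  10639260325774464))))) (blue 11 17219842789020676)) (blue 11 17219842789016704)))))) (split 0 4 (split 1 4 (split 0
  6 (red 11 13555990600585408) (split 1 5 (red 11 11374490746525826) (split 1 6 (red 11 13626290560211074) (split 2 5
  (red 11 11442658321997892) (blue 11 12571925554442244))))) (split 3 4 (split 0 5 (red 11 11304328359940160) (split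
  0 6 (red 11 13556128173625408) (split 1 5 (red 11 11370294766772226) (split 1 6 (red 11 13622094580457474) (split 2
  4 (split 2 5 (red 11 11445065844097092) (blue 11 12571925554442244)) (blue 11 10317926715402244)))))) (split 0 5
  (split 1 5 (red 11 12501490164996226) (split 2 5 (split 3 5 (red 11 12642359852441606) (split 4 5 (red 11
  12712731818887176) (split 2 4 (split 0 6 (split 1 6 (red 11 14755489169676290) (split 2 6 (split 3 6 (red 11
  14896364059133958) (split 3 7 (split 4 6 (red 11 14966730655827976) (split 4 7 (split 5 6 (red 11
  15037099400005642) (split 5 7 (bip true 8624490 171999726) (blue 11 16164242838362186))) (blue 11
  16093805311797320))) (blue 11 16023298994645254))) (blue 11 14752396821795844))) (split 1 6 (split 2 6 (red 11
  14755520402653380) (split 3 6 (split 4 6 (bip true 6392104 171999660) (blue 11 14676294401890376)) (blue 11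
  14813858010079302))) (blue 11 14676294202794178))) (blue 11 10528170858255364)))) (blue 11 12500597008045060)))
  (split 1 5 (split 2 4 (split 2 5 (red 11 12501521565712580) (split 3 5 (split 4 5 (bip true 6392104 171999594)
  (blue 11 12424492440721480)) (blue 11 12562058129285190))) (blue 11 10382896880723972)) (blue 11
  12424492241625282))))) (split 0 5 (split 1 5 (split 0 6 (red 11 13558191771324608) (split 1 4 (red 11
  9124892103579778) (split 1 6 (red 11 13628491730950274) (split 2 4 (red 11 9190858510411844) (blue 11
  10317926717501444))))) (split 3 5 (split 0 6 (red 11 13558329344364608) (split 1 4 (red 11 9118494955186178) (split
  1 6 (red 11 13622094582556674) (split 2 4 (red 11 9191202432843844) (blue 11 10317926717501444))))) (split 1 4
  (split 2 4 (red 11 10247522695315652) (split 2 5 (split 3 4 (split 4 5 (bip true 4227368 241273194) (blue 11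
  12497128925466632)) (blue 11 10310258248493126)) (blue 11 12634696761516036))) (blue 11 10172690282555586))))
  (split 1 4 (split 2 4 (split 0 6 (red 11 13553858220499008) (split 1 5 (red 11 11374628319565826) (split 1 6 (red
  11 13626428133251074) (split 2 5 (red 11 11444928271057092) (blue 11 12571925553389572))))) (split 1 5 (split 2 5
  (red 11 12571927689527492) (split 3 4 (split 3 5 (split 4 5 (red 11 12712798455955528) (split 1 6 (split 0 6 (red
  11 14685189210050624) (split 2 6 (red 11 14825926694207556) (split 2 7 (split 3 6 (split 3 7 (red 11
  17079958852634630) (split 4 6 (red 11 14966797292896328) (split 4 7 (split 5 6 (red 11 15037166037073994) (split 5
  7 (bip true 8556906 241273326) (blue 11 16164242836197386))) (blue 11 17137209728602120)))) (blue 11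
  14823891851942982)) (blue 11 15952861463881988)))) (split 0 6 (split 2 6 (split 4 6 (bip true 4227368 241273260)
  (blue 11 14748930886635528)) (blue 11 14748930756616196)) (blue 11 14748930622529664)))) (blue 11
  12570759524588614)) (blue 11 10321160881577030))) (blue 11 12430159475182786))) (split 2 5 (split 3 5 (split 3 6
  (red 11 13769366788147206) (split 4 5 (red 11 12636894470934856) (blue 11 11298591259105352))) (blue 11
  12642223360417862)) (blue 11 12571860082434052))))))

blowup5-3 : Tree
blowup5-3 =
  split 0 1 (split 0 2 (split 1 2 (split 0 3 (red 11 11339306542176352) (split 0 4 (red 11 14720304797587552) (split
  1 3 (red 11 11444962636896259) (split 1 4 (red 11 14825960892307459) (bip false 1053827 379894188))))) (split 0 3
  (split 1 3 (red 11 12571963129108483) (split 2 3 (red 11 12677619321441286) (split 2 4 (split 3 4 (bip true 7548233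
  68172204) (blue 11 15037273384032361)) (blue 11 14931620412925030)))) (split 1 3 (split 2 3 (bip true 4301030
  68169033) (split 0 4 (split 1 4 (red 11 14822666652391427) (split 2 4 (red 11 16058620798077958) (blue 11
  13660711830199398))) (split 1 4 (split 2 4 (bip true 4301030 68172204) (bip false 1056998 379894188)) (blue 11
  13556988308066499)))) (split 2 3 (split 0 4 (split 1 4 (red 11 14825891332919299) (split 2 4 (red 11
  14928322844724230) (blue 11 13698860477193318))) (split 1 4 (split 2 4 (bip true 4301030 68172204) (blue 11
  13556988210453606)) (bip false 1053827 379894188))) (blue 11 12431088303610982))))) (split 0 3 (split 1 3 (split 0
  4 (red 11 14720308021961824) (split 1 2 (red 11 8063967605859331) (split 1 4 (red 11 14825964116681731) (bip false
  1053827 275986860)))) (split 1 2 (split 2 3 (bip true 1056998 172076361) (split 0 4 (split 1 4 (red 11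
  14819368120656899) (split 2 4 (bip true 1056998 172079532) (bip false 4301030 379894188))) (split 1 4 (split 2 4
  (red 11 16058620895690854) (blue 11 13555161938304006)) (blue 11 13553686652719395)))) (split 2 3 (split 0 4 (split
  1 4 (red 11 14825894456627203) (split 2 4 (bip true 1056998 379894188) (blue 11 13697863070555142))) (split 1 4
  (split 2 4 (red 11 14896357614649638) (blue 11 14720304766098438)) (bip false 1053827 275986860))) (blue 11
  12571963163712518)))) (split 2 3 (split 1 2 (split 1 3 (red 11 12677619456708611) (split 0 4 (split 1 4 (red 11
  14720301645631491) (split 2 4 (bip true 1056998 172079532) (blue 11 13662644305173510))) (split 1 4 (split 2 4 (red
  11 14928322942337126) (blue 11 14931447472233478)) (bip false 1053827 379894188)))) (split 1 3 (split 0 4 (split 1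
  4 (red 11 14720301743247363) (split 2 4 (red 11 14896257659047206) (blue 11 15952964640349190))) (split 1 4 (split
  2 4 (bip true 4301030 379894188) (blue 11 14921725781255174)) (bip false 1053827 275986860))) (bip false 1053827
  275983689))) (split 0 4 (split 1 2 (split 1 4 (red 11 15847308341252291) (split 2 4 (bip true 1056998 172079532)
  (blue 11 14755731736665094))) (blue 11 9156013765984451)) (blue 11 14720308122723520))))) (split 0 2 (split 0 3
  (split 2 3 (split 0 4 (red 11 14720308122723520) (split 1 2 (red 11 9156013765984451) (split 1 4 (split 2 4 (red 11
  14755731736665094) (bip false 1056998 172079532)) (blue 11 15847308341252291)))) (split 1 2 (split 1 3 (bip true
  1053827 275983689) (split 0 4 (split 1 4 (bip true 1053827 275986860) (split 2 4 (red 11 14921725781255174) (bip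
  false 4301030 379894188))) (split 1 4 (split 2 4 (red 11 15952964640349190) (blue 11 14896257659047206)) (blue 11
  14720301743247363)))) (split 1 3 (split 0 4 (split 1 4 (bip true 1053827 379894188) (split 2 4 (red 11
  14931447472233478) (blue 11 14928322942337126))) (split 1 4 (split 2 4 (red 11 13662644305173510) (bip false
  1056998 172079532)) (blue 11 14720301645631491))) (blue 11 12677619456708611)))) (split 1 3 (split 1 2 (split 2 3
  (red 11 12571963163712518) (split 0 4 (split 1 4 (bip true 1053827 275986860) (split 2 4 (red 11 14720304766098438)
  (blue 11 14896357614649638))) (split 1 4 (split 2 4 (red 11 13697863070555142) (bip false 1056998 379894188)) (blue
  11 14825894456627203)))) (split 2 3 (split 0 4 (split 1 4 (red 11 13553686652719395) (split 2 4 (red 11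
  13555161938304006) (blue 11 16058620895690854))) (split 1 4 (split 2 4 (bip true 4301030 379894188) (bip false
  1056998 172079532)) (blue 11 14819368120656899))) (bip false 1056998 172076361))) (split 0 4 (split 1 2 (split 1 4
  (bip true 1053827 275986860) (blue 11 14825964116681731)) (blue 11 8063967605859331)) (blue 11
  14720308021961824)))) (split 1 2 (split 0 3 (split 1 3 (split 2 3 (red 11 12431088303610982) (split 0 4 (split 1 4
  (bip true 1053827 379894188) (split 2 4 (red 11 13556988210453606) (bip false 4301030 68172204))) (split 1 4 (split
  2 4 (red 11 13698860477193318) (blue 11 14928322844724230)) (blue 11 14825891332919299)))) (split 2 3 (split 0 4
  (split 1 4 (red 11 13556988308066499) (split 2 4 (bip true 1056998 379894188) (bip false 4301030 68172204))) (split
  1 4 (split 2 4 (red 11 13660711830199398) (blue 11 16058620798077958)) (blue 11 14822666652391427))) (bip false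
  4301030 68169033))) (split 1 3 (split 2 3 (split 2 4 (red 11 14931620412925030) (split 3 4 (red 11
  15037273384032361) (bip false 7548233 68172204))) (blue 11 12677619321441286)) (blue 11 12571963129108483))) (split
  0 3 (split 0 4 (split 1 3 (split 1 4 (bip true 1053827 379894188) (blue 11 14825960892307459)) (blue 11
  11444962636896259)) (blue 11 14720304797587552)) (blue 11 11339306542176352))))

square : Tree
square =
  split 0 1 (split 0 2 (split 0 3 (split 0 4 (split 1 2 (split 1 3 (red 4 98369) (split 1 4 (red 4 131137) (split 2 3
  (red 4 98338) (split 2 4 (red 4 131106) (blue 4 132194))))) (split 1 3 (split 1 4 (red 4 131169) (split 2 3 (red 4
  99330) (split 3 4 (red 4 131107) (blue 4 132163)))) (split 1 4 (split 2 4 (red 4 132098) (split 3 4 (red 4 132099)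
  (blue 4 133155))) (split 2 3 (split 2 4 (red 4 131170) (split 3 4 (red 4 131139) (blue 4 133155))) (split 2 4
  (split 3 4 (red 4 133123) (blue 4 132163)) (blue 4 132194)))))) (split 0 5 (split 1 2 (split 1 3 (red 4 98369)
  (split 1 5 (red 4 163905) (split 2 3 (red 4 98338) (split 2 5 (red 4 163874) (blue 4 164962))))) (split 1 3 (split
  1 5 (red 4 163937) (split 2 3 (red 4 99330) (split 3 5 (red 4 163875) (blue 4 164931)))) (split 1 4 (split 2 4 (red
  4 132098) (split 3 4 (red 4 132099) (blue 4 133155))) (split 2 3 (split 2 5 (red 4 163938) (split 3 5 (red 4
  163907) (blue 4 165923))) (split 2 4 (split 3 4 (red 4 133123) (blue 4 132163)) (blue 4 132194)))))) (split 1 2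
  (split 1 3 (red 4 98369) (split 2 3 (red 4 98338) (split 1 4 (split 2 4 (red 4 132098) (split 2 5 (split 3 4 (red 4
  132099) (split 3 5 (red 4 165891) (blue 4 163971))) (blue 4 163970))) (split 1 5 (split 2 4 (split 3 4 (red 4
  133123) (split 3 5 (red 4 164867) (blue 4 163971))) (blue 4 132194)) (blue 4 163969))))) (split 1 3 (split 2 3 (red
  4 99330) (split 1 4 (split 2 4 (red 4 132098) (split 2 5 (split 3 4 (red 4 132099) (split 3 5 (red 4 165891) (blue
  4 163971))) (blue 4 163970))) (split 1 5 (split 2 5 (red 4 164866) (split 3 4 (split 4 5 (red 4 164964) (blue 4
  165924)) (blue 4 132163))) (blue 4 163969)))) (split 1 4 (split 2 4 (red 4 132098) (split 3 4 (red 4 132099) (blue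
  4 133155))) (split 1 5 (split 2 5 (red 4 164866) (split 3 5 (red 4 164867) (blue 4 165923))) (blue 4 163969)))))))
  (split 0 4 (split 0 5 (split 1 2 (split 1 4 (red 4 131137) (split 1 5 (red 4 163905) (split 2 4 (red 4 131106)
  (split 2 5 (red 4 163874) (blue 4 164994))))) (split 1 3 (split 2 3 (red 4 99330) (split 3 4 (red 4 131107) (split
  3 5 (red 4 163875) (split 1 4 (split 1 5 (red 4 163969) (blue 4 166977)) (blue 4 134209))))) (split 1 4 (split 1 5
  (red 4 163969) (split 2 4 (red 4 132098) (split 4 5 (red 4 163876) (blue 4 164932)))) (split 1 5 (split 2 5 (red 4
  164866) (split 4 5 (red 4 164868) (blue 4 165924))) (split 2 3 (split 3 4 (red 4 131139) (split 3 5 (red 4 163907)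
  (blue 4 164995))) (split 2 4 (split 2 5 (red 4 163970) (blue 4 164962)) (blue 4 132194))))))) (split 1 3 (split 2 3
  (red 4 99330) (split 2 5 (split 3 4 (red 4 131107) (split 4 5 (red 4 165892) (blue 4 163940))) (blue 4 163938)))
  (split 1 5 (split 2 5 (red 4 164866) (split 4 5 (red 4 164868) (split 2 3 (split 3 4 (red 4 131139) (blue 4
  136195)) (blue 4 98466)))) (blue 4 163937)))) (split 0 5 (split 1 3 (split 2 3 (red 4 99330) (split 2 4 (split 3 5
  (red 4 163875) (split 4 5 (red 4 163908) (blue 4 166916))) (blue 4 131170))) (split 1 4 (split 2 4 (red 4 132098)
  (split 4 5 (red 4 163876) (split 2 3 (split 3 5 (red 4 163907) (blue 4 167939)) (blue 4 98434)))) (blue 4 131169)))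
  (split 1 3 (split 2 3 (red 4 99330) (split 2 4 (split 2 5 (split 1 4 (red 4 133121) (split 1 5 (red 4 165889) (blue
  4 163969))) (blue 4 163938)) (blue 4 131170))) (split 1 4 (split 1 5 (split 2 4 (red 4 132098) (split 2 5 (red 4
  164866) (blue 4 163970))) (blue 4 163937)) (blue 4 131169)))))) (split 0 3 (split 0 4 (split 0 5 (split 1 3 (split
  1 4 (red 4 131169) (split 1 5 (red 4 163937) (split 3 4 (red 4 131107) (split 3 5 (red 4 163875) (blue 4
  164995))))) (split 1 4 (split 1 5 (red 4 163969) (split 3 4 (red 4 132099) (split 4 5 (red 4 163876) (blue 4
  164964)))) (split 1 5 (split 3 5 (red 4 164867) (split 4 5 (red 4 164868) (blue 4 166948))) (split 2 3 (split 2 4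
  (red 4 131170) (split 2 5 (red 4 163938) (blue 4 164994))) (split 2 4 (split 2 5 (red 4 163970) (blue 4 164962))
  (blue 4 132194)))))) (split 1 2 (split 2 3 (red 4 98338) (split 2 4 (red 4 131106) (split 3 5 (split 4 5 (red 4
  166916) (blue 4 163908)) (blue 4 163907)))) (split 1 5 (split 3 5 (red 4 164867) (split 4 5 (red 4 164868) (split 2
  3 (split 2 4 (red 4 131170) (blue 4 136194)) (blue 4 103426)))) (blue 4 163905)))) (split 0 5 (split 1 2 (split 2 3
  (red 4 98338) (split 2 5 (red 4 163874) (split 3 4 (split 4 5 (red 4 163940) (blue 4 165892)) (blue 4 131139))))
  (split 1 4 (split 3 4 (red 4 132099) (split 4 5 (red 4 163876) (split 2 3 (split 2 5 (red 4 163938) (blue 4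
  167938)) (blue 4 102402)))) (blue 4 131137))) (split 1 2 (split 2 3 (red 4 98338) (split 3 4 (split 3 5 (split 1 4
  (red 4 134145) (split 1 5 (red 4 166913) (blue 4 163969))) (blue 4 163907)) (blue 4 131139))) (split 1 4 (split 1 5
  (split 3 4 (red 4 132099) (split 3 5 (red 4 164867) (blue 4 163971))) (blue 4 163905)) (blue 4 131137))))) (split 0
  4 (split 0 5 (split 1 2 (split 2 4 (red 4 131106) (split 2 5 (red 4 163874) (split 3 4 (split 3 5 (red 4 163971)
  (blue 4 165891)) (blue 4 133123)))) (split 1 3 (split 3 4 (red 4 131107) (split 3 5 (red 4 163875) (split 2 4
  (split 2 5 (red 4 163970) (blue 4 166914)) (blue 4 134146)))) (blue 4 98369))) (split 1 2 (split 2 4 (red 4 131106)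
  (split 3 4 (split 4 5 (split 1 3 (red 4 102401) (split 1 5 (red 4 167937) (blue 4 163937))) (blue 4 163908)) (blue
  4 133123))) (split 1 3 (split 1 5 (split 3 4 (red 4 131107) (split 4 5 (red 4 164868) (blue 4 163940))) (blue 4
  163905)) (blue 4 98369)))) (split 0 5 (split 1 2 (split 2 5 (red 4 163874) (split 3 5 (split 4 5 (split 1 3 (red 4
  103425) (split 1 4 (red 4 136193) (blue 4 131169))) (blue 4 165892)) (blue 4 165891))) (split 1 3 (split 1 4 (split
  3 5 (red 4 163875) (split 4 5 (red 4 163876) (blue 4 166916))) (blue 4 131137)) (blue 4 98369))) (split 1 2 (split
  1 3 (split 1 4 (split 2 3 (split 2 4 (red 4 132194) (split 3 4 (red 4 132163) (blue 4 133123))) (split 2 4 (split 3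
  4 (red 4 133155) (blue 4 131139)) (blue 4 131170))) (split 1 5 (split 2 3 (split 2 5 (red 4 164962) (split 3 5 (red
  4 164931) (blue 4 165891))) (split 2 4 (split 3 4 (red 4 133155) (blue 4 131139)) (blue 4 131170))) (blue 4
  163969))) (split 1 4 (split 1 5 (split 2 3 (split 3 4 (red 4 132163) (split 3 5 (red 4 164931) (blue 4 163971)))
  (split 2 4 (split 2 5 (red 4 164994) (blue 4 163938)) (blue 4 131170))) (blue 4 163937)) (blue 4 131169))) (split 1
  3 (split 1 4 (split 1 5 (split 2 3 (split 2 4 (red 4 132194) (split 2 5 (red 4 164962) (blue 4 163970))) (split 2 4
  (split 2 5 (red 4 164994) (blue 4 163938)) (blue 4 131170))) (blue 4 163905)) (blue 4 131137)) (blue 4 98369)))))))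
  (split 0 2 (split 0 3 (split 0 4 (split 0 5 (split 1 2 (split 1 3 (red 4 98369) (split 1 4 (red 4 131137) (split 1
  5 (red 4 163905) (split 2 3 (split 2 4 (red 4 131170) (split 2 5 (red 4 163938) (blue 4 164994))) (split 2 4 (split
  2 5 (red 4 163970) (blue 4 164962)) (blue 4 132194)))))) (split 1 3 (split 1 4 (red 4 131169) (split 1 5 (red 4
  163937) (split 2 3 (split 2 4 (red 4 131170) (split 2 5 (red 4 163938) (blue 4 164994))) (split 3 4 (split 3 5 (red
  4 163971) (blue 4 164931)) (blue 4 132163))))) (split 1 4 (split 1 5 (red 4 163969) (split 2 3 (split 2 4 (red 4
  131170) (split 3 4 (red 4 131139) (blue 4 133155))) (split 2 5 (split 3 5 (red 4 165891) (blue 4 164931)) (blue 4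
  164962)))) (split 2 3 (split 2 4 (red 4 131170) (split 3 4 (red 4 131139) (blue 4 133155))) (split 2 4 (split 3 4
  (red 4 133123) (blue 4 132163)) (blue 4 132194)))))) (split 1 2 (split 1 3 (red 4 98369) (split 1 4 (red 4 131137)
  (split 3 5 (split 4 5 (red 4 166916) (blue 4 163876)) (blue 4 163875)))) (split 2 5 (split 3 5 (red 4 165891)
  (split 4 5 (red 4 165892) (split 1 3 (split 1 4 (red 4 131169) (blue 4 136193)) (blue 4 103425)))) (blue 4
  163874)))) (split 0 5 (split 1 2 (split 1 3 (red 4 98369) (split 1 5 (red 4 163905) (split 3 4 (split 4 5 (red 4
  163940) (blue 4 164868)) (blue 4 131107)))) (split 2 4 (split 3 4 (red 4 133123) (split 4 5 (red 4 163908) (split 1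
  3 (split 1 5 (red 4 163937) (blue 4 167937)) (blue 4 102401)))) (blue 4 131106))) (split 1 2 (split 1 3 (red 4
  98369) (split 3 4 (split 3 5 (split 2 4 (red 4 134146) (split 2 5 (red 4 166914) (blue 4 163970))) (blue 4 163875))
  (blue 4 131107))) (split 2 4 (split 2 5 (split 3 4 (red 4 133123) (split 3 5 (red 4 165891) (blue 4 163971))) (blue
  4 163874)) (blue 4 131106))))) (split 0 4 (split 0 5 (split 1 2 (split 1 4 (red 4 131137) (split 1 5 (red 4 163905)
  (split 3 4 (split 3 5 (red 4 163971) (blue 4 164867)) (blue 4 132099)))) (split 2 3 (split 3 4 (red 4 131139)
  (split 3 5 (red 4 163907) (split 1 4 (split 1 5 (red 4 163969) (blue 4 166913)) (blue 4 134145)))) (blue 4 98338)))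
  (split 1 2 (split 1 4 (red 4 131137) (split 3 4 (split 4 5 (split 2 3 (red 4 102402) (split 2 5 (red 4 167938)
  (blue 4 163938))) (blue 4 163876)) (blue 4 132099))) (split 2 3 (split 2 5 (split 3 4 (red 4 131139) (split 4 5
  (red 4 165892) (blue 4 163940))) (blue 4 163874)) (blue 4 98338)))) (split 0 5 (split 1 2 (split 1 5 (red 4 163905)
  (split 3 5 (split 4 5 (split 2 3 (red 4 103426) (split 2 4 (red 4 136194) (blue 4 131170))) (blue 4 164868)) (blue
  4 164867))) (split 2 3 (split 2 4 (split 3 5 (red 4 163907) (split 4 5 (red 4 163908) (blue 4 166916))) (blue 4
  131106)) (blue 4 98338))) (split 1 3 (split 1 4 (split 1 5 (split 2 3 (split 2 4 (red 4 132194) (split 2 5 (red 4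
  164962) (blue 4 163970))) (split 2 4 (split 2 5 (red 4 164994) (blue 4 163938)) (blue 4 131170))) (split 3 5 (split
  4 5 (red 4 166948) (blue 4 164868)) (blue 4 164867))) (split 1 5 (split 3 4 (split 4 5 (red 4 164964) (blue 4
  163876)) (blue 4 132099)) (blue 4 163969))) (split 1 4 (split 1 5 (split 3 4 (split 3 5 (red 4 164995) (blue 4
  163875)) (blue 4 131107)) (blue 4 163937)) (blue 4 131169)))))) (split 0 3 (split 0 4 (split 0 5 (split 1 3 (split
  1 4 (red 4 131169) (split 1 5 (red 4 163937) (split 2 4 (split 2 5 (red 4 163970) (blue 4 164866)) (blue 4
  132098)))) (split 2 3 (split 2 4 (red 4 131170) (split 2 5 (red 4 163938) (split 1 4 (split 1 5 (red 4 163969)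
  (blue 4 165889)) (blue 4 133121)))) (blue 4 99330))) (split 1 3 (split 1 4 (red 4 131169) (split 2 4 (split 4 5
  (split 2 3 (red 4 98434) (split 3 5 (red 4 167939) (blue 4 163907))) (blue 4 163876)) (blue 4 132098))) (split 2 3
  (split 2 4 (red 4 131170) (split 3 5 (split 4 5 (red 4 166916) (blue 4 163908)) (blue 4 163875))) (blue 4 99330))))
  (split 0 5 (split 1 3 (split 1 5 (red 4 163937) (split 2 5 (split 4 5 (split 2 3 (red 4 98466) (split 3 4 (red 4
  136195) (blue 4 131139))) (blue 4 164868)) (blue 4 164866))) (split 2 3 (split 2 5 (red 4 163938) (split 3 4 (split
  4 5 (red 4 163940) (blue 4 165892)) (blue 4 131107))) (blue 4 99330))) (split 1 2 (split 1 3 (split 1 4 (split 1 5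
  (split 2 3 (split 2 4 (red 4 132194) (split 2 5 (red 4 164962) (blue 4 163970))) (split 3 4 (split 3 5 (red 4
  164995) (blue 4 163907)) (blue 4 131139))) (split 2 5 (split 4 5 (red 4 165924) (blue 4 164868)) (blue 4 164866)))
  (split 1 5 (split 2 4 (split 4 5 (red 4 164932) (blue 4 163876)) (blue 4 132098)) (blue 4 163969))) (split 2 3
  (split 3 4 (split 3 5 (split 1 4 (red 4 134209) (split 1 5 (red 4 166977) (blue 4 163969))) (blue 4 163875)) (blue
  4 131107)) (blue 4 99330))) (split 1 4 (split 1 5 (split 2 4 (split 2 5 (red 4 164994) (blue 4 163874)) (blue 4
  131106)) (blue 4 163905)) (blue 4 131137))))) (split 0 4 (split 0 5 (split 1 2 (split 1 3 (split 1 4 (split 1 5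
  (red 4 163969) (split 2 5 (split 3 5 (red 4 165923) (blue 4 164867)) (blue 4 164866))) (split 2 4 (split 3 4 (red 4
  133155) (blue 4 132099)) (blue 4 132098))) (split 2 3 (split 1 4 (split 1 5 (red 4 163969) (split 2 5 (split 3 4
  (red 4 132163) (split 4 5 (red 4 165924) (blue 4 164964))) (blue 4 164866))) (split 2 4 (split 2 5 (red 4 163970)
  (split 3 4 (split 3 5 (red 4 163971) (blue 4 165891)) (blue 4 132099))) (blue 4 132098))) (blue 4 99330))) (split 1
  3 (split 2 3 (split 1 4 (split 1 5 (red 4 163969) (split 2 4 (red 4 132194) (split 3 4 (split 3 5 (red 4 163971)
  (blue 4 164867)) (blue 4 133123)))) (split 2 4 (split 2 5 (red 4 163970) (split 3 4 (split 3 5 (red 4 163971) (blue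
  4 165891)) (blue 4 132099))) (blue 4 132098))) (blue 4 98338)) (blue 4 98369))) (split 1 2 (split 1 3 (split 1 4
  (split 2 3 (split 2 4 (red 4 132194) (split 3 4 (red 4 132163) (blue 4 133123))) (split 2 5 (split 3 5 (red 4
  165923) (blue 4 163907)) (blue 4 163938))) (split 2 4 (split 3 4 (red 4 133155) (blue 4 132099)) (blue 4 132098)))
  (split 1 5 (split 2 3 (split 3 5 (red 4 164931) (blue 4 163875)) (blue 4 99330)) (blue 4 163937))) (split 1 3
  (split 1 5 (split 2 3 (split 2 5 (red 4 164962) (blue 4 163874)) (blue 4 98338)) (blue 4 163905)) (blue 4 98369))))
  (split 1 2 (split 1 3 (split 1 4 (split 2 3 (split 2 4 (red 4 132194) (split 3 4 (red 4 132163) (blue 4 133123)))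
  (split 2 4 (split 3 4 (red 4 133155) (blue 4 131139)) (blue 4 131170))) (split 2 4 (split 3 4 (red 4 133155) (blue
  4 132099)) (blue 4 132098))) (split 1 4 (split 2 3 (split 3 4 (red 4 132163) (blue 4 131107)) (blue 4 99330)) (blue
  4 131169))) (split 1 3 (split 1 4 (split 2 3 (split 2 4 (red 4 132194) (blue 4 131106)) (blue 4 98338)) (blue 4
  131137)) (blue 4 98369))))))

-- Counting the classes of each size, for n = 4 and n = 5

module Grey4 {V : Set} (_≟_ : DecidableEquality V) (W : List V) (uW : Unique W)
  (lab : V → ℕ) (χ : V → V → Bool) (χ-sym : ∀ x y → χ x y ≡ χ y x)
  (homog : ∀ {x x′ y} → x ∈ W → x′ ∈ W → y ∈ W → lab x ≡ lab x′ → lab x ≢ lab y → χ x y ≡ χ x′ y)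
  (classBound : ClassBound lab 3 W) (noOdd : ∀ c → ¬ HasCycle (Adj W lab χ c) 9) (big : 30 ≤ length W) where

  open BlowUp _≟_ W uW lab χ χ-sym homog 2 classBound noOdd big

  few₁ : length (large 1) ≤ 16
  few₁ with length (large 1) ≤? 16
  ... | yes h = h
  ... | no h = ⊥-elim (NoGrey4.impossible _≟_ (tops 17) (T.tops-unique) lab χ χ-sym T.tops-injective
    (λ c → noOdd c ∘ HasCycle-map λ (p , q , r) → T.tops⊆ p , T.tops⊆ q , r) T.tops-length)
    where
    module T = Transversal 17 (≰⇒> h)

  few₂ : length (large 2) ≤ 6
  few₂ with length (large 2) ≤? 6
  ... | yes h = h
  ... | no h with l , w , a ← chosen 2 7 (≰⇒> h) =
    ⊥-elim (Seeded.impossible 7 blowup4-2 refl square refl (take 7 (large 2)) l (<ᵇ-sound refl) w a)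

  few₃ : length (large 3) ≤ 6
  few₃ with length (large 3) ≤? 6
  ... | yes h = h
  ... | no h with l , w , a ← chosen 3 7 (≰⇒> h) =
    ⊥-elim (Seeded.impossible 7 blowup4-2 refl square refl (take 7 (large 3)) l (<ᵇ-sound refl)
      (All.map (λ (l , r) → ≤-trans (n≤1+n 2) l , r) w) a)

  -- A class of size i counts at levels 1, ..., i, so |W| ≤ 6 + 6 + 16 = 28, below 7n + 2 = 30.
  impossible : ⊥
  impossible = <⇒≱ (<ᵇ-sound {28} {30} refl) (≤-trans big (≤-trans (≤-reflexive parts-sum)
    (+-mono-≤ (≤-trans (≤-reflexive (tally-large 3)) few₃) (+-mono-≤ (≤-trans (≤-reflexive (tally-large 2)) few₂)
      (+-monoˡ-≤ 0 (≤-trans (≤-reflexive (tally-large 1)) few₁))))))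

module Grey5 {V : Set} (_≟_ : DecidableEquality V) (W : List V) (uW : Unique W)
  (lab : V → ℕ) (χ : V → V → Bool) (χ-sym : ∀ x y → χ x y ≡ χ y x)
  (homog : ∀ {x x′ y} → x ∈ W → x′ ∈ W → y ∈ W → lab x ≡ lab x′ → lab x ≢ lab y → χ x y ≡ χ x′ y)
  (classBound : ClassBound lab 4 W) (noOdd : ∀ c → ¬ HasCycle (Adj W lab χ c) 11) (big : 37 ≤ length W) where

  open BlowUp _≟_ W uW lab χ χ-sym homog 3 classBound noOdd big

  few₁ : length (large 1) ≤ 20
  few₁ with length (large 1) ≤? 20
  ... | yes h = h
  ... | no h = ⊥-elim (NoGrey5.impossible _≟_ (tops 21) (T.tops-unique) lab χ χ-sym T.tops-injective
    (λ c → noOdd c ∘ HasCycle-map λ (p , q , r) → T.tops⊆ p , T.tops⊆ q , r) T.tops-length)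
    where
    module T = Transversal 21 (≰⇒> h)

  few₂ : length (large 2) ≤ 7
  few₂ with length (large 2) ≤? 7
  ... | yes h = h
  ... | no h with l , w , a ← chosen 2 8 (≰⇒> h) =
    ⊥-elim (Seeded.impossible 8 blowup5-2 refl square refl (take 8 (large 2)) l (<ᵇ-sound refl) w a)

  -- Five classes of three vertices are refuted without a seeded 4-cycle, and one bound covers
  -- levels 3 and 4.
  few₃ : ∀ c → 3 ≤ c → length (large c) ≤ 4
  few₃ c 3≤c with length (large c) ≤? 4
  ... | yes h = h
  ... | no h with l , w , a ← chosen c 5 (≰⇒> h) =
    ⊥-elim (refute 3 (take 5 (large c)) 5 l (All.map (λ (l , r) → ≤-trans 3≤c l , r) w) a true [] blowup5-3 [] refl)

  -- Level by level |W| ≤ 4 + 4 + 7 + 20 = 35, below 7n + 2 = 37.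
  impossible : ⊥
  impossible = <⇒≱ (<ᵇ-sound {35} {37} refl) (≤-trans big (≤-trans (≤-reflexive parts-sum)
    (+-mono-≤ (≤-trans (≤-reflexive (tally-large 4)) (few₃ 4 (<ᵇ-sound refl)))
      (+-mono-≤ (≤-trans (≤-reflexive (tally-large 3)) (few₃ 3 (<ᵇ-sound refl)))
        (+-mono-≤ (≤-trans (≤-reflexive (tally-large 2)) few₂)
          (+-monoˡ-≤ 0 (≤-trans (≤-reflexive (tally-large 1)) few₁)))))))

-- Gallai partitions

module Components {V : Set} (_≟_ : DecidableEquality V) {E : V → V → Set} (sy : Symmetric E)
  (E? : ∀ x y → Dec (E x y)) where

  Linked : List V → V → V → Set
  Linked W = Star λ x y → x ∈ W × y ∈ W × E x y

  record Labelling (W : List V) : Set where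
    field
      label : V → V
      label-∈ : ∀ {x} → x ∈ W → label x ∈ W
      edge-label : ∀ {x y} → x ∈ W → y ∈ W → E x y → label x ≡ label y
      label-linked : ∀ {x y} → x ∈ W → y ∈ W → label x ≡ label y → Linked W x y

  open Labelling

  -- Vertices are added one at a time: the new vertex becomes the common label of all old components
  -- to which it has an edge.
  components : ∀ W → Unique W → Labelling W
  components [] _ = record { label = id ; label-∈ = id ; edge-label = λ () ; label-linked = λ () }
  components (v ∷ W) u@(_ ∷ u′) = record
    { label = λ x → new (touched? x) x
    ; label-∈ = λ {x} p → new-∈ (touched? x) p
    ; edge-label = λ {x} {y} p q e → new-edge (touched? x) (touched? y) p q e
    ; label-linked = λ {x} {y} p q e → new-linked (touched? x) (touched? y) p q e
    }
    where
    old = components W u′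
    Touched : V → Set
    Touched x = x ≡ v ⊎ Any (λ u → label old u ≡ label old x × E v u) W
    touched? : ∀ x → Dec (Touched x)
    touched? x = (x ≟ v) ⊎-dec any? (λ u → (label old u ≟ label old x) ×-dec E? v u) W
    new : ∀ {x} → Dec (Touched x) → V → V
    new (yes _) x = v
    new (no _) x = label old x
    within : ∀ {x} → ¬ Touched x → x ∈ v ∷ W → x ∈ W
    within t (here e) = ⊥-elim (t (inj₁ e))
    within t (there p) = p
    new-∈ : ∀ {x} (t : Dec (Touched x)) → x ∈ v ∷ W → new t x ∈ v ∷ W
    new-∈ (yes _) _ = here refl
    new-∈ (no t) p = there (label-∈ old (within t p))
    blocked : ∀ {x y} → Touched x → x ∈ v ∷ W → ¬ Touched y → y ∈ W → ¬ E x y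
    blocked _ (here refl) t q e = t (inj₂ (lose q (refl , e)))
    blocked (inj₁ refl) (there p) t q e = head∉ u p
    blocked (inj₂ s) (there p) t q e with w , w∈ , e′ , e″ ← find s =
      t (inj₂ (lose w∈ (≡-trans e′ (edge-label old p q e) , e″)))
    new-edge : ∀ {x y} (t : Dec (Touched x)) (t′ : Dec (Touched y)) → x ∈ v ∷ W → y ∈ v ∷ W → E x y → new t x ≡ new t′ y
    new-edge (yes _) (yes _) _ _ _ = refl
    new-edge (yes t) (no t′) p q e = ⊥-elim (blocked t p t′ (within t′ q) e)
    new-edge (no t) (yes t′) p q e = ⊥-elim (blocked t′ q t (within t p) (sy e))
    new-edge (no t) (no t′) p q e = edge-label old (within t p) (within t′ q) e
    lift : ∀ {x y} → Linked W x y → Linked (v ∷ W) x y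
    lift = Star.map λ (p , q , e) → there p , there q , e
    hub : ∀ {x} → Touched x → x ∈ v ∷ W → Linked (v ∷ W) x v
    hub (inj₁ refl) _ = ε
    hub (inj₂ s) (here refl) = ε
    hub (inj₂ s) (there p) with w , w∈ , e , e′ ← find s =
      lift (label-linked old p w∈ (≡-sym e)) ◅◅ ((there w∈ , here refl , sy e′) ◅ ε)
    reversed : ∀ {x y} → Linked (v ∷ W) x y → Linked (v ∷ W) y x
    reversed = Star.reverse λ (p , q , e) → q , p , sy e
    new-linked : ∀ {x y} (t : Dec (Touched x)) (t′ : Dec (Touched y)) → x ∈ v ∷ W → y ∈ v ∷ W → new t x ≡ new t′ y → Linked (v ∷ W) x y
    new-linked (yes t) (yes t′) p q _ = hub t p ◅◅ reversed (hub t′ q)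
    new-linked (yes t) (no t′) p q e = ⊥-elim (head∉ u (subst (_∈ W) (≡-sym e) (label-∈ old (within t′ q))))
    new-linked (no t) (yes t′) p q e = ⊥-elim (head∉ u (subst (_∈ W) e (label-∈ old (within t p))))
    new-linked (no t) (no t′) p q e = lift (label-linked old (within t p) (within t′ q) e)

module GallaiPartition {V C : Set} (_≟_ : DecidableEquality V) (_≟c_ : DecidableEquality C)
  (col : V → V → C) (col-sym : ∀ x y → col x y ≡ col y x)
  (gallai : ∀ {x y z} → x ≢ y → y ≢ z → x ≢ z → col x y ≡ col y z ⊎ col y z ≡ col x z ⊎ col x y ≡ col x z) where

  _∈₂_,_ : C → C → C → Set
  c ∈₂ r , b = c ≡ r ⊎ c ≡ b

  pair? : ∀ c r b → Dec (c ∈₂ r , b)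
  pair? c r b = (c ≟c r) ⊎-dec (c ≟c b)

  record Partition (W : List V) : Set where
    field
      r b : C
      label : V → V
      two-colours : ∀ {x y} → x ∈ W → y ∈ W → label x ≢ label y → col x y ∈₂ r , b
      homogeneous : ∀ {x x′ y} → x ∈ W → x′ ∈ W → y ∈ W → label x ≡ label x′ → label x ≢ label y → col x y ≡ col x′ y
      separated : ∃₂ λ x y → x ∈ W × y ∈ W × label x ≢ label y

  -- A weak form of a Gallai partition, with two sides that need not be homogeneous. This is all
  -- that the induction on vertices produces directly.
  record Cut (W : List V) : Set₁ where
    field
      r b : C
      Side : V → Set
      side? : ∀ x → Dec (Side x)
      inside : ∃ λ x → x ∈ W × Side x
      outside : ∃ λ x → x ∈ W × ¬ Side x
      cross : ∀ {x y} → x ∈ W → y ∈ W → Side x → ¬ Side y → col x y ∈₂ r , b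

  -- The classes are the components of the graph of all edges coloured neither r
  -- nor b: by the Gallai condition every outside vertex sees both ends of such
  -- an edge in the same colour.
  cut⇒partition : ∀ W → Unique W → Cut W → Partition W
  cut⇒partition W u cut = record
    { r = r ; b = b ; label = label
    ; two-colours = rb
    ; homogeneous = λ p p′ q e ne → along (label-linked p p′ e) p q ne
    ; separated = apart
    }
    where
    open Cut cut
    E : V → V → Set
    E x y = x ≢ y × ¬ (col x y ∈₂ r , b)
    E-sym : Symmetric E
    E-sym {x} {y} (ne , h) = ne ∘ ≡-sym , λ h′ → h (subst (_∈₂ r , b) (col-sym y x) h′)
    open Components _≟_ E-sym (λ x y → ¬? (x ≟ y) ×-dec ¬? (pair? (col x y) r b))
    open Labelling (components W u)
    rb : ∀ {x y} → x ∈ W → y ∈ W → label x ≢ label y → col x y ∈₂ r , b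
    rb {x} {y} p q ne = decidable-stable (pair? (col x y) r b) λ h →
      ne (edge-label p q ((λ e → ne (cong label e)) , h))
    along : ∀ {x x′ y} → Linked W x x′ → x ∈ W → y ∈ W → label x ≢ label y → col x y ≡ col x′ y
    along ε _ _ _ = refl
    along {x} {x′} {y} (_◅_ {j = w} (p , p′ , ne , h) s) _ q d =
      ≡-trans (one (gallai ne w≢y (λ e → d (cong label e)))) (along s p′ q d′)
      where
      ew : label x ≡ label w
      ew = edge-label p p′ (ne , h)
      d′ : label w ≢ label y
      d′ e = d (≡-trans ew e)
      w≢y : w ≢ y
      w≢y e = d′ (cong label e)
      one : col x w ≡ col w y ⊎ col w y ≡ col x y ⊎ col x w ≡ col x y → col x y ≡ col w y
      one (inj₁ e) = ⊥-elim (h (subst (_∈₂ r , b) (≡-sym e) (rb p′ q d′)))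
      one (inj₂ (inj₁ e)) = ≡-sym e
      one (inj₂ (inj₂ e)) = ⊥-elim (h (subst (_∈₂ r , b) (≡-sym e) (rb p q d)))
    stays : ∀ {x y} → Linked W x y → Side x → Side y
    stays ε s = s
    stays (_◅_ {j = w} (p , q , _ , h) l) s = stays l (decidable-stable (side? w) λ ns → h (cross p q s ns))
    apart : ∃₂ λ x y → x ∈ W × y ∈ W × label x ≢ label y
    apart with x , p , s ← inside | y , q , ns ← outside = x , y , p , q , λ e → ns (stays (label-linked p q e) s)

  -- If some class sees v in r and b only, it forms one side of a cut in the same colours. Otherwise
  -- every class has a vertex whose edge to v is neither r nor b; all these edges have one colour g,
  -- and the edges from v to the other vertices of `W` have one further colour. Those other vertices
  -- then form one side, or v alone does if there are none.
  extend-cut : ∀ v W → v ∉ W → Partition W → Cut (v ∷ W)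
  extend-cut v W v∉ P with any? (λ u → All.all? (λ x → ¬? (label x ≟ label u) ⊎-dec pair? (col v x) r b) W) W
    where open Partition P
  ... | yes some with u , u∈ , good ← find some = record
    { r = r ; b = b
    ; Side = λ x → x ≢ v × label x ≡ label u
    ; side? = λ x → ¬? (x ≟ v) ×-dec (label x ≟ label u)
    ; inside = u , there u∈ , (λ { refl → v∉ u∈ }) , refl
    ; outside = v , here refl , λ s → proj₁ s refl
    ; cross = crossing′
    }
    where
    open Partition P
    crossing′ : ∀ {x y} → x ∈ v ∷ W → y ∈ v ∷ W → x ≢ v × label x ≡ label u → ¬ (y ≢ v × label y ≡ label u) → col x y ∈₂ r , b
    crossing′ (here e) _ (ne , _) _ = ⊥-elim (ne e)
    crossing′ {x} (there p) (here refl) (_ , e) _ with All.lookup good p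
    ... | inj₁ h = ⊥-elim (h e)
    ... | inj₂ h = subst (_∈₂ r , b) (col-sym v x) h
    crossing′ (there p) (there q) (_ , e) s = two-colours p q λ e′ → s ((λ { refl → v∉ q }) , ≡-trans (≡-sym e′) e)
  ... | no none = rest
    where
    open Partition P
    ≢v : ∀ {x} → x ∈ W → v ≢ x
    ≢v p refl = v∉ p
    Z : V → Set
    Z x = ¬ (col v x ∈₂ r , b)
    meets : ∀ {u} → u ∈ W → ∃ λ z → z ∈ W × label z ≡ label u × Z z
    meets {u} u∈ with any? (λ x → (label x ≟ label u) ×-dec ¬? (pair? (col v x) r b)) W
    ... | yes s with z , z∈ , e , h ← find s = z , z∈ , e , h
    ... | no s = ⊥-elim (none (lose u∈ (All.tabulate λ {x} x∈ → choose x∈ (label x ≟ label u) (pair? (col v x) r b))))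
      where
      choose : ∀ {x} → x ∈ W → Dec (label x ≡ label u) → Dec (col v x ∈₂ r , b) → ¬ (label x ≡ label u) ⊎ (col v x ∈₂ r , b)
      choose _ (no d) _ = inj₁ d
      choose _ (yes d) (yes h) = inj₂ h
      choose x∈ (yes d) (no h) = ⊥-elim (s (lose x∈ (d , h)))
    agree : ∀ {z z′} → z ∈ W → z′ ∈ W → Z z → Z z′ → label z ≢ label z′ → col v z ≡ col v z′
    agree {z} {z′} p p′ h h′ d with gallai (≢v p) (λ e → d (cong label e)) (≢v p′)
    ... | inj₁ e = ⊥-elim (h (subst (_∈₂ r , b) (≡-sym e) (two-colours p p′ d)))
    ... | inj₂ (inj₁ e) = ⊥-elim (h′ (subst (_∈₂ r , b) e (two-colours p p′ d)))
    ... | inj₂ (inj₂ e) = e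
    other : ∀ x → x ∈ W → ∃ λ z → z ∈ W × label z ≢ label x × Z z
    other x x∈ with u₁ , u₂ , p₁ , p₂ , d ← separated with label u₁ ≟ label x
    ... | no d₁ with z , z∈ , e , h ← meets p₁ = z , z∈ , (λ e′ → d₁ (≡-trans (≡-sym e) e′)) , h
    ... | yes d₁ with z , z∈ , e , h ← meets p₂ = z , z∈ , (λ e′ → d (≡-trans d₁ (≡-trans (≡-sym e′) e))) , h
    z₀∃ : ∃ λ z → z ∈ W × Z z
    z₀∃ with u₁ , _ , p₁ , _ ← separated with z , z∈ , _ , h ← meets p₁ = z , z∈ , h
    z₀ = proj₁ z₀∃
    g = col v z₀
    all-g : ∀ {z} → z ∈ W → Z z → col v z ≡ g
    all-g {z} p h with label z ≟ label z₀
    ... | no d = agree p (proj₁ (proj₂ z₀∃)) h (proj₂ (proj₂ z₀∃)) d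
    -- Within one class `agree` says nothing, so the comparison passes through a vertex of another
    -- class.
    ... | yes d with z₂ , p₂ , d₂ , h₂ ← other z p =
      ≡-trans (agree p p₂ h h₂ (d₂ ∘ ≡-sym)) (agree p₂ (proj₁ (proj₂ z₀∃)) h₂ (proj₂ (proj₂ z₀∃)) λ e → d₂ (≡-trans e (≡-sym d)))
    -- An edge from y to a class not containing y repeats the colour of v y,
    -- since every class contains a vertex z with v z coloured g.
    spread : ∀ {y w} → y ∈ W → w ∈ W → col v y ∈₂ r , b → label y ≢ label w → col y w ≡ col v y
    spread {y} {w} p q h d with z , z∈ , e , hz ← meets q =
      ≡-trans (≡-trans (col-sym y w) (≡-trans (homogeneous q z∈ p (≡-sym e) (d ∘ ≡-sym)) (col-sym z y))) (one (gallai (≢v p) (λ e′ → d′ (cong label e′)) (≢v z∈)))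
      where
      d′ : label y ≢ label z
      d′ e′ = d (≡-trans e′ e)
      one : col v y ≡ col y z ⊎ col y z ≡ col v z ⊎ col v y ≡ col v z → col y z ≡ col v y
      one (inj₁ e′) = ≡-sym e′
      one (inj₂ (inj₁ e′)) = ⊥-elim (hz (subst (_∈₂ r , b) e′ (two-colours p z∈ d′)))
      one (inj₂ (inj₂ e′)) = ⊥-elim (hz (subst (_∈₂ r , b) e′ h))
    same-colour : ∀ {y y′} → y ∈ W → y′ ∈ W → col v y ∈₂ r , b → col v y′ ∈₂ r , b → col v y ≡ col v y′
    same-colour {y} {y′} p p′ h h′ with label y ≟ label y′
    ... | no d = ≡-trans (≡-sym (spread p p′ h d)) (≡-trans (col-sym y y′) (spread p′ p h′ (d ∘ ≡-sym)))
    ... | yes d with z , z∈ , dz , _ ← other y p =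
      ≡-trans (≡-sym (spread p z∈ h (dz ∘ ≡-sym))) (≡-trans (homogeneous p p′ z∈ d (dz ∘ ≡-sym))
        (spread p′ z∈ h′ λ e → dz (≡-sym (≡-trans d e))))
    rest : Cut (v ∷ W)
    rest with any? (λ y → pair? (col v y) r b) W
    ... | no noY = record
      { r = g ; b = g
      ; Side = _≡ v ; side? = _≟ v
      ; inside = v , here refl , refl
      ; outside = z₀ , there (proj₁ (proj₂ z₀∃)) , λ e → ≢v (proj₁ (proj₂ z₀∃)) (≡-sym e)
      ; cross = λ { _ (here e) refl ne → ⊥-elim (ne e) ; _ (there q) refl _ → inj₁ (all-g q λ h → noY (lose q h)) }
      }
    ... | yes someY with y₀ , y₀∈ , h₀ ← find someY = record
      { r = col v y₀ ; b = g
      ; Side = λ x → x ≢ v × col v x ∈₂ r , b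
      ; side? = λ x → ¬? (x ≟ v) ×-dec pair? (col v x) r b
      ; inside = y₀ , there y₀∈ , (λ e → ≢v y₀∈ (≡-sym e)) , h₀
      ; outside = v , here refl , λ s → proj₁ s refl
      ; cross = crossing′
      }
      where
      crossing′ : ∀ {x y} → x ∈ v ∷ W → y ∈ v ∷ W → x ≢ v × col v x ∈₂ r , b → ¬ (y ≢ v × col v y ∈₂ r , b) → col x y ∈₂ col v y₀ , g
      crossing′ (here e) _ (ne , _) _ = ⊥-elim (ne e)
      crossing′ {x} (there p) (here refl) (_ , h) _ = inj₁ (≡-trans (col-sym x v) (same-colour p y₀∈ h h₀))
      crossing′ {x} {y} (there p) (there q) (_ , h) s = one (gallai (≢v p) (λ e → hy (subst (λ w → col v w ∈₂ r , b) e h)) (≢v q))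
        where
        hy : Z y
        hy h′ = s ((λ e → ≢v q (≡-sym e)) , h′)
        one : col v x ≡ col x y ⊎ col x y ≡ col v y ⊎ col v x ≡ col v y → col x y ∈₂ col v y₀ , g
        one (inj₁ e) = inj₁ (≡-trans (≡-sym e) (same-colour p y₀∈ h h₀))
        one (inj₂ (inj₁ e)) = inj₂ (≡-trans e (all-g q hy))
        one (inj₂ (inj₂ e)) = ⊥-elim (hy (subst (_∈₂ r , b) e h))

  partition : ∀ W → Unique W → 2 ≤ length W → Partition W
  partition (x ∷ []) u (s≤s ())
  partition (x ∷ y ∷ []) u _ = cut⇒partition (x ∷ y ∷ []) u record
    { r = col x y ; b = col x y
    ; Side = _≡ x ; side? = _≟ x
    ; inside = x , here refl , refl
    ; outside = y , there (here refl) , λ { refl → head∉ u (here refl) }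
    ; cross = λ { _ (here e) refl ne → ⊥-elim (ne e) ; _ (there (here refl)) refl _ → inj₁ refl }
    }
  partition (x ∷ W@(_ ∷ _ ∷ _)) u@(_ ∷ u′) _ =
    cut⇒partition (x ∷ W) u (extend-cut x W (head∉ u) (partition W u′ (s≤s (s≤s z≤n))))

-- Covering by two paths

module _ {V : Set} {R : V → V → Set} where

  interleave : List V → List V → List V
  interleave (x ∷ xs) (y ∷ ys) = x ∷ y ∷ interleave xs ys
  interleave _ ys = ys

  interleave-↭ : ∀ xs ys → length xs ≤ length ys → interleave xs ys ↭ xs ++ ys
  interleave-↭ [] ys _ = ↭-refl
  interleave-↭ (x ∷ xs) (y ∷ ys) (s≤s h) = prep x (↭-trans (prep y (interleave-↭ xs ys h)) (↭-sym (shift y xs ys)))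

  Path-interleave : ∀ x xs {y z ys} → Path R y z ys → length (x ∷ xs) ≤ length ys →
    (∀ {a b} → a ∈ x ∷ xs → b ∈ ys → R a b × R b a) → Path R x z (interleave (x ∷ xs) ys)
  Path-interleave x [] stop _ c = proj₁ (c (here refl) (here refl)) ◂ stop
  Path-interleave x (_ ∷ _) stop (s≤s ()) c
  Path-interleave x [] (s ◂ p) _ c = proj₁ (c (here refl) (here refl)) ◂ (s ◂ p)
  Path-interleave x (x′ ∷ xs) (s ◂ p) (s≤s h) c =
    proj₁ (c (here refl) (here refl)) ◂ proj₂ (c (there (here refl)) (here refl)) ◂
    Path-interleave x′ xs p h (λ a b → c (there a) (there b))

  Path-take : ∀ {x z vs} k → Path R x z vs → 0 < k → k ≤ length vs → ∃ λ y → Path R x y (take k vs)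
  Path-take (suc k) stop _ _ = _ , subst (Path R _ _) (≡-sym (cong (_ ∷_) (take-[] k))) stop
    where
    take-[] : ∀ k → take k [] ≡ []
    take-[] zero = refl
    take-[] (suc k) = refl
  Path-take (suc zero) (s ◂ p) _ _ = _ , stop
  Path-take (suc (suc k)) (s ◂ p) _ (s≤s h) with y , q ← Path-take (suc k) p (s≤s z≤n) h = y , s ◂ q

  -- The vertices of `X` are inserted between the first vertices of the path, which is cut to m -
  -- |X| vertices; the last vertex of the path is joined back to `X`. Because the rest of the path
  -- is followed along its own edges, both parities of m are possible.
  hinge-cycle : ∀ {x z vs} m X → Path R x z vs → Unique vs → Unique X → 0 < length X →
    (∀ {a b} → a ∈ X → b ∈ vs → R a b × R b a) → (∀ {v} → v ∈ X → v ∉ vs) →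
    2 * length X ≤ m → m ≤ length vs + length X → HasCycle R m
  hinge-cycle {vs = vs} m X@(a ∷ X′) p u uX _ c dis h h′
    with k ← m ∸ length X in ek
    with hk ← +-cancelʳ-≤ (length X) (length X) k (≤-trans (≤-reflexive (≡-trans (cong (length X +_) (≡-sym (+-identityʳ (length X)))) refl))
      (≤-trans h (≤-trans (≤-reflexive (≡-sym (m∸n+n≡m (≤-trans (m≤m+n (length X) _) h)))) (≤-reflexive (cong (_+ length X) ek)))))
    with hv ← ≤-trans (≤-reflexive (≡-sym ek)) (m≤n+o⇒m∸n≤o m (length X) (≤-trans h′ (≤-reflexive (+-comm (length vs) (length X)))))
    with y , q ← Path-take k p (≤-trans (s≤s z≤n) hk) hv =
    interleave X ws , a , y , Path-interleave a X′ q lw (λ α β → c α (∈-take k β)) ,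
    proj₂ (c (here refl) (∈-take k (Path-last∈ q))) ,
    Unique-resp-↭ (↭-sym il) (Unique-++⁺ uX (Uniqueₚ.take⁺ k u) λ α β → dis α (∈-take k β)) ,
    ≡-trans (↭-length il) (≡-trans (length-++ X) (≡-trans (cong (length X +_) (length-take-≤ k vs hv))
      (≡-trans (cong (length X +_) (≡-sym ek)) (m+[n∸m]≡n (≤-trans (m≤m+n (length X) _) h)))))
    where
    ws = take k vs
    lw : length X ≤ length ws
    lw = ≤-trans hk (≤-reflexive (≡-sym (length-take-≤ k vs hv)))
    il : interleave X ws ↭ X ++ ws
    il = interleave-↭ X ws lw

  Trail : List V → Set
  Trail vs = vs ≡ [] ⊎ ∃₂ λ x z → Path R x z vs

  Path-tail : ∀ {x z v vs} → Path R x z (v ∷ vs) → Trail vs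
  Path-tail stop = inj₁ refl
  Path-tail (_ ◂ p) = inj₂ (_ , _ , p)

module PathPartition {V : Set} (_≟_ : DecidableEquality V) (W : List V) (uW : Unique W)
  (lab : V → ℕ) (χ : V → V → Bool) (χ-sym : ∀ x y → χ x y ≡ χ y x)
  (homog : ∀ {x x′ y} → x ∈ W → x′ ∈ W → y ∈ W → lab x ≡ lab x′ → lab x ≢ lab y → χ x y ≡ χ x′ y)
  (g : ℕ) (classBound : ClassBound lab (suc g) W) where

  private
    A[_] = Adj W lab χ
    asym : ∀ c → Symmetric A[ c ]
    asym c = Adj-sym W lab χ χ-sym c

  -- The argument of Gerencsér and Gyárfás for covering a two-coloured complete graph by a red and a
  -- blue path. With grey edges it stops only when all uncovered vertices lie in the classes of the
  -- two starting points.
  record Result : Set where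
    field
      Rs Bs Us : List V
      red-trail : Trail {R = A[ true ]} Rs
      blue-trail : Trail {R = A[ false ]} Bs
      whole : Rs ++ Bs ++ Us ↭ W
      few : length Us ≤ 2 * g

  private
    -- The classes of r and b have at most g + 1 vertices, and r and b themselves are covered.
    few-left : ∀ {r b Us} → Unique Us → Us ⊆ W → r ∈ W → b ∈ W → r ∉ Us → b ∉ Us →
      (∀ {u} → u ∈ Us → lab r ≡ lab u ⊎ lab b ≡ lab u) → length Us ≤ 2 * g
    few-left {r} {b} {Us} u s r∈ b∈ r∉ b∉ h = ≤-trans (length-cover (same? lab r) (same? lab b) Us h)
      (≤-trans (+-mono-≤ (part r∈ r∉) (part b∈ b∉)) (≤-reflexive (cong (g +_) (≡-sym (+-identityʳ g)))))
      where
      part : ∀ {x} → x ∈ W → x ∉ Us → length (filter (same? lab x) Us) ≤ g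
      part {x} x∈ x∉ = ≤-pred (classBound (x ∷ filter (same? lab x) Us)
        (Unique-cons (λ p → x∉ (proj₁ (∈-filter⁻ (same? lab x) p))) (Uniqueₚ.filter⁺ _ u))
        (λ { (here refl) → x∈ ; (there p) → s (proj₁ (∈-filter⁻ (same? lab x) p)) })
        (λ p q → ≡-trans (≡-sym (val p)) (val q)))
        where
        val : ∀ {y} → y ∈ x ∷ filter (same? lab x) Us → lab x ≡ lab y
        val (here refl) = refl
        val (there p) = proj₂ (∈-filter⁻ (same? lab x) {xs = Us} p)

    shift₂ : ∀ (Rs Bs : List V) {u us Us} → Us ↭ u ∷ us → u ∷ Rs ++ Bs ++ us ↭ Rs ++ Bs ++ Us
    shift₂ Rs Bs {u} {us} p = ↭-trans (↭-trans (↭-sym (shift u Rs (Bs ++ us))) (++⁺ˡ Rs (↭-sym (shift u Bs us)))) (++⁺ˡ Rs (++⁺ˡ Bs (↭-sym p)))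

    shift₃ : ∀ (Rs Bs : List V) {u us Us} → Us ↭ u ∷ us → Rs ++ (u ∷ Bs) ++ us ↭ Rs ++ Bs ++ Us
    shift₃ Rs Bs {u} {us} p = ++⁺ˡ Rs (↭-trans (↭-sym (shift u Bs us)) (++⁺ˡ Bs (↭-sym p)))

  -- A vertex u outside the classes of the ends r, b extends one of the two paths,
  -- or u r is blue and u b is red; then the edge r b moves r or b to the other path.
  grow : ∀ k Rs Bs Us → length Us ≤ k → Trail {R = A[ true ]} Rs → Trail {R = A[ false ]} Bs → Rs ++ Bs ++ Us ↭ W → Result
  grow k Rs Bs [] h tr tb w = record { Rs = Rs ; Bs = Bs ; Us = [] ; red-trail = tr ; blue-trail = tb ; whole = w ; few = z≤n }
  grow (suc k) Rs Bs (u ∷ Us) (s≤s h) (inj₁ refl) tb w =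
    grow k (u ∷ []) Bs Us h (inj₂ (u , u , stop)) tb (↭-trans (shift₂ [] Bs ↭-refl) w)
  grow (suc k) Rs Bs (u ∷ Us) (s≤s h) (inj₂ tr) (inj₁ refl) w =
    grow k Rs (u ∷ []) Us h (inj₂ tr) (inj₂ (u , u , stop)) (↭-trans (shift₃ Rs [] ↭-refl) w)
  grow (suc k) Rs Bs Us@(_ ∷ _) h (inj₂ (r , z , p)) (inj₂ (b , y , q)) w
    with any? (λ u → ¬? (same? lab r u) ×-dec ¬? (same? lab b u)) Us
  ... | no none = record { Rs = Rs ; Bs = Bs ; Us = Us ; red-trail = inj₂ (r , z , p) ; blue-trail = inj₂ (b , y , q) ; whole = w
      ; few = few-left (Unique-++⁻ʳ Bs (Unique-++⁻ʳ Rs uall)) (λ m → in-W (∈-++⁺ʳ Rs (∈-++⁺ʳ Bs m)))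
          (in-W (∈-++⁺ˡ (Path-head∈ p))) (in-W (∈-++⁺ʳ Rs (∈-++⁺ˡ (Path-head∈ q))))
          (λ m → Unique-disjoint Rs uall (Path-head∈ p) (∈-++⁺ʳ Bs m))
          (Unique-disjoint Bs (Unique-++⁻ʳ Rs uall) (Path-head∈ q)) cover }
    where
    uall : Unique (Rs ++ Bs ++ Us)
    uall = Unique-resp-↭ (↭-sym w) uW
    in-W : ∀ {v} → v ∈ Rs ++ Bs ++ Us → v ∈ W
    in-W = ∈-resp-↭ w
    cover : ∀ {u} → u ∈ Us → lab r ≡ lab u ⊎ lab b ≡ lab u
    cover {u} m with same? lab r u | same? lab b u
    ... | yes e | _ = inj₁ e
    ... | no _ | yes e = inj₂ e
    ... | no d | no d′ = ⊥-elim (none (lose m (d , d′)))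
  ... | yes some with u , u∈ , dr , db ← find some with us , e ← ↭-head u∈ = extend (χ u r) (χ u b) refl refl
    where
    in-W : ∀ {v} → v ∈ Rs ++ Bs ++ Us → v ∈ W
    in-W = ∈-resp-↭ w
    u∈W : u ∈ W
    u∈W = in-W (∈-++⁺ʳ Rs (∈-++⁺ʳ Bs u∈))
    r∈W : r ∈ W
    r∈W = in-W (∈-++⁺ˡ (Path-head∈ p))
    b∈W : b ∈ W
    b∈W = in-W (∈-++⁺ʳ Rs (∈-++⁺ˡ (Path-head∈ q)))
    hk : length us ≤ k
    hk = ≤-pred (≤-trans (≤-reflexive (≡-sym (↭-length e))) h)
    rs = proj₁ (Path-cons p)
    er : Rs ≡ r ∷ rs
    er = proj₂ (Path-cons p)
    bs = proj₁ (Path-cons q)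
    eb : Bs ≡ b ∷ bs
    eb = proj₂ (Path-cons q)
    extend : ∀ c c′ → χ u r ≡ c → χ u b ≡ c′ → Result
    extend true c′ e₁ e₂ = grow k (u ∷ Rs) Bs us hk (inj₂ (u , z , (u∈W , r∈W , (dr ∘ ≡-sym) , e₁) ◂ p)) (inj₂ (b , y , q))
      (↭-trans (shift₂ Rs Bs e) w)
    extend false false e₁ e₂ = grow k Rs (u ∷ Bs) us hk (inj₂ (r , z , p)) (inj₂ (u , y , (u∈W , b∈W , (db ∘ ≡-sym) , e₂) ◂ q))
      (↭-trans (shift₃ Rs Bs e) w)
    extend false true e₁ e₂ with same? lab r b
    -- If r and b were in one class, homogeneity would give u the same colour to both.
    ... | yes l = contradiction (≡-trans (≡-sym e₁) (≡-trans (≡-trans (χ-sym u r) (≡-trans (homog r∈W b∈W u∈W l dr) (χ-sym b u))) e₂)) λ ()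
    ... | no l with χ r b in e₃
    ...   | true = grow k (u ∷ b ∷ Rs) bs us hk
      (inj₂ (u , z , (u∈W , b∈W , (db ∘ ≡-sym) , e₂) ◂ (b∈W , r∈W , (l ∘ ≡-sym) , ≡-trans (χ-sym b r) e₃) ◂ p))
      (Path-tail (subst (Path A[ false ] b y) eb q))
      (↭-trans (prep u (↭-sym (shift b Rs (bs ++ us)))) (↭-trans (shift₂ Rs (b ∷ bs) e)
        (↭-trans (↭-reflexive (cong (λ l → Rs ++ l ++ Us) (≡-sym eb))) w)))
    ...   | false = grow k rs (u ∷ r ∷ Bs) us hk (Path-tail (subst (Path A[ true ] r z) er p))
      (inj₂ (u , y , (u∈W , r∈W , (dr ∘ ≡-sym) , e₁) ◂ (r∈W , b∈W , l , e₃) ◂ q))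
      (↭-trans (shift₃ rs (r ∷ Bs) e) (↭-trans (shift r rs (Bs ++ Us))
        (↭-trans (↭-reflexive (cong (λ l → l ++ Bs ++ Us) (≡-sym er))) w)))

  result : Result
  result = grow (length W) [] [] W ≤-refl (inj₁ refl) (inj₁ refl) ↭-refl

-- Induction on the number of colours

-- The only facts that depend on certificates. The first is sharp and settles two colours; the
-- second is needed for three or more colours, where the induction leaves slack.
UngreyedBound GreyedBound : Set → ℕ → Set
UngreyedBound V j =
  ∀ W → Unique W → (lab : V → ℕ) (χ : V → V → Bool) → (∀ x y → χ x y ≡ χ y x) →
  (∀ {x y} → x ∈ W → y ∈ W → lab x ≡ lab y → x ≡ y) →
  (∀ c → ¬ HasCycle (Adj W lab χ c) (2 * (2 + j) + 1)) → length W ≡ suc (4 * (2 + j)) → ⊥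
GreyedBound V j =
  ∀ W → Unique W → (lab : V → ℕ) (χ : V → V → Bool) → (∀ x y → χ x y ≡ χ y x) →
  (∀ {x x′ y} → x ∈ W → x′ ∈ W → y ∈ W → lab x ≡ lab x′ → lab x ≢ lab y → χ x y ≡ χ x′ y) →
  ClassBound lab (suc j) W → (∀ c → ¬ HasCycle (Adj W lab χ c) (2 * (2 + j) + 1)) → 7 * (2 + j) + 2 ≤ length W → ⊥

module Induction {V C : Set} (_≟_ : DecidableEquality V) (_≟c_ : DecidableEquality C)
  (code : V → ℕ) (code-inj : ∀ {x y} → code x ≡ code y → x ≡ y)
  (col : V → V → C) (col-sym : ∀ x y → col x y ≡ col y x)
  (gallai : ∀ {x y z} → x ≢ y → y ≢ z → x ≢ z → col x y ≡ col y z ⊎ col y z ≡ col x z ⊎ col x y ≡ col x z)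
  (j : ℕ)
  (noCycle : ∀ c → ¬ HasCycle (λ x y → x ≢ y × col x y ≡ c) (2 * (2 + j) + 1))
  (noGrey : UngreyedBound V j)
  (grey : GreyedBound V j)
  where

  open import Data.List.Membership.DecPropositional _≟_ using (_∈?_)

  n : ℕ
  n = 2 + j

  Mono : C → V → V → Set
  Mono c x y = x ≢ y × col x y ≡ c

  Mono-sym : ∀ c → Symmetric (Mono c)
  Mono-sym c {x} {y} (ne , e) = ne ∘ ≡-sym , ≡-trans (col-sym y x) e

  Mono-irrefl : ∀ c {v} → ¬ Mono c v v
  Mono-irrefl c (ne , _) = ne refl

  module M (c : C) = Bipartite _≟_ {R = Mono c} (Mono-sym c) (Mono-irrefl c) j

  Joined : C → List V → List V → Set
  Joined c A B = ∀ {x y} → x ∈ A → y ∈ B → Mono c x y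

  weight : (C → List V) → List C → ℕ
  weight X L = sum (map (length ∘ X) L)

  -- The sets X c stand for vertices already split off: X c is joined to W in
  -- colour c, and edges inside X c are never used.
  record Config (L : List C) (W : List V) (X : C → List V) : Set where
    field
      L-unique : Unique L
      W-unique : Unique W
      colours : ∀ {x y} → x ∈ W → y ∈ W → x ≢ y → col x y ∈ L
      X-unique : ∀ {c} → c ∈ L → Unique (X c)
      X-joined : ∀ {c} → c ∈ L → Joined c (X c) W
      X-small : ∀ {c} → c ∈ L → length (X c) ≤ suc j

  -- Counting the attached vertices together with `W` makes absorption free: moving vertices from
  -- `W` into the sets `X c` leaves the sum unchanged.
  Bounded : ℕ → Set
  Bounded k = ∀ L W X → length L ≡ k → Config L W X → length W + weight X L ≤ n * 2 ^ k

  weight≤ : ∀ X L → (∀ {c} → c ∈ L → length (X c) ≤ suc j) → weight X L ≤ length L * suc j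
  weight≤ X [] _ = z≤n
  weight≤ X (c ∷ L) h = +-mono-≤ (h (here refl)) (weight≤ X L (h ∘ there))

  -- The sets attached in k + 1 colours leave room for n + 1 further vertices within the bound. For
  -- one colour this is the equality (n - 1) + (n + 1) = 2n.
  room : ∀ k → suc k * suc j + suc n ≤ n * 2 ^ suc k
  room zero = ≤-reflexive (arith j)
    where
    arith : ∀ j → 1 * suc j + suc (2 + j) ≡ (2 + j) * (2 * 1)
    arith = solve-∀
  room (suc k) = ≤-trans (≤-reflexive (arith₁ (suc k * suc j) j)) (≤-trans (+-mono-≤ (room k) (room₁ k)) (≤-reflexive (arith₂ (2 + j) (2 ^ suc k))))
    where
    arith₁ : ∀ a j → suc j + a + suc (2 + j) ≡ a + suc (2 + j) + suc j
    arith₁ = solve-∀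
    arith₂ : ∀ a b → a * b + a * b ≡ a * (2 * b)
    arith₂ = solve-∀
    room₁ : ∀ k → suc j ≤ n * 2 ^ suc k
    room₁ k = ≤-trans (≤-trans (m≤m+n (suc j) (k * suc j)) (m≤m+n _ (suc n))) (room k)

  bounded₀ : Bounded 0
  bounded₀ [] [] X _ _ = z≤n
  bounded₀ [] (x ∷ []) X _ _ = s≤s z≤n
  bounded₀ [] (x ∷ y ∷ W) X _ cfg with W-unique | colours (here refl) (there (here refl)) (λ { refl → head∉ W-unique (here refl) })
    where open Config cfg
  ... | _ | ()

  same-code-bound : ∀ (z : V) (zs : List V) → Unique zs → (∀ {x} → x ∈ zs → x ≡ z) → length zs ≤ 1
  same-code-bound z zs u h = length-⊆ {ys = z ∷ []} u λ p → here (h p)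

  -- Edges inside `X c` may not be used, so `X c` becomes one class, of fewer than n vertices, and
  -- every vertex of `W` a class of its own; the union is complete multipartite in the only colour.
  bounded₁ : Bounded 1
  bounded₁ (c ∷ []) W X _ cfg with length W + (length (X c) + 0) ≤? n * 2
  ... | yes h = h
  ... | no h = ⊥-elim (noCycle c (Multipartite.multipartite-cycle lab (suc j) uniq
      (≤-trans (≤-reflexive (arith n)) (≤-trans (≰⇒> h) (≤-reflexive (≡-trans (arith′ (length W) (length (X c))) (≡-sym (length-++ (X c)))))))
      bound edge))
    where
    open Config cfg
    arith : ∀ n → 2 * n + 1 ≡ suc (n * 2)
    arith = solve-∀
    arith′ : ∀ w x → w + (x + 0) ≡ x + w
    arith′ = solve-∀
    c∈ : c ∈ c ∷ []
    c∈ = here refl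
    lab : V → ℕ
    lab v with v ∈? X c
    ... | yes _ = 0
    ... | no _ = suc (code v)
    uniq : Unique (X c ++ W)
    uniq = Unique-++⁺ (X-unique c∈) W-unique λ p q → Mono-irrefl c (X-joined c∈ p q)
    bound : ClassBound lab n (X c ++ W)
    bound [] _ _ _ = z≤n
    bound zs@(z ∷ _) u sub al = main (z ∈? X c)
      where
      inX : z ∈ X c → ∀ v → lab v ≡ lab z → v ∈ X c
      inX zX v e with v ∈? X c | z ∈? X c
      ... | yes p | _ = p
      ... | no _ | yes _ = contradiction e λ ()
      ... | no _ | no q = ⊥-elim (q zX)
      eq : z ∉ X c → ∀ v → lab v ≡ lab z → v ≡ z
      eq zX v e with v ∈? X c | z ∈? X c
      ... | _ | yes p = ⊥-elim (zX p)
      ... | yes _ | no _ = contradiction e λ ()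
      ... | no _ | no _ = code-inj (suc-injective e)
      main : Dec (z ∈ X c) → length zs ≤ n
      main (yes zX) = ≤-trans (length-⊆ u λ {v} m → inX zX v (al m (here refl))) (≤-trans (X-small c∈) (n≤1+n _))
      main (no zX) = ≤-trans (same-code-bound z zs u λ {v} m → eq zX v (al m (here refl))) (s≤s z≤n)
    edge : ∀ {x y} → x ∈ X c ++ W → y ∈ X c ++ W → lab x ≢ lab y → Mono c x y
    edge {x} {y} p q ne with x ∈? X c | y ∈? X c
    ... | yes _ | yes _ = contradiction refl ne
    ... | yes xX | no yX = X-joined c∈ xX (outside q yX)
      where
      outside : y ∈ X c ++ W → y ∉ X c → y ∈ W
      outside q h with ∈-++⁻ (X c) q
      ... | inj₁ r = contradiction r h
      ... | inj₂ r = r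
    ... | no xX | yes yX = Mono-sym c (X-joined c∈ yX ([ (λ r → contradiction r xX) , id ]′ (∈-++⁻ (X c) p)))
    ... | no xX | no yX with colours x∈ y∈ x≢y
      where
      x∈ : x ∈ W
      x∈ = [ (λ r → contradiction r xX) , id ]′ (∈-++⁻ (X c) p)
      y∈ : y ∈ W
      y∈ = [ (λ r → contradiction r yX) , id ]′ (∈-++⁻ (X c) q)
      x≢y : x ≢ y
      x≢y e = ne (cong (suc ∘ code) e)
    ...   | here e = (λ e′ → ne (cong (suc ∘ code) e′)) , e

  -- Two colours with attached sets

  module Coloured (r b : C) (W : List V) (uW : Unique W) (lab : V → ℕ)
    (two-colours : ∀ {x y} → x ∈ W → y ∈ W → lab x ≢ lab y → col x y ≡ r ⊎ col x y ≡ b)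
    (homog : ∀ {x x′ y} → x ∈ W → x′ ∈ W → y ∈ W → lab x ≡ lab x′ → lab x ≢ lab y → col x y ≡ col x′ y) where

    χ : V → V → Bool
    χ x y = ⌊ col x y ≟c r ⌋

    χ-sym : ∀ x y → χ x y ≡ χ y x
    χ-sym x y = cong (λ c → ⌊ c ≟c r ⌋) (col-sym x y)

    colour : Bool → C
    colour true = r
    colour false = b

    real : ∀ c {x y} → Adj W lab χ c x y → Mono (colour c) x y
    real true {x} {y} (p , q , ne , e) with col x y ≟c r
    ... | yes h = (λ e′ → ne (cong lab e′)) , h
    ... | no h = contradiction e λ ()
    real false {x} {y} (p , q , ne , e) with col x y ≟c r
    ... | yes h = contradiction e λ ()
    ... | no h with two-colours p q ne
    ...   | inj₁ h′ = contradiction h′ h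
    ...   | inj₂ h′ = (λ e′ → ne (cong lab e′)) , h′

    χ-colour : r ≢ b → ∀ β {x y} → col x y ≡ colour β → χ x y ≡ β
    χ-colour r≢b true {x} {y} e with col x y ≟c r
    ... | yes _ = refl
    ... | no h = contradiction e h
    χ-colour r≢b false {x} {y} e with col x y ≟c r
    ... | yes h = contradiction (≡-trans (≡-sym h) e) r≢b
    ... | no _ = refl

    χ-homog : ∀ {x x′ y} → x ∈ W → x′ ∈ W → y ∈ W → lab x ≡ lab x′ → lab x ≢ lab y → χ x y ≡ χ x′ y
    χ-homog p p′ q e ne = cong (λ c → ⌊ c ≟c r ⌋) (homog p p′ q e ne)

    hinged : ∀ c Y vs → Trail {R = Adj W lab χ c} vs → Unique vs → vs ⊆ W → Unique Y → 0 < length Y →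
      length Y ≤ suc j → Joined (colour c) Y W → length vs + length Y ≤ 2 * n
    hinged c Y vs (inj₁ refl) _ _ _ _ hY _ = ≤-trans hY (≤-trans (n≤1+n _) (m≤m+n n _))
    hinged c Y vs (inj₂ (x , z , p)) u sub uY 0< hY J with length vs + length Y ≤? 2 * n
    ... | yes h = h
    ... | no h = ⊥-elim (noCycle (colour c) (hinge-cycle (2 * n + 1) Y (Path-map (real c) p) u uY 0<
      (λ α β → J α (sub β) , Mono-sym (colour c) (J α (sub β))) (λ α β → Mono-irrefl (colour c) (J α (sub β)))
      (≤-trans (*-monoʳ-≤ 2 (≤-trans hY (n≤1+n _))) (m≤m+n _ 1)) (≤-trans (≤-reflexive (+-comm (2 * n) 1)) (≰⇒> h))))

    -- Each path shares the allowance 2n of `hinged` with the set attached in its colour, so only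
    -- the uncovered vertices, at most 2g, go beyond 4n.
    two-sided : ∀ g → ClassBound lab (suc g) W → ∀ Xr Xb → Unique Xr → Unique Xb → 0 < length Xr → 0 < length Xb →
      length Xr ≤ suc j → length Xb ≤ suc j → Joined r Xr W → Joined b Xb W →
      length W + (length Xr + length Xb) ≤ 4 * n + 2 * g
    two-sided g cb Xr Xb ur ub 0r 0b hr hb Jr Jb =
      ≤-trans (≤-reflexive (≡-trans (cong (_+ (length Xr + length Xb)) (≡-trans (≡-sym (↭-length whole))
        (≡-trans (length-++ Rs) (cong (length Rs +_) (length-++ Bs))))) (arith (length Rs) (length Bs) (length Us) (length Xr) (length Xb))))
      (≤-trans (+-mono-≤ (+-mono-≤ red-bound blue-bound) few) (≤-reflexive (arith′ n g)))
      where
      open PathPartition _≟_ W uW lab χ χ-sym χ-homog g cb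
      open Result result
      uall : Unique (Rs ++ Bs ++ Us)
      uall = Unique-resp-↭ (↭-sym whole) uW
      red-bound : length Rs + length Xr ≤ 2 * n
      red-bound = hinged true Xr Rs red-trail (Unique-++⁻ˡ Rs uall) (λ m → ∈-resp-↭ whole (∈-++⁺ˡ m)) ur 0r hr Jr
      blue-bound : length Bs + length Xb ≤ 2 * n
      blue-bound = hinged false Xb Bs blue-trail (Unique-++⁻ˡ Bs (Unique-++⁻ʳ Rs uall)) (λ m → ∈-resp-↭ whole (∈-++⁺ʳ Rs (∈-++⁺ˡ m))) ub 0b hb Jb
      arith : ∀ a b c x y → a + (b + c) + (x + y) ≡ a + x + (b + y) + c
      arith = solve-∀
      arith′ : ∀ n g → 2 * n + 2 * n + 2 * g ≡ 4 * n + 2 * g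
      arith′ = solve-∀

    -- One-sided case: the edges inside X are given the colour not β. They lie in
    -- a component with at most n - 1 vertices, so they are on no long cycle.
    module OneSided (β : Bool) (X : List V) (uX : Unique X) (hX : length X ≤ suc j) (J : Joined (colour β) X W)
      (r≢b : r ≢ b) where

      W′ : List V
      W′ = X ++ W

      -- Even labels make the vertices of `X` classes of their own, odd labels preserve the classes
      -- of `W`; the parities keep them apart.
      lab′ : V → ℕ
      lab′ v = if ⌊ v ∈? X ⌋ then 2 * code v else suc (2 * lab v)

      χ′ : V → V → Bool
      χ′ x y = if ⌊ x ∈? X ⌋ ∧ ⌊ y ∈? X ⌋ then not β else χ x y

      in-W : ∀ {v} → v ∈ W′ → v ∉ X → v ∈ W
      in-W p h = [ (λ q → contradiction q h) , id ]′ (∈-++⁻ X p)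

      χ′-sym : ∀ x y → χ′ x y ≡ χ′ y x
      χ′-sym x y with x ∈? X | y ∈? X
      ... | yes _ | yes _ = refl
      ... | yes _ | no _ = χ-sym x y
      ... | no _ | yes _ = χ-sym x y
      ... | no _ | no _ = χ-sym x y

      uW′ : Unique W′
      uW′ = Unique-++⁺ uX uW λ p q → Mono-irrefl (colour β) (J p q)

      X-edge : ∀ {x w} → x ∈ X → w ∈ W → χ x w ≡ β
      X-edge p q = χ-colour r≢b β (proj₂ (J p q))

      X-edge′ : ∀ {x w} → x ∈ X → w ∈ W → χ w x ≡ β
      X-edge′ p q = χ-colour r≢b β (proj₂ (Mono-sym (colour β) (J p q)))

      data Kind (v : V) : Set where
        in-X : v ∈ X → lab′ v ≡ 2 * code v → Kind v
        out-X : v ∉ X → lab′ v ≡ suc (2 * lab v) → Kind v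

      kind : ∀ v → Kind v
      kind v with v ∈? X in e
      ... | yes p = in-X p (cong (λ d → if ⌊ d ⌋ then 2 * code v else suc (2 * lab v)) e)
      ... | no p = out-X p (cong (λ d → if ⌊ d ⌋ then 2 * code v else suc (2 * lab v)) e)

      χ′-out : ∀ {x y} → x ∉ X → χ′ x y ≡ χ x y
      χ′-out {x} {y} h with x ∈? X
      ... | yes p = contradiction p h
      ... | no _ = refl

      χ′-in : ∀ {x y} → x ∈ X → y ∈ X → χ′ x y ≡ not β
      χ′-in {x} {y} p q with x ∈? X | y ∈? X
      ... | yes _ | yes _ = refl
      ... | no h | _ = contradiction p h
      ... | yes _ | no h = contradiction q h

      lab′-X : ∀ {x y} → x ∈ X → lab′ x ≡ lab′ y → x ≡ y
      lab′-X {x} {y} p e with kind x | kind y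
      ... | out-X h _ | _ = contradiction p h
      ... | in-X _ e₁ | in-X _ e₂ = code-inj (*-cancelˡ-≡ (code x) (code y) 2 (≡-trans (≡-sym e₁) (≡-trans e e₂)))
      ... | in-X _ e₁ | out-X _ e₂ = ⊥-elim (even≢odd (code x) (lab y) (≡-trans (≡-sym e₁) (≡-trans e e₂)))

      lab′-W : ∀ {x y} → x ∉ X → lab′ x ≡ lab′ y → y ∉ X × lab x ≡ lab y
      lab′-W {x} {y} h e with kind x | kind y
      ... | in-X p _ | _ = contradiction p h
      ... | out-X _ e₁ | out-X h′ e₂ = h′ , *-cancelˡ-≡ (lab x) (lab y) 2 (suc-injective (≡-trans (≡-sym e₁) (≡-trans e e₂)))
      ... | out-X _ e₁ | in-X _ e₂ = ⊥-elim (even≢odd (code y) (lab x) (≡-trans (≡-sym e₂) (≡-trans (≡-sym e) e₁)))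

      lab-≢ : ∀ {x y} → x ∉ X → y ∉ X → lab′ x ≢ lab′ y → lab x ≢ lab y
      lab-≢ {x} {y} h h′ ne e with kind x | kind y
      ... | in-X p _ | _ = h p
      ... | out-X _ _ | in-X p _ = h′ p
      ... | out-X _ e₁ | out-X _ e₂ = ne (≡-trans e₁ (≡-trans (cong (λ l → suc (2 * l)) e) (≡-sym e₂)))

      χ′-homog : ∀ {x x′ y} → x ∈ W′ → x′ ∈ W′ → y ∈ W′ → lab′ x ≡ lab′ x′ → lab′ x ≢ lab′ y → χ′ x y ≡ χ′ x′ y
      χ′-homog {x} {x′} {y} p p′ q e ne = main (x ∈? X) (y ∈? X)
        where
        main : Dec (x ∈ X) → Dec (y ∈ X) → χ′ x y ≡ χ′ x′ y
        main (yes xX) _ = cong (λ v → χ′ v y) (lab′-X xX e)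
        main (no xX) d with h , e′ ← lab′-W {x} {x′} xX e = ≡-trans (χ′-out xX) (≡-trans (out d) (≡-sym (χ′-out h)))
          where
          out : Dec (y ∈ X) → χ x y ≡ χ x′ y
          out (yes yX) = ≡-trans (X-edge′ yX (in-W p xX)) (≡-sym (X-edge′ yX (in-W p′ h)))
          out (no yX) = χ-homog (in-W p xX) (in-W p′ h) (in-W q yX) e′ (lab-≢ xX yX ne)

      private
        A′[_] = Adj W′ lab′ χ′

      not-self : ∀ c → c ≢ not c
      not-self true ()
      not-self false ()

      to-Mono : ∀ {x y} → A′[ β ] x y → Mono (colour β) x y
      to-Mono {x} {y} (p , q , ne , e) = main (x ∈? X) (y ∈? X)
        where
        main : Dec (x ∈ X) → Dec (y ∈ X) → Mono (colour β) x y
        main (yes xX) (yes yX) = ⊥-elim (not-self β (≡-trans (≡-sym e) (χ′-in xX yX)))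
        main (yes xX) (no yX) = J xX (in-W q yX)
        main (no xX) (yes yX) = Mono-sym (colour β) (J yX (in-W p xX))
        main (no xX) (no yX) = real β (in-W p xX , in-W q yX , lab-≢ xX yX ne , ≡-trans (≡-sym (χ′-out xX)) e)

      step-X : ∀ {x y} → A′[ not β ] x y → x ∈ X → y ∈ X
      step-X {x} {y} (p , q , ne , e) xX = main (y ∈? X)
        where
        main : Dec (y ∈ X) → y ∈ X
        main (yes yX) = yX
        main (no yX) = ⊥-elim (not-self β (≡-trans (≡-sym (X-edge xX (in-W q yX))) (≡-trans (χ-sym x y)
          (≡-trans (≡-sym (χ′-out yX)) (≡-trans (χ′-sym y x) e)))))

      path-X : ∀ {x z vs} → Path A′[ not β ] x z vs → x ∈ X → vs ⊆ X
      path-X stop h (here refl) = h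
      path-X (s ◂ p) h (here refl) = h
      path-X (s ◂ p) h (there m) = path-X p (step-X s h) m

      path-W : ∀ {x z vs} → Path A′[ not β ] x z vs → x ∉ X → Path (Mono (colour (not β))) x z vs
      path-W stop h = stop
      path-W {x} (_◂_ {y = y} s@(p , q , ne , e) t) h = real (not β) (in-W p h , in-W q h′ , lab-≢ h h′ ne , ≡-trans (≡-sym (χ′-out h)) e) ◂ path-W t h′
        where
        h′ : y ∉ X
        h′ yX = h (step-X (Adj-sym W′ lab′ χ′ χ′-sym (not β) s) yX)

      noOdd : ∀ c → ¬ HasCycle A′[ c ] (2 * n + 1)
      noOdd c h with c Boolₚ.≟ β
      ... | yes refl = noCycle (colour β) (HasCycle-map to-Mono h)
      ... | no ne with ≢⇒≡not ne
      noOdd c (vs , x , z , p , t@(zW , xW , d , e) , u , l) | no ne | refl = main (x ∈? X)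
        where
        main : Dec (x ∈ X) → ⊥
        main (yes xX) = <⇒≱ (≤-trans (s≤s (≤-trans hX (≤-trans (n≤1+n _) (m≤m+n n _)))) (≤-reflexive (≡-sym (≡-trans l (+-comm (2 * n) 1)))))
          (length-⊆ u (path-X p xX))
        main (no xX) = noCycle (colour (not β)) (vs , x , z , path-W p xX ,
          real (not β) (in-W zW zX , in-W xW xX , lab-≢ zX xX d , ≡-trans (≡-sym (χ′-out zX)) e) , u , l)
          where
          zX : z ∉ X
          zX q = xX (step-X t q)

      bound-ungreyed : (∀ {x y} → x ∈ W → y ∈ W → lab x ≡ lab y → x ≡ y) → length W + length X ≤ 4 * n
      bound-ungreyed inj with length W + length X ≤? 4 * n
      ... | yes h = h
      ... | no h with W″ , u , sub , len ← shrink (suc (4 * n)) uW′ (≤-trans (≰⇒> h) (≤-reflexive (≡-trans (+-comm (length W) _) (≡-sym (length-++ X))))) =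
        ⊥-elim (noGrey W″ u lab′ χ′ χ′-sym (λ {x} {y} p q e → inj′ (sub p) (sub q) e (x ∈? X))
          (λ c → noOdd c ∘ HasCycle-map λ (p , q , t) → sub p , sub q , t) len)
        where
        inj′ : ∀ {x y} → x ∈ W′ → y ∈ W′ → lab′ x ≡ lab′ y → Dec (x ∈ X) → x ≡ y
        inj′ p q e (yes xX) = lab′-X xX e
        inj′ p q e (no xX) with h , e′ ← lab′-W xX e = inj (in-W p xX) (in-W q h) e′

      bound-greyed : ClassBound lab (suc j) W → length W + length X ≤ 7 * n + 1
      bound-greyed cb with length W + length X ≤? 7 * n + 1
      ... | yes h = h
      ... | no h = ⊥-elim (grey W′ uW′ lab′ χ′ χ′-sym χ′-homog cb′ noOdd
        (≤-trans (≤-reflexive (+-suc (7 * n) 1)) (≤-trans (≰⇒> h) (≤-reflexive (≡-trans (+-comm (length W) _) (≡-sym (length-++ X)))))))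
        where
        cb′ : ClassBound lab′ (suc j) W′
        cb′ [] _ _ _ = z≤n
        cb′ zs@(z ∷ _) u sub al = main (z ∈? X)
          where
          main : Dec (z ∈ X) → length zs ≤ suc j
          main (yes zX) = ≤-trans (same-code-bound z zs u λ m → ≡-sym (lab′-X zX (al (here refl) m))) (s≤s z≤n)
          main (no zX) = cb zs u (λ m → in-W (sub m) (proj₁ (lab′-W zX (al (here refl) m))))
            λ m m′ → ≡-trans (≡-sym (proj₂ (lab′-W zX (al (here refl) m)))) (proj₂ (lab′-W zX (al (here refl) m′)))

    no-large-class : r ≢ b → ClassBound lab (suc j) W → ∀ Xr Xb → Unique Xr → Unique Xb →
      length Xr ≤ suc j → length Xb ≤ suc j → Joined r Xr W → Joined b Xb W →
      length W + (length Xr + length Xb) ≤ 7 * n + 1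
    no-large-class r≢b cb Xr [] ur ub hr hb Jr Jb =
      ≤-trans (≤-reflexive (cong (length W +_) (+-identityʳ (length Xr)))) (OneSided.bound-greyed true Xr ur hr Jr r≢b cb)
    no-large-class r≢b cb [] Xb@(_ ∷ _) ur ub hr hb Jr Jb = OneSided.bound-greyed false Xb ub hb Jb r≢b cb
    no-large-class r≢b cb Xr@(_ ∷ _) Xb@(_ ∷ _) ur ub hr hb Jr Jb =
      -- Here the paths leave at most 2(n - 2) vertices uncovered, and 4n + 2(n - 2) is below the
      -- allowance.
      ≤-trans (two-sided j cb Xr Xb ur ub (s≤s z≤n) (s≤s z≤n) hr hb Jr Jb)
        (≤-trans (m≤m+n (4 * n + 2 * j) (7 + j)) (≤-reflexive (arith j)))
      where
      arith : ∀ j → 4 * (2 + j) + 2 * j + (7 + j) ≡ 7 * (2 + j) + 1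
      arith = solve-∀

    singletons : r ≢ b → (∀ {x y} → x ∈ W → y ∈ W → lab x ≡ lab y → x ≡ y) → ∀ Xr Xb → Unique Xr → Unique Xb →
      length Xr ≤ suc j → length Xb ≤ suc j → Joined r Xr W → Joined b Xb W →
      length W + (length Xr + length Xb) ≤ 4 * n
    singletons r≢b inj Xr [] ur ub hr hb Jr Jb =
      ≤-trans (≤-reflexive (cong (length W +_) (+-identityʳ (length Xr)))) (OneSided.bound-ungreyed true Xr ur hr Jr r≢b inj)
    singletons r≢b inj [] Xb@(_ ∷ _) ur ub hr hb Jr Jb = OneSided.bound-ungreyed false Xb ub hb Jb r≢b inj
    singletons r≢b inj Xr@(_ ∷ _) Xb@(_ ∷ _) ur ub hr hb Jr Jb =
      ≤-trans (two-sided 0 cb Xr Xb ur ub (s≤s z≤n) (s≤s z≤n) hr hb Jr Jb) (≤-reflexive (+-identityʳ (4 * n)))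
      where
      cb : ClassBound lab 1 W
      cb [] _ _ _ = z≤n
      cb zs@(z ∷ _) u sub al = same-code-bound z zs u λ m → inj (sub m) (sub (here refl)) (al m (here refl))

  -- Two colours need no Gallai partition: every vertex is taken as its own class, and the sharp
  -- bound 4n applies.
  bounded₂ : Bounded 2
  bounded₂ (r ∷ b ∷ []) W X _ cfg = ≤-trans (≤-reflexive (cong (λ l → length W + (length (X r) + l)) (+-identityʳ (length (X b)))))
    (≤-trans (Coloured.singletons r b W W-unique code
      (λ p q ne → two∈ (colours p q λ e → ne (cong code e)))
      (λ {x} {x′} {y} _ _ _ e _ → cong (λ v → col v y) (code-inj e))
      (λ e → head∉ L-unique (here e)) (λ _ _ → code-inj)
      (X r) (X b) (X-unique (here refl)) (X-unique (there (here refl))) (X-small (here refl)) (X-small (there (here refl)))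
      (X-joined (here refl)) (X-joined (there (here refl)))) (≤-reflexive (*-comm 4 n)))
    where
    open Config cfg
    two∈ : ∀ {c} → c ∈ r ∷ b ∷ [] → c ≡ r ⊎ c ≡ b
    two∈ (here e) = inj₁ e
    two∈ (there (here e)) = inj₂ e

  Config-↭ : ∀ {L L′ W X} → L ↭ L′ → Config L W X → Config L′ W X
  Config-↭ p cfg = record
    { L-unique = Unique-resp-↭ p L-unique
    ; W-unique = W-unique
    ; colours = λ m m′ ne → ∈-resp-↭ p (colours m m′ ne)
    ; X-unique = λ m → X-unique (∈-resp-↭ (↭-sym p) m)
    ; X-joined = λ m → X-joined (∈-resp-↭ (↭-sym p) m)
    ; X-small = λ m → X-small (∈-resp-↭ (↭-sym p) m)
    }
    where open Config cfg

  weight-↭ : ∀ X {L L′} → L ↭ L′ → weight X L ≡ weight X L′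
  weight-↭ X p = sum-↭ (↭-map⁺ (length ∘ X) p)

  weight-cong : ∀ {X X′} L → (∀ {c} → c ∈ L → X c ≡ X′ c) → weight X L ≡ weight X′ L
  weight-cong [] h = refl
  weight-cong (c ∷ L) h = cong₂ _+_ (cong length (h (here refl))) (weight-cong L (h ∘ there))

  override : C → List V → (C → List V) → C → List V
  override p Y X c = if ⌊ c ≟c p ⌋ then Y else X c

  override-same : ∀ p Y X → override p Y X p ≡ Y
  override-same p Y X with p ≟c p
  ... | yes _ = refl
  ... | no h = contradiction refl h

  override-other : ∀ p Y X {c} → c ≢ p → override p Y X c ≡ X c
  override-other p Y X {c} h with c ≟c p
  ... | yes e = contradiction e h
  ... | no _ = refl

  Free : C → List V → Set
  Free p U = ∀ {x y} → x ∈ U → y ∈ U → ¬ Mono p x y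

  -- What `inner-edge` leaves for a set joined in colour p to at least n vertices. The alternative
  -- of n or fewer vertices is harmless, because `room` has space for them.
  Sparse : C → List V → Set
  Sparse p U = length U ≤ n ⊎ Free p U

  sparse : ∀ p {A U} → Unique A → Unique U → Joined p A U → n ≤ length A → Sparse p U
  sparse p {A} {U} uA uU J h with suc n ≤? length U
  ... | no h′ = inj₁ (≤-pred (≰⇒> h′))
  ... | yes h′ = inj₂ λ m m′ e → noCycle p (M.inner-edge p uA uU J h h′ m m′ e)

  Joined-sym : ∀ {p A B} → Joined p A B → Joined p B A
  Joined-sym {p} J m m′ = Mono-sym p (J m′ m)

  -- The induction step for three or more colours

  module Step (k : ℕ) (IH₁ : Bounded (2 + k)) (IH₂ : Bounded (1 + k)) where

    -- The bound for k + 1 colours, the unit of account of the step: losing two colours costs F,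
    -- losing one costs 2F, and the goal is 4F.
    F : ℕ
    F = n * 2 ^ suc k

    2n≤F : 2 * n ≤ F
    2n≤F = ≤-trans (≤-reflexive (*-comm 2 n)) (*-monoʳ-≤ n (≤-trans (≤-reflexive (≡-sym (*-identityʳ 2))) (*-monoʳ-≤ 2 (m^n>0 2 k))))

    double : n * 2 ^ (2 + k) ≡ 2 * F
    double = arith n (2 ^ suc k)
      where
      arith : ∀ a b → a * (2 * b) ≡ 2 * (a * b)
      arith = solve-∀

    quadruple : n * 2 ^ (3 + k) ≡ 4 * F
    quadruple = arith n (2 ^ suc k)
      where
      arith : ∀ a b → a * (2 * (2 * b)) ≡ 4 * (a * b)
      arith = solve-∀

    module _ {p q : C} {L : List C} {W : List V} {X : C → List V} (len : length L ≡ suc k) (cfg : Config (p ∷ q ∷ L) W X) where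

      open Config cfg

      σ-room : weight X L + suc n ≤ F
      σ-room = ≤-trans (+-monoˡ-≤ (suc n) (≤-trans (weight≤ X L λ m → X-small (there (there m))) (≤-reflexive (cong (_* suc j) len)))) (room k)

      without-two : ∀ U → Unique U → U ⊆ W → Sparse p U → Sparse q U → length U + weight X L ≤ F
      without-two U u sub (inj₁ h) _ = ≤-trans (+-monoˡ-≤ (weight X L) h) (≤-trans (≤-reflexive (+-comm n _)) (≤-trans (+-monoʳ-≤ (weight X L) (n≤1+n n)) σ-room))
      without-two U u sub (inj₂ _) (inj₁ h) = without-two U u sub (inj₁ h) (inj₁ h)
      without-two U u sub (inj₂ fp) (inj₂ fq) = IH₂ L U X len record
        { L-unique = drop₂ L-unique
        ; W-unique = u
        ; colours = λ m m′ ne → colour∈ m m′ ne (colours (sub m) (sub m′) ne)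
        ; X-unique = λ m → X-unique (there (there m))
        ; X-joined = λ m a b → X-joined (there (there m)) a (sub b)
        ; X-small = λ m → X-small (there (there m))
        }
        where
        drop₂ : Unique (p ∷ q ∷ L) → Unique L
        drop₂ (_ ∷ _ ∷ u) = u
        colour∈ : ∀ {x y} → x ∈ U → y ∈ U → x ≢ y → col x y ∈ p ∷ q ∷ L → col x y ∈ L
        colour∈ m m′ ne (here e) = ⊥-elim (fp m m′ (ne , e))
        colour∈ m m′ ne (there (here e)) = ⊥-elim (fq m m′ (ne , e))
        colour∈ m m′ ne (there (there h)) = h

      -- `Y` replaces `X q` as the set attached in colour q; callers put the old `X q` into `Y`
      -- unless it is empty.
      without-one : ∀ U Y → Unique U → U ⊆ W → Sparse p U → Unique Y → length Y ≤ suc j → Joined q Y U →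
        length U + length Y + weight X L ≤ 2 * F
      without-one U Y u sub (inj₁ h) uY hY J = ≤-trans (+-monoˡ-≤ (weight X L) (+-mono-≤ h hY))
        (≤-trans (≤-reflexive (arith j (weight X L))) (≤-trans (+-mono-≤ σ-room (≤-trans (≤-trans (m≤n+m j 2) (m≤m+n n (n + 0))) 2n≤F)) (≤-reflexive (arith′ F))))
        where
        arith : ∀ j s → 2 + j + suc j + s ≡ s + suc (2 + j) + j
        arith = solve-∀
        arith′ : ∀ f → f + f ≡ 2 * f
        arith′ = solve-∀
      without-one U Y u sub (inj₂ fp) uY hY J = ≤-trans (≤-reflexive (≡-trans (+-assoc (length U) (length Y) _) (cong (length U +_)
          (cong₂ _+_ (cong length (≡-sym (override-same q Y X))) (weight-cong L λ m → ≡-sym (override-other q Y X (≢q m)))))))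
        (≤-trans (IH₁ (q ∷ L) U X′ (cong suc len) record
        { L-unique = tail L-unique
        ; W-unique = u
        ; colours = λ m m′ ne → colour∈ m m′ ne (colours (sub m) (sub m′) ne)
        ; X-unique = λ { (here refl) → subst Unique (≡-sym (override-same q Y X)) uY
                       ; (there m) → subst Unique (≡-sym (override-other q Y X (≢q m))) (X-unique (there (there m))) }
        ; X-joined = λ { (here refl) → λ a → J (subst (_ ∈_) (override-same q Y X) a)
                       ; (there m) → λ a b → X-joined (there (there m)) (subst (_ ∈_) (override-other q Y X (≢q m)) a) (sub b) }
        ; X-small = λ { (here refl) → subst (λ l → length l ≤ suc j) (≡-sym (override-same q Y X)) hY
                      ; (there m) → subst (λ l → length l ≤ suc j) (≡-sym (override-other q Y X (≢q m))) (X-small (there (there m))) }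
        }) (≤-reflexive double))
        where
        X′ = override q Y X
        tail : Unique (p ∷ q ∷ L) → Unique (q ∷ L)
        tail (_ ∷ u) = u
        ≢q : ∀ {c} → c ∈ L → c ≢ q
        ≢q m refl = head∉ (tail L-unique) m
        colour∈ : ∀ {x y} → x ∈ U → y ∈ U → x ≢ y → col x y ∈ p ∷ q ∷ L → col x y ∈ q ∷ L
        colour∈ m m′ ne (here e) = ⊥-elim (fp m m′ (ne , e))
        colour∈ m m′ ne (there h) = h

    -- The order of r and b is a parameter, so each case is treated for one colour only, and its
    -- mirror image is a second instance.
    module Frame {r b : C} {L : List C} {W : List V} {X : C → List V} (len : length L ≡ suc k)
      (cfg : Config (r ∷ b ∷ L) W X) (lab : V → ℕ)
      (two-colours : ∀ {x y} → x ∈ W → y ∈ W → lab x ≢ lab y → col x y ≡ r ⊎ col x y ≡ b)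
      (homog : ∀ {x x′ y} → x ∈ W → x′ ∈ W → y ∈ W → lab x ≡ lab x′ → lab x ≢ lab y → col x y ≡ col x′ y) where

      open Config cfg

      cfg′ : Config (b ∷ r ∷ L) W X
      cfg′ = Config-↭ (swap r b ↭-refl) cfg

      r≢b : r ≢ b
      r≢b e = head∉ L-unique (here e)

      σ = weight X L

      Goal : Set
      Goal = length W + (length (X r) + (length (X b) + σ)) ≤ 4 * F

      data Big : List V → Set where
        big : ∀ {A} → Block lab W A → n ≤ length A → Big A

      unique : ∀ {A} → Big A → Unique A
      unique (big (block _ u _ _ _) _) = u

      sub : ∀ {A} → Big A → A ⊆ W
      sub (big (block _ _ s _ _) _) = s

      size : ∀ {A} → Big A → n ≤ length A
      size (big _ h) = h

      top : ∀ {A} → Big A → ∃ λ a → a ∈ A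
      top (big (block h _ _ _ _) _) = nonempty h

      toward : ∀ {v A} → v ∈ W → Big A → v ∉ A → (∀ {x} → x ∈ A → Mono r v x) ⊎ (∀ {x} → x ∈ A → Mono b v x)
      toward {v} {A} v∈ B@(big (block _ _ s al full) _) v∉ with a , a∈ ← top B = pick (two-colours v∈ (s a∈) (far a∈))
        where
        far : ∀ {x} → x ∈ A → lab v ≢ lab x
        far m e = v∉ (full m v∈ (≡-sym e))
        same : ∀ {x} → x ∈ A → col v x ≡ col v a
        same {x} m = ≡-trans (col-sym v x) (≡-trans (homog (s m) (s a∈) v∈ (al m a∈) λ e → far m (≡-sym e)) (col-sym a v))
        pick : col v a ≡ r ⊎ col v a ≡ b → (∀ {x} → x ∈ A → Mono r v x) ⊎ (∀ {x} → x ∈ A → Mono b v x)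
        pick (inj₁ e) = inj₁ λ m → (λ e′ → far m (cong lab e′)) , ≡-trans (same m) e
        pick (inj₂ e) = inj₂ λ m → (λ e′ → far m (cong lab e′)) , ≡-trans (same m) e

      spread : ∀ {A B a} → Big A → Big B → (∀ {v} → v ∈ A → v ∉ B) → a ∈ A →
        ∀ p {x y} → col a y ≡ p → x ∈ A → y ∈ B → Mono p x y
      spread (big (block _ _ s al _) _) (big (block _ _ s′ _ full) _) dis a∈ p e m m′ = (λ { refl → dis m m′ }) ,
        ≡-trans (homog (s m) (s a∈) (s′ m′) (al m a∈) λ e′ → dis m (full m′ (s m) (≡-sym e′))) e

      between : ∀ {A B} → Big A → Big B → (∀ {v} → v ∈ A → v ∉ B) → Joined r A B ⊎ Joined b A B
      between {A} {B} α@(big (block _ _ s al _) _) β dis with a , a∈ ← top α with toward (s a∈) β (dis a∈)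
      ... | inj₁ h = inj₁ λ m m′ → spread α β dis a∈ r (proj₂ (h m′)) m m′
      ... | inj₂ h = inj₂ λ m m′ → spread α β dis a∈ b (proj₂ (h m′)) m m′

      no-apex : ∀ p {A B v} → Big A → Big B → Joined p A B → v ∉ A → v ∉ B →
        (∀ {x} → x ∈ A → Mono p v x) → (∀ {x} → x ∈ B → Mono p v x) → ⊥
      no-apex p α β J v∉A v∉B hA hB with a , a∈ ← top α | c , c∈ ← top β =
        noCycle p (M.apex p (unique α) (unique β) J (size α) (size β) v∉A v∉B a∈ c∈ (hA a∈) (hB c∈))

      -- A vertex of `X p` is joined to all of `W` in colour p and would be an apex over the pair.
      X-empty : ∀ {p} → p ∈ r ∷ b ∷ L → ∀ {A B} → Big A → Big B → Joined p A B → length (X p) ≤ 0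
      X-empty {p} p∈ {A} {B} α β J with X p | X-joined p∈
      ... | [] | _ = z≤n
      ... | x ∷ _ | h = ⊥-elim (no-apex p α β J (λ m → Mono-irrefl p (h (here refl) (sub α m))) (λ m → Mono-irrefl p (h (here refl) (sub β m)))
        (λ m → h (here refl) (sub α m)) (λ m → h (here refl) (sub β m)))

      -- If p is absent, the set is complete multipartite in q, and its classes have fewer than n
      -- vertices.
      one-colour : ∀ p q → (∀ {c} → c ≡ r ⊎ c ≡ b → c ≢ p → c ≡ q) → ∀ O → Unique O → O ⊆ W → ClassBound lab (suc j) O →
        Sparse p O → length O ≤ 2 * n
      one-colour p q other O u s cb (inj₁ h) = ≤-trans h (m≤m+n n _)
      one-colour p q other O u s cb (inj₂ free) with length O ≤? 2 * n
      ... | yes h = h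
      ... | no h = ⊥-elim (noCycle q (Multipartite.multipartite-cycle lab (suc j) u
        (≤-trans (≤-reflexive (+-comm (2 * n) 1)) (≰⇒> h)) (λ zs uz z⊆ al → ≤-trans (cb zs uz z⊆ al) (n≤1+n _))
        λ m m′ ne → (λ e → ne (cong lab e)) , other (two-colours (s m) (s m′) ne) λ e → free m m′ ((λ e → ne (cong lab e)) , e)))

      not-r : ∀ {c} → c ≡ r ⊎ c ≡ b → c ≢ r → c ≡ b
      not-r (inj₁ e) h = contradiction e h
      not-r (inj₂ e) h = e

      not-b : ∀ {c} → c ≡ r ⊎ c ≡ b → c ≢ b → c ≡ r
      not-b (inj₁ e) h = e
      not-b (inj₂ e) h = contradiction e h

      -- If both colours are absent, no two classes can meet `O`, and a single class has fewer than
      -- n vertices there.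
      one-class : ∀ O → Unique O → O ⊆ W → ClassBound lab (suc j) O → Sparse r O → Sparse b O → length O ≤ n
      one-class O u s cb (inj₁ h) _ = h
      one-class O u s cb (inj₂ _) (inj₁ h) = h
      one-class O u s cb (inj₂ fr) (inj₂ fb) with alike-or-apart lab O u
      ... | inj₁ al = ≤-trans (cb O u id al) (n≤1+n _)
      ... | inj₂ (x , y , m , m′ , ne) with two-colours (s m) (s m′) ne
      ...   | inj₁ e = ⊥-elim (fr m m′ ((λ e → ne (cong lab e)) , e))
      ...   | inj₂ e = ⊥-elim (fb m m′ ((λ e → ne (cong lab e)) , e))

      outside : List V → List V
      outside U = filter (λ v → ¬? (v ∈? U)) W

      outside-∈ : ∀ {U v} → v ∈ outside U → v ∈ W × v ∉ U
      outside-∈ {U} = ∈-filter⁻ (λ v → ¬? (v ∈? U)) {xs = W}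

      outside-unique : ∀ U → Unique (outside U)
      outside-unique U = Uniqueₚ.filter⁺ _ W-unique

      outside-length : ∀ U → length W ≤ length (outside U) + length U
      outside-length U = ≤-trans (length-⊆ W-unique cover) (≤-reflexive (length-++ (outside U)))
        where
        cover : W ⊆ outside U ++ U
        cover {v} m with v ∈? U
        ... | yes p = ∈-++⁺ʳ (outside U) p
        ... | no p = ∈-++⁺ˡ (∈-filter⁺ (λ v → ¬? (v ∈? U)) m p)

      X-disjoint : ∀ {p} → p ∈ r ∷ b ∷ L → ∀ {v} → v ∈ X p → v ∉ W
      X-disjoint {p} p∈ m m′ = Mono-irrefl p (X-joined p∈ m m′)

      attached : ∀ {p} → p ∈ r ∷ b ∷ L → ∀ {O U} → Unique O → O ⊆ W → U ⊆ W → Joined p O U →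
        Unique (O ++ X p) × Joined p (O ++ X p) U × length (O ++ X p) ≡ length O + length (X p)
      attached p∈ {O} uO s s′ J = Unique-++⁺ uO (X-unique p∈) (λ m m′ → X-disjoint p∈ m′ (s m)) ,
        (λ m m′ → [ (λ a → J a m′) , (λ a → X-joined p∈ a (s′ m′)) ]′ (∈-++⁻ O m)) , length-++ O

      -- By `no-apex` an outer vertex is not blue to both `A` and `D`, and not red to `B` and one of
      -- them; so it is red to `A` or `D` and blue to `B`. This excludes red edges inside `Y`. As
      -- `A` and `D` lose both colours, they cost F each. `B` and `Y` cost 2F together: a small `Y`
      -- is attached to `B`, and a larger one takes blue from `B` as well.
      three-classes : ∀ {A B D} → Big A → Big B → Big D → (∀ {v} → v ∈ A → v ∉ B) → (∀ {v} → v ∈ B → v ∉ D) →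
        (∀ {v} → v ∈ A → v ∉ D) → Joined r A B → Joined r B D → Joined b A D → Goal
      three-classes {A} {B} {D} α β δ AB∅ BD∅ AD∅ AB BD AD = ≤-trans (+-mono-≤ hW (+-mono-≤ (X-empty (here refl) α β AB)
          (+-monoˡ-≤ σ (X-empty (there (here refl)) α δ AD)))) (finish (length Y ≤? suc j))
        where
        Y = outside (A ++ B ++ D)
        Y-∈ : ∀ {v} → v ∈ Y → v ∈ W × v ∉ A × v ∉ B × v ∉ D
        Y-∈ m with m′ , h ← outside-∈ m = m′ , (λ p → h (∈-++⁺ˡ p)) , (λ p → h (∈-++⁺ʳ A (∈-++⁺ˡ p))) , λ p → h (∈-++⁺ʳ A (∈-++⁺ʳ B p))
        uY = outside-unique (A ++ B ++ D)
        hW : length W ≤ length Y + (length A + (length B + length D))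
        hW = ≤-trans (outside-length (A ++ B ++ D)) (≤-reflexive (cong (length Y +_) (≡-trans (length-++ A) (cong (length A +_) (length-++ B)))))
        red-end : ∀ {v} → v ∈ Y → (∀ {x} → x ∈ A → Mono r v x) ⊎ (∀ {x} → x ∈ D → Mono r v x)
        red-end m with v∈ , vA , vB , vD ← Y-∈ m with toward v∈ α vA | toward v∈ δ vD
        ... | inj₁ h | _ = inj₁ h
        ... | inj₂ _ | inj₁ h = inj₂ h
        ... | inj₂ h | inj₂ h′ = ⊥-elim (no-apex b α δ AD vA vD h h′)
        YB : Joined b Y B
        YB m m′ with v∈ , vA , vB , vD ← Y-∈ m with toward v∈ β vB
        ... | inj₂ h = h m′
        ... | inj₁ h with red-end m
        ...   | inj₁ h′ = ⊥-elim (no-apex r α β AB vA vB h′ h)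
        ...   | inj₂ h′ = ⊥-elim (no-apex r β δ BD vB vD h h′)
        A-bound : length A + σ ≤ F
        A-bound = without-two len cfg A (unique α) (sub α) (sparse r (unique β) (unique α) (Joined-sym AB) (size β))
          (sparse b (unique δ) (unique α) (Joined-sym AD) (size δ))
        D-bound : length D + σ ≤ F
        D-bound = without-two len cfg D (unique δ) (sub δ) (sparse r (unique β) (unique δ) BD (size β))
          (sparse b (unique α) (unique δ) AD (size α))
        B-sparse : Sparse r B
        B-sparse = sparse r (unique α) (unique β) AB (size α)
        red-pick : ∀ {v} → v ∈ Y → ∃₂ λ a a′ → a ∈ A ++ D × a′ ∈ A ++ D × a ≢ a′ × Mono r v a × Mono r v a′
        red-pick m with red-end m
        ... | inj₁ h with a , a′ , p , p′ , ne ← two-distinct (unique α) (≤-trans (s≤s (s≤s z≤n)) (size α)) =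
          a , a′ , ∈-++⁺ˡ p , ∈-++⁺ˡ p′ , ne , h p , h p′
        ... | inj₂ h with a , a′ , p , p′ , ne ← two-distinct (unique δ) (≤-trans (s≤s (s≤s z≤n)) (size δ)) =
          a , a′ , ∈-++⁺ʳ A p , ∈-++⁺ʳ A p′ , ne , h p , h p′
        Y-free : Free r Y
        Y-free m m′ e with a , _ , p , _ , _ , va , _ ← red-pick m | c , c′ , q , q′ , ne , vc , vc′ ← red-pick m′
          with _ , yA , yB , yD ← Y-∈ m | _ , yA′ , yB′ , yD′ ← Y-∈ m′ = close (a ≟ c)
          where
          go : ∀ {a′} → a′ ∈ A ++ D → a ≢ a′ → Mono r _ a′ → ⊥
          go q ne v = noCycle r (M.attach r (Unique-++⁺ (unique α) (unique δ) AD∅) (unique β)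
            (λ s t → [ (λ u → AB u t) , (λ u → Mono-sym r (BD t u)) ]′ (∈-++⁻ A s))
            (≤-trans (size α) (≤-trans (m≤m+n _ _) (≤-reflexive (≡-sym (length-++ A))))) (≤-trans (n≤1+n _) (size β))
            (λ s → [ yA , yD ]′ (∈-++⁻ A s)) yB (λ s → [ yA′ , yD′ ]′ (∈-++⁻ A s)) yB′ e p q ne va v)
          close : Dec (a ≡ c) → ⊥
          close (no d) = go q d vc
          close (yes refl) = go q′ ne vc′
        finish : Dec (length Y ≤ suc j) → length Y + (length A + (length B + length D)) + (0 + (0 + σ)) ≤ 4 * F
        finish (yes h) = ≤-trans (m≤m+n _ (σ + σ)) (≤-trans (≤-reflexive (arith (length Y) (length A) (length B) (length D) σ))
          (≤-trans (+-mono-≤ A-bound (+-mono-≤ D-bound (without-one len cfg B Y (unique β) (sub β) B-sparse uY h YB))) (≤-reflexive (arith′ F))))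
          where
          arith : ∀ y a b d s → y + (a + (b + d)) + (0 + (0 + s)) + (s + s) ≡ a + s + (d + s + (b + y + s))
          arith = solve-∀
          arith′ : ∀ f → f + (f + 2 * f) ≡ 4 * f
          arith′ = solve-∀
        finish (no h) = ≤-trans (m≤m+n _ (σ + σ + σ)) (≤-trans (≤-reflexive (arith (length Y) (length A) (length B) (length D) σ))
          (≤-trans (+-mono-≤ A-bound (+-mono-≤ D-bound (+-mono-≤
            (without-two len cfg B (unique β) (sub β) B-sparse (sparse b uY (unique β) YB (≰⇒> h)))
            (without-two len cfg Y uY (proj₁ ∘ Y-∈) (inj₂ Y-free) (sparse b (unique β) uY (Joined-sym YB) (size β))))))
            (≤-reflexive (arith′ F))))
          where
          arith : ∀ y a b d s → y + (a + (b + d)) + (0 + (0 + s)) + (s + s + s) ≡ a + s + (d + s + (b + s + (y + s)))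
          arith = solve-∀
          arith′ : ∀ f → f + (f + (f + f)) ≡ 4 * f
          arith′ = solve-∀

      -- One half of the account for a red pair, used again with `A` and `B` exchanged. If the
      -- vertices blue to `A` are few, they are attached to `A` together with `X b` (`few`);
      -- otherwise `A` loses blue in addition to red (`many`).
      module Side {A B : List V} (α : Big A) (β : Big B) (AB : Joined r A B) (O : List V) (uO : Unique O)
        (O-∈ : ∀ {v} → v ∈ O → v ∈ W × v ∉ A × v ∉ B) (cb : ClassBound lab (suc j) O) where

        a₀ = proj₁ (top α)

        blue? : ∀ v → Dec (col v a₀ ≡ b)
        blue? v = col v a₀ ≟c b

        Ob Or : List V
        Ob = filter blue? O
        Or = filter (¬? ∘ blue?) O

        Ob-∈ : ∀ {v} → v ∈ Ob → v ∈ O × col v a₀ ≡ b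
        Ob-∈ = ∈-filter⁻ blue? {xs = O}

        Or-∈ : ∀ {v} → v ∈ Or → v ∈ O × col v a₀ ≢ b
        Or-∈ = ∈-filter⁻ (¬? ∘ blue?) {xs = O}

        uOb : Unique Ob
        uOb = Uniqueₚ.filter⁺ blue? uO

        uOr : Unique Or
        uOr = Uniqueₚ.filter⁺ _ uO

        O-length : length O ≡ length Ob + length Or
        O-length = ≡-sym (length-filter-split blue? O)

        blue-A : Joined b Ob A
        blue-A m m′ with v∈O , e ← Ob-∈ m with v∈ , vA , _ ← O-∈ v∈O with toward v∈ α vA
        ... | inj₁ h = ⊥-elim (r≢b (≡-trans (≡-sym (proj₂ (h (proj₂ (top α))))) e))
        ... | inj₂ h = h m′

        red-A : Joined r Or A
        red-A m m′ with v∈O , ne ← Or-∈ m with v∈ , vA , _ ← O-∈ v∈O with toward v∈ α vA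
        ... | inj₁ h = h m′
        ... | inj₂ h = ⊥-elim (ne (proj₂ (h (proj₂ (top α)))))

        blue-B : Joined b Or B
        blue-B m m′ with v∈O , _ ← Or-∈ m with v∈ , vA , vB ← O-∈ v∈O with toward v∈ β vB
        ... | inj₁ h = ⊥-elim (no-apex r α β AB vA vB (red-A m) h)
        ... | inj₂ h = h m′

        bound-sub : ∀ {U} → U ⊆ O → ClassBound lab (suc j) U
        bound-sub s zs u z⊆ = cb zs u (λ m → s (z⊆ m))

        Or≤ : length Or ≤ n
        Or≤ = one-class Or uOr (λ m → proj₁ (O-∈ (proj₁ (Or-∈ m)))) (bound-sub (λ m → proj₁ (Or-∈ m)))
          (sparse r (unique α) uOr (Joined-sym red-A) (size α)) (sparse b (unique β) uOr (Joined-sym blue-B) (size β))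

        Ob≤ : length Ob ≤ 2 * n
        Ob≤ = one-colour b r not-b Ob uOb (λ m → proj₁ (O-∈ (proj₁ (Ob-∈ m)))) (bound-sub (λ m → proj₁ (Ob-∈ m)))
          (sparse b (unique α) uOb (Joined-sym blue-A) (size α))

        A-sparse : Sparse r A
        A-sparse = sparse r (unique β) (unique α) (Joined-sym AB) (size β)

        private
          att = attached (there (here refl)) {Ob} {A} uOb (λ m → proj₁ (O-∈ (proj₁ (Ob-∈ m)))) (sub α) blue-A

        few : length Ob + length (X b) ≤ suc j → length A + (length Ob + length (X b)) + σ ≤ 2 * F
        few h with u , J , l ← att = ≤-trans (≤-reflexive (cong (λ m → length A + m + σ) (≡-sym l)))
          (without-one len cfg A (Ob ++ X b) (unique α) (sub α) A-sparse u (≤-trans (≤-reflexive l) h) J)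

        many : ¬ (length Ob + length (X b) ≤ suc j) → length A + σ ≤ F
        many h with u , J , l ← att = without-two len cfg A (unique α) (sub α) A-sparse
          (sparse b u (unique α) J (≤-trans (≰⇒> h) (≤-reflexive (≡-sym l))))

      -- Each outer vertex is blue to `A` or to `B`, by `no-apex`. A side whose blue set is small is
      -- charged 2F including that set. A side that loses both colours is charged only F, and the F
      -- saved pays for outer vertices: at most n if this happens on one side, and at most 4n, with
      -- `X b`, if it happens on both.
      two-classes : ∀ {A B} → Big A → Big B → (∀ {v} → v ∈ A → v ∉ B) → Joined r A B →
        ClassBound lab (suc j) (outside (A ++ B)) → Goal
      two-classes {A} {B} α β dis AB cb = ≤-trans (+-mono-≤ hW (+-monoˡ-≤ (xb + σ) (X-empty (here refl) α β AB)))
          (finish (length S.Ob + xb ≤? suc j) (length T.Ob + xb ≤? suc j))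
        where
        O = outside (A ++ B)
        xb = length (X b)
        xb≤ : xb ≤ suc j
        xb≤ = X-small (there (here refl))
        O-∈ : ∀ {v} → v ∈ O → v ∈ W × v ∉ A × v ∉ B
        O-∈ m with m′ , h ← outside-∈ m = m′ , (λ p → h (∈-++⁺ˡ p)) , λ p → h (∈-++⁺ʳ A p)
        O-∈′ : ∀ {v} → v ∈ O → v ∈ W × v ∉ B × v ∉ A
        O-∈′ m with v∈ , vA , vB ← O-∈ m = v∈ , vB , vA
        uO = outside-unique (A ++ B)
        module S = Side α β AB O uO O-∈ cb
        module T = Side β α (Joined-sym AB) O uO O-∈′ cb
        hW : length W ≤ length O + (length A + length B)
        hW = ≤-trans (outside-length (A ++ B)) (≤-reflexive (cong (length O +_) (length-++ A)))
        O≤ : length O ≤ length S.Ob + length T.Ob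
        O≤ = length-cover S.blue? T.blue? O λ {v} m → either m (S.blue? v)
          where
          either : ∀ {v} → v ∈ O → Dec (col v S.a₀ ≡ b) → col v S.a₀ ≡ b ⊎ col v T.a₀ ≡ b
          either m (yes e) = inj₁ e
          either m (no ne) = inj₂ (proj₂ (S.blue-B (∈-filter⁺ (¬? ∘ S.blue?) m ne) (proj₂ (top β))))
        finish : Dec (length S.Ob + xb ≤ suc j) → Dec (length T.Ob + xb ≤ suc j) →
          length O + (length A + length B) + (0 + (xb + σ)) ≤ 4 * F
        -- `X b` and σ are charged to both sides; counting them twice only weakens the estimate.
        finish (yes h) (yes h′) = ≤-trans (+-monoˡ-≤ (xb + σ) (+-monoˡ-≤ (length A + length B) O≤)) (≤-trans (m≤m+n _ (xb + σ))
          (≤-trans (≤-reflexive (arith (length S.Ob) (length T.Ob) (length A) (length B) xb σ))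
            (≤-trans (+-mono-≤ (S.few h) (T.few h′)) (≤-reflexive (arith′ F)))))
          where
          arith : ∀ s t a b x w → s + t + (a + b) + (x + w) + (x + w) ≡ a + (s + x) + w + (b + (t + x) + w)
          arith = solve-∀
          arith′ : ∀ f → 2 * f + 2 * f ≡ 4 * f
          arith′ = solve-∀
        finish (yes h) (no h′) = ≤-trans (+-monoˡ-≤ (xb + σ) (+-monoˡ-≤ (length A + length B) (≤-reflexive S.O-length))) (≤-trans (m≤m+n _ σ)
          (≤-trans (≤-reflexive (arith (length S.Ob) (length S.Or) (length A) (length B) xb σ))
            (≤-trans (+-mono-≤ (S.few h) (+-mono-≤ (T.many h′) (≤-trans S.Or≤ (≤-trans (m≤m+n n _) 2n≤F)))) (≤-reflexive (arith′ F)))))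
          where
          arith : ∀ s t a b x w → s + t + (a + b) + (x + w) + w ≡ a + (s + x) + w + (b + w + t)
          arith = solve-∀
          arith′ : ∀ f → 2 * f + (f + f) ≡ 4 * f
          arith′ = solve-∀
        finish (no h) (yes h′) = ≤-trans (+-monoˡ-≤ (xb + σ) (+-monoˡ-≤ (length A + length B) (≤-reflexive T.O-length))) (≤-trans (m≤m+n _ σ)
          (≤-trans (≤-reflexive (arith (length T.Ob) (length T.Or) (length A) (length B) xb σ))
            (≤-trans (+-mono-≤ (T.few h′) (+-mono-≤ (S.many h) (≤-trans T.Or≤ (≤-trans (m≤m+n n _) 2n≤F)))) (≤-reflexive (arith′ F)))))
          where
          arith : ∀ s t a b x w → s + t + (a + b) + (x + w) + w ≡ b + (s + x) + w + (a + w + t)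
          arith = solve-∀
          arith′ : ∀ f → 2 * f + (f + f) ≡ 4 * f
          arith′ = solve-∀
        finish (no h) (no h′) = ≤-trans (+-monoˡ-≤ (xb + σ) (+-monoˡ-≤ (length A + length B) (≤-reflexive S.O-length))) (≤-trans (m≤m+n _ σ)
          (≤-trans (≤-reflexive (arith (length S.Ob) (length S.Or) (length A) (length B) xb σ))
            (≤-trans (+-mono-≤ (S.many h) (+-mono-≤ (T.many h′) (≤-trans (+-mono-≤ S.Ob≤ (+-mono-≤ S.Or≤ (≤-trans xb≤ (n≤1+n _))))
              (≤-trans (≤-reflexive (arith″ n)) (+-mono-≤ 2n≤F 2n≤F))))) (≤-reflexive (arith′ F)))))
          where
          arith : ∀ s t a b x w → s + t + (a + b) + (x + w) + w ≡ a + w + (b + w + (s + (t + x)))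
          arith = solve-∀
          arith′ : ∀ f → f + (f + (f + f)) ≡ 4 * f
          arith′ = solve-∀
          arith″ : ∀ n → 2 * n + (n + n) ≡ 2 * n + 2 * n
          arith″ = solve-∀

      -- If the outer vertices are few in both colours, `A` need not lose a colour; they are
      -- absorbed into `X r` and `X b`, and `rec` continues with all colours on the smaller set `A`.
      -- Otherwise `A` loses a colour, and the outer vertices on that side, at most 2n, fit into
      -- what is saved.
      one-large-class : ∀ {A} → Big A → ClassBound lab (suc j) (outside A) → length A < length W →
        (∀ W′ X′ → length W′ < length W → Config (r ∷ b ∷ L) W′ X′ → length W′ + weight X′ (r ∷ b ∷ L) ≤ 4 * F) → Goal
      one-large-class {A} α cb smaller rec = ≤-trans (+-monoˡ-≤ _ hW) (finish (length Or + xr ≤? suc j) (length Ob + xb ≤? suc j))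
        where
        O = outside A
        xr = length (X r)
        xb = length (X b)
        a₀ = proj₁ (top α)
        red? : ∀ v → Dec (col v a₀ ≡ r)
        red? v = col v a₀ ≟c r
        Or = filter red? O
        Ob = filter (¬? ∘ red?) O
        uOr : Unique Or
        uOr = Uniqueₚ.filter⁺ red? (outside-unique A)
        uOb : Unique Ob
        uOb = Uniqueₚ.filter⁺ _ (outside-unique A)
        Or-∈ : ∀ {v} → v ∈ Or → v ∈ O × col v a₀ ≡ r
        Or-∈ = ∈-filter⁻ red? {xs = O}
        Ob-∈ : ∀ {v} → v ∈ Ob → v ∈ O × col v a₀ ≢ r
        Ob-∈ = ∈-filter⁻ (¬? ∘ red?) {xs = O}
        Or⊆ : Or ⊆ W
        Or⊆ m = proj₁ (outside-∈ (proj₁ (Or-∈ m)))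
        Ob⊆ : Ob ⊆ W
        Ob⊆ m = proj₁ (outside-∈ (proj₁ (Ob-∈ m)))
        hW : length W ≤ length Or + length Ob + length A
        hW = ≤-trans (outside-length A) (≤-reflexive (cong (_+ length A) (≡-sym (length-filter-split red? O))))
        red-A : Joined r Or A
        red-A m m′ with v∈O , e ← Or-∈ m with v∈ , vA ← outside-∈ v∈O with toward v∈ α vA
        ... | inj₁ h = h m′
        ... | inj₂ h = ⊥-elim (r≢b (≡-trans (≡-sym e) (proj₂ (h (proj₂ (top α))))))
        blue-A : Joined b Ob A
        blue-A m m′ with v∈O , ne ← Ob-∈ m with v∈ , vA ← outside-∈ v∈O with toward v∈ α vA
        ... | inj₁ h = ⊥-elim (ne (proj₂ (h (proj₂ (top α)))))
        ... | inj₂ h = h m′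
        Or≤ : length Or ≤ 2 * n
        Or≤ = one-colour r b not-r Or uOr Or⊆ (λ zs u z⊆ → cb zs u (λ m → proj₁ (Or-∈ (z⊆ m))))
          (sparse r (unique α) uOr (Joined-sym red-A) (size α))
        Ob≤ : length Ob ≤ 2 * n
        Ob≤ = one-colour b r not-b Ob uOb Ob⊆ (λ zs u z⊆ → cb zs u (λ m → proj₁ (Ob-∈ (z⊆ m))))
          (sparse b (unique α) uOb (Joined-sym blue-A) (size α))
        xr≤ : xr ≤ suc j
        xr≤ = X-small (here refl)
        xb≤ : xb ≤ suc j
        xb≤ = X-small (there (here refl))
        att-r = attached (here refl) {Or} {A} uOr Or⊆ (sub α) red-A
        att-b = attached (there (here refl)) {Ob} {A} uOb Ob⊆ (sub α) blue-A
        sparse-r : ¬ (length Or + xr ≤ suc j) → Sparse r A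
        sparse-r h with u , J , l ← att-r = sparse r u (unique α) J (≤-trans (≰⇒> h) (≤-reflexive (≡-sym l)))
        sparse-b : ¬ (length Ob + xb ≤ suc j) → Sparse b A
        sparse-b h with u , J , l ← att-b = sparse b u (unique α) J (≤-trans (≰⇒> h) (≤-reflexive (≡-sym l)))
        finish : Dec (length Or + xr ≤ suc j) → Dec (length Ob + xb ≤ suc j) →
          length Or + length Ob + length A + (xr + (xb + σ)) ≤ 4 * F
        finish (yes h) (yes h′) with ur , Jr , lr ← att-r | ub , Jb , lb ← att-b =
          ≤-trans (≤-reflexive (≡-trans (arith (length Or) (length Ob) (length A) xr xb σ) (cong (length A +_)
            (cong₂ _+_ (≡-trans (≡-sym lr) (cong length (≡-sym Xr))) (cong₂ _+_ (≡-trans (≡-sym lb) (cong length (≡-sym Xb)))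
              (weight-cong L λ m → ≡-sym (X-rest m)))))))
          (rec A X′ smaller record
            { L-unique = L-unique
            ; W-unique = unique α
            ; colours = λ m m′ → colours (sub α m) (sub α m′)
            ; X-unique = λ { (here refl) → subst Unique (≡-sym Xr) ur ; (there (here refl)) → subst Unique (≡-sym Xb) ub
                           ; (there (there m)) → subst Unique (≡-sym (X-rest m)) (X-unique (there (there m))) }
            ; X-joined = λ { (here refl) → λ s → Jr (subst (_ ∈_) Xr s) ; (there (here refl)) → λ s → Jb (subst (_ ∈_) Xb s)
                           ; (there (there m)) → λ s t → X-joined (there (there m)) (subst (_ ∈_) (X-rest m) s) (sub α t) }
            ; X-small = λ { (here refl) → ≤-trans (≤-reflexive (≡-trans (cong length Xr) lr)) h
                          ; (there (here refl)) → ≤-trans (≤-reflexive (≡-trans (cong length Xb) lb)) h′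
                          ; (there (there m)) → ≤-trans (≤-reflexive (cong length (X-rest m))) (X-small (there (there m))) }
            })
          where
          X₁ = override b (Ob ++ X b) X
          X′ = override r (Or ++ X r) X₁
          Xr : X′ r ≡ Or ++ X r
          Xr = override-same r (Or ++ X r) X₁
          Xb : X′ b ≡ Ob ++ X b
          Xb = ≡-trans (override-other r (Or ++ X r) X₁ (λ e → r≢b (≡-sym e))) (override-same b (Ob ++ X b) X)
          tail : Unique (r ∷ b ∷ L) → Unique (b ∷ L)
          tail (_ ∷ u) = u
          X-rest : ∀ {c} → c ∈ L → X′ c ≡ X c
          X-rest m = ≡-trans (override-other r (Or ++ X r) X₁ λ { refl → head∉ L-unique (there m) }) (override-other b (Ob ++ X b) X λ { refl → head∉ (tail L-unique) m })
          arith : ∀ o p a x y s → o + p + a + (x + (y + s)) ≡ a + (o + x + (p + y + s))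
          arith = solve-∀
        finish (no h) (yes h′) with ub , Jb , lb ← att-b =
          ≤-trans (≤-reflexive (arith (length Or) (length Ob) (length A) xr xb σ)) (≤-trans (+-mono-≤
            (≤-trans (≤-reflexive (cong (λ m → length A + m + σ) (≡-sym lb)))
              (without-one len cfg A (Ob ++ X b) (unique α) (sub α) (sparse-r h) ub (≤-trans (≤-reflexive lb) h′) Jb))
            (+-mono-≤ (≤-trans Or≤ 2n≤F) (≤-trans xr≤ (≤-trans (n≤1+n _) (≤-trans (m≤m+n n _) 2n≤F))))) (≤-reflexive (arith′ F)))
          where
          arith : ∀ o p a x y s → o + p + a + (x + (y + s)) ≡ a + (p + y) + s + (o + x)
          arith = solve-∀
          arith′ : ∀ f → 2 * f + (f + f) ≡ 4 * f
          arith′ = solve-∀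
        finish (yes h) (no h′) with ur , Jr , lr ← att-r =
          ≤-trans (≤-reflexive (arith (length Or) (length Ob) (length A) xr xb σ)) (≤-trans (+-mono-≤
            (≤-trans (≤-reflexive (cong (λ m → length A + m + σ) (≡-sym lr)))
              (without-one len cfg′ A (Or ++ X r) (unique α) (sub α) (sparse-b h′) ur (≤-trans (≤-reflexive lr) h) Jr))
            (+-mono-≤ (≤-trans Ob≤ 2n≤F) (≤-trans xb≤ (≤-trans (n≤1+n _) (≤-trans (m≤m+n n _) 2n≤F))))) (≤-reflexive (arith′ F)))
          where
          arith : ∀ o p a x y s → o + p + a + (x + (y + s)) ≡ a + (o + x) + s + (p + y)
          arith = solve-∀
          arith′ : ∀ f → 2 * f + (f + f) ≡ 4 * f
          arith′ = solve-∀
        finish (no h) (no h′) = ≤-trans (≤-reflexive (arith (length Or) (length Ob) (length A) xr xb σ))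
          (≤-trans (+-mono-≤ (without-two len cfg A (unique α) (sub α) (sparse-r h) (sparse-b h′))
            (+-mono-≤ (≤-trans Or≤ 2n≤F) (+-mono-≤ (≤-trans Ob≤ 2n≤F) (≤-trans (+-mono-≤ (≤-trans xr≤ (n≤1+n _)) (≤-trans xb≤ (n≤1+n _)))
              (≤-trans (≤-reflexive (cong (n +_) (≡-sym (+-identityʳ n)))) 2n≤F))))) (≤-reflexive (arith′ F)))
          where
          arith : ∀ o p a x y s → o + p + a + (x + (y + s)) ≡ a + s + (o + (p + (x + y)))
          arith = solve-∀
          arith′ : ∀ f → f + (f + (f + f)) ≡ 4 * f
          arith′ = solve-∀

      -- The allowance is used up exactly: 7n + 1 + σ = (σ + n + 1) + 3 · 2n, and each of these four
      -- terms is at most F.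
      no-class : ClassBound lab (suc j) W → Goal
      no-class cb = ≤-trans (≤-reflexive (arith (length W) (length (X r)) (length (X b)) σ))
        (≤-trans (+-monoˡ-≤ σ (Coloured.no-large-class r b W W-unique lab two-colours homog r≢b cb (X r) (X b)
          (X-unique (here refl)) (X-unique (there (here refl))) (X-small (here refl)) (X-small (there (here refl)))
          (X-joined (here refl)) (X-joined (there (here refl)))))
        (≤-trans (≤-reflexive (arith′ n σ)) (≤-trans (+-mono-≤ σ-room′ (+-mono-≤ 2n≤F (+-mono-≤ 2n≤F 2n≤F))) (≤-reflexive (arith″ F)))))
        where
        σ-room′ : σ + suc n ≤ F
        σ-room′ = σ-room len cfg
        arith : ∀ w x y s → w + (x + (y + s)) ≡ w + (x + y) + s
        arith = solve-∀
        arith′ : ∀ n s → 7 * n + 1 + s ≡ s + suc n + (2 * n + (2 * n + 2 * n))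
        arith′ = solve-∀
        arith″ : ∀ f → f + (f + (f + f)) ≡ 4 * f
        arith″ = solve-∀

      swapped-goal : length W + (length (X b) + (length (X r) + σ)) ≤ 4 * F → Goal
      swapped-goal h = ≤-trans (≤-reflexive (arith (length W) (length (X r)) (length (X b)) σ)) h
        where
        arith : ∀ w x y s → w + (x + (y + s)) ≡ w + (y + (x + s))
        arith = solve-∀

    module Dispatch {r b : C} {L : List C} {W : List V} {X : C → List V} (len : length L ≡ suc k)
      (cfg : Config (r ∷ b ∷ L) W X) (lab : V → ℕ)
      (two-colours : ∀ {x y} → x ∈ W → y ∈ W → lab x ≢ lab y → col x y ≡ r ⊎ col x y ≡ b)
      (homog : ∀ {x x′ y} → x ∈ W → x′ ∈ W → y ∈ W → lab x ≡ lab x′ → lab x ≢ lab y → col x y ≡ col x′ y)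
      (separated : ∃₂ λ x y → x ∈ W × y ∈ W × lab x ≢ lab y)
      (rec : ∀ W′ X′ → length W′ < length W → Config (r ∷ b ∷ L) W′ X′ → length W′ + weight X′ (r ∷ b ∷ L) ≤ 4 * F) where

      open Config cfg

      swap₂ : ∀ {c} → c ≡ r ⊎ c ≡ b → c ≡ b ⊎ c ≡ r
      swap₂ (inj₁ e) = inj₂ e
      swap₂ (inj₂ e) = inj₁ e

      module F₁ = Frame len cfg lab two-colours homog
      module F₂ = Frame len F₁.cfg′ lab (λ p q ne → swap₂ (two-colours p q ne)) homog

      parts : List (List V)
      parts = classes lab (length W) W

      large : List (List V)
      large = filter (λ A → n ≤? length A) parts

      data Class (A : List V) : Set where
        class : Block lab W A → n ≤ length A → Class A

      big₁ : ∀ {A} → Class A → F₁.Big A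
      big₁ (class β h) = F₁.big β h

      big₂ : ∀ {A} → Class A → F₂.Big A
      big₂ (class β h) = F₂.big β h

      large-class : ∀ {A} → A ∈ large → Class A
      large-class m with p , h ← ∈-filter⁻ (λ A → n ≤? length A) {xs = parts} m =
        class (All.lookup (classes-blocks lab (length W) W W-unique) p) h

      small-elsewhere : ∀ O → O ⊆ W → (∀ {A v} → A ∈ large → v ∈ A → v ∉ O) → ClassBound lab (suc j) O
      small-elsewhere O s avoid′ [] _ _ _ = z≤n
      small-elsewhere O s avoid′ zs@(z ∷ _) u z⊆ al
        with A , A∈ , z∈ ← classes-∈ lab (length W) W ≤-refl (s (z⊆ (here refl)))
        with block _ _ _ _ full ← All.lookup (classes-blocks lab (length W) W W-unique) A∈
        with n ≤? length A
      ... | yes h = ⊥-elim (avoid′ (∈-filter⁺ (λ A → n ≤? length A) A∈ h) z∈ (z⊆ (here refl)))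
      ... | no h = ≤-trans (length-⊆ u λ m → full z∈ (s (z⊆ m)) (al (here refl) m)) (≤-pred (≰⇒> h))

      Disjoint : List V → List V → Set
      Disjoint A B = ∀ {v} → v ∈ A → v ∉ B

      pair-goal : ∀ {A B} → Class A → Class B → Disjoint A B → ClassBound lab (suc j) (F₁.outside (A ++ B)) → F₁.Goal
      pair-goal α β dis cb with F₁.between (big₁ α) (big₁ β) dis
      ... | inj₁ J = F₁.two-classes (big₁ α) (big₁ β) dis J cb
      ... | inj₂ J = F₁.swapped-goal (F₂.two-classes (big₂ α) (big₂ β) dis J cb)

      -- Three pairs of one colour would give an apex. Otherwise exactly two pairs share a colour,
      -- and the class common to them takes the middle place in `three-classes`.
      triple-goal : ∀ {A B D} → Class A → Class B → Class D → Disjoint A B → Disjoint B D → Disjoint A D → F₁.Goal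
      triple-goal {A} {B} {D} α β δ AB∅ BD∅ AD∅
        with F₁.between (big₁ α) (big₁ β) AB∅ | F₁.between (big₁ β) (big₁ δ) BD∅ | F₁.between (big₁ α) (big₁ δ) AD∅
      ... | inj₁ AB | inj₁ BD | inj₂ AD = F₁.three-classes (big₁ α) (big₁ β) (big₁ δ) AB∅ BD∅ AD∅ AB BD AD
      ... | inj₁ AB | inj₂ BD | inj₁ AD = F₁.three-classes (big₁ β) (big₁ α) (big₁ δ) (λ p q → AB∅ q p) AD∅ BD∅ (Joined-sym AB) AD BD
      ... | inj₂ AB | inj₁ BD | inj₁ AD = F₁.three-classes (big₁ α) (big₁ δ) (big₁ β) AD∅ (λ p q → BD∅ q p) AB∅ AD (Joined-sym BD) AB
      ... | inj₂ AB | inj₂ BD | inj₁ AD = F₁.swapped-goal (F₂.three-classes (big₂ α) (big₂ β) (big₂ δ) AB∅ BD∅ AD∅ AB BD AD)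
      ... | inj₂ AB | inj₁ BD | inj₂ AD = F₁.swapped-goal (F₂.three-classes (big₂ β) (big₂ α) (big₂ δ) (λ p q → AB∅ q p) AD∅ BD∅ (Joined-sym AB) AD BD)
      ... | inj₁ AB | inj₂ BD | inj₂ AD = F₁.swapped-goal (F₂.three-classes (big₂ α) (big₂ δ) (big₂ β) AD∅ (λ p q → BD∅ q p) AB∅ AD (Joined-sym BD) AB)
      ... | inj₁ AB | inj₁ BD | inj₁ AD with d , m ← F₁.top (big₁ δ) =
        ⊥-elim (F₁.no-apex r (big₁ α) (big₁ β) AB (λ p → AD∅ p m) (λ p → BD∅ p m) (λ p → Mono-sym r (AD p m)) (λ p → Mono-sym r (BD p m)))
      ... | inj₂ AB | inj₂ BD | inj₂ AD with d , m ← F₁.top (big₁ δ) =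
        ⊥-elim (F₁.no-apex b (big₁ α) (big₁ β) AB (λ p → AD∅ p m) (λ p → BD∅ p m) (λ p → Mono-sym b (AD p m)) (λ p → Mono-sym b (BD p m)))

      by-classes : ∀ Bs → Bs ≡ large → F₁.Goal
      by-classes [] e = F₁.no-class (small-elsewhere W id λ m → ⊥-elim (none (subst (_ ∈_) (≡-sym e) m)))
        where
        none : ∀ {A : List V} → A ∉ []
        none ()
      by-classes (A ∷ []) e = F₁.one-large-class (big₁ α)
        (small-elsewhere (F₁.outside A) (proj₁ ∘ F₁.outside-∈) λ m v∈ v∈O → avoid′ (subst (_ ∈_) (≡-sym e) m) v∈ v∈O) smaller rec
        where
        α : Class A
        α = large-class (subst (A ∈_) e (here refl))
        avoid′ : ∀ {B v} → B ∈ A ∷ [] → v ∈ B → v ∉ F₁.outside A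
        avoid′ (here refl) v∈ v∈O = proj₂ (F₁.outside-∈ v∈O) v∈
        -- The partition separates two vertices, so one class is never all of `W`; this makes the
        -- recursion descend.
        missing : ∃ λ w → w ∈ W × w ∉ A
        missing = find-missing separated
          where
          find-missing : (∃₂ λ x y → x ∈ W × y ∈ W × lab x ≢ lab y) → ∃ λ w → w ∈ W × w ∉ A
          find-missing (x , y , p , q , ne) with x ∈? A | y ∈? A
          ... | no h | _ = x , p , h
          ... | yes _ | no h = y , q , h
          ... | yes h | yes h′ with class (block _ _ _ al _) _ ← α = ⊥-elim (ne (al h h′))
        smaller : length A < length W
        smaller with w , p , h ← missing = length-⊆ {xs = w ∷ A} (Unique-cons h (F₁.unique (big₁ α)))
          λ { (here refl) → p ; (there m) → F₁.sub (big₁ α) m }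
      by-classes (A ∷ B ∷ []) e with subst (AllPairs (Apart lab)) (≡-sym e) (AllPairsₚ.filter⁺ _ (classes-apart lab (length W) W W-unique))
      ... | (AB ∷ []) ∷ _ =
        pair-goal (large-class (subst (A ∈_) e (here refl))) (large-class (subst (B ∈_) e (there (here refl)))) (λ p q → AB p q refl)
          (small-elsewhere (F₁.outside (A ++ B)) (proj₁ ∘ F₁.outside-∈) λ m v∈ v∈O → avoid′ (subst (_ ∈_) (≡-sym e) m) v∈ v∈O)
        where
        avoid′ : ∀ {D v} → D ∈ A ∷ B ∷ [] → v ∈ D → v ∉ F₁.outside (A ++ B)
        avoid′ (here refl) v∈ v∈O = proj₂ (F₁.outside-∈ v∈O) (∈-++⁺ˡ v∈)
        avoid′ (there (here refl)) v∈ v∈O = proj₂ (F₁.outside-∈ v∈O) (∈-++⁺ʳ A v∈)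
      -- Further large classes need no case of their own, since `three-classes` does not restrict
      -- the outer vertices.
      by-classes (A ∷ B ∷ D ∷ _) e with subst (AllPairs (Apart lab)) (≡-sym e) (AllPairsₚ.filter⁺ _ (classes-apart lab (length W) W W-unique))
      ... | (AB ∷ AD ∷ _) ∷ (BD ∷ _) ∷ _ =
        triple-goal (large-class (subst (A ∈_) e (here refl))) (large-class (subst (B ∈_) e (there (here refl))))
          (large-class (subst (D ∈_) e (there (there (here refl))))) (λ p q → AB p q refl) (λ p q → BD p q refl) (λ p q → AD p q refl)

      goal : F₁.Goal
      goal = by-classes large refl

    -- The two colours of a partition may coincide or, as far as its type tells, lie outside `L`.
    -- They are replaced by two distinct members of `L` that include those of the two lying in `L`.
    choose : ∀ L → Unique L → 2 ≤ length L → ∀ r b → ∃₂ λ r′ b′ → ∃ λ L′ → L ↭ r′ ∷ b′ ∷ L′ ×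
      (∀ {c} → c ∈ L → c ≡ r ⊎ c ≡ b → c ≡ r′ ⊎ c ≡ b′)
    choose L u h r b = main (any? (r ≟c_) L) (any? (b ≟c_) L)
      where
      Choice = ∃₂ λ r′ b′ → ∃ λ L′ → L ↭ r′ ∷ b′ ∷ L′ × (∀ {c} → c ∈ L → c ≡ r ⊎ c ≡ b → c ≡ r′ ⊎ c ≡ b′)
      neither : ∀ M → M ≡ L → r ∉ L → b ∉ L → Choice
      neither (r′ ∷ b′ ∷ L′) e r∉ b∉ = r′ , b′ , L′ , ↭-reflexive (≡-sym e) ,
        λ { m (inj₁ refl) → ⊥-elim (r∉ m) ; m (inj₂ refl) → ⊥-elim (b∉ m) }
      neither [] refl _ _ = contradiction h λ ()
      neither (_ ∷ []) refl _ _ = contradiction h λ { (s≤s ()) }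
      first : ∀ M → L ↭ r ∷ M → Dec (b ∈ M) → Choice
      first M p (yes b∈) with L′ , p′ ← ↭-head b∈ = r , b , L′ , ↭-trans p (prep r p′) , λ _ e → e
      first [] p (no _) = contradiction (≤-trans h (≤-reflexive (↭-length p))) λ { (s≤s ()) }
      first (m ∷ M) p (no b∉) = r , m , M , p , λ { _ (inj₁ e) → inj₁ e ; c∈ (inj₂ refl) → other (∈-resp-↭ p c∈) }
        where
        other : b ∈ r ∷ m ∷ M → b ≡ r ⊎ b ≡ m
        other (here e) = inj₁ e
        other (there q) = ⊥-elim (b∉ q)
      second : r ∉ L → ∀ M → L ↭ b ∷ M → Choice
      second r∉ [] p = contradiction (≤-trans h (≤-reflexive (↭-length p))) λ { (s≤s ()) }
      second r∉ (m ∷ M) p = b , m , M , p , λ { c∈ (inj₁ refl) → ⊥-elim (r∉ c∈) ; _ (inj₂ e) → inj₁ e }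
      main : Dec (r ∈ L) → Dec (b ∈ L) → Choice
      main (yes r∈) _ with M , p ← ↭-head r∈ = first M p (any? (b ≟c_) M)
      main (no r∉) (yes b∈) with M , p ← ↭-head b∈ = second r∉ M p
      main (no r∉) (no b∉) = neither L refl r∉ b∉

    -- Absorption keeps all colours, so the step needs an inner induction on |W|. A `W` with at most
    -- one vertex is covered by `room`.
    by-size : ∀ f L W X → length W ≤ f → length L ≡ 3 + k → Config L W X → length W + weight X L ≤ n * 2 ^ (3 + k)
    by-size f L W X hf len cfg with 2 ≤? length W
    ... | no h = ≤-trans (+-mono-≤ (≤-pred (≰⇒> h)) (weight≤ X L X-small)) (≤-trans (≤-reflexive (≡-trans (cong (λ l → 1 + l * suc j) len) (+-comm 1 _)))
      (≤-trans (+-monoʳ-≤ ((3 + k) * suc j) (s≤s z≤n)) (room (2 + k))))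
      where open Config cfg
    by-size zero L W X hf len cfg | yes h = contradiction (≤-trans h hf) λ ()
    by-size (suc f) L W X hf len cfg | yes h = goal
      where
      open Config cfg
      module G = GallaiPartition _≟_ _≟c_ col col-sym gallai
      open G.Partition (G.partition W W-unique h) renaming (r to r₀; b to b₀; two-colours to two₀; homogeneous to homog₀; separated to sep₀)
      chosen : ∃₂ λ r b → ∃ λ L′ → L ↭ r ∷ b ∷ L′ × (∀ {c} → c ∈ L → c ≡ r₀ ⊎ c ≡ b₀ → c ≡ r ⊎ c ≡ b)
      chosen = choose L L-unique (≤-trans (s≤s (s≤s z≤n)) (≤-reflexive (≡-sym len))) r₀ b₀
      r = proj₁ chosen
      b = proj₁ (proj₂ chosen)
      L′ = proj₁ (proj₂ (proj₂ chosen))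
      p : L ↭ r ∷ b ∷ L′
      p = proj₁ (proj₂ (proj₂ (proj₂ chosen)))
      lab : V → ℕ
      lab v = code (label v)
      len₂ : length (r ∷ b ∷ L′) ≡ 3 + k
      len₂ = ≡-trans (≡-sym (↭-length p)) len
      goal : length W + weight X L ≤ n * 2 ^ (3 + k)
      goal = ≤-trans (≤-reflexive (cong (length W +_) (weight-↭ X p))) (≤-trans (Dispatch.goal (suc-injective (suc-injective len₂)) (Config-↭ p cfg) lab
        (λ x∈ y∈ ne → proj₂ (proj₂ (proj₂ (proj₂ chosen))) (colours x∈ y∈ λ e → ne (cong lab e)) (two₀ x∈ y∈ λ e → ne (cong code e)))
        (λ x∈ x′∈ y∈ e ne → homog₀ x∈ x′∈ y∈ (code-inj e) λ e′ → ne (cong code e′))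
        (let x , y , x∈ , y∈ , ne = sep₀ in x , y , x∈ , y∈ , λ e → ne (code-inj e))
        λ W′ X′ h′ cfg₂ → ≤-trans (by-size f (r ∷ b ∷ L′) W′ X′ (≤-pred (≤-trans h′ hf)) len₂ cfg₂) (≤-reflexive quadruple))
        (≤-reflexive (≡-sym quadruple)))

    bounded-step : Bounded (3 + k)
    bounded-step L W X len cfg = by-size (length W) L W X ≤-refl len cfg

  bounded : ∀ k → Bounded k
  bounded 0 = bounded₀
  bounded 1 = bounded₁
  bounded 2 = bounded₂
  bounded (suc (suc (suc k))) = Step.bounded-step k (bounded (suc (suc k))) (bounded (suc k))

-- The Gallai-Ramsey numbers

module _ {V : Set} where

  Path-tabulate : ∀ {R : V → V → Set} m (v : Fin (suc m) → V) → (∀ i → R (v (inject₁ i)) (v (suc i))) →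
    Path R (v zero) (v (fromℕ m)) (tabulate v)
  Path-tabulate zero v h = stop
  Path-tabulate (suc m) v h = h zero ◂ Path-tabulate m (v ∘ suc) (h ∘ suc)

  Path-image : ∀ {U : Set} {R : V → V → Set} {S : U → U → Set} (f : V → U) → ∀ {x z vs} → Path R x z vs →
    (∀ {a b} → a ∈ vs → b ∈ vs → R a b → S (f a) (f b)) → Path S (f x) (f z) (map f vs)
  Path-image f stop h = stop
  Path-image f (r ◂ p) h = h (here refl) (there (Path-head∈ p)) r ◂ Path-image f p (λ a b → h (there a) (there b))

  Unique-image : ∀ {U : Set} (f : V → U) vs → (∀ {a b} → a ∈ vs → b ∈ vs → f a ≡ f b → a ≡ b) → Unique vs → Unique (map f vs)
  Unique-image f [] h _ = []
  Unique-image f (v ∷ vs) h u@(_ ∷ u′) = Unique-cons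
    (λ m → let w , p , e = ∈-map⁻ f m in head∉ u (subst (_∈ vs) (≡-sym (h (here refl) (there p) e)) p))
    (Unique-image f vs (λ a b → h (there a) (there b)) u′)

-- The theorem asks for an explicit cycle, whereas the induction only refutes its absence; a finite
-- search closes this gap constructively.
module Search {N : ℕ} {R : Fin N → Fin N → Set} (R? : ∀ x y → Dec (R x y)) where

  list? : ∀ m {Q : List (Fin N) → Set} → (∀ vs → Dec (Q vs)) → Dec (∃ λ vs → length vs ≡ m × Q vs)
  list? zero Q? with Q? []
  ... | yes q = yes ([] , refl , q)
  ... | no h = no λ { ([] , _ , q) → h q }
  list? (suc m) Q? with Finₚ.any? (λ x → list? m (λ vs → Q? (x ∷ vs)))
  ... | yes (x , vs , e , q) = yes (x ∷ vs , cong suc e , q)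
  ... | no h = no λ { (x ∷ vs , e , q) → h (x , vs , suc-injective e , q) }

  trail? : ∀ w x vs → Dec (∃ λ z → Path R x z (x ∷ vs) × R z w)
  trail? w x [] with R? x w
  ... | yes r = yes (x , stop , r)
  ... | no h = no λ { (_ , stop , r) → h r ; (_ , (_ ◂ ()) , _) }
  trail? w x (y ∷ vs) with R? x y | trail? w y vs
  ... | yes r | yes (z , p , s) = yes (z , r ◂ p , s)
  ... | no h | _ = no λ { (_ , (r ◂ stop) , _) → h r ; (_ , (r ◂ (_ ◂ _)) , _) → h r }
  ... | _ | no h = no λ { (_ , (_ ◂ stop) , s) → h (_ , stop , s) ; (_ , (_ ◂ (t ◂ p)) , s) → h (_ , t ◂ p , s) }

  cyclic? : ∀ vs → Dec (∃₂ λ x z → Path R x z vs × R z x)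
  cyclic? [] = no λ { (_ , _ , () , _) }
  cyclic? (x ∷ vs) with trail? x x vs
  ... | yes (z , p , r) = yes (x , z , p , r)
  ... | no h = no λ { (_ , z , stop , r) → h (z , stop , r) ; (_ , z , (s ◂ p) , r) → h (z , s ◂ p , r) }

  open import Data.List.Membership.DecPropositional (Finₚ._≟_ {N}) using (_∈?_)

  unique? : (vs : List (Fin N)) → Dec (Unique vs)
  unique? [] = yes []
  unique? (x ∷ vs) with x ∈? vs | unique? vs
  ... | yes p | _ = no λ u → head∉ u p
  ... | no _ | no h = no λ { (_ ∷ u) → h u }
  ... | no h | yes u = yes (Unique-cons h u)

  hasCycle? : ∀ m → Dec (HasCycle R m)
  hasCycle? m with list? m (λ vs → cyclic? vs ×-dec unique? vs)
  ... | yes (vs , e , (x , z , p , r) , u) = yes (vs , x , z , p , r , u , e)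
  ... | no h = no λ (vs , x , z , p , r , u , e) → h (vs , e , (x , z , p , r) , u)

module UpperBound (j : ℕ)
  (noGrey : ∀ {V} → DecidableEquality V → UngreyedBound V j)
  (grey : ∀ {V} → DecidableEquality V → GreyedBound V j) where

  n : ℕ
  n = 2 + j

  arrows : ∀ k → Arrows k (2 * n) (n * 2 ^ k + 1)
  arrows k c isGallai with Finₚ.any? (λ i → Search.hasCycle? (λ x y → ¬? (x Finₚ.≟ y) ×-dec (col c x y Finₚ.≟ i)) (2 * n + 1))
  ... | yes (i , vs , x , z , p , r , u , e) = i , v , v-inj , edges , close
    where
    e′ : length vs ≡ suc (2 * n)
    e′ = ≡-trans e (+-comm (2 * n) 1)
    v : Fin (suc (2 * n)) → Fin (n * 2 ^ k + 1)
    v a = nth x vs (toℕ a)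
    short : ∀ a → toℕ a < length vs
    short a = subst (toℕ a <_) (≡-sym e′) (Finₚ.toℕ<n a)
    v-inj : ∀ {a b} → v a ≡ v b → a ≡ b
    v-inj {a} {b} h = Finₚ.toℕ-injective (nth-injective x vs u (short a) (short b) h)
    edges : ∀ (a : Fin (2 * n)) → col c (v (inject₁ a)) (v (suc a)) ≡ i
    edges a = ≡-trans (cong (λ t → col c (nth x vs t) (v (suc a))) (Finₚ.toℕ-inject₁ a))
      (proj₂ (Path-nth-step x p (toℕ a) (short (suc a))))
    close : col c (v (fromℕ (2 * n))) (v zero) ≡ i
    close = ≡-trans (cong₂ (col c) (≡-trans (cong (nth x vs) (≡-trans (Finₚ.toℕ-fromℕ (2 * n)) (cong pred (≡-sym e′))))
      (Path-nth-last x p)) (Path-nth-head x p)) (proj₂ r)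
  -- The induction is applied to the whole graph with all attached sets empty, and n · 2^k + 1
  -- vertices exceed its bound by one.
  ... | no none = ⊥-elim (<⇒≱ (≤-reflexive (+-comm 1 (n * 2 ^ k))) (≤-trans (≤-reflexive (≡-sym (length-allFin (n * 2 ^ k + 1))))
      (≤-trans (m≤m+n _ _) (bounded k (allFin k) (allFin (n * 2 ^ k + 1)) (λ _ → []) (length-allFin k) record
        { L-unique = Uniqueₚ.allFin⁺ k
        ; W-unique = Uniqueₚ.allFin⁺ _
        ; colours = λ _ _ _ → ∈-allFin _
        ; X-unique = λ _ → []
        ; X-joined = λ _ ()
        ; X-small = λ _ → z≤n
        }))))
    where
    length-allFin : ∀ m → length (allFin m) ≡ m
    length-allFin m = length-tabulate {n = m} id
    triangle : ∀ {x y z} → x ≢ y → y ≢ z → x ≢ z → col c x y ≡ col c y z ⊎ col c y z ≡ col c x z ⊎ col c x y ≡ col c x z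
    triangle {x} {y} {z} xy yz xz with col c x y Finₚ.≟ col c y z | col c y z Finₚ.≟ col c x z | col c x y Finₚ.≟ col c x z
    ... | yes e | _ | _ = inj₁ e
    ... | no _ | yes e | _ = inj₂ (inj₁ e)
    ... | no _ | no _ | yes e = inj₂ (inj₂ e)
    ... | no a | no b | no d = ⊥-elim (isGallai (x , y , z , xy , yz , xz , a , b , d))
    open Induction Finₚ._≟_ Finₚ._≟_ toℕ Finₚ.toℕ-injective (col c) (EdgeColouring.sym c) triangle j
      (λ i h → none (i , h)) (noGrey Finₚ._≟_) (grey Finₚ._≟_) using (bounded)

-- The extremal colouring: 2^t blocks of size s with all edges inside them in
-- colour 0, and colour i + 1 between the halves of each run of 2^(i+1) blocks.
module LowerBound (s : ℕ) where

  half : ℕ → ℕ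
  half t = s * 2 ^ t

  half-double : ∀ t → half (suc t) ≡ half t + half t
  half-double t = arith s (2 ^ t)
    where
    arith : ∀ a b → a * (2 * b) ≡ a * b + a * b
    arith = solve-∀

  shade : ℕ → ℕ → ℕ → ℕ
  shade zero x y = 0
  shade (suc t) x y with x <? half t | y <? half t
  ... | yes _ | yes _ = shade t x y
  ... | yes _ | no _ = suc t
  ... | no _ | yes _ = suc t
  ... | no _ | no _ = shade t (x ∸ half t) (y ∸ half t)

  shade≤ : ∀ t x y → shade t x y ≤ t
  shade≤ zero x y = z≤n
  shade≤ (suc t) x y with x <? half t | y <? half t
  ... | yes _ | yes _ = ≤-trans (shade≤ t x y) (n≤1+n t)
  ... | yes _ | no _ = ≤-refl
  ... | no _ | yes _ = ≤-refl
  ... | no _ | no _ = ≤-trans (shade≤ t _ _) (n≤1+n t)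

  shade-sym : ∀ t x y → shade t x y ≡ shade t y x
  shade-sym zero x y = refl
  shade-sym (suc t) x y with x <? half t | y <? half t
  ... | yes _ | yes _ = shade-sym t x y
  ... | yes _ | no _ = refl
  ... | no _ | yes _ = refl
  ... | no _ | no _ = shade-sym t _ _

  shade-gallai : ∀ t x y z → shade t x y ≡ shade t y z ⊎ shade t y z ≡ shade t x z ⊎ shade t x y ≡ shade t x z
  shade-gallai zero x y z = inj₁ refl
  shade-gallai (suc t) x y z with x <? half t | y <? half t | z <? half t
  ... | yes _ | yes _ | yes _ = shade-gallai t x y z
  ... | yes _ | yes _ | no _ = inj₂ (inj₁ refl)
  ... | yes _ | no _ | yes _ = inj₁ refl
  ... | yes _ | no _ | no _ = inj₂ (inj₂ refl)
  ... | no _ | yes _ | yes _ = inj₂ (inj₂ refl)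
  ... | no _ | yes _ | no _ = inj₁ refl
  ... | no _ | no _ | yes _ = inj₂ (inj₁ refl)
  ... | no _ | no _ | no _ = shade-gallai t _ _ _

  Shaded : ℕ → ℕ → ℕ → ℕ → Set
  Shaded t c x y = shade t x y ≡ c

  data Sides (t x y c : ℕ) : Set where
    low : x < half t → y < half t → Shaded t c x y → Sides t x y c
    high : half t ≤ x → half t ≤ y → Shaded t c (x ∸ half t) (y ∸ half t) → Sides t x y c
    across : c ≡ suc t → (x < half t × half t ≤ y) ⊎ (half t ≤ x × y < half t) → Sides t x y c

  sides : ∀ t {c x y} → Shaded (suc t) c x y → Sides t x y c
  sides t {c} {x} {y} e with x <? half t | y <? half t
  ... | yes p | yes q = low p q e
  ... | yes p | no q = across (≡-sym e) (inj₁ (p , ≮⇒≥ q))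
  ... | no p | yes q = across (≡-sym e) (inj₂ (≮⇒≥ p , q))
  ... | no p | no q = high (≮⇒≥ p) (≮⇒≥ q) e

  not-top : ∀ t {x y} → ¬ Shaded t (suc t) x y
  not-top t {x} {y} e = <⇒≱ (≤-reflexive (≡-sym e)) (shade≤ t x y)

  -- Colour `suc t` only joins the two halves, so each edge changes the half, and the parity of the
  -- number of vertices decides in which half a walk ends.
  even-walk : ∀ t {x z vs} → Path (Shaded (suc t) (suc t)) x z vs →
    (x < half t → (∃ λ m → length vs ≡ suc (2 * m) × z < half t) ⊎ (∃ λ m → length vs ≡ 2 * m × half t ≤ z)) ×
    (half t ≤ x → (∃ λ m → length vs ≡ suc (2 * m) × half t ≤ z) ⊎ (∃ λ m → length vs ≡ 2 * m × z < half t))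
  even-walk t stop = (λ h → inj₁ (0 , refl , h)) , λ h → inj₁ (0 , refl , h)
  even-walk t (r ◂ p) with even-walk t p | sides t r
  ... | _ | low _ _ e = ⊥-elim (not-top t e)
  ... | _ | high _ _ e = ⊥-elim (not-top t e)
  ... | _ , g | across _ (inj₁ (lx , hy)) = (λ _ → shift-parity (g hy)) , λ hx → ⊥-elim (<⇒≱ lx hx)
    where
    shift-parity : ∀ {l} {A B : Set} → (∃ λ m → l ≡ suc (2 * m) × A) ⊎ (∃ λ m → l ≡ 2 * m × B) →
      (∃ λ m → suc l ≡ suc (2 * m) × B) ⊎ (∃ λ m → suc l ≡ 2 * m × A)
    shift-parity (inj₁ (m , e , a)) = inj₂ (suc m , ≡-trans (cong suc e) (≡-sym (*-suc 2 m)) , a)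
    shift-parity (inj₂ (m , e , b)) = inj₁ (m , cong suc e , b)
  ... | f , _ | across _ (inj₂ (hx , ly)) = (λ lx → ⊥-elim (<⇒≱ lx hx)) , λ _ → shift-parity (f ly)
    where
    shift-parity : ∀ {l} {A B : Set} → (∃ λ m → l ≡ suc (2 * m) × A) ⊎ (∃ λ m → l ≡ 2 * m × B) →
      (∃ λ m → suc l ≡ suc (2 * m) × B) ⊎ (∃ λ m → suc l ≡ 2 * m × A)
    shift-parity (inj₁ (m , e , a)) = inj₂ (suc m , ≡-trans (cong suc e) (≡-sym (*-suc 2 m)) , a)
    shift-parity (inj₂ (m , e , b)) = inj₁ (m , cong suc e , b)

  all-low : ∀ t {c x z vs} → c ≢ suc t → Path (Shaded (suc t) c) x z vs → x < half t → ∀ {v} → v ∈ vs → v < half t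
  all-low t ne stop h (here refl) = h
  all-low t ne (r ◂ p) h (here refl) = h
  all-low t ne (r ◂ p) h (there m) with sides t r
  ... | low _ h′ _ = all-low t ne p h′ m
  ... | high h′ _ _ = ⊥-elim (<⇒≱ h h′)
  ... | across e _ = contradiction e ne

  all-high : ∀ t {c x z vs} → c ≢ suc t → Path (Shaded (suc t) c) x z vs → half t ≤ x → ∀ {v} → v ∈ vs → half t ≤ v
  all-high t ne stop h (here refl) = h
  all-high t ne (r ◂ p) h (here refl) = h
  all-high t ne (r ◂ p) h (there m) with sides t r
  ... | low h′ _ _ = ⊥-elim (<⇒≱ h′ h)
  ... | high _ h′ _ = all-high t ne p h′ m
  ... | across e _ = contradiction e ne

  -- The top colour is bipartite, and s + 1 is odd because s is even. A cycle of any other colour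
  -- stays in one half, and the recursion descends to a block, which has only s vertices.
  no-cycle : ∀ t c l {x z vs} → s ≡ 2 * l → Path (Shaded t c) x z vs → Shaded t c z x → Unique vs →
    (∀ {v} → v ∈ vs → v < half t) → length vs ≢ suc s
  no-cycle zero c l _ p r u small e = <⇒≱ (≤-reflexive (≡-sym e)) (≤-trans (length-⊆ u λ {v} m → ∈-upTo⁺ (≤-trans (small m) (≤-reflexive (*-identityʳ s))))
    (≤-reflexive (length-upTo s)))
  no-cycle (suc t) c l {x} {z} {vs} es p r u small e with c Nat.≟ suc t
  ... | yes refl with sides t r
  ...   | low _ _ e′ = not-top t e′
  ...   | high _ _ e′ = not-top t e′
  ...   | across _ (inj₁ (lz , hx)) with proj₂ (even-walk t p) hx
  ...     | inj₁ (_ , _ , hz) = <⇒≱ lz hz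
  ...     | inj₂ (m , em , _) = even≢odd m l (≡-trans (≡-sym em) (≡-trans e (cong suc es)))
  no-cycle (suc t) c l {x} {z} {vs} es p r u small e | yes refl | across _ (inj₂ (hz , lx)) with proj₁ (even-walk t p) lx
  ...     | inj₁ (_ , _ , lz) = <⇒≱ lz hz
  ...     | inj₂ (m , em , _) = even≢odd m l (≡-trans (≡-sym em) (≡-trans e (cong suc es)))
  no-cycle (suc t) c l {x} {z} {vs} es p r u small e | no ne = main (x <? half t)
    where
    main : Dec (x < half t) → ⊥
    main (yes lx) = no-cycle t c l es (subst (Path (Shaded t c) x z) (map-id vs) (Path-image id p λ a b → down (below-half a) (below-half b)))
        (down (below-half (Path-last∈ p)) (below-half (Path-head∈ p)) r) u below-half e
      where
      below-half : ∀ {v} → v ∈ vs → v < half t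
      below-half = all-low t ne p lx
      down : ∀ {a b} → a < half t → b < half t → Shaded (suc t) c a b → Shaded t c a b
      down la lb q with sides t q
      ... | low _ _ e′ = e′
      ... | high ha _ _ = ⊥-elim (<⇒≱ la ha)
      ... | across e′ _ = contradiction e′ ne
    main (no hx) = no-cycle t c l es (Path-image (_∸ half t) p λ a b → down (above a) (above b))
        (down (above (Path-last∈ p)) (above (Path-head∈ p)) r)
        (Unique-image (_∸ half t) vs (λ a b → ∸-cancelʳ-≡ (above a) (above b)) u)
        small′ (≡-trans (length-map (_∸ half t) vs) e)
      where
      above : ∀ {v} → v ∈ vs → half t ≤ v
      above = all-high t ne p (≮⇒≥ hx)
      down : ∀ {a b} → half t ≤ a → half t ≤ b → Shaded (suc t) c a b → Shaded t c (a ∸ half t) (b ∸ half t)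
      down ha hb q with sides t q
      ... | low la _ _ = ⊥-elim (<⇒≱ la ha)
      ... | high _ _ e′ = e′
      ... | across e′ _ = contradiction e′ ne
      small′ : ∀ {v} → v ∈ map (_∸ half t) vs → v < half t
      small′ m with w , m′ , refl ← ∈-map⁻ (_∸ half t) m =
        +-cancelʳ-< (half t) (w ∸ half t) (half t) (subst (_< half t + half t) (≡-sym (m∸n+n≡m (above m′)))
          (≤-trans (small m′) (≤-reflexive (half-double t))))

  colouring : ∀ N t → EdgeColouring N (suc t)
  colouring N t = record
    { col = λ x y → fromℕ< (s≤s (shade≤ t (toℕ x) (toℕ y)))
    ; sym = λ x y → Finₚ.toℕ-injective (≡-trans (Finₚ.toℕ-fromℕ< _) (≡-trans (shade-sym t (toℕ x) (toℕ y)) (≡-sym (Finₚ.toℕ-fromℕ< _))))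
    }

  colouring-shade : ∀ N t x y → toℕ (col (colouring N t) x y) ≡ shade t (toℕ x) (toℕ y)
  colouring-shade N t x y = Finₚ.toℕ-fromℕ< _

  colouring-gallai : ∀ N t → Gallai (colouring N t)
  colouring-gallai N t (x , y , z , _ , _ , _ , a , b , d) with shade-gallai t (toℕ x) (toℕ y) (toℕ z)
  ... | inj₁ e = a (Finₚ.toℕ-injective (≡-trans (colouring-shade N t x y) (≡-trans e (≡-sym (colouring-shade N t y z)))))
  ... | inj₂ (inj₁ e) = b (Finₚ.toℕ-injective (≡-trans (colouring-shade N t y z) (≡-trans e (≡-sym (colouring-shade N t x z)))))
  ... | inj₂ (inj₂ e) = d (Finₚ.toℕ-injective (≡-trans (colouring-shade N t x y) (≡-trans e (≡-sym (colouring-shade N t x z)))))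

  -- `shade` does not depend on N, so restricting one colouring to its first N vertices settles all
  -- smaller orders together.
  not-arrows : ∀ l t N → s ≡ 2 * l → N ≤ half t → ¬ Arrows (suc t) s N
  not-arrows l t N es hN arrows with i , v , inj , edges , close ← arrows (colouring N t) (colouring-gallai N t) =
    no-cycle t (toℕ i) l {vs = tabulate w} es (Path-tabulate s w λ a → shaded (edges a)) (shaded close)
      (Uniqueₚ.tabulate⁺ λ h → inj (Finₚ.toℕ-injective h)) small (length-tabulate w)
    where
    w : Fin (suc s) → ℕ
    w a = toℕ (v a)
    shaded : ∀ {x y} → col (colouring N t) x y ≡ i → Shaded t (toℕ i) (toℕ x) (toℕ y)
    shaded {x} {y} e = ≡-trans (≡-sym (colouring-shade N t x y)) (cong toℕ e)
    small : ∀ {a} → a ∈ tabulate w → a < half t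
    small m with q , refl ← ∈-tabulate⁻ {f = w} m = ≤-trans (Finₚ.toℕ<n (v q)) hN

-- Blocks of s = 2n vertices and t doublings give 2n · 2^t = n · 2^(t+1) vertices in t + 1 colours.
isGR : ∀ n t → Arrows (suc t) (2 * n) (n * 2 ^ suc t + 1) → IsGR (suc t) (2 * n) (n * 2 ^ suc t + 1)
isGR n t h = m≤n+m 1 (n * 2 ^ suc t) , h , λ N _ N< → LowerBound.not-arrows (2 * n) n t N refl
  (≤-trans (≤-pred (≤-trans N< (≤-reflexive (+-comm (n * 2 ^ suc t) 1)))) (≤-reflexive (arith n (2 ^ t))))
  where
  arith : ∀ n b → n * (2 * b) ≡ 2 * n * b
  arith = solve-∀

theorem1p8 : ∀ (n k : ℕ) → (n ≡ 4 ⊎ n ≡ 5) → 1 ≤ k →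
    IsGR k (2 * n) (n * 2 ^ k + 1)
theorem1p8 n (suc t) (inj₁ refl) _ = isGR 4 t (UpperBound.arrows 2 NoGrey4.impossible Grey4.impossible (suc t))
theorem1p8 n (suc t) (inj₂ refl) _ = isGR 5 t (UpperBound.arrows 3 NoGrey5.impossible Grey5.impossible (suc t))
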